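{- Let $A,B,C$ be multiplicative characters of $\mathbb{F}_q$ such that $A\neq\varepsilon$, $B\neq\varepsilon$, $C^2\neq\varepsilon$, $A\neq C^2$ and $B\neq C^2$. Write $y=\frac{ -x^2}{4(1-x)}$ and $$M=\frac{\overline{A}(1-x)\,g(\overline{A}C)\,g(\overline{B}C\varphi)}{\varphi(-1)\,C(4)\,g(\varphi)\,g(\overline{A}C^2)\,g(\overline{B})}.$$ Then for every $x\in\mathbb{F}_q$ with $x\neq1$, \begin{align*} &{}_2F_1(A,B;\,C^2\mid x)\,{}_2F_1(A,C^2\overline{B};\,C^2\mid x)\\ &=\frac{q\,AB(-1)\,(\overline{A^2}B)(1-x)\,\overline{C^2}(x)}{g(A)\,g(\overline{B})\,g(\overline{A}C^2)\,g(B\overline{C^2})}\,\delta\!\left(\frac{x-2}{x-1}\right)+qM\,{}_4F_3(A,B,\overline{A}C^2,\overline{B}C^2;\,C^2,C,C\varphi\mid y)\\ &\quad+(q-1)M\Big[\tfrac{q-1}{q}\,{}_2F_1(A,B;\,C^2\mid y)\,\delta(\overline{A}C)\,\delta(\overline{B}C\varphi)-{}_3F_2(A,B,\overline{B}C^2;\,C^2,C\varphi\mid y)\,\delta(\overline{A}C)\\ &\qquad\qquad-{}_3F_2(A,B,\overline{A}C^2;\,C^2,C\mid y)\,\delta(\overline{B}C\varphi)\Big]\\ &\quad-\frac{(q-1)\,\overline{A}(1-x)\,\overline{C}(x^2)\,C(1-x)}{q\,g(A)\,g(\overline{B})\,g(B\overline{C^2})\,g(\overline{A}C^2)}\Big[(q-1)\delta(A\overline{C})\delta(B\overline{C})-q\,BC(-1)\delta(A\overline{C})-q\,AC(-1)\delta(B\overline{C})\\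 &\qquad+(q-1)\varphi(1-x)\delta(A\overline{C}\varphi)\delta(B\overline{C}\varphi)-q\,BC(-1)\varphi(x-1)\delta(A\overline{C}\varphi)-q\,AC(-1)\varphi(x-1)\delta(B\overline{C}\varphi)\Big]. \end{align*}
   Context: Let $p$ be an odd prime, $q=p^r$, and $\mathbb{F}_q$ the field with $q$ elements. Multiplicative characters of $\mathbb{F}_q^\times$ are extended to $\mathbb{F}_q$ by $\chi(0)=0$ (including the trivial character $\varepsilon$). $\varphi$ is the quadratic character. Characters are multiplied pointwise, $\overline{A}$ is the inverse of $A$, and an expression like $(\overline{A^2}B)(1-x)$ or $AB(-1)$ means the product character evaluated at that element of $\mathbb{F}_q$. For a character $A$, $\delta(A)=1$ if $A=\varepsilon$ and $0$ otherwise; for $x\in\mathbb{F}_q$, $\delta(x)=1$ if $x=0$ and $0$ otherwise. The Gauss sum is $g(\chi)=\sum_{x\in\mathbb{F}_q}\chi(x)\theta(x)$ with $\theta(\alpha)=\zeta_p^{\mathrm{tr}(\alpha)}$, $\zeta_p$ a fixed primitive $p$-th root of unity, $\mathrm{tr}$ the trace to $\mathbb{F}_p$. The binomial coefficient is $\binom{A}{B}=\frac{B(-1)}{q}\sum_{x\in\mathbb{F}_q}A(x)\overline{B}(1-x)$. Greene's series: ${}_{n+1}F_n(A_0,\dots,A_n;\,B_1,\dots,B_n\mid x)=\frac{q}{q-1}\sum_{\chi}\binom{A_0\chi}{\chi}\prod_{i=1}^n\binom{A_i\chi}{B_i\chi}\chi(x)$, summed over all multiplicative characters $\chi$. -}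

module Defs where

open import Level using (0ℓ)
open import Data.Nat as ℕ using (ℕ; zero; suc; _∸_)
open import Data.Nat.Primality using (Prime)
open import Data.Bool using (Bool; true; false; if_then_else_)
open import Data.List using (List; []; _∷_; length; map; foldr; upTo)
open import Data.Bool.ListAction using (any; all)
open import Data.List.Membership.Propositional using (_∈_)
open import Data.List.Relation.Unary.All using (All)
open import Data.List.Relation.Unary.Any using (Any)
open import Data.List.Relation.Unary.Unique.Propositional using (Unique)
open import Data.List.Relation.Unary.AllPairs using (AllPairs)
open import Data.Product using (_×_; _,_)
open import Relation.Nullary using (¬_; does)
open import Relation.Binary.PropositionalEquality using (_≡_)
open import Relation.Binary.Definitions using (DecidableEquality)
open import Algebra.Structures using (IsCommutativeRing)

record DField : Set₁ where
  infixl 6 _+_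
  infixl 7 _*_
  field
    Carrier : Set
    _+_ _*_ : Carrier → Carrier → Carrier
    -_      : Carrier → Carrier
    0# 1#   : Carrier
    _⁻¹     : Carrier → Carrier
    isCommutativeRing : IsCommutativeRing _≡_ _+_ _*_ -_ 0# 1#
    _≟_     : DecidableEquality Carrier
    0≢1     : ¬ (0# ≡ 1#)
    ⁻¹-inverse : ∀ x → ¬ (x ≡ 0#) → x * (x ⁻¹) ≡ 1#
    0⁻¹     : 0# ⁻¹ ≡ 0#

  infixl 6 _-_
  _-_ : Carrier → Carrier → Carrier
  x - y = x + (- y)

  infixl 7 _/_
  _/_ : Carrier → Carrier → Carrier
  x / y = x * (y ⁻¹)

  _×1 : ℕ → Carrier
  zero  ×1 = 0#
  suc n ×1 = 1# + (n ×1)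

  infixr 8 _^_
  _^_ : Carrier → ℕ → Carrier
  x ^ zero  = 1#
  x ^ suc n = x * (x ^ n)

  sumL : {A : Set} → List A → (A → Carrier) → Carrier
  sumL xs f = foldr (λ a s → f a + s) 0# xs

  prodL : List Carrier → Carrier
  prodL = foldr _*_ 1#

-- Multiplicative characters of F with values in K, extended by χ(0) = 0.
-- (A map with χ 0 = 0, χ 1 = 1, χ (xy) = χ x χ y is exactly a
-- homomorphism F^× → K^× extended by 0.)

module _ (F K : DField) where
  private
    module F = DField F
    module K = DField K

  record IsChar (χ : F.Carrier → K.Carrier) : Set where
    field
      at0  : χ F.0# ≡ K.0#
      at1  : χ F.1# ≡ K.1#
      mult : ∀ x y → χ (x F.* y) ≡ χ x K.* χ y

-- Standing setting: F = F_q a finite field of odd prime characteristic p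
-- with q = p^r elements; K a field of characteristic 0 (playing the role
-- of ℂ) containing a primitive p-th root of unity ζ and having the full
-- group of q-1 characters of F^×, listed (without repetition) in `chars`.

record Setup : Set₁ where
  field
    F K     : DField
    p r     : ℕ
    p-prime : Prime p
    p-odd   : ¬ (p ≡ 2)
    elems   : List (DField.Carrier F)
    elems-complete : ∀ x → x ∈ elems
    elems-unique   : Unique elems
    F-char  : DField._×1 F p ≡ DField.0# F
    F-size  : length elems ≡ p ℕ.^ r
    K-char0 : ∀ n → ¬ (DField._×1 K (suc n) ≡ DField.0# K)
    ζ       : DField.Carrier K
    ζ-root  : DField._^_ K ζ p ≡ DField.1# K
    ζ-prim  : ¬ (ζ ≡ DField.1# K)
    chars   : List (DField.Carrier F → DField.Carrier K)
    chars-are      : All (IsChar F K) chars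
    chars-complete : ∀ χ → IsChar F K χ → Any (λ ψ → ∀ x → ψ x ≡ χ x) chars
    chars-distinct : AllPairs (λ ψ χ → ¬ (∀ x → ψ x ≡ χ x)) chars
    chars-length   : length chars ≡ (p ℕ.^ r) ∸ 1

module Ops (S : Setup) where
  open Setup S
  module F = DField F
  module K = DField K
  open K public using (Carrier; _+_; _*_; -_; 0#; 1#; _⁻¹; _-_; _/_; _×1; _^_)

  Char : Set
  Char = F.Carrier → K.Carrier

  qN : ℕ
  qN = p ℕ.^ r

  q : K.Carrier
  q = qN ×1

  1F -1F 2F 4F : F.Carrier
  1F = F.1#
  -1F = F.- F.1#
  2F = 2 F.×1
  4F = 4 F.×1

  infixl 7 _·_
  _·_ : Char → Char → Char
  (A · B) x = A x * B x

  inv : Char → Char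
  inv A x = (A x) ⁻¹

  ε : Char
  ε x = if does (x F.≟ F.0#) then 0# else 1#

  isSquare : F.Carrier → Bool
  isSquare x = any (λ y → does ((y F.* y) F.≟ x)) elems

  φ : Char
  φ x = if does (x F.≟ F.0#) then 0#
        else (if isSquare x then 1# else - 1#)

  δc : Char → K.Carrier
  δc A = if all (λ x → does (A x K.≟ ε x)) elems then 1# else 0#

  δF : F.Carrier → K.Carrier
  δF x = if does (x F.≟ F.0#) then 1# else 0#

  tr : F.Carrier → F.Carrier
  tr α = F.sumL (upTo r) (λ i → α F.^ (p ℕ.^ i))

  -- the k < p with k·1 = t (t in the prime field)
  primeIndex : F.Carrier → ℕ
  primeIndex t = go p
    where
      go : ℕ → ℕ
      go zero    = 0
      go (suc n) = if does ((n F.×1) F.≟ t) then n else go n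

  θ : F.Carrier → K.Carrier
  θ α = ζ ^ primeIndex (tr α)

  g : Char → K.Carrier
  g χ = K.sumL elems (λ x → χ x * θ x)

  binom : Char → Char → K.Carrier
  binom A B = (B -1F / q) * K.sumL elems (λ x → A x * inv B (1F F.- x))

  -- Greene's series  {n+1}F{n}(A0, A1..An; B1..Bn | x),
  -- given A0 and the list of pairs (Ai , Bi)
  hyp : Char → List (Char × Char) → F.Carrier → K.Carrier
  hyp A0 ps x = (q / (q - 1#)) *
    K.sumL chars (λ χ → binom (A0 · χ) χ
                        * K.prodL (map (λ { (Ai , Bi) → binom (Ai · χ) (Bi · χ) }) ps)
                        * χ x)

  ₂F₁ : Char → Char → Char → F.Carrier → K.Carrier
  ₂F₁ A0 A1 B1 x = hyp A0 ((A1 , B1) ∷ []) x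

  ₃F₂ : Char → Char → Char → Char → Char → F.Carrier → K.Carrier
  ₃F₂ A0 A1 A2 B1 B2 x = hyp A0 ((A1 , B1) ∷ (A2 , B2) ∷ []) x

  ₄F₃ : Char → Char → Char → Char → Char → Char → Char → F.Carrier → K.Carrier
  ₄F₃ A0 A1 A2 A3 B1 B2 B3 x = hyp A0 ((A1 , B1) ∷ (A2 , B2) ∷ (A3 , B3) ∷ []) x

  _≈χ_ : Char → Char → Set
  A ≈χ B = ∀ x → A x ≡ B x

{-# OPTIONS --safe #-}

-- Write P = C² and N = g(A) g(B̄) g(ĀP) g(BP̄).  Expanding the binomial
-- coefficients in Jacobi sums and using orthogonality of characters gives
-- Greene's integral for ₂F₁, and Gauss sums allow its upper parameters to be
-- exchanged; N times the left-hand side becomes the product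
--   Σ_u A(u) ĀP(1-u) B̄(1-xu) · Σ_v PB̄(v) B(1-v) Ā(1-xv).
-- On the right, the Hasse–Davenport formula for φ and the Gauss sum formula
-- for binomial coefficients turn the ₄F₃ together with its ₃F₂ and ₂F₁
-- corrections into one series in Gauss sums, hence into a multiple of
--   Σ_χ χ(w) J(Aχ, ĀPχ) J(Bχ, χ̄) J(B̄Pχ, P̄χ̄),   w = -x²/(1-x),
-- up to the term χ = Ā; by orthogonality this is again a double sum over 𝔽_q.
-- Two Möbius substitutions, u ↦ a for fixed v and then v ↦ r for fixed a,
-- match the two double sums; the points where they degenerate produce
-- elementary one-variable sums, which account for all the δ-terms.
--
-- The additive character θ needs the trace to be additive, to take values in
-- the prime field and not to vanish identically: these follow from the
-- Frobenius map and from bounding the number of roots by the degree.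

module Submission where

open import Defs
open import Algebra.Bundles using (CommutativeRing)
import Algebra.Properties.CommutativeSemiring.Binomial as Binomial
import Algebra.Properties.CommutativeSemiring.Exp as CommExp
import Algebra.Properties.Monoid.Mult as Mult
import Algebra.Properties.Monoid.Sum as MonoidSum
import Algebra.Properties.Ring as RingProperties
import Algebra.Properties.Semiring.Exp as Exp
import Algebra.Solver.Ring as RingSolver
import Algebra.Solver.Ring.AlmostCommutativeRing as ACR
open import Algebra.Structures using (IsCommutativeRing)
open import Data.Bool using (if_then_else_; _∧_; _∨_)
open import Data.Bool.ListAction using (any; all)
open import Data.Empty using (⊥-elim; ⊥)
open import Data.Fin.Base as Fin using (Fin; toℕ)
import Data.Fin.Properties as Finₚ
open import Data.Integer using (0ℤ; 1ℤ)
open import Data.Integer.Base as ℤ using (ℤ; -[1+_])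
import Data.Integer.Properties as ℤₚ
open import Data.List using (List; []; _∷_; _++_; length; _∷ʳ_; map; upTo)
open import Data.List.Membership.Propositional using (_∈_; lose)
open import Data.List.Membership.Propositional.Properties using (∈-map⁺; ∈-length)
open import Data.List.Membership.Propositional.Properties.WithK using (unique∧set⇒bag)
import Data.List.Properties as Listₚ
open import Data.List.Relation.Binary.BagAndSetEquality using (∼bag⇒↭)
open import Data.List.Relation.Binary.Permutation.Propositional as Perm using (_↭_)
import Data.List.Relation.Binary.Permutation.Propositional.Properties as Permₚ
open import Data.List.Relation.Unary.All as All using (All; []; _∷_)
import Data.List.Relation.Unary.All.Properties as Allₚ
open import Data.List.Relation.Unary.AllPairs using (AllPairs; []; _∷_)
open import Data.List.Relation.Unary.Any as Any using (Any; here; there)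
open import Data.List.Relation.Unary.Unique.Propositional using (Unique)
import Data.List.Relation.Unary.Unique.Propositional.Properties as Uniqueₚ
open import Data.Maybe using (Maybe; just; nothing)
open import Data.Nat as ℕ using (ℕ; zero; suc; _<_; _≤_; _∸_; s≤s; z≤n; _!)
open import Data.Nat.Combinatorics as Combinatorics using (nCn≡1; k![n∸k]!∣n!; nCk≡n!/k![n-k]!)
open import Data.Nat.Coprimality using (Coprime; coprime-Bézout)
open import Data.Nat.DivMod using (m/n*n≡m)
open import Data.Nat.Divisibility using (_∣_; _∤_; divides; ∣⇒≤; m∣m*n; _∣?_)
open import Data.Nat.GCD using (module Bézout)
open import Data.Nat.Primality using (Prime; euclidsLemma; prime⇒irreducible; prime⇒nonTrivial; prime⇒nonZero)
import Data.Nat.Properties as ℕₚ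
open import Data.Product using (_×_; _,_; proj₁; proj₂; ∃)
open import Data.Sum using (_⊎_; inj₁; inj₂)
open import Data.Vec using (Vec; []; _∷_; lookup)
open import Function.Bundles using (mk⇔)
open import Level using (0ℓ)
open import Relation.Binary.Core using (Rel)
open import Relation.Binary.Definitions using (Decidable)
open import Relation.Binary.PropositionalEquality as ≡ using (_≡_; _≢_; refl; sym; trans; cong; cong₂; subst; module ≡-Reasoning)
open import Relation.Binary.Structures using (IsEquivalence)
open import Relation.Nullary using (¬_; yes; no; Dec; does)
open import Relation.Nullary.Decidable using (dec-true; dec-false; decidable-stable; map′)

-- The conditions on A and B keep A, B, AC̄² and BC̄² nontrivial. These are the products such as
-- (Aχ)χ̄ in which χ cancels, so the Jacobi sums involved are exact quotients of Gauss sums for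
-- every χ at once. The lower parameters C and Cφ have no such protection: when ĀC or B̄Cφ is
-- trivial, the binomial coefficient exceeds its Gauss sum expression by (q-1)/q. Multiplying out
-- two corrected binomials is what creates the ₃F₂ and ₂F₁ terms.
--
-- The last bracket has two sources. If B² = C², the term at infinity of the first substitution
-- becomes a trivial character sum; if A² = C², the exceptional term χ = Ā survives. Each equation
-- has the two solutions C and Cφ, hence the paired deltas. The delta at x = 2 appears where a ratio
-- of linear forms becomes constant.
--
-- The 4 in y is absorbed by χ(4) from the duplication formula, so w = 4y. The quadratic a(1-a) is
-- created by the second substitution, which turns 1 - axv into 1 - wa(1-a)r up to a denominator.
--
-- Since 0⁻¹ = 0 and characters vanish at 0, most degenerate points give 0 on both sides; the others
-- have to be tracked exactly.

-- Rational expressions are brought to a single fraction, which reduces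
-- their equality to a polynomial one once every inverted
-- subexpression is known not to vanish.
infixl 6 _⊕_ _⊖_
infixl 7 _⊗_ _⊘_
infix  8 ⊝_ ⅟_
data Rational (n : ℕ) : Set where
  ‵_  : Fin n → Rational n
  ♯_  : ℤ → Rational n
  _⊕_ _⊖_ _⊗_ _⊘_ : Rational n → Rational n → Rational n
  ⊝_ ⅟_ : Rational n → Rational n

#0 : ∀ {n} → Rational (1 ℕ.+ n)
#0 = ‵ Fin.zero

#1 : ∀ {n} → Rational (2 ℕ.+ n)
#1 = ‵ Fin.suc Fin.zero

#2 : ∀ {n} → Rational (3 ℕ.+ n)
#2 = ‵ Fin.suc (Fin.suc Fin.zero)

#3 : ∀ {n} → Rational (4 ℕ.+ n)
#3 = ‵ Fin.suc (Fin.suc (Fin.suc Fin.zero))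

𝟙 : ∀ {n} → Rational n
𝟙 = ♯ ℤ.1ℤ

divisors : ∀ {n} → Rational n → List (Rational n)
divisors (‵ i)   = []
divisors (♯ c)   = []
divisors (a ⊕ b) = divisors a ++ divisors b
divisors (a ⊖ b) = divisors a ++ divisors b
divisors (a ⊗ b) = divisors a ++ divisors b
divisors (a ⊘ b) = divisors a ++ (b ∷ divisors b)
divisors (⊝ a)   = divisors a
divisors (⅟ a)   = a ∷ divisors a

-- Field arithmetic: a ring solver with integer coefficients, and fractions

module FieldProperties (K : DField) where
  open DField K public
  open IsCommutativeRing isCommutativeRing public
    using (+-assoc; +-comm; +-identityˡ; +-identityʳ; *-assoc; *-comm; *-identityˡ; *-identityʳ;
           distribˡ; distribʳ; zeroˡ; zeroʳ; -‿inverseˡ; -‿inverseʳ)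

  commutativeRing : CommutativeRing 0ℓ 0ℓ
  commutativeRing = record { isCommutativeRing = isCommutativeRing }

  private
    module R = RingProperties (CommutativeRing.ring commutativeRing)

  ×1-homo-+ : ∀ m n → (m ℕ.+ n) ×1 ≡ m ×1 + n ×1
  ×1-homo-+ zero    n = sym (+-identityˡ _)
  ×1-homo-+ (suc m) n = trans (cong (1# +_) (×1-homo-+ m n)) (sym (+-assoc _ _ _))

  ×1-homo-* : ∀ m n → (m ℕ.* n) ×1 ≡ m ×1 * n ×1
  ×1-homo-* zero    n = sym (zeroˡ _)
  ×1-homo-* (suc m) n = begin
    (n ℕ.+ m ℕ.* n) ×1          ≡⟨ ×1-homo-+ n (m ℕ.* n) ⟩
    n ×1 + (m ℕ.* n) ×1         ≡⟨ cong₂ _+_ (sym (*-identityˡ _)) (×1-homo-* m n) ⟩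
    1# * n ×1 + m ×1 * n ×1     ≡⟨ sym (distribʳ _ _ _) ⟩
    (1# + m ×1) * n ×1          ∎
    where open ≡-Reasoning

  private
    -- 1 is sent to 1# itself rather than to 1# + 0#, so that the solver's
    -- constants agree definitionally with the ones in goals.
    ⟦_⟧ℕ : ℕ → Carrier
    ⟦ zero ⟧ℕ        = 0#
    ⟦ suc zero ⟧ℕ    = 1#
    ⟦ suc (suc n) ⟧ℕ = 1# + ⟦ suc n ⟧ℕ

    ⟦⟧ℕ≡×1 : ∀ n → ⟦ n ⟧ℕ ≡ n ×1
    ⟦⟧ℕ≡×1 zero          = refl
    ⟦⟧ℕ≡×1 (suc zero)    = sym (+-identityʳ 1#)
    ⟦⟧ℕ≡×1 (suc (suc n)) = cong (1# +_) (⟦⟧ℕ≡×1 (suc n))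

    ⟦_⟧ℤ : ℤ → Carrier
    ⟦ ℤ.+ n ⟧ℤ      = ⟦ n ⟧ℕ
    ⟦ -[1+ n ] ⟧ℤ = - ⟦ suc n ⟧ℕ

    ×1ℤ : ℤ → Carrier
    ×1ℤ (ℤ.+ n)    = n ×1
    ×1ℤ -[1+ n ] = - (suc n ×1)

    ⟦⟧ℤ≡×1ℤ : ∀ i → ⟦ i ⟧ℤ ≡ ×1ℤ i
    ⟦⟧ℤ≡×1ℤ (ℤ.+ n)    = ⟦⟧ℕ≡×1 n
    ⟦⟧ℤ≡×1ℤ -[1+ n ] = cong -_ (⟦⟧ℕ≡×1 (suc n))

    cancel-1 : ∀ a b → (1# + a) - (1# + b) ≡ a - b
    cancel-1 a b = begin
      (1# + a) - (1# + b)         ≡⟨ cong₂ _+_ (+-comm 1# a) (sym (R.-‿+-comm 1# b)) ⟩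
      (a + 1#) + (- 1# + - b)     ≡⟨ +-assoc a 1# _ ⟩
      a + (1# + (- 1# + - b))     ≡⟨ cong (a +_) (sym (+-assoc 1# (- 1#) (- b))) ⟩
      a + ((1# - 1#) + - b)       ≡⟨ cong (λ z → a + (z + - b)) (-‿inverseʳ 1#) ⟩
      a + (0# + - b)              ≡⟨ cong (a +_) (+-identityˡ _) ⟩
      a - b                       ∎
      where open ≡-Reasoning

    ×1ℤ-⊖ : ∀ m n → ×1ℤ (m ℤ.⊖ n) ≡ m ×1 - n ×1
    ×1ℤ-⊖ m zero = begin
      m ×1        ≡⟨ sym (+-identityʳ _) ⟩
      m ×1 + 0#   ≡⟨ cong (m ×1 +_) (sym R.-0#≈0#) ⟩
      m ×1 - 0#   ∎
      where open ≡-Reasoning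
    ×1ℤ-⊖ zero    (suc n) = sym (+-identityˡ _)
    ×1ℤ-⊖ (suc m) (suc n) = begin
      ×1ℤ (suc m ℤ.⊖ suc n) ≡⟨ cong ×1ℤ (ℤₚ.[1+m]⊖[1+n]≡m⊖n m n) ⟩
      ×1ℤ (m ℤ.⊖ n)         ≡⟨ ×1ℤ-⊖ m n ⟩
      m ×1 - n ×1           ≡⟨ sym (cancel-1 (m ×1) (n ×1)) ⟩
      (1# + m ×1) - (1# + n ×1) ∎
      where open ≡-Reasoning

    ×1ℤ-neg : ∀ i → ×1ℤ (ℤ.- i) ≡ - ×1ℤ i
    ×1ℤ-neg (ℤ.+ zero)  = sym R.-0#≈0#
    ×1ℤ-neg (ℤ.+ suc n) = refl
    ×1ℤ-neg -[1+ n ]  = sym (R.-‿involutive _)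

    ×1ℤ-+ : ∀ i j → ×1ℤ (i ℤ.+ j) ≡ ×1ℤ i + ×1ℤ j
    ×1ℤ-+ (ℤ.+ m)    (ℤ.+ n)    = ×1-homo-+ m n
    ×1ℤ-+ (ℤ.+ m)    -[1+ n ] = ×1ℤ-⊖ m (suc n)
    ×1ℤ-+ -[1+ m ] (ℤ.+ n)    = trans (×1ℤ-⊖ n (suc m)) (+-comm _ _)
    ×1ℤ-+ -[1+ m ] -[1+ n ] = begin
      - (suc (suc (m ℕ.+ n)) ×1)      ≡⟨ cong (λ k → - (k ×1)) (cong suc (sym (ℕₚ.+-suc m n))) ⟩
      - ((suc m ℕ.+ suc n) ×1)        ≡⟨ cong -_ (×1-homo-+ (suc m) (suc n)) ⟩
      - (suc m ×1 + suc n ×1)         ≡⟨ sym (R.-‿+-comm _ _) ⟩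
      - (suc m ×1) + - (suc n ×1)     ∎
      where open ≡-Reasoning

    ×1ℤ-* : ∀ i j → ×1ℤ (i ℤ.* j) ≡ ×1ℤ i * ×1ℤ j
    ×1ℤ-* (ℤ.+ m) (ℤ.+ n) = trans (cong ×1ℤ (sym (ℤₚ.pos-* m n))) (×1-homo-* m n)
    ×1ℤ-* (ℤ.+ m) -[1+ n ] = begin
      ×1ℤ (ℤ.+ m ℤ.* ℤ.- (ℤ.+ suc n))      ≡⟨ cong ×1ℤ (sym (ℤₚ.neg-distribʳ-* (ℤ.+ m) (ℤ.+ suc n))) ⟩
      ×1ℤ (ℤ.- (ℤ.+ m ℤ.* ℤ.+ suc n))      ≡⟨ ×1ℤ-neg (ℤ.+ m ℤ.* ℤ.+ suc n) ⟩
      - ×1ℤ (ℤ.+ m ℤ.* ℤ.+ suc n)          ≡⟨ cong -_ (×1ℤ-* (ℤ.+ m) (ℤ.+ suc n)) ⟩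
      - (m ×1 * suc n ×1)              ≡⟨ R.-‿distribʳ-* _ _ ⟩
      m ×1 * - (suc n ×1)              ∎
      where open ≡-Reasoning
    ×1ℤ-* -[1+ m ] (ℤ.+ n) = begin
      ×1ℤ (ℤ.- (ℤ.+ suc m) ℤ.* ℤ.+ n)      ≡⟨ cong ×1ℤ (sym (ℤₚ.neg-distribˡ-* (ℤ.+ suc m) (ℤ.+ n))) ⟩
      ×1ℤ (ℤ.- (ℤ.+ suc m ℤ.* ℤ.+ n))      ≡⟨ ×1ℤ-neg (ℤ.+ suc m ℤ.* ℤ.+ n) ⟩
      - ×1ℤ (ℤ.+ suc m ℤ.* ℤ.+ n)          ≡⟨ cong -_ (×1ℤ-* (ℤ.+ suc m) (ℤ.+ n)) ⟩
      - (suc m ×1 * n ×1)              ≡⟨ R.-‿distribˡ-* _ _ ⟩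
      - (suc m ×1) * n ×1              ∎
      where open ≡-Reasoning
    ×1ℤ-* -[1+ m ] -[1+ n ] = begin
      (suc m ℕ.* suc n) ×1             ≡⟨ ×1-homo-* (suc m) (suc n) ⟩
      suc m ×1 * suc n ×1              ≡⟨ sym (R.-‿involutive _) ⟩
      - - (suc m ×1 * suc n ×1)        ≡⟨ cong -_ (R.-‿distribʳ-* _ _) ⟩
      - (suc m ×1 * - (suc n ×1))      ≡⟨ R.-‿distribˡ-* _ _ ⟩
      - (suc m ×1) * - (suc n ×1)      ∎
      where open ≡-Reasoning

    -- The laws are proved for `×1ℤ`, whose cases are uniform in n, and then transported to the
    -- solver's `⟦_⟧ℤ`.
    via-×1ℤ₂ : ∀ {_∙_ : ℤ → ℤ → ℤ} {_∘_ : Carrier → Carrier → Carrier} →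
               (∀ i j → ×1ℤ (i ∙ j) ≡ ×1ℤ i ∘ ×1ℤ j) → ∀ i j → ⟦ i ∙ j ⟧ℤ ≡ ⟦ i ⟧ℤ ∘ ⟦ j ⟧ℤ
    via-×1ℤ₂ {_∙_} {_∘_} h i j = begin
      ⟦ i ∙ j ⟧ℤ          ≡⟨ ⟦⟧ℤ≡×1ℤ (i ∙ j) ⟩
      ×1ℤ (i ∙ j)         ≡⟨ h i j ⟩
      ×1ℤ i ∘ ×1ℤ j       ≡⟨ sym (cong₂ _∘_ (⟦⟧ℤ≡×1ℤ i) (⟦⟧ℤ≡×1ℤ j)) ⟩
      ⟦ i ⟧ℤ ∘ ⟦ j ⟧ℤ     ∎
      where open ≡-Reasoning

    almostCommutativeRing : ACR.AlmostCommutativeRing 0ℓ 0ℓ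
    almostCommutativeRing = ACR.fromCommutativeRing commutativeRing

    ℤ-morphism : CommutativeRing.rawRing ℤₚ.+-*-commutativeRing ACR.-Raw-AlmostCommutative⟶ almostCommutativeRing
    ℤ-morphism = record
      { ⟦_⟧    = ⟦_⟧ℤ
      ; +-homo = via-×1ℤ₂ {ℤ._+_} {_+_} ×1ℤ-+
      ; *-homo = via-×1ℤ₂ {ℤ._*_} {_*_} ×1ℤ-*
      ; -‿homo = λ i → trans (⟦⟧ℤ≡×1ℤ (ℤ.- i)) (trans (×1ℤ-neg i) (cong -_ (sym (⟦⟧ℤ≡×1ℤ i))))
      ; 0-homo = refl
      ; 1-homo = refl
      }

    coeff≟ : ∀ i j → Maybe (⟦ i ⟧ℤ ≡ ⟦ j ⟧ℤ)
    coeff≟ i j with i ℤₚ.≟ j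
    ... | yes i≡j = just (cong ⟦_⟧ℤ i≡j)
    ... | no _    = nothing

  module Solver = RingSolver (CommutativeRing.rawRing ℤₚ.+-*-commutativeRing) almostCommutativeRing
                    ℤ-morphism coeff≟
  open Solver public using (solve; Polynomial; con; var; _:=_; _:+_; _:*_; _:-_; :-_)

  infixl 7 _≢*_

  ⁻¹-inverseˡ : ∀ x → x ≢ 0# → x ⁻¹ * x ≡ 1#
  ⁻¹-inverseˡ x x≢0 = trans (*-comm _ _) (⁻¹-inverse x x≢0)

  *-cancelˡ : ∀ {x y z} → x ≢ 0# → x * y ≡ x * z → y ≡ z
  *-cancelˡ {x} {y} {z} x≢0 eq = begin
    y              ≡⟨ sym (lemma y) ⟩
    x ⁻¹ * (x * y) ≡⟨ cong (x ⁻¹ *_) eq ⟩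
    x ⁻¹ * (x * z) ≡⟨ lemma z ⟩
    z              ∎
    where
    open ≡-Reasoning
    lemma : ∀ t → x ⁻¹ * (x * t) ≡ t
    lemma t = trans (sym (*-assoc _ _ _)) (trans (cong (_* t) (⁻¹-inverseˡ x x≢0)) (*-identityˡ t))

  *-cancelʳ : ∀ {x y z} → x ≢ 0# → y * x ≡ z * x → y ≡ z
  *-cancelʳ x≢0 eq = *-cancelˡ x≢0 (trans (*-comm _ _) (trans eq (*-comm _ _)))

  _≢*_ : ∀ {x y} → x ≢ 0# → y ≢ 0# → x * y ≢ 0#
  _≢*_ {x} x≢0 y≢0 xy≡0 = y≢0 (*-cancelˡ x≢0 (trans xy≡0 (sym (zeroʳ x))))

  x*y≡0 : ∀ {x y} → x * y ≡ 0# → x ≡ 0# ⊎ y ≡ 0#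
  x*y≡0 {x} xy≡0 with x ≟ 0#
  ... | yes x≡0 = inj₁ x≡0
  ... | no  x≢0 = inj₂ (*-cancelˡ x≢0 (trans xy≡0 (sym (zeroʳ x))))

  x*y≡y⇒y≡0 : ∀ {x y} → x ≢ 1# → x * y ≡ y → y ≡ 0#
  x*y≡y⇒y≡0 {x} {y} x≢1 xy≡y with y ≟ 0#
  ... | yes y≡0 = y≡0
  ... | no  y≢0 = ⊥-elim (x≢1 (*-cancelʳ y≢0 (trans xy≡y (sym (*-identityˡ y)))))

  ⁻¹-unique : ∀ {x y} → x * y ≡ 1# → y ≡ x ⁻¹
  ⁻¹-unique {x} {y} xy≡1 = *-cancelˡ x≢0 (trans xy≡1 (sym (⁻¹-inverse x x≢0)))
    where
    x≢0 : x ≢ 0#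
    x≢0 x≡0 = 0≢1 (trans (sym (zeroˡ y)) (trans (cong (_* y) (sym x≡0)) xy≡1))

  ⁻¹-≢0 : ∀ {x} → x ≢ 0# → x ⁻¹ ≢ 0#
  ⁻¹-≢0 {x} x≢0 eq = 0≢1 (trans (sym (zeroʳ x)) (trans (cong (x *_) (sym eq)) (⁻¹-inverse x x≢0)))

  1≢0 : 1# ≢ 0#
  1≢0 eq = 0≢1 (sym eq)

  1⁻¹ : 1# ⁻¹ ≡ 1#
  1⁻¹ = sym (⁻¹-unique (*-identityˡ 1#))

  ⁻¹-involutive : ∀ x → x ⁻¹ ⁻¹ ≡ x
  ⁻¹-involutive x with x ≟ 0#
  ... | yes refl = trans (cong _⁻¹ 0⁻¹) 0⁻¹
  ... | no  x≢0  = sym (⁻¹-unique (⁻¹-inverseˡ x x≢0))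

  ⁻¹-distrib-* : ∀ x y → (x * y) ⁻¹ ≡ x ⁻¹ * y ⁻¹
  ⁻¹-distrib-* x y with x ≟ 0# | y ≟ 0#
  ... | yes refl | _ = trans (cong _⁻¹ (zeroˡ y)) (trans 0⁻¹ (sym (trans (cong (_* y ⁻¹) 0⁻¹) (zeroˡ _))))
  ... | no _ | yes refl = trans (cong _⁻¹ (zeroʳ x)) (trans 0⁻¹ (sym (trans (cong (x ⁻¹ *_) 0⁻¹) (zeroʳ _))))
  ... | no x≢0 | no y≢0 = sym (⁻¹-unique (begin
    x * y * (x ⁻¹ * y ⁻¹)    ≡⟨ solve 4 (λ a b c d → a :* b :* (c :* d) := a :* c :* (b :* d)) refl x y (x ⁻¹) (y ⁻¹) ⟩
    x * x ⁻¹ * (y * y ⁻¹)    ≡⟨ cong₂ _*_ (⁻¹-inverse x x≢0) (⁻¹-inverse y y≢0) ⟩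
    1# * 1#                  ≡⟨ *-identityˡ 1# ⟩
    1#                       ∎))
    where open ≡-Reasoning

  -0≡0 : - 0# ≡ 0#
  -0≡0 = R.-0#≈0#

  x-y≡0⇒x≡y : ∀ {x y} → x - y ≡ 0# → x ≡ y
  x-y≡0⇒x≡y {x} {y} eq = begin
    x            ≡⟨ solve 2 (λ a b → a := (a :- b) :+ b) refl x y ⟩
    (x - y) + y  ≡⟨ cong (_+ y) eq ⟩
    0# + y       ≡⟨ +-identityˡ y ⟩
    y            ∎
    where open ≡-Reasoning

  x≡y⇒x-y≡0 : ∀ {x y} → x ≡ y → x - y ≡ 0#
  x≡y⇒x-y≡0 {x} refl = -‿inverseʳ x

  -≢0 : ∀ {x} → x ≢ 0# → - x ≢ 0#
  -≢0 {x} x≢0 eq = x≢0 (trans (sym (R.-‿involutive x)) (trans (cong -_ eq) -0≡0))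

  /-unique : ∀ {x n d} → d ≢ 0# → x * d ≡ n → x ≡ n / d
  /-unique {x} {n} {d} d≢0 eq = *-cancelʳ d≢0 (begin
    x * d          ≡⟨ eq ⟩
    n              ≡⟨ sym (*-identityʳ n) ⟩
    n * 1#         ≡⟨ cong (n *_) (sym (⁻¹-inverseˡ d d≢0)) ⟩
    n * (d ⁻¹ * d) ≡⟨ sym (*-assoc _ _ _) ⟩
    n / d * d      ∎)
    where open ≡-Reasoning

  private
    module _ {x y p q n m : Carrier} (xp≡n : x * p ≡ n) where
      +-fraction : y * q ≡ m → (x + y) * (p * q) ≡ n * q + m * p
      +-fraction refl = trans (solve 4 (λ x y p q → (x :+ y) :* (p :* q) := (x :* p) :* q :+ (y :* q) :* p) refl x y p q)
                              (cong (λ z → z * q + _) xp≡n)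

      sub-fraction : y * q ≡ m → (x - y) * (p * q) ≡ n * q - m * p
      sub-fraction refl = trans (solve 4 (λ x y p q → (x :- y) :* (p :* q) := (x :* p) :* q :- (y :* q) :* p) refl x y p q)
                              (cong (λ z → z * q - _) xp≡n)

      *-fraction : y * q ≡ m → (x * y) * (p * q) ≡ n * m
      *-fraction refl = trans (solve 4 (λ x y p q → (x :* y) :* (p :* q) := (x :* p) :* (y :* q)) refl x y p q)
                              (cong (_* _) xp≡n)

    neg-fraction : ∀ {x p n} → x * p ≡ n → (- x) * p ≡ - n
    neg-fraction {x} {p} xp≡n = trans (solve 2 (λ x p → (:- x) :* p := :- (x :* p)) refl x p) (cong -_ xp≡n)

    /-fraction : ∀ {x y p q n m} → y ≢ 0# → x * p ≡ n → y * q ≡ m → (x / y) * (p * m) ≡ n * q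
    /-fraction {x} {y} {p} {q} {n} y≢0 xp≡n refl = begin
      x * y ⁻¹ * (p * (y * q))    ≡⟨ solve 5 (λ x i p y q → (x :* i) :* (p :* (y :* q)) := (x :* p) :* q :* (y :* i)) refl x (y ⁻¹) p y q ⟩
      x * p * q * (y * y ⁻¹)      ≡⟨ cong₂ (λ a b → a * q * b) xp≡n (⁻¹-inverse y y≢0) ⟩
      n * q * 1#                  ≡⟨ *-identityʳ _ ⟩
      n * q                       ∎
      where open ≡-Reasoning

    ⁻¹-fraction : ∀ {x p n} → x ≢ 0# → x * p ≡ n → x ⁻¹ * n ≡ p
    ⁻¹-fraction {x} {p} x≢0 refl = trans (sym (*-assoc _ _ _)) (trans (cong (_* p) (⁻¹-inverseˡ x x≢0)) (*-identityˡ p))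

    cross-multiply : ∀ {x y p q n m} → p ≢ 0# → q ≢ 0# → x * p ≡ n → y * q ≡ m → n * q ≡ m * p → x ≡ y
    cross-multiply {x} {y} {p} {q} {n} {m} p≢0 q≢0 xp≡n yq≡m eq = *-cancelʳ (p≢0 ≢* q≢0) (begin
      x * (p * q)      ≡⟨ solve 3 (λ x p q → x :* (p :* q) := (x :* p) :* q) refl x p q ⟩
      x * p * q        ≡⟨ cong (_* q) xp≡n ⟩
      n * q            ≡⟨ eq ⟩
      m * p            ≡⟨ cong (_* p) (sym yq≡m) ⟩
      y * q * p        ≡⟨ solve 3 (λ y p q → (y :* q) :* p := y :* (p :* q)) refl y p q ⟩
      y * (p * q)      ∎)
      where open ≡-Reasoning

  module _ {n : ℕ} (ρ : Vec Carrier n) where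
    ⟦_⟧ᵣ : Rational n → Carrier
    ⟦ ‵ i ⟧ᵣ   = lookup ρ i
    ⟦ ♯ c ⟧ᵣ   = ⟦ c ⟧ℤ
    ⟦ a ⊕ b ⟧ᵣ = ⟦ a ⟧ᵣ + ⟦ b ⟧ᵣ
    ⟦ a ⊖ b ⟧ᵣ = ⟦ a ⟧ᵣ - ⟦ b ⟧ᵣ
    ⟦ a ⊗ b ⟧ᵣ = ⟦ a ⟧ᵣ * ⟦ b ⟧ᵣ
    ⟦ a ⊘ b ⟧ᵣ = ⟦ a ⟧ᵣ / ⟦ b ⟧ᵣ
    ⟦ ⊝ a ⟧ᵣ   = - ⟦ a ⟧ᵣ
    ⟦ ⅟ a ⟧ᵣ   = ⟦ a ⟧ᵣ ⁻¹

  num den : ∀ {n} → Rational n → Polynomial n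
  num (‵ i)   = var i
  num (♯ c)   = con c
  num (a ⊕ b) = num a :* den b :+ num b :* den a
  num (a ⊖ b) = num a :* den b :- num b :* den a
  num (a ⊗ b) = num a :* num b
  num (a ⊘ b) = num a :* den b
  num (⊝ a)   = :- num a
  num (⅟ a)   = den a
  den (‵ i)   = con (ℤ.+ 1)
  den (♯ c)   = con (ℤ.+ 1)
  den (a ⊕ b) = den a :* den b
  den (a ⊖ b) = den a :* den b
  den (a ⊗ b) = den a :* den b
  den (a ⊘ b) = den a :* num b
  den (⊝ a)   = den a
  den (⅟ a)   = num a

  module _ {n : ℕ} (ρ : Vec Carrier n) where
    Defined : List (Rational n) → Set
    Defined = All (λ e → ⟦ ρ ⟧ᵣ e ≢ 0#)

    private
      ⟦_⟧ₚ : Polynomial n → Carrier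
      ⟦ p ⟧ₚ = Solver.⟦_⟧ p ρ

    split : ∀ as {bs} → Defined (as ++ bs) → Defined as × Defined bs
    split as = Allₚ.++⁻ as

    -- That the denominator is nonzero has to be proved along with the fraction. In a quotient the
    -- numerator of b moves into the denominator; it equals the value of b times a nonzero
    -- denominator, and b itself is listed among the divisors.
    fraction : ∀ e → Defined (divisors e) → ⟦ den e ⟧ₚ ≢ 0# × ⟦ ρ ⟧ᵣ e * ⟦ den e ⟧ₚ ≡ ⟦ num e ⟧ₚ
    fraction (‵ i) _ = 1≢0 , *-identityʳ _
    fraction (♯ c) _ = 1≢0 , *-identityʳ _
    fraction (a ⊕ b) ds =
      let da , db = split (divisors a) ds ; na , ea = fraction a da ; nb , eb = fraction b db
      in na ≢* nb , +-fraction ea eb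
    fraction (a ⊖ b) ds =
      let da , db = split (divisors a) ds ; na , ea = fraction a da ; nb , eb = fraction b db
      in na ≢* nb , sub-fraction ea eb
    fraction (a ⊗ b) ds =
      let da , db = split (divisors a) ds ; na , ea = fraction a da ; nb , eb = fraction b db
      in na ≢* nb , *-fraction ea eb
    fraction (a ⊘ b) ds with split (divisors a) ds
    ... | da , b≢0 ∷ db =
      let na , ea = fraction a da ; nb , eb = fraction b db
      in na ≢* subst (_≢ 0#) eb (b≢0 ≢* nb) , /-fraction b≢0 ea eb
    fraction (⊝ a) ds =
      let na , ea = fraction a ds
      in na , neg-fraction ea
    fraction (⅟ a) (a≢0 ∷ ds) =
      let na , ea = fraction a ds
      in subst (_≢ 0#) ea (a≢0 ≢* na) , ⁻¹-fraction a≢0 ea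

    -- Cross-multiplication leaves a polynomial identity between solver normal forms, so callers
    -- pass `refl` for it. The nonvanishing facts come in the order of `divisors`: for a quotient,
    -- first those of the dividend, then the divisor, then those inside the divisor.
    fieldEq : ∀ e₁ e₂ → Defined (divisors e₁) → Defined (divisors e₂) →
              Solver.⟦_⟧↓ (num e₁ :* den e₂) ρ ≡ Solver.⟦_⟧↓ (num e₂ :* den e₁) ρ →
              ⟦ ρ ⟧ᵣ e₁ ≡ ⟦ ρ ⟧ᵣ e₂
    fieldEq e₁ e₂ d₁ d₂ eq =
      let n₁ , q₁ = fraction e₁ d₁ ; n₂ , q₂ = fraction e₂ d₂
      in cross-multiply n₁ n₂ q₁ q₂ (Solver.prove ρ (num e₁ :* den e₂) (num e₂ :* den e₁) eq)

-- Finite sums over enumerated types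

record Enumeration (A : Set) : Set₁ where
  infix 4 _≈_ _≈?_
  field
    -- Equality is a parameter because characters are functions and are compared pointwise, while
    -- field elements use `_≡_`. Completeness and distinctness together make every class occur
    -- exactly once in the list.
    _≈_           : Rel A 0ℓ
    isEquivalence : IsEquivalence _≈_
    _≈?_          : Decidable _≈_
    list          : List A
    complete      : ∀ a → Any (a ≈_) list
    distinct      : AllPairs (λ a b → ¬ (a ≈ b)) list
  open IsEquivalence isEquivalence public
    renaming (refl to ≈-refl; sym to ≈-sym; trans to ≈-trans)

module Sums (K : DField) where
  open FieldProperties K

  infix 8 [_]
  [_] : {P : Set} → Dec P → Carrier
  [ P? ] = if does P? then 1# else 0#

  [_]-yes : {P : Set} (P? : Dec P) → P → [ P? ] ≡ 1#
  [ P? ]-yes p rewrite dec-true P? p = refl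

  [_]-no : {P : Set} (P? : Dec P) → ¬ P → [ P? ] ≡ 0#
  [ P? ]-no ¬p rewrite dec-false P? ¬p = refl

  [_]-cong : {P Q : Set} (P? : Dec P) (Q? : Dec Q) → (P → Q) → (Q → P) → [ P? ] ≡ [ Q? ]
  [ yes p ]-cong Q? to from = sym ([ Q? ]-yes (to p))
  [ no ¬p ]-cong Q? to from = sym ([ Q? ]-no (λ q → ¬p (from q)))

  -- Lets an equation that depends on a condition be used under the indicator of that condition.
  [_]-* : {P : Set} (P? : Dec P) {x y : Carrier} → (P → x ≡ y) → [ P? ] * x ≡ [ P? ] * y
  [ yes p ]-* x≡y = cong (1# *_) (x≡y p)
  [ no _ ]-* x≡y = trans (zeroˡ _) (sym (zeroˡ _))

  module _ {A : Set} where
    sumL-cong : ∀ xs {f g : A → Carrier} → (∀ x → f x ≡ g x) → sumL xs f ≡ sumL xs g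
    sumL-cong []       f≡g = refl
    sumL-cong (x ∷ xs) f≡g = cong₂ _+_ (f≡g x) (sumL-cong xs f≡g)

    sumL-0 : ∀ (xs : List A) → sumL xs (λ _ → 0#) ≡ 0#
    sumL-0 []       = refl
    sumL-0 (x ∷ xs) = trans (+-identityˡ _) (sumL-0 xs)

    sumL-1 : ∀ (xs : List A) → sumL xs (λ _ → 1#) ≡ length xs ×1
    sumL-1 []       = refl
    sumL-1 (x ∷ xs) = cong (1# +_) (sumL-1 xs)

    sumL-+ : ∀ xs (f g : A → Carrier) → sumL xs (λ x → f x + g x) ≡ sumL xs f + sumL xs g
    sumL-+ []       f g = sym (+-identityˡ 0#)
    sumL-+ (x ∷ xs) f g = trans (cong (f x + g x +_) (sumL-+ xs f g))
      (solve 4 (λ a b c d → a :+ b :+ (c :+ d) := a :+ c :+ (b :+ d)) refl _ _ _ _)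

    sumL-* : ∀ xs c (f : A → Carrier) → sumL xs (λ x → c * f x) ≡ c * sumL xs f
    sumL-* []       c f = sym (zeroʳ c)
    sumL-* (x ∷ xs) c f = trans (cong (c * f x +_) (sumL-* xs c f)) (sym (distribˡ _ _ _))

  sumL-swap : {A B : Set} (xs : List A) (ys : List B) (f : A → B → Carrier) →
              sumL xs (λ x → sumL ys (f x)) ≡ sumL ys (λ y → sumL xs (λ x → f x y))
  sumL-swap []       ys f = sym (sumL-0 ys)
  sumL-swap (x ∷ xs) ys f = trans (cong (sumL ys (f x) +_) (sumL-swap xs ys f))
                                  (sym (sumL-+ ys (f x) _))

  module _ {A : Set} (E : Enumeration A) where
    open Enumeration E

    ∑ : (A → Carrier) → Carrier
    ∑ = sumL list

    Respects : (A → Carrier) → Set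
    Respects f = ∀ {x y} → x ≈ y → f x ≡ f y

    private
      sumL-[]-miss : ∀ xs a (f : A → Carrier) → All (λ x → ¬ (a ≈ x)) xs → sumL xs (λ x → [ a ≈? x ] * f x) ≡ 0#
      sumL-[]-miss []       a f []          = refl
      sumL-[]-miss (x ∷ xs) a f (a≉x ∷ a≉s) = begin
        [ a ≈? x ] * f x + sumL xs _  ≡⟨ cong₂ (λ s t → s * f x + t) ([ a ≈? x ]-no a≉x) (sumL-[]-miss xs a f a≉s) ⟩
        0# * f x + 0#                 ≡⟨ trans (+-identityʳ _) (zeroˡ _) ⟩
        0#                            ∎
        where open ≡-Reasoning

      sumL-[]-hit : ∀ xs a (f : A → Carrier) → Respects f → AllPairs (λ a b → ¬ (a ≈ b)) xs → Any (a ≈_) xs →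
                    sumL xs (λ x → [ a ≈? x ] * f x) ≡ f a
      sumL-[]-hit (x ∷ xs) a f resp (x≉s ∷ _) (here a≈x) = begin
        [ a ≈? x ] * f x + sumL xs _  ≡⟨ cong₂ (λ s t → s * f x + t) ([ a ≈? x ]-yes a≈x)
                                          (sumL-[]-miss xs a f (All.map (λ x≉y a≈y → x≉y (≈-trans (≈-sym a≈x) a≈y)) x≉s)) ⟩
        1# * f x + 0#                 ≡⟨ trans (+-identityʳ _) (*-identityˡ _) ⟩
        f x                           ≡⟨ sym (resp a≈x) ⟩
        f a                           ∎
        where open ≡-Reasoning
      sumL-[]-hit (x ∷ xs) a f resp (x≉s ∷ dis) (there a∈xs) = begin
        [ a ≈? x ] * f x + sumL xs _  ≡⟨ cong₂ (λ s t → s * f x + t) ([ a ≈? x ]-no (miss x≉s a∈xs)) (sumL-[]-hit xs a f resp dis a∈xs) ⟩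
        0# * f x + f a                ≡⟨ cong (_+ f a) (zeroˡ _) ⟩
        0# + f a                      ≡⟨ +-identityˡ _ ⟩
        f a                           ∎
        where
        open ≡-Reasoning
        miss : ∀ {ys} → All (λ y → ¬ (x ≈ y)) ys → Any (a ≈_) ys → ¬ (a ≈ x)
        miss (x≉y ∷ _)  (here a≈y)  a≈x = x≉y (≈-trans (≈-sym a≈x) a≈y)
        miss (_ ∷ x≉ys) (there a∈) a≈x = miss x≉ys a∈ a≈x

    ∑-[] : ∀ a f → Respects f → ∑ (λ x → [ a ≈? x ] * f x) ≡ f a
    ∑-[] a f resp = sumL-[]-hit list a f resp distinct (complete a)

    -- The sum is n times c, where n counts the terms equal to c, so characteristic 0 forces n = 0.
    -- This counting argument later gives the orthogonality of characters at a point and the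
    -- multiplicativity of φ.
    ∑-two-valued : (∀ n → suc n ×1 ≢ 0#) → ∀ {c} → c ≢ 0# → ∀ f → Respects f →
                   (∀ a → f a ≡ 0# ⊎ f a ≡ c) → ∑ f ≡ 0# → ∀ a → f a ≡ 0#
    ∑-two-valued char0 {c} c≢0 f resp values ∑f≡0 a = go list (λ _ → values _) ∑f≡0 (complete a)
      where
      count : ∀ xs → ∃ λ n → sumL xs f ≡ n ×1 * c
      count []       = 0 , sym (zeroˡ c)
      count (x ∷ xs) with count xs | values x
      ... | n , eq | inj₁ fx≡0 = n , trans (cong₂ _+_ fx≡0 eq) (+-identityˡ _)
      ... | n , eq | inj₂ fx≡c = suc n , (begin
          f x + sumL xs f       ≡⟨ cong₂ _+_ (trans fx≡c (sym (*-identityˡ c))) eq ⟩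
          1# * c + n ×1 * c     ≡⟨ sym (distribʳ _ _ _) ⟩
          suc n ×1 * c          ∎)
          where open ≡-Reasoning

      go : ∀ xs → (∀ x → f x ≡ 0# ⊎ f x ≡ c) → sumL xs f ≡ 0# → Any (a ≈_) xs → f a ≡ 0#
      go (x ∷ xs) vals eq a∈ with vals x | count xs
      ... | inj₂ fx≡c | n , eq′ = ⊥-elim ((char0 n ≢* c≢0) (begin
          suc n ×1 * c        ≡⟨ distribʳ _ _ _ ⟩
          1# * c + n ×1 * c   ≡⟨ cong₂ _+_ (trans (*-identityˡ c) (sym fx≡c)) (sym eq′) ⟩
          f x + sumL xs f     ≡⟨ eq ⟩
          0#                  ∎))
          where open ≡-Reasoning
      go (x ∷ xs) vals eq (here a≈x)  | inj₁ fx≡0 | _ = trans (resp a≈x) fx≡0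
      go (x ∷ xs) vals eq (there a∈)  | inj₁ fx≡0 | _ =
        go xs vals (trans (sym (+-identityˡ _)) (trans (cong (_+ sumL xs f) (sym fx≡0)) eq)) a∈

  -- f and h may vanish at points where σ and τ fail to be mutually inverse.
  module _ {A B : Set} (E : Enumeration A) (E′ : Enumeration B) where
    private
      module A = Enumeration E
      module B = Enumeration E′

    ∑-reindex : ∀ {f h} → Respects E f → Respects E′ h →
                ∀ (σ : A → B) (τ : B → A) →
                (∀ {x y} → x A.≈ y → σ x B.≈ σ y) → (∀ {x y} → x B.≈ y → τ x A.≈ τ y) →
                (∀ x → f x ≢ 0# → x A.≈ τ (σ x) × f x ≡ h (σ x)) →
                (∀ y → h y ≢ 0# → y B.≈ σ (τ y) × h y ≡ f (τ y)) →
                ∑ E f ≡ ∑ E′ h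
    ∑-reindex {f} {h} f-resp h-resp σ τ σ-cong τ-cong to from = begin
      ∑ E f
        ≡⟨ sumL-cong A.list (λ x → sym (row x)) ⟩
      -- The pairs with σ x ≈ y and τ y ≈ x form the graph of a bijection that covers both supports.
      -- Summed by rows they give the sum of f, by columns that of h.
      ∑ E (λ x → ∑ E′ (λ y → [ σ x B.≈? y ] * ([ τ y A.≈? x ] * f x)))
        ≡⟨ sumL-swap A.list B.list _ ⟩
      ∑ E′ (λ y → ∑ E (λ x → [ σ x B.≈? y ] * ([ τ y A.≈? x ] * f x)))
        ≡⟨ sumL-cong B.list (λ y → sumL-cong A.list (λ x → exchange x y)) ⟩
      ∑ E′ (λ y → ∑ E (λ x → [ τ y A.≈? x ] * ([ σ x B.≈? y ] * h y)))
        ≡⟨ sumL-cong B.list column ⟩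
      ∑ E′ h ∎
      where
      open ≡-Reasoning

      row : ∀ x → ∑ E′ (λ y → [ σ x B.≈? y ] * ([ τ y A.≈? x ] * f x)) ≡ f x
      row x = trans (∑-[] E′ (σ x) _ (λ {y} {z} y≈z → cong (_* f x)
                      ([ τ y A.≈? x ]-cong (τ z A.≈? x) (A.≈-trans (τ-cong (B.≈-sym y≈z))) (A.≈-trans (τ-cong y≈z))))) here-or-zero
        where
        here-or-zero : [ τ (σ x) A.≈? x ] * f x ≡ f x
        here-or-zero with f x ≟ 0#
        ... | yes fx≡0 = trans (cong (_ *_) fx≡0) (trans (zeroʳ _) (sym fx≡0))
        ... | no  fx≢0 = trans (cong (_* f x) ([ τ (σ x) A.≈? x ]-yes (A.≈-sym (proj₁ (to x fx≢0))))) (*-identityˡ _)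

      column : ∀ y → ∑ E (λ x → [ τ y A.≈? x ] * ([ σ x B.≈? y ] * h y)) ≡ h y
      column y = trans (∑-[] E (τ y) _ (λ {w} {x} w≈x → cong (_* h y)
                         ([ σ w B.≈? y ]-cong (σ x B.≈? y) (B.≈-trans (σ-cong (A.≈-sym w≈x))) (B.≈-trans (σ-cong w≈x))))) here-or-zero
        where
        here-or-zero : [ σ (τ y) B.≈? y ] * h y ≡ h y
        here-or-zero with h y ≟ 0#
        ... | yes hy≡0 = trans (cong (_ *_) hy≡0) (trans (zeroʳ _) (sym hy≡0))
        ... | no  hy≢0 = trans (cong (_* h y) ([ σ (τ y) B.≈? y ]-yes (B.≈-sym (proj₁ (from y hy≢0))))) (*-identityˡ _)

      agree : ∀ x y → σ x B.≈ y → τ y A.≈ x → f x ≡ h y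
      agree x y σx≈y τy≈x with f x ≟ 0# | h y ≟ 0#
      ... | no  fx≢0 | _        = trans (proj₂ (to x fx≢0)) (h-resp σx≈y)
      ... | yes fx≡0 | yes hy≡0 = trans fx≡0 (sym hy≡0)
      ... | yes fx≡0 | no  hy≢0 = sym (trans (proj₂ (from y hy≢0)) (f-resp τy≈x))

      exchange : ∀ x y → [ σ x B.≈? y ] * ([ τ y A.≈? x ] * f x) ≡ [ τ y A.≈? x ] * ([ σ x B.≈? y ] * h y)
      exchange x y with σ x B.≈? y | τ y A.≈? x
      ... | yes p | yes q = cong (λ t → 1# * (1# * t)) (agree x y p q)
      ... | yes _ | no  _ = trans (*-identityˡ _) (trans (zeroˡ _) (sym (zeroˡ _)))
      ... | no  _ | yes _ = trans (zeroˡ _) (sym (trans (*-identityˡ _) (zeroˡ _)))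
      ... | no  _ | no  _ = trans (zeroˡ _) (sym (zeroˡ _))

-- Primes, the Frobenius map and roots of polynomials

prime∤⇒coprime : ∀ {p n} → Prime p → p ∤ n → Coprime p n
prime∤⇒coprime p-prime p∤n (d∣p , d∣n) with prime⇒irreducible p-prime d∣p
... | inj₁ d≡1 = d≡1
... | inj₂ d≡p = ⊥-elim (p∤n (subst (_∣ _) d≡p d∣n))

prime∤! : ∀ {p} → Prime p → ∀ n → n < p → p ∤ n !
prime∤! p-prime zero    n<p p∣1 = ℕₚ.<⇒≱ (ℕ.nonTrivial⇒n>1 _ {{prime⇒nonTrivial p-prime}}) (∣⇒≤ p∣1)
prime∤! p-prime (suc n) n<p p∣n! with euclidsLemma (suc n) (n !) p-prime p∣n!
... | inj₁ p∣1+n = ℕₚ.<⇒≱ n<p (∣⇒≤ p∣1+n)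
... | inj₂ p∣n!  = prime∤! p-prime n (ℕₚ.<-trans (ℕₚ.n<1+n n) n<p) p∣n!

-- p divides p!, which is the binomial coefficient times k! (p-k)!, and by `prime∤!` it divides
-- neither of these factorials.
prime∣C : ∀ {p} → Prime p → ∀ k → 0 < k → k < p → p ∣ (p Combinatorics.C k)
prime∣C {p} p-prime k 0<k k<p with euclidsLemma (p Combinatorics.C k) (k ! ℕ.* (p ∸ k) !) p-prime p∣product
  where
  instance _ = k ℕₚ.!* (p ∸ k) !≢0

  product≡p! : (p Combinatorics.C k) ℕ.* (k ! ℕ.* (p ∸ k) !) ≡ p !
  product≡p! = trans (cong (λ c → c ℕ.* (k ! ℕ.* (p ∸ k) !)) (nCk≡n!/k![n-k]! (ℕₚ.<⇒≤ k<p))) (m/n*n≡m (k![n∸k]!∣n! (ℕₚ.<⇒≤ k<p)))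

  n∣n! : ∀ {n} → 0 < n → n ∣ n !
  n∣n! {suc n} _ = m∣m*n (n !)

  p∣product : p ∣ (p Combinatorics.C k) ℕ.* (k ! ℕ.* (p ∸ k) !)
  p∣product = subst (p ∣_) (sym product≡p!) (n∣n! (ℕₚ.<-trans 0<k k<p))
... | inj₁ p∣C = p∣C
... | inj₂ p∣! with euclidsLemma (k !) ((p ∸ k) !) p-prime p∣!
...   | inj₁ p∣k!   = ⊥-elim (prime∤! p-prime k k<p p∣k!)
...   | inj₂ p∣p-k! = ⊥-elim (prime∤! p-prime (p ∸ k) (ℕₚ.∸-monoʳ-< {p} {k} {0} 0<k (ℕₚ.<⇒≤ k<p)) p∣p-k!)

module Powers (K : DField) where
  open FieldProperties K
  private
    module K = CommutativeRing commutativeRing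
    module Expᴷ = Exp K.semiring
    module CommExpᴷ = CommExp K.commutativeSemiring

  ^≡Exp : ∀ x n → x ^ n ≡ x Expᴷ.^ n
  ^≡Exp x zero    = refl
  ^≡Exp x (suc n) = cong (x *_) (^≡Exp x n)

  ^-homo-* : ∀ x m n → x ^ (m ℕ.+ n) ≡ x ^ m * x ^ n
  ^-homo-* x m n = trans (^≡Exp x (m ℕ.+ n)) (trans (Expᴷ.^-homo-* x m n) (sym (cong₂ _*_ (^≡Exp x m) (^≡Exp x n))))

  ^-assocʳ : ∀ x m n → (x ^ m) ^ n ≡ x ^ (m ℕ.* n)
  ^-assocʳ x m n = begin
    (x ^ m) ^ n            ≡⟨ ^≡Exp (x ^ m) n ⟩
    (x ^ m) Expᴷ.^ n       ≡⟨ cong (Expᴷ._^ n) (^≡Exp x m) ⟩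
    (x Expᴷ.^ m) Expᴷ.^ n  ≡⟨ Expᴷ.^-assocʳ x m n ⟩
    x Expᴷ.^ (m ℕ.* n)     ≡⟨ sym (^≡Exp x (m ℕ.* n)) ⟩
    x ^ (m ℕ.* n)          ∎
    where open ≡-Reasoning

  0^ : ∀ {n} → 0 < n → 0# ^ n ≡ 0#
  0^ (s≤s _) = zeroˡ _

  1^ : ∀ n → 1# ^ n ≡ 1#
  1^ zero    = refl
  1^ (suc n) = trans (*-identityˡ _) (1^ n)

  x^[m*n]≡1 : ∀ {x} m n → x ^ n ≡ 1# → x ^ (m ℕ.* n) ≡ 1#
  x^[m*n]≡1 {x} m n xⁿ≡1 = begin
    x ^ (m ℕ.* n) ≡⟨ cong (x ^_) (ℕₚ.*-comm m n) ⟩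
    x ^ (n ℕ.* m) ≡⟨ sym (^-assocʳ x n m) ⟩
    (x ^ n) ^ m   ≡⟨ cong (_^ m) xⁿ≡1 ⟩
    1# ^ m        ≡⟨ 1^ m ⟩
    1#            ∎
    where open ≡-Reasoning

  coprime⇒x≡1 : ∀ {x m n} → Coprime m n → x ^ m ≡ 1# → x ^ n ≡ 1# → x ≡ 1#
  coprime⇒x≡1 {x} {m} {n} m⊥n xᵐ≡1 xⁿ≡1 with coprime-Bézout m⊥n
  ... | Bézout.+- a b eq = begin
    x                      ≡⟨ sym (trans (cong (x *_) (x^[m*n]≡1 b n xⁿ≡1)) (*-identityʳ x)) ⟩
    x ^ (1 ℕ.+ b ℕ.* n)    ≡⟨ cong (x ^_) eq ⟩
    x ^ (a ℕ.* m)          ≡⟨ x^[m*n]≡1 a m xᵐ≡1 ⟩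
    1#                     ∎
    where open ≡-Reasoning
  ... | Bézout.-+ a b eq = begin
    x                      ≡⟨ sym (trans (cong (x *_) (x^[m*n]≡1 a m xᵐ≡1)) (*-identityʳ x)) ⟩
    x ^ (1 ℕ.+ a ℕ.* m)    ≡⟨ cong (x ^_) eq ⟩
    x ^ (b ℕ.* n)          ≡⟨ x^[m*n]≡1 b n xⁿ≡1 ⟩
    1#                     ∎
    where open ≡-Reasoning

  ×1-multiple : ∀ a {n} → n ×1 ≡ 0# → (a ℕ.* n) ×1 ≡ 0#
  ×1-multiple a {n} n≡0 = trans (×1-homo-* a n) (trans (cong (a ×1 *_) n≡0) (zeroʳ _))

  coprime-×1≢0 : ∀ {m n} → Coprime m n → m ×1 ≡ 0# → n ×1 ≢ 0#
  coprime-×1≢0 {m} {n} m⊥n m≡0 n≡0 with coprime-Bézout m⊥n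
  ... | Bézout.+- a b eq = 0≢1 (trans (sym (×1-multiple a m≡0))
          (trans (cong _×1 (sym eq)) (trans (cong (1# +_) (×1-multiple b n≡0)) (+-identityʳ 1#))))
  ... | Bézout.-+ a b eq = 0≢1 (trans (sym (×1-multiple b n≡0))
          (trans (cong _×1 (sym eq)) (trans (cong (1# +_) (×1-multiple a m≡0)) (+-identityʳ 1#))))

  module _ {p} (p-prime : Prime p) (char-p : p ×1 ≡ 0#) where
    private
      module B = Binomial K.commutativeSemiring
      module M = Mult K.+-monoid
      module Sum = MonoidSum K.+-monoid

      ×≡×1 : ∀ n x → n M.× x ≡ n ×1 * x
      ×≡×1 zero    x = sym (zeroˡ x)
      ×≡×1 (suc n) x = trans (cong₂ _+_ (sym (*-identityˡ x)) (×≡×1 n x)) (sym (distribʳ _ _ _))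

      p∣n⇒n×≡0 : ∀ {n} x → p ∣ n → n M.× x ≡ 0#
      p∣n⇒n×≡0 x (divides k refl) =
        trans (×≡×1 (k ℕ.* p) x) (trans (cong (_* x) (×1-multiple k char-p)) (zeroˡ x))

    ^p-+ : ∀ x y → (x + y) ^ p ≡ x ^ p + y ^ p
    ^p-+ x y = begin
      (x + y) ^ p        ≡⟨ ^≡Exp (x + y) p ⟩
      (x + y) Expᴷ.^ p   ≡⟨ B.theorem p x y ⟩
      B.binomialExpansion x y p ≡⟨ expansion p refl (ℕ.nonTrivial⇒n>1 _ {{prime⇒nonTrivial p-prime}}) ⟩
      x Expᴷ.^ p + y Expᴷ.^ p ≡⟨ sym (cong₂ _+_ (^≡Exp x p) (^≡Exp y p)) ⟩
      x ^ p + y ^ p      ∎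
      where
      open ≡-Reasoning
      -- The exponent is generalised to an n equal to p so that it can be matched as a double
      -- successor; this splits off the first and last terms, and p divides every coefficient in
      -- between.
      expansion : ∀ n → n ≡ p → 1 < n → B.binomialExpansion x y n ≡ x Expᴷ.^ n + y Expᴷ.^ n
      expansion n@(suc m@(suc l)) refl (s≤s (s≤s z≤n)) = begin
        t Fin.zero + Sum.sum (λ i → t (Fin.suc i))
          ≡⟨ cong₂ _+_ first (Sum.sum-init-last (λ i → t (Fin.suc i))) ⟩
        y Expᴷ.^ n + (Sum.sum (λ i → t (Fin.suc (Fin.inject₁ i))) + t (Fin.suc (Fin.fromℕ m)))
          ≡⟨ cong (y Expᴷ.^ n +_) (cong₂ _+_ (trans (Sum.sum-cong-≗ middle) (Sum.sum-replicate-zero m)) final) ⟩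
        y Expᴷ.^ n + (0# + x Expᴷ.^ n)
          ≡⟨ trans (cong (y Expᴷ.^ n +_) (+-identityˡ _)) (+-comm _ _) ⟩
        x Expᴷ.^ n + y Expᴷ.^ n ∎
        where
        t : Fin (suc n) → Carrier
        t = B.binomialTerm x y n
        first : t Fin.zero ≡ y Expᴷ.^ n
        first = trans (+-identityʳ _) (*-identityˡ _)
        middle : ∀ (i : Fin m) → t (Fin.suc (Fin.inject₁ i)) ≡ 0#
        middle i = p∣n⇒n×≡0 _ (prime∣C p-prime _ (s≤s z≤n)
          (s≤s (subst (_< m) (sym (Finₚ.toℕ-inject₁ i)) (Finₚ.toℕ<n i))))
        final : t (Fin.suc (Fin.fromℕ m)) ≡ x Expᴷ.^ n
        final = begin
          term (toℕ (Fin.suc (Fin.fromℕ m)))   ≡⟨ cong (λ k → term (suc k)) (Finₚ.toℕ-fromℕ m) ⟩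
          term n                                ≡⟨ cong₂ (λ c k → c M.× (x Expᴷ.^ n * y Expᴷ.^ k)) (nCn≡1 n) (ℕₚ.n∸n≡0 n) ⟩
          1 M.× (x Expᴷ.^ n * 1#)              ≡⟨ trans (+-identityʳ _) (*-identityʳ _) ⟩
          x Expᴷ.^ n                            ∎
          where
          term : ℕ → Carrier
          term k = (n Combinatorics.C k) M.× (x Expᴷ.^ k * y Expᴷ.^ (n ∸ k))

  -- Degree n c f says that f is a polynomial function of degree at most n
  -- whose coefficient at xⁿ is c, in terms of its difference quotients.
  Degree : ℕ → Carrier → (Carrier → Carrier) → Set
  Degree zero    c f = ∀ x → f x ≡ c
  Degree (suc n) c f = ∀ r → ∃ λ g → Degree n c g × (∀ x → f x - f r ≡ (x - r) * g x)

  Degree-+ : ∀ n {c d f g} → Degree n c f → Degree n d g → Degree n (c + d) (λ x → f x + g x)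
  Degree-+ zero    df dg x = cong₂ _+_ (df x) (dg x)
  Degree-+ (suc n) {f = f} {g} df dg r with df r | dg r
  ... | f′ , df′ , eqf | g′ , dg′ , eqg = (λ x → f′ x + g′ x) , Degree-+ n df′ dg′ , λ x → begin
    (f x + g x) - (f r + g r)         ≡⟨ solve 4 (λ a b c d → (a :+ b) :- (c :+ d) := (a :- c) :+ (b :- d)) refl _ _ _ _ ⟩
    (f x - f r) + (g x - g r)         ≡⟨ cong₂ _+_ (eqf x) (eqg x) ⟩
    (x - r) * f′ x + (x - r) * g′ x   ≡⟨ sym (distribˡ _ _ _) ⟩
    (x - r) * (f′ x + g′ x)           ∎
    where open ≡-Reasoning

  Degree-* : ∀ n a {c f} → Degree n c f → Degree n (a * c) (λ x → a * f x)
  Degree-* zero    a df x = cong (a *_) (df x)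
  Degree-* (suc n) a {f = f} df r with df r
  ... | f′ , df′ , eqf = (λ x → a * f′ x) , Degree-* n a df′ , λ x → begin
    a * f x - a * f r      ≡⟨ solve 3 (λ a b c → a :* b :- a :* c := a :* (b :- c)) refl _ _ _ ⟩
    a * (f x - f r)        ≡⟨ cong (a *_) (eqf x) ⟩
    a * ((x - r) * f′ x)   ≡⟨ solve 3 (λ a b c → a :* (b :* c) := b :* (a :* c)) refl _ _ _ ⟩
    (x - r) * (a * f′ x)   ∎
    where open ≡-Reasoning

  Degree-suc : ∀ n {c f} → Degree n c f → Degree (suc n) 0# f
  Degree-suc zero    df r = (λ _ → 0#) , (λ _ → refl) , λ x →
    trans (x≡y⇒x-y≡0 (trans (df x) (sym (df r)))) (sym (zeroʳ _))
  Degree-suc (suc n) df r with df r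
  ... | f′ , df′ , eqf = f′ , Degree-suc n df′ , eqf

  Degree-< : ∀ {m n c f} → m < n → Degree m c f → Degree n 0# f
  Degree-< {m} {suc n} (s≤s m≤n) df with ℕₚ.m≤n⇒m<n∨m≡n m≤n
  ... | inj₁ m<n  = Degree-suc n (Degree-< m<n df)
  ... | inj₂ refl = Degree-suc n df

  -- Product rule for difference quotients: xf(x) - rf(r) = (x-r)(f(x) + rf′(x)). The summand rf′
  -- has lower degree than f and leaves the leading coefficient alone.
  Degree-x* : ∀ n {c f} → Degree n c f → Degree (suc n) c (λ x → x * f x)
  Degree-x* zero {f = f} df r = f , df , λ x → begin
    x * f x - r * f r    ≡⟨ cong (λ t → x * f x - r * t) (trans (df r) (sym (df x))) ⟩
    x * f x - r * f x    ≡⟨ solve 3 (λ x r a → x :* a :- r :* a := (x :- r) :* a) refl _ _ _ ⟩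
    (x - r) * f x        ∎
    where open ≡-Reasoning
  Degree-x* (suc n) {c} {f} df r with df r
  ... | f′ , df′ , eqf = (λ x → f x + r * f′ x) ,
    subst (λ d → Degree (suc n) d _) (trans (cong (c +_) (zeroʳ r)) (+-identityʳ c))
          (Degree-+ (suc n) df (Degree-* (suc n) r (Degree-suc n df′))) , λ x → begin
      x * f x - r * f r                    ≡⟨ solve 4 (λ x r a b → x :* a :- r :* b := (x :- r) :* a :+ r :* (a :- b)) refl _ _ _ _ ⟩
      (x - r) * f x + r * (f x - f r)      ≡⟨ cong (λ t → (x - r) * f x + r * t) (eqf x) ⟩
      (x - r) * f x + r * ((x - r) * f′ x) ≡⟨ solve 4 (λ d a r b → d :* a :+ r :* (d :* b) := d :* (a :+ r :* b)) refl _ _ _ _ ⟩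
      (x - r) * (f x + r * f′ x)           ∎
    where open ≡-Reasoning

  Degree-^ : ∀ n → Degree n 1# (_^ n)
  Degree-^ zero    x = refl
  Degree-^ (suc n) = Degree-x* n (Degree-^ n)

  -- Divide out one root r. At any other root x the factor x - r is nonzero, so the difference
  -- quotient vanishes there; its degree is one less and its leading coefficient is the same.
  length-roots≤degree : ∀ n {c f} → c ≢ 0# → Degree n c f → ∀ {xs} → Unique xs → All (λ x → f x ≡ 0#) xs → length xs ≤ n
  length-roots≤degree n       c≢0 df [] [] = z≤n
  length-roots≤degree zero    c≢0 df (_ ∷ _) (fx≡0 ∷ _) = ⊥-elim (c≢0 (trans (sym (df _)) fx≡0))
  length-roots≤degree (suc n) {f = f} c≢0 df {r ∷ xs} (r≢xs ∷ uniq) (fr≡0 ∷ fxs≡0) with df r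
  ... | g , dg , eqg = s≤s (length-roots≤degree n c≢0 dg uniq (All.zipWith root (r≢xs , fxs≡0)))
    where
    root : ∀ {x} → r ≢ x × f x ≡ 0# → g x ≡ 0#
    root {x} (r≢x , fx≡0) with x*y≡0 (trans (sym (eqg x)) (x≡y⇒x-y≡0 (trans fx≡0 (sym fr≡0))))
    ... | inj₁ x-r≡0 = ⊥-elim (r≢x (sym (x-y≡0⇒x≡y x-r≡0)))
    ... | inj₂ gx≡0  = gx≡0

  prodL-↭ : ∀ {xs ys} → xs ↭ ys → prodL xs ≡ prodL ys
  prodL-↭ Perm.refl          = refl
  prodL-↭ (Perm.prep x p)    = cong (x *_) (prodL-↭ p)
  prodL-↭ (Perm.swap {xs} {ys} x y p) = trans (solve 3 (λ a b c → a :* (b :* c) := b :* (a :* c)) refl x y (prodL xs))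
                                    (cong (λ t → y * (x * t)) (prodL-↭ p))
  prodL-↭ (Perm.trans p q)   = trans (prodL-↭ p) (prodL-↭ q)

  module _ {xs : List Carrier} (complete : ∀ x → x ∈ xs) (unique : Unique xs) where
    private
      -- Replacing 0 by 1 lets the product over the whole field stand for the product of its units,
      -- with no need to filter the list.
      nonzero : Carrier → Carrier
      nonzero x = if does (x ≟ 0#) then 1# else x

      nonzero≢0 : ∀ x → nonzero x ≢ 0#
      nonzero≢0 x with x ≟ 0#
      ... | yes _   = 1≢0
      ... | no x≢0 = x≢0

      prodL≢0 : ∀ ys → prodL (map nonzero ys) ≢ 0#
      prodL≢0 []       = 1≢0
      prodL≢0 (y ∷ ys) = nonzero≢0 y ≢* prodL≢0 ys

      module _ {α : Carrier} (α≢0 : α ≢ 0#) where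
        scale : Carrier → Carrier
        scale x = if does (x ≟ 0#) then 1# else α

        nonzero-scale : ∀ x → nonzero (α * x) ≡ scale x * nonzero x
        nonzero-scale x with x ≟ 0# | (α * x) ≟ 0#
        ... | yes _    | yes _    = sym (*-identityˡ 1#)
        ... | yes refl | no αx≢0  = ⊥-elim (αx≢0 (zeroʳ α))
        ... | no x≢0   | yes αx≡0 = ⊥-elim ((α≢0 ≢* x≢0) αx≡0)
        ... | no _     | no _     = refl

        prodL-scale : ∀ ys → prodL (map nonzero (map (α *_) ys)) ≡ prodL (map scale ys) * prodL (map nonzero ys)
        prodL-scale []       = sym (*-identityˡ 1#)
        prodL-scale (y ∷ ys) = trans (cong₂ _*_ (nonzero-scale y) (prodL-scale ys))
          (solve 4 (λ a b c d → (a :* b) :* (c :* d) := (a :* c) :* (b :* d)) refl _ _ _ _)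

        α*-↭ : xs ↭ map (α *_) xs
        α*-↭ = ∼bag⇒↭ (unique∧set⇒bag unique (Uniqueₚ.map⁺ (*-cancelˡ α≢0) unique)
          (λ {x} → mk⇔ (λ _ → subst (_∈ map (α *_) xs) (α*[α⁻¹*x] x) (∈-map⁺ (α *_) (complete (α ⁻¹ * x)))) (λ _ → complete _)))
          where
          α*[α⁻¹*x] : ∀ x → α * (α ⁻¹ * x) ≡ x
          α*[α⁻¹*x] x = trans (sym (*-assoc _ _ _)) (trans (cong (_* x) (⁻¹-inverse α α≢0)) (*-identityˡ x))

        prodL-scale≡1 : prodL (map scale xs) ≡ 1#
        prodL-scale≡1 = *-cancelʳ (prodL≢0 xs) (trans (sym (prodL-scale xs))
          (trans (sym (prodL-↭ (Permₚ.map⁺ nonzero α*-↭))) (sym (*-identityˡ _))))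

        prodL-scale-miss : ∀ ys → All (0# ≢_) ys → prodL (map scale ys) ≡ α ^ length ys
        prodL-scale-miss []       []            = refl
        prodL-scale-miss (y ∷ ys) (0≢y ∷ 0≢ys) with y ≟ 0#
        ... | yes y≡0 = ⊥-elim (0≢y (sym y≡0))
        ... | no _    = cong (α *_) (prodL-scale-miss ys 0≢ys)

        prodL-scale-hit : ∀ ys → Unique ys → 0# ∈ ys → α * prodL (map scale ys) ≡ α ^ length ys
        prodL-scale-hit (y ∷ ys) (y≢ys ∷ _) (here refl) with 0# ≟ 0#
        ... | yes _   = cong (α *_) (trans (*-identityˡ _) (prodL-scale-miss ys y≢ys))
        ... | no 0≢0  = ⊥-elim (0≢0 refl)
        prodL-scale-hit (y ∷ ys) (y≢ys ∷ uniq) (there 0∈ys) with y ≟ 0#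
        ... | yes refl = ⊥-elim (All.lookup y≢ys 0∈ys refl)
        ... | no _     = cong (α *_) (prodL-scale-hit ys uniq 0∈ys)

    -- For nonzero x, multiplication by x permutes the field and preserves the product of the units;
    -- cancelling that product shows that the factors `scale` multiply to 1. They are x at every
    -- entry except the single 0, so one more x completes the power.
    x^length≡x : ∀ x → x ^ length xs ≡ x
    x^length≡x x with x ≟ 0#
    ... | no x≢0 = trans (sym (prodL-scale-hit x≢0 xs unique (complete 0#)))
                         (trans (cong (x *_) (prodL-scale≡1 x≢0)) (*-identityʳ x))
    ... | yes refl = 0^ (∈-length (complete 0#))

-- Induction as a term whose motive is left to unification, so that it can involve the local
-- function of `primeIndex`, which cannot be named outside its definition.
ℕ-induction : (P : ℕ → Set) → P 0 → (∀ n → P n → P (suc n)) → ∀ n → P n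
ℕ-induction P base step zero    = base
ℕ-induction P base step (suc n) = step n (ℕ-induction P base step n)

-- The trace to the prime field

module Trace (S : Setup) where
  open Setup S using (p; r; p-prime; elems; elems-complete; elems-unique; F-char; F-size)
  open Ops S using (tr; primeIndex)
  private
    module K where
      open FieldProperties (Setup.K S) public
      open Powers (Setup.K S) public
    open FieldProperties (Setup.F S)
    open Powers (Setup.F S)
    open Sums (Setup.F S) using (sumL-cong; sumL-+)

    1<p : 1 < p
    1<p = ℕ.nonTrivial⇒n>1 p {{prime⇒nonTrivial p-prime}}

    0<p : 0 < p
    0<p = ℕₚ.<-trans (s≤s z≤n) 1<p

  ×1≡0⇒p∣ : ∀ {n} → n ×1 ≡ 0# → p ∣ n
  ×1≡0⇒p∣ {n} n≡0 = decidable-stable (p ∣? n) (λ p∤n → coprime-×1≢0 (prime∤⇒coprime p-prime p∤n) F-char n≡0)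

  x^q≡x : ∀ x → x ^ (p ℕ.^ r) ≡ x
  x^q≡x x = subst (λ n → x ^ n ≡ x) F-size (x^length≡x elems-complete elems-unique x)

  r≢0 : r ≢ 0
  r≢0 r≡0 = two (subst (λ n → length elems ≡ p ℕ.^ n) r≡0 F-size) (elems-complete 0#) (elems-complete 1#)
    where
    two : ∀ {xs} → length xs ≡ 1 → 0# ∈ xs → 1# ∈ xs → ⊥
    two {_ ∷ []} _ (here 0≡x) (here 1≡x) = 0≢1 (trans 0≡x (sym 1≡x))

  ^pⁿ-+ : ∀ n x y → (x + y) ^ (p ℕ.^ n) ≡ x ^ (p ℕ.^ n) + y ^ (p ℕ.^ n)
  ^pⁿ-+ zero    x y = trans (*-identityʳ _) (sym (cong₂ _+_ (*-identityʳ x) (*-identityʳ y)))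
  ^pⁿ-+ (suc n) x y = begin
    (x + y) ^ (p ℕ.* p ℕ.^ n)                       ≡⟨ sym (^-assocʳ (x + y) p (p ℕ.^ n)) ⟩
    ((x + y) ^ p) ^ (p ℕ.^ n)                       ≡⟨ cong (_^ (p ℕ.^ n)) (^p-+ p-prime F-char x y) ⟩
    (x ^ p + y ^ p) ^ (p ℕ.^ n)                     ≡⟨ ^pⁿ-+ n (x ^ p) (y ^ p) ⟩
    (x ^ p) ^ (p ℕ.^ n) + (y ^ p) ^ (p ℕ.^ n)       ≡⟨ cong₂ _+_ (^-assocʳ x p (p ℕ.^ n)) (^-assocʳ y p (p ℕ.^ n)) ⟩
    x ^ (p ℕ.* p ℕ.^ n) + y ^ (p ℕ.* p ℕ.^ n)       ∎
    where open ≡-Reasoning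

  tr-+ : ∀ x y → tr (x + y) ≡ tr x + tr y
  tr-+ x y = trans (sumL-cong (upTo r) (λ i → ^pⁿ-+ i x y)) (sumL-+ (upTo r) _ _)

  private
    partialTrace : ℕ → Carrier → Carrier
    partialTrace n x = sumL (upTo n) (λ i → x ^ (p ℕ.^ i))

    sumL-∷ʳ : ∀ (xs : List ℕ) n f → sumL (xs ∷ʳ n) f ≡ sumL xs f + f n
    sumL-∷ʳ []       n f = trans (+-identityʳ _) (sym (+-identityˡ _))
    sumL-∷ʳ (x ∷ xs) n f = trans (cong (f x +_) (sumL-∷ʳ xs n f)) (sym (+-assoc _ _ _))

    partialTrace-suc : ∀ n x → partialTrace (suc n) x ≡ partialTrace n x + x ^ (p ℕ.^ n)
    partialTrace-suc n x = trans (cong (λ l → sumL l (λ i → x ^ (p ℕ.^ i))) (sym (Listₚ.upTo-∷ʳ n)))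
                                 (sumL-∷ʳ (upTo n) n _)

    -- Frobenius shifts the partial trace by one step.
    partialTrace-^p : ∀ n x → partialTrace n x ^ p + x ≡ partialTrace n x + x ^ (p ℕ.^ n)
    partialTrace-^p zero    x = trans (cong (_+ x) (0^ 0<p)) (cong (0# +_) (sym (*-identityʳ x)))
    partialTrace-^p (suc n) x = begin
      partialTrace (suc n) x ^ p + x
        ≡⟨ cong (λ t → t ^ p + x) (partialTrace-suc n x) ⟩
      (partialTrace n x + x ^ (p ℕ.^ n)) ^ p + x
        ≡⟨ cong (_+ x) (^p-+ p-prime F-char _ _) ⟩
      (partialTrace n x ^ p + (x ^ (p ℕ.^ n)) ^ p) + x
        ≡⟨ solve 3 (λ a b x → (a :+ b) :+ x := (a :+ x) :+ b) refl _ _ _ ⟩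
      (partialTrace n x ^ p + x) + (x ^ (p ℕ.^ n)) ^ p
        ≡⟨ cong₂ _+_ (partialTrace-^p n x) (trans (^-assocʳ x (p ℕ.^ n) p) (cong (x ^_) (ℕₚ.*-comm (p ℕ.^ n) p))) ⟩
      (partialTrace n x + x ^ (p ℕ.^ n)) + x ^ (p ℕ.^ suc n)
        ≡⟨ cong (_+ x ^ (p ℕ.^ suc n)) (sym (partialTrace-suc n x)) ⟩
      partialTrace (suc n) x + x ^ (p ℕ.^ suc n) ∎
      where open ≡-Reasoning

    Degree-cong : ∀ n {c} f g → (∀ x → f x ≡ g x) → Degree n c f → Degree n c g
    Degree-cong zero    f g f≡g df x = trans (sym (f≡g x)) (df x)
    Degree-cong (suc n) f g f≡g df r with df r
    ... | f′ , df′ , eq = f′ , df′ , λ x → trans (sym (cong₂ _-_ (f≡g x) (f≡g r))) (eq x)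

    -- The newest power of x has larger degree than all earlier ones together, so it determines the
    -- leading coefficient.
    Degree-partialTrace : ∀ n → Degree (p ℕ.^ n) 1# (partialTrace (suc n))
    Degree-partialTrace< : ∀ n → Degree (p ℕ.^ n) 0# (partialTrace n)
    Degree-partialTrace n = subst (λ c → Degree (p ℕ.^ n) c (partialTrace (suc n))) (+-identityˡ 1#)
      (Degree-cong (p ℕ.^ n) (λ x → partialTrace n x + x ^ (p ℕ.^ n)) (partialTrace (suc n)) (λ x → sym (partialTrace-suc n x))
        (Degree-+ (p ℕ.^ n) (Degree-partialTrace< n) (Degree-^ (p ℕ.^ n))))
    Degree-partialTrace< zero    = Degree-suc 0 (λ _ → refl)
    Degree-partialTrace< (suc n) = Degree-< (ℕₚ.^-monoʳ-< p 1<p (ℕₚ.n<1+n n)) (Degree-partialTrace n)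

  -- After r steps the power gained by the Frobenius shift is x^q = x, which is the one lost, so the
  -- shift permutes the terms of the trace cyclically.
  tr^p : ∀ x → tr x ^ p ≡ tr x
  tr^p x = begin
    tr x ^ p              ≡⟨ solve 2 (λ a x → a := (a :+ x) :- x) refl _ x ⟩
    (tr x ^ p + x) - x    ≡⟨ cong (_- x) (trans (partialTrace-^p r x) (cong (tr x +_) (x^q≡x x))) ⟩
    (tr x + x) - x        ≡⟨ solve 2 (λ a x → (a :+ x) :- x := a) refl _ x ⟩
    tr x                  ∎
    where open ≡-Reasoning

  -- As a polynomial of degree p^(r-1) with leading coefficient 1, the trace has fewer than q roots.
  tr-nontrivial : ∃ λ x → tr x ≢ 0#
  tr-nontrivial with All.all? (λ x → tr x ≟ 0#) elems
  ... | no ¬all = Any.satisfied (Allₚ.¬All⇒Any¬ (λ x → tr x ≟ 0#) elems ¬all)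
  ... | yes all = ⊥-elim (too-many r refl)
    where
    too-many : ∀ n → n ≡ r → ⊥
    too-many zero    0≡r    = r≢0 (sym 0≡r)
    too-many (suc n) refl = ℕₚ.<⇒≱ (ℕₚ.^-monoʳ-< p 1<p (ℕₚ.n<1+n n))
      (subst (_≤ p ℕ.^ n) F-size (length-roots≤degree (p ℕ.^ n) 1≢0 (Degree-partialTrace n) elems-unique all))

  private
    ×1^p : ∀ n → (n ×1) ^ p ≡ n ×1
    ×1^p zero    = 0^ 0<p
    ×1^p (suc n) = trans (^p-+ p-prime F-char 1# (n ×1)) (cong₂ _+_ (1^ p) (×1^p n))

    ×1-injective : ∀ {m n} → m < n → n < p → m ×1 ≢ n ×1
    ×1-injective {m} {n} m<n n<p m≡n = ℕₚ.<⇒≱ (ℕₚ.≤-<-trans (ℕₚ.m∸n≤m n m) n<p) (∣⇒≤ {{ℕ.>-nonZero (ℕₚ.m<n⇒0<n∸m m<n)}}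
      (×1≡0⇒p∣ {n ∸ m} (begin
        (n ∸ m) ×1                  ≡⟨ solve 2 (λ a b → a := (b :+ a) :- b) refl ((n ∸ m) ×1) (m ×1) ⟩
        (m ×1 + (n ∸ m) ×1) - m ×1  ≡⟨ cong (_- m ×1) (sym (×1-homo-+ m (n ∸ m))) ⟩
        (m ℕ.+ (n ∸ m)) ×1 - m ×1   ≡⟨ cong (λ k → k ×1 - m ×1) (ℕₚ.m+[n∸m]≡n (ℕₚ.<⇒≤ m<n)) ⟩
        n ×1 - m ×1                 ≡⟨ x≡y⇒x-y≡0 (sym m≡n) ⟩
        0#                          ∎)))
      where open ≡-Reasoning

    Degree-x^p-x : Degree p 1# (λ x → x ^ p - x)
    Degree-x^p-x = subst (λ c → Degree p c (λ x → x ^ p - x)) (trans (cong (1# +_) (zeroʳ _)) (+-identityʳ 1#))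
      (Degree-cong p (λ x → x ^ p + - 1# * x ^ 1) (λ x → x ^ p - x) (λ x → cong (x ^ p +_) (solve 1 (λ a → :- con (ℤ.+ 1) :* (a :* con (ℤ.+ 1)) := :- a) refl x))
        (Degree-+ p (Degree-^ p) (Degree-* p (- 1#) (Degree-< 1<p (Degree-^ 1)))))
      where import Data.Integer as ℤ

  -- The p distinct multiples of 1 are already roots of x^p - x; any other root would be root number
  -- p + 1 of a polynomial of degree p.
  x^p≡x⇒x≡n×1 : ∀ {x} → x ^ p ≡ x → ∃ λ n → n < p × n ×1 ≡ x
  x^p≡x⇒x≡n×1 {x} x^p≡x = decidable-stable (ℕₚ.anyUpTo? (λ n → (n ×1) ≟ x) p) λ none →
    ℕₚ.<⇒≱ (ℕₚ.n<1+n p) (subst (_≤ p) (cong suc (Listₚ.length-applyUpTo _×1 p))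
      (length-roots≤degree p 1≢0 Degree-x^p-x
        (Allₚ.applyUpTo⁺₁ _×1 p (λ i<p x≡i → none (_ , i<p , sym x≡i)) ∷ Uniqueₚ.applyUpTo⁺₁ _×1 p ×1-injective)
        (x≡y⇒x-y≡0 x^p≡x ∷ Allₚ.applyUpTo⁺₂ _×1 p (λ i → x≡y⇒x-y≡0 (×1^p i)))))

  -- primeIndex scans down from p with a local function; abstracting the
  -- starting point p from the goal makes that function available to induction.
  primeIndex-×1 : ∀ t n → n < p → n ×1 ≡ t → primeIndex t ×1 ≡ t
  primeIndex-×1 t = from-induction (ℕ-induction _ (λ _ ()) step)
    where
    from-induction : (∀ k → _) → ∀ n → n < p → n ×1 ≡ t → primeIndex t ×1 ≡ t
    from-induction ind with p
    ... | k = ind k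

    step : ∀ k → _ → _
    step k ih n n<1+k n≡t with (k ×1) ≟ t
    ... | yes k≡t = k≡t
    ... | no  k≢t with ℕₚ.m≤n⇒m<n∨m≡n (ℕ.s≤s⁻¹ n<1+k)
    ...   | inj₁ n<k  = ih n n<k n≡t
    ...   | inj₂ refl = ⊥-elim (k≢t n≡t)

  primeIndex-tr : ∀ x → primeIndex (tr x) ×1 ≡ tr x
  primeIndex-tr x with x^p≡x⇒x≡n×1 (tr^p x)
  ... | n , n<p , n≡t = primeIndex-×1 (tr x) n n<p n≡t

-- The additive character of the field

module AdditiveCharacter (S : Setup) where
  open Setup S using (p; p-prime; elems; elems-complete; elems-unique; F-char; ζ; ζ-root; ζ-prim)
  open Ops S using (tr; primeIndex; θ)
  open Trace S
  private
    module F where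
      open FieldProperties (Setup.F S) public
      open Powers (Setup.F S) public
    open FieldProperties (Setup.K S)
    open Powers (Setup.K S)

  elements : Enumeration F.Carrier
  elements = record
    { _≈_           = _≡_
    ; isEquivalence = ≡.isEquivalence
    ; _≈?_          = F._≟_
    ; list          = elems
    ; complete      = elems-complete
    ; distinct      = elems-unique
    }

  open Sums (Setup.K S)

  private
    ζ^-cong-≤ : ∀ {m n} → m ≤ n → m F.×1 ≡ n F.×1 → ζ ^ m ≡ ζ ^ n
    ζ^-cong-≤ {m} {n} m≤n m≡n with ×1≡0⇒p∣ {n ∸ m} (begin
        (n ∸ m) F.×1                      ≡⟨ F.solve 2 (λ a b → a F.:= (b F.:+ a) F.:- b) refl ((n ∸ m) F.×1) (m F.×1) ⟩
        (m F.×1 F.+ (n ∸ m) F.×1) F.- m F.×1 ≡⟨ cong (F._- (m F.×1)) (sym (F.×1-homo-+ m (n ∸ m))) ⟩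
        (m ℕ.+ (n ∸ m)) F.×1 F.- m F.×1   ≡⟨ cong (λ k → k F.×1 F.- m F.×1) (ℕₚ.m+[n∸m]≡n m≤n) ⟩
        n F.×1 F.- m F.×1                 ≡⟨ F.x≡y⇒x-y≡0 (sym m≡n) ⟩
        F.0#                              ∎)
      where open ≡-Reasoning
    ... | divides k n∸m≡k*p = sym (begin
        ζ ^ n                ≡⟨ cong (ζ ^_) (sym (ℕₚ.m+[n∸m]≡n m≤n)) ⟩
        ζ ^ (m ℕ.+ (n ∸ m))  ≡⟨ ^-homo-* ζ m (n ∸ m) ⟩
        ζ ^ m * ζ ^ (n ∸ m)  ≡⟨ cong (λ d → ζ ^ m * ζ ^ d) n∸m≡k*p ⟩
        ζ ^ m * ζ ^ (k ℕ.* p) ≡⟨ cong (ζ ^ m *_) (x^[m*n]≡1 k p ζ-root) ⟩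
        ζ ^ m * 1#           ≡⟨ *-identityʳ _ ⟩
        ζ ^ m                ∎)
      where open ≡-Reasoning

    ζ^-cong : ∀ m n → m F.×1 ≡ n F.×1 → ζ ^ m ≡ ζ ^ n
    ζ^-cong m n m≡n with ℕₚ.≤-total m n
    ... | inj₁ m≤n = ζ^-cong-≤ m≤n m≡n
    ... | inj₂ n≤m = sym (ζ^-cong-≤ n≤m (sym m≡n))

  -- The indices of traces add only modulo p, and `ζ-root` absorbs the difference.
  θ-+ : ∀ x y → θ (x F.+ y) ≡ θ x * θ y
  θ-+ x y = trans (ζ^-cong (primeIndex (tr (x F.+ y))) (primeIndex (tr x) ℕ.+ primeIndex (tr y)) (begin
      primeIndex (tr (x F.+ y)) F.×1                          ≡⟨ primeIndex-tr (x F.+ y) ⟩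
      tr (x F.+ y)                                            ≡⟨ tr-+ x y ⟩
      tr x F.+ tr y                                           ≡⟨ sym (cong₂ F._+_ (primeIndex-tr x) (primeIndex-tr y)) ⟩
      primeIndex (tr x) F.×1 F.+ primeIndex (tr y) F.×1       ≡⟨ sym (F.×1-homo-+ (primeIndex (tr x)) _) ⟩
      (primeIndex (tr x) ℕ.+ primeIndex (tr y)) F.×1          ∎))
    (^-homo-* ζ (primeIndex (tr x)) (primeIndex (tr y)))
    where open ≡-Reasoning

  -- Where the trace is nonzero the index is prime to p. If ζ to that index were 1, then together
  -- with ζ^p = 1 this would force ζ = 1.
  θ-nontrivial : ∃ λ x → θ x ≢ 1#
  θ-nontrivial with tr-nontrivial
  ... | x , tr≢0 = x , λ θx≡1 → ζ-prim (coprime⇒x≡1 (prime∤⇒coprime p-prime p∤index) ζ-root θx≡1)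
    where
    p∤index : p ∤ primeIndex (tr x)
    p∤index (divides k eq) = tr≢0 (trans (sym (primeIndex-tr x)) (trans (cong F._×1 eq) (F.×1-multiple k F-char)))

  ∑-translate : ∀ a (f : F.Carrier → Carrier) → ∑ elements (λ x → f (x F.+ a)) ≡ ∑ elements f
  ∑-translate a f = ∑-reindex elements elements (cong _) (cong _) (F._+ a) (F._- a) (cong _) (cong _)
    (λ x _ → F.solve 2 (λ x a → x F.:= (x F.:+ a) F.:- a) refl x a , refl)
    (λ y _ → sym (back y) , cong f (sym (back y)))
    where
    back : ∀ y → (y F.- a) F.+ a ≡ y
    back y = F.solve 2 (λ y a → (y F.:- a) F.:+ a F.:= y) refl y a

  ∑θ≡0 : ∑ elements θ ≡ 0#
  ∑θ≡0 with θ-nontrivial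
  ... | a , θa≢1 = x*y≡y⇒y≡0 θa≢1 (begin
      θ a * ∑ elements θ              ≡⟨ sym (sumL-* elems (θ a) θ) ⟩
      ∑ elements (λ x → θ a * θ x)    ≡⟨ sumL-cong elems (λ x → trans (*-comm _ _) (sym (θ-+ x a))) ⟩
      ∑ elements (λ x → θ (x F.+ a))  ≡⟨ ∑-translate a θ ⟩
      ∑ elements θ                    ∎)
    where open ≡-Reasoning

-- Multiplicative characters and their orthogonality

all-does : {A : Set} {P : A → Set} (P? : ∀ x → Dec (P x)) (xs : List A) →
           all (λ x → does (P? x)) xs ≡ does (All.all? P? xs)
all-does P? []       = refl
all-does P? (x ∷ xs) = cong (does (P? x) ∧_) (all-does P? xs)

module Characters (S : Setup) where
  open Setup S using (r)
  open Setup S using (p; p-prime; elems; elems-complete; elems-unique; F-size; K-char0;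
                      chars; chars-are; chars-complete; chars-distinct; chars-length) public
  open Ops S using (Char; qN; q; _·_; inv; ε; δc; δF; _≈χ_) public
  open AdditiveCharacter S using (elements; ∑-translate) public
  open Trace S using (r≢0)
  module F where
    open FieldProperties (Setup.F S) public
    open Powers (Setup.F S) public
  open FieldProperties (Setup.K S) public
  open Sums (Setup.K S) public

  record Character : Set where
    constructor character
    field
      ⟦_⟧    : Char
      isChar : IsChar (Setup.F S) (Setup.K S) ⟦_⟧
    open IsChar isChar public
  open Character public using (⟦_⟧; isChar)

  at0 : ∀ A → ⟦ A ⟧ F.0# ≡ 0#
  at0 A = Character.at0 A

  at1 : ∀ A → ⟦ A ⟧ F.1# ≡ 1#
  at1 A = Character.at1 A

  mult : ∀ A x y → ⟦ A ⟧ (x F.* y) ≡ ⟦ A ⟧ x * ⟦ A ⟧ y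
  mult A = Character.mult A

  module _ (A : Character) where
    ⟦⟧≢0 : ∀ {x} → x ≢ F.0# → ⟦ A ⟧ x ≢ 0#
    ⟦⟧≢0 {x} x≢0 Ax≡0 = 1≢0 (begin
      1#                        ≡⟨ sym (at1 A) ⟩
      ⟦ A ⟧ F.1#                ≡⟨ cong ⟦ A ⟧ (sym (F.⁻¹-inverse x x≢0)) ⟩
      ⟦ A ⟧ (x F.* x F.⁻¹)      ≡⟨ mult A x (x F.⁻¹) ⟩
      ⟦ A ⟧ x * ⟦ A ⟧ (x F.⁻¹)  ≡⟨ cong (_* ⟦ A ⟧ (x F.⁻¹)) Ax≡0 ⟩
      0# * ⟦ A ⟧ (x F.⁻¹)       ≡⟨ zeroˡ _ ⟩
      0#                        ∎)
      where open ≡-Reasoning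

    ⟦⟧-⁻¹ : ∀ x → ⟦ A ⟧ (x F.⁻¹) ≡ (⟦ A ⟧ x) ⁻¹
    ⟦⟧-⁻¹ x with x F.≟ F.0#
    ... | yes refl = trans (cong ⟦ A ⟧ F.0⁻¹) (trans (at0 A) (trans (sym 0⁻¹) (cong _⁻¹ (sym (at0 A)))))
    ... | no x≢0   = ⁻¹-unique (trans (sym (mult A x (x F.⁻¹))) (trans (cong ⟦ A ⟧ (F.⁻¹-inverse x x≢0)) (at1 A)))

    ⟦⟧-/ : ∀ x y → ⟦ A ⟧ (x F./ y) ≡ ⟦ A ⟧ x / ⟦ A ⟧ y
    ⟦⟧-/ x y = trans (mult A x (y F.⁻¹)) (cong (⟦ A ⟧ x *_) (⟦⟧-⁻¹ y))

  ε-char : Character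
  ε-char = character ε record { at0 = ε-at0 ; at1 = ε-at1 ; mult = ε-mult }
    where
    ε-at0 : ε F.0# ≡ 0#
    ε-at0 with F.0# F.≟ F.0#
    ... | yes _  = refl
    ... | no 0≢0 = ⊥-elim (0≢0 refl)

    ε-at1 : ε F.1# ≡ 1#
    ε-at1 with F.1# F.≟ F.0#
    ... | yes 1≡0 = ⊥-elim (F.1≢0 1≡0)
    ... | no _    = refl

    ε-mult : ∀ x y → ε (x F.* y) ≡ ε x * ε y
    ε-mult x y with x F.≟ F.0# | y F.≟ F.0# | (x F.* y) F.≟ F.0#
    ... | yes _    | _        | yes _    = sym (zeroˡ _)
    ... | no _     | yes _    | yes _    = sym (zeroʳ _)
    ... | no x≢0   | no y≢0   | yes xy≡0 = ⊥-elim ((x≢0 F.≢* y≢0) xy≡0)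
    ... | yes refl | _        | no xy≢0  = ⊥-elim (xy≢0 (F.zeroˡ y))
    ... | no _     | yes refl | no xy≢0  = ⊥-elim (xy≢0 (F.zeroʳ x))
    ... | no _     | no _     | no _     = sym (*-identityˡ 1#)

  ε≡1 : ∀ {x} → x ≢ F.0# → ε x ≡ 1#
  ε≡1 {x} x≢0 rewrite dec-false (x F.≟ F.0#) x≢0 = refl

  infixl 7 _⊛_
  _⊛_ : Character → Character → Character
  ⟦ A ⊛ B ⟧ = ⟦ A ⟧ · ⟦ B ⟧
  isChar (A ⊛ B) = record
    { at0  = trans (cong (_* _) (at0 A)) (zeroˡ _)
    ; at1  = trans (cong₂ _*_ (at1 A) (at1 B)) (*-identityˡ 1#)
    ; mult = λ x y → trans (cong₂ _*_ (mult A x y) (mult B x y))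
               (solve 4 (λ a b c d → (a :* b) :* (c :* d) := (a :* c) :* (b :* d)) refl _ _ _ _)
    }

  infix 9 _ᶜ
  _ᶜ : Character → Character
  ⟦ A ᶜ ⟧ = inv ⟦ A ⟧
  isChar (A ᶜ) = record
    { at0  = trans (cong _⁻¹ (at0 A)) 0⁻¹
    ; at1  = trans (cong _⁻¹ (at1 A)) 1⁻¹
    ; mult = λ x y → trans (cong _⁻¹ (mult A x y)) (⁻¹-distrib-* _ _)
    }

  infix 4 _≋_ _≋?_
  _≋_ : Character → Character → Set
  A ≋ B = ⟦ A ⟧ ≈χ ⟦ B ⟧

  private
    agree? : ∀ A B → Dec (All (λ x → ⟦ A ⟧ x ≡ ⟦ B ⟧ x) elems)
    agree? A B = All.all? (λ x → ⟦ A ⟧ x ≟ ⟦ B ⟧ x) elems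

  _≋?_ : ∀ A B → Dec (A ≋ B)
  A ≋? B = map′ (λ all x → All.lookup all (elems-complete x)) (λ A≋B → All.tabulate (λ {x} _ → A≋B x)) (agree? A B)

  δ : Character → Carrier
  δ A = [ A ≋? ε-char ]

  δ-yes : ∀ A → A ≋ ε-char → δ A ≡ 1#
  δ-yes A = [ A ≋? ε-char ]-yes

  δ-no : ∀ A → ¬ (A ≋ ε-char) → δ A ≡ 0#
  δ-no A = [ A ≋? ε-char ]-no

  δ-cong : ∀ {A B} → A ≋ B → δ A ≡ δ B
  δ-cong {A} {B} A≋B = [ A ≋? ε-char ]-cong (B ≋? ε-char) (λ h x → trans (sym (A≋B x)) (h x)) (λ h x → trans (A≋B x) (h x))

  δc≡δ : ∀ A → δc ⟦ A ⟧ ≡ δ A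
  δc≡δ A = cong (λ b → if b then 1# else 0#) (all-does (λ x → ⟦ A ⟧ x ≟ ε x) elems)

  ≋-on-units : ∀ A B → (∀ {x} → x ≢ F.0# → ⟦ A ⟧ x ≡ ⟦ B ⟧ x) → A ≋ B
  ≋-on-units A B h x with x F.≟ F.0#
  ... | yes refl = trans (at0 A) (sym (at0 B))
  ... | no x≢0   = h x≢0

  ⊛ᶜ≋ε : ∀ A → A ⊛ A ᶜ ≋ ε-char
  ⊛ᶜ≋ε A = ≋-on-units (A ⊛ A ᶜ) ε-char λ {x} x≢0 → trans (⁻¹-inverse (⟦ A ⟧ x) (⟦⟧≢0 A x≢0)) (sym (ε≡1 x≢0))

  ε⊛ : ∀ A → ε-char ⊛ A ≋ A
  ε⊛ A = ≋-on-units (ε-char ⊛ A) A λ x≢0 → trans (cong (_* _) (ε≡1 x≢0)) (*-identityˡ _)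

  ⊛-cancel : ∀ A B → A ⊛ (A ᶜ ⊛ B) ≋ B
  ⊛-cancel A B x = trans (sym (*-assoc _ _ _)) (trans (cong (_* ⟦ B ⟧ x) (⊛ᶜ≋ε A x)) (ε⊛ B x))

  ⊛-ᶜ-cancel : ∀ A B → A ᶜ ⊛ (A ⊛ B) ≋ B
  ⊛-ᶜ-cancel A B x = trans (sym (*-assoc _ _ _)) (trans (cong (_* ⟦ B ⟧ x) (trans (*-comm _ _) (⊛ᶜ≋ε A x))) (ε⊛ B x))

  ≋⇒⊛ᶜ≋ε : ∀ {A B} → A ≋ B → A ⊛ B ᶜ ≋ ε-char
  ≋⇒⊛ᶜ≋ε {A} {B} A≋B x = trans (cong (_* _) (A≋B x)) (⊛ᶜ≋ε B x)

  ⊛ᶜ≋ε⇒≋ : ∀ {A B} → A ⊛ B ᶜ ≋ ε-char → A ≋ B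
  ⊛ᶜ≋ε⇒≋ {A} {B} h x = trans (sym (⊛-cancel B A x)) (trans (cong (⟦ B ⟧ x *_) (trans (*-comm _ _) (h x)))
                         (trans (*-comm _ _) (ε⊛ B x)))

  private
    -- `chars` holds bare functions. Attaching the proofs in place keeps the order, so sums over the
    -- two lists agree term by term.
    attach : ∀ {χs} → All (IsChar (Setup.F S) (Setup.K S)) χs → List Character
    attach []         = []
    attach (χ-is ∷ χs) = character _ χ-is ∷ attach χs

    attach-complete : ∀ {χs} (is : All (IsChar _ _) χs) A → Any (λ ψ → ψ ≈χ ⟦ A ⟧) χs → Any (A ≋_) (attach is)
    attach-complete (_ ∷ is) A (here ψ≈A) = here (λ x → sym (ψ≈A x))
    attach-complete (_ ∷ is) A (there A∈) = there (attach-complete is A A∈)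

    attach-distinct : ∀ {χs} (is : All (IsChar _ _) χs) → AllPairs (λ ψ χ → ¬ (ψ ≈χ χ)) χs → AllPairs (λ A B → ¬ (A ≋ B)) (attach is)
    attach-distinct []       []           = []
    attach-distinct (_ ∷ is) (≉s ∷ pairs) = lift is ≉s ∷ attach-distinct is pairs
      where
      lift : ∀ {ψ χs} (is : All (IsChar _ _) χs) → All (λ χ → ¬ (ψ ≈χ χ)) χs → All (λ B → ¬ (ψ ≈χ ⟦ B ⟧)) (attach is)
      lift []       []       = []
      lift (_ ∷ is) (≉ ∷ ≉s) = ≉ ∷ lift is ≉s

    sumL-attach : ∀ {χs} (is : All (IsChar _ _) χs) (f : Char → Carrier) → sumL (attach is) (λ A → f ⟦ A ⟧) ≡ sumL χs f
    sumL-attach []       f = refl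
    sumL-attach (_ ∷ is) f = cong (_ +_) (sumL-attach is f)

  characters : Enumeration Character
  characters = record
    { _≈_           = _≋_
    ; isEquivalence = record { refl = λ _ → refl ; sym = λ A≋B x → sym (A≋B x) ; trans = λ A≋B B≋C x → trans (A≋B x) (B≋C x) }
    ; _≈?_          = _≋?_
    ; list          = attach chars-are
    ; complete      = λ A → attach-complete chars-are A (chars-complete ⟦ A ⟧ (isChar A))
    ; distinct      = attach-distinct chars-are chars-distinct
    }

  ∑χ : (Character → Carrier) → Carrier
  ∑χ = ∑ characters

  ∑x : (F.Carrier → Carrier) → Carrier
  ∑x = ∑ elements

  sumL-chars : ∀ f → sumL chars f ≡ ∑χ (λ A → f ⟦ A ⟧)
  sumL-chars f = sym (sumL-attach chars-are f)

  private
    1<qN : 1 < qN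
    1<qN with r | r≢0
    ... | zero  | 0≢0 = ⊥-elim (0≢0 refl)
    ... | suc n | _   = ℕₚ.≤-trans 1<p (ℕₚ.m≤m*n p (p ℕ.^ n) {{ℕ.>-nonZero (ℕₚ.m^n>0 p {{prime⇒nonZero p-prime}} n)}})
      where
      1<p : 1 < p
      1<p = ℕ.nonTrivial⇒n>1 p {{prime⇒nonTrivial p-prime}}

    [n∸1]×1 : ∀ {n} → 1 < n → (n ∸ 1) ×1 ≡ n ×1 - 1#
    [n∸1]×1 {suc n} _ = solve 1 (λ a → a := (con 1ℤ :+ a) :- con 1ℤ) refl (n ×1)

    >0⇒×1≢0 : ∀ {n} → 0 < n → n ×1 ≢ 0#
    >0⇒×1≢0 {suc n} _ = K-char0 n

  q≢0 : q ≢ 0#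
  q≢0 = >0⇒×1≢0 (ℕₚ.<-trans (s≤s z≤n) 1<qN)

  q-1≢0 : q - 1# ≢ 0#
  q-1≢0 eq = >0⇒×1≢0 (ℕₚ.m<n⇒0<n∸m 1<qN) (trans ([n∸1]×1 1<qN) eq)

  ∑x-1 : ∑x (λ _ → 1#) ≡ q
  ∑x-1 = trans (sumL-1 elems) (cong _×1 F-size)

  ∑χ-1 : ∑χ (λ _ → 1#) ≡ q - 1#
  ∑χ-1 = trans (sym (sumL-chars (λ _ → 1#))) (trans (sumL-1 chars) (trans (cong _×1 chars-length) ([n∸1]×1 1<qN)))

  ∑x-cong : ∀ {f g : F.Carrier → Carrier} → (∀ x → f x ≡ g x) → ∑x f ≡ ∑x g
  ∑x-cong = sumL-cong elems

  ∑χ-cong : ∀ {f g : Character → Carrier} → (∀ A → f A ≡ g A) → ∑χ f ≡ ∑χ g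
  ∑χ-cong = sumL-cong (Enumeration.list characters)

  ∑x-* : ∀ c (f : F.Carrier → Carrier) → ∑x (λ x → c * f x) ≡ c * ∑x f
  ∑x-* = sumL-* elems

  ∑χ-* : ∀ c (f : Character → Carrier) → ∑χ (λ x → c * f x) ≡ c * ∑χ f
  ∑χ-* = sumL-* (Enumeration.list characters)

  ∑x-*ʳ : ∀ c (f : F.Carrier → Carrier) → ∑x (λ x → f x * c) ≡ ∑x f * c
  ∑x-*ʳ c f = trans (∑x-cong (λ x → *-comm (f x) c)) (trans (∑x-* c f) (*-comm _ _))

  ∑x-+ : ∀ (f g : F.Carrier → Carrier) → ∑x (λ x → f x + g x) ≡ ∑x f + ∑x g
  ∑x-+ = sumL-+ elems

  ∑χ-+ : ∀ (f g : Character → Carrier) → ∑χ (λ x → f x + g x) ≡ ∑χ f + ∑χ g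
  ∑χ-+ = sumL-+ (Enumeration.list characters)

  ∑χx-swap : ∀ (f : Character → F.Carrier → Carrier) → ∑χ (λ A → ∑x (f A)) ≡ ∑x (λ x → ∑χ (λ A → f A x))
  ∑χx-swap = sumL-swap (Enumeration.list characters) elems

  ∑xx-swap : ∀ (f : F.Carrier → F.Carrier → Carrier) → ∑x (λ x → ∑x (f x)) ≡ ∑x (λ y → ∑x (λ x → f x y))
  ∑xx-swap = sumL-swap elems elems

  infix 8 [_≡?_]
  [_≡?_] : F.Carrier → F.Carrier → Carrier
  [ x ≡? y ] = [ x F.≟ y ]

  ∑x-[] : ∀ a (f : F.Carrier → Carrier) → ∑x (λ x → [ a ≡? x ] * f x) ≡ f a
  ∑x-[] a f = ∑-[] elements a f (cong f)

  ∑x-reindex : ∀ {f h : F.Carrier → Carrier} (σ τ : F.Carrier → F.Carrier) →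
               (∀ x → f x ≢ 0# → x ≡ τ (σ x) × f x ≡ h (σ x)) →
               (∀ y → h y ≢ 0# → y ≡ σ (τ y) × h y ≡ f (τ y)) →
               ∑x f ≡ ∑x h
  ∑x-reindex {f} {h} σ τ = ∑-reindex elements elements (cong f) (cong h) σ τ (cong σ) (cong τ)

  ∑x-scale : ∀ {a} → a ≢ F.0# → (f : F.Carrier → Carrier) → ∑x (λ x → f (a F.* x)) ≡ ∑x f
  ∑x-scale {a} a≢0 f = ∑x-reindex (a F.*_) (a F.⁻¹ F.*_)
    (λ x _ → sym (back x) , refl) (λ y _ → sym (forth y) , cong f (sym (forth y)))
    where
    back : ∀ x → a F.⁻¹ F.* (a F.* x) ≡ x
    back x = trans (sym (F.*-assoc _ _ _)) (trans (cong (F._* x) (F.⁻¹-inverseˡ a a≢0)) (F.*-identityˡ x))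
    forth : ∀ x → a F.* (a F.⁻¹ F.* x) ≡ x
    forth x = trans (sym (F.*-assoc _ _ _)) (trans (cong (F._* x) (F.⁻¹-inverse a a≢0)) (F.*-identityˡ x))

  [0≡]+ε≡1 : ∀ x → [ F.0# ≡? x ] + ε x ≡ 1#
  [0≡]+ε≡1 x with F.0# F.≟ x | x F.≟ F.0#
  ... | yes _   | yes _   = +-identityʳ 1#
  ... | no _    | no _    = +-identityˡ 1#
  ... | yes 0≡x | no x≢0  = ⊥-elim (x≢0 (sym 0≡x))
  ... | no 0≢x  | yes x≡0 = ⊥-elim (0≢x (sym x≡0))

  ∑x-units : ∀ f → ∑x (λ x → ε x * f x) ≡ ∑x f - f F.0#
  ∑x-units f = begin
    ∑x (λ x → ε x * f x)
      ≡⟨ solve 2 (λ a b → a := (b :+ a) :- b) refl (∑x (λ x → ε x * f x)) (f F.0#) ⟩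
    (f F.0# + ∑x (λ x → ε x * f x)) - f F.0#
      ≡⟨ cong (λ t → (t + ∑x (λ x → ε x * f x)) - f F.0#) (sym (∑x-[] F.0# f)) ⟩
    (∑x (λ x → [ F.0# ≡? x ] * f x) + ∑x (λ x → ε x * f x)) - f F.0#
      ≡⟨ cong (_- f F.0#) (sym (∑x-+ _ _)) ⟩
    ∑x (λ x → [ F.0# ≡? x ] * f x + ε x * f x) - f F.0#
      ≡⟨ cong (_- f F.0#) (∑x-cong (λ x → trans (sym (distribʳ _ _ _)) (trans (cong (_* f x) ([0≡]+ε≡1 x)) (*-identityˡ _)))) ⟩
    ∑x f - f F.0# ∎
    where open ≡-Reasoning

  ∑x-ε : ∑x ε ≡ q - 1#
  ∑x-ε = trans (∑x-cong (λ x → sym (*-identityʳ (ε x)))) (trans (∑x-units (λ _ → 1#)) (cong (_- 1#) ∑x-1))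

  ∑x-nontrivial : ∀ A → ¬ (A ≋ ε-char) → ∑x ⟦ A ⟧ ≡ 0#
  ∑x-nontrivial A A≉ε with All.all? (λ x → ⟦ A ⟧ x ≟ ε x) elems
  ... | yes all = ⊥-elim (A≉ε (λ x → All.lookup all (elems-complete x)))
  ... | no ¬all with Any.satisfied (Allₚ.¬All⇒Any¬ (λ x → ⟦ A ⟧ x ≟ ε x) elems ¬all)
  ...   | a , Aa≢εa = x*y≡y⇒y≡0 (λ Aa≡1 → Aa≢εa (trans Aa≡1 (sym (ε≡1 a≢0)))) (begin
          ⟦ A ⟧ a * ∑x ⟦ A ⟧               ≡⟨ sym (∑x-* _ _) ⟩
          ∑x (λ x → ⟦ A ⟧ a * ⟦ A ⟧ x)     ≡⟨ ∑x-cong (λ x → sym (mult A a x)) ⟩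
          ∑x (λ x → ⟦ A ⟧ (a F.* x))       ≡⟨ ∑x-scale a≢0 ⟦ A ⟧ ⟩
          ∑x ⟦ A ⟧                         ∎)
    where
    open ≡-Reasoning
    a≢0 : a ≢ F.0#
    a≢0 refl = Aa≢εa (trans (at0 A) (sym (at0 ε-char)))

  ∑x-character : ∀ A → ∑x ⟦ A ⟧ ≡ (q - 1#) * δ A
  ∑x-character A with A ≋? ε-char
  ... | yes A≋ε = trans (∑x-cong A≋ε) (trans ∑x-ε (sym (trans (cong (_ *_) (δ-yes A A≋ε)) (*-identityʳ _))))
  ... | no A≉ε  = trans (∑x-nontrivial A A≉ε) (sym (trans (cong (_ *_) (δ-no A A≉ε)) (zeroʳ _)))

  private
    total : F.Carrier → Carrier
    total x = ∑χ (λ A → ⟦ A ⟧ x)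

    -- If some B has B(x) ≠ 1, multiplication by B permutes the characters and scales the sum by
    -- B(x), so the sum is 0. Otherwise all of its q - 1 terms are 1.
    total-cases : ∀ x → total x ≡ 0# ⊎ total x ≡ q - 1#
    total-cases x with All.all? (λ A → ⟦ A ⟧ x ≟ 1#) (Enumeration.list characters)
    ... | yes all = inj₂ (trans (sumL-cong-all all) ∑χ-1)
      where
      sumL-cong-all : ∀ {As} → All (λ A → ⟦ A ⟧ x ≡ 1#) As → sumL As (λ A → ⟦ A ⟧ x) ≡ sumL As (λ _ → 1#)
      sumL-cong-all []         = refl
      sumL-cong-all (eq ∷ eqs) = cong₂ _+_ eq (sumL-cong-all eqs)
    ... | no ¬all with Any.satisfied (Allₚ.¬All⇒Any¬ (λ A → ⟦ A ⟧ x ≟ 1#) (Enumeration.list characters) ¬all)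
    ...   | B , Bx≢1 = inj₁ (x*y≡y⇒y≡0 Bx≢1 (begin
            ⟦ B ⟧ x * total x                ≡⟨ sym (∑χ-* _ _) ⟩
            ∑χ (λ A → ⟦ B ⟧ x * ⟦ A ⟧ x)     ≡⟨ ∑-reindex characters characters (λ A≋C → cong (⟦ B ⟧ x *_) (A≋C x)) (λ A≋C → A≋C x)
                                                  (B ⊛_) (B ᶜ ⊛_) (λ A≋C x → cong (_ *_) (A≋C x)) (λ A≋C x → cong (_ *_) (A≋C x))
                                                  (λ A _ → (λ x → sym (⊛-ᶜ-cancel B A x)) , refl)
                                                  (λ A _ → (λ x → sym (⊛-cancel B A x)) , sym (⊛-cancel B A x)) ⟩
            total x                          ∎))
      where open ≡-Reasoning

    total-1 : total F.1# ≡ q - 1#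
    total-1 = trans (∑χ-cong at1) ∑χ-1

    ∑x-total : ∑x total ≡ q - 1#
    ∑x-total = begin
      ∑x total                              ≡⟨ sym (∑χx-swap (λ A x → ⟦ A ⟧ x)) ⟩
      ∑χ (λ A → ∑x ⟦ A ⟧)                   ≡⟨ ∑χ-cong (λ A → trans (∑x-character A) (trans (*-comm _ _) (cong (_* _) (sym-≋ A)))) ⟩
      ∑χ (λ A → [ ε-char ≋? A ] * (q - 1#)) ≡⟨ ∑-[] characters ε-char (λ _ → q - 1#) (λ _ → refl) ⟩
      q - 1#                                ∎
      where
      open ≡-Reasoning
      sym-≋ : ∀ A → δ A ≡ [ ε-char ≋? A ]
      sym-≋ A = [ A ≋? ε-char ]-cong (ε-char ≋? A) (λ h x → sym (h x)) (λ h x → sym (h x))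

    rest : F.Carrier → Carrier
    rest x = total x - [ F.1# ≡? x ] * (q - 1#)

    drop : ∀ t → t - 0# * (q - 1#) ≡ t
    drop t = solve 2 (λ t c → t :- con 0ℤ :* c := t) refl t (q - 1#)

    rest-cases : ∀ x → rest x ≡ 0# ⊎ rest x ≡ q - 1#
    rest-cases x with F.1# F.≟ x
    ... | yes refl = inj₁ (x≡y⇒x-y≡0 (trans total-1 (sym (*-identityˡ _))))
    ... | no _ with total-cases x
    ...   | inj₁ eq = inj₁ (trans (drop (total x)) eq)
    ...   | inj₂ eq = inj₂ (trans (drop (total x)) eq)

    ∑x-rest : ∑x rest ≡ 0#
    ∑x-rest = begin
      ∑x rest
        ≡⟨ ∑x-+ total (λ x → - ([ F.1# ≡? x ] * (q - 1#))) ⟩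
      ∑x total + ∑x (λ x → - ([ F.1# ≡? x ] * (q - 1#)))
        ≡⟨ cong₂ _+_ ∑x-total (∑x-cong (λ x → solve 2 (λ a b → :- (a :* b) := a :* (:- b)) refl [ F.1# ≡? x ] (q - 1#))) ⟩
      (q - 1#) + ∑x (λ x → [ F.1# ≡? x ] * (- (q - 1#)))
        ≡⟨ cong ((q - 1#) +_) (∑x-[] F.1# (λ _ → - (q - 1#))) ⟩
      (q - 1#) - (q - 1#)
        ≡⟨ -‿inverseʳ _ ⟩
      0# ∎
      where open ≡-Reasoning

  -- That characters separate points is obtained by counting. Each `total x` is 0 or q - 1, and over
  -- all x they add up to q - 1, because only ε has a nonzero sum. The point 1 already uses up this
  -- amount, so by `∑-two-valued` nothing is left for the others.
  ∑χ-at : ∀ x → ∑χ (λ A → ⟦ A ⟧ x) ≡ [ F.1# ≡? x ] * (q - 1#)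
  ∑χ-at x = x-y≡0⇒x≡y (∑-two-valued elements K-char0 q-1≢0 rest (cong rest) rest-cases ∑x-rest x)

-- Gauss sums and Jacobi sums

module GaussSums (S : Setup) where
  open Characters S public
  open Setup S using (ζ; ζ-root)
  open Ops S using (θ; g; primeIndex; tr)
  open AdditiveCharacter S using (θ-+; ∑θ≡0)
  private
    module K = Powers (Setup.K S)

  1-_ : F.Carrier → F.Carrier
  1- x = F.1# F.- x

  -1F : F.Carrier
  -1F = F.- F.1#

  -1≢0 : -1F ≢ F.0#
  -1≢0 = F.-≢0 F.1≢0

  sign² : ∀ A → ⟦ A ⟧ -1F * ⟦ A ⟧ -1F ≡ 1#
  sign² A = trans (sym (mult A -1F -1F)) (trans (cong ⟦ A ⟧ (F.solve 0 (F.:- F.con 1ℤ F.:* F.:- F.con 1ℤ F.:= F.con 1ℤ) refl)) (at1 A))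

  sign-⁻¹ : ∀ A → (⟦ A ⟧ -1F) ⁻¹ ≡ ⟦ A ⟧ -1F
  sign-⁻¹ A = sym (⁻¹-unique (sign² A))

  ⟦⟧-neg : ∀ A x → ⟦ A ⟧ (F.- x) ≡ ⟦ A ⟧ -1F * ⟦ A ⟧ x
  ⟦⟧-neg A x = trans (cong ⟦ A ⟧ (F.solve 1 (λ x → F.:- x F.:= (F.:- F.con 1ℤ) F.:* x) refl x)) (mult A -1F x)

  ∑x-shift : ∀ a (f : F.Carrier → Carrier) → ∑x (λ x → f (a F.+ x)) ≡ ∑x f
  ∑x-shift a f = trans (∑x-cong (λ x → cong f (F.+-comm a x))) (∑-translate a f)

  ∑x-reflect : ∀ a (f : F.Carrier → Carrier) → ∑x (λ x → f (a F.- x)) ≡ ∑x f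
  ∑x-reflect a f = ∑x-reindex (λ x → a F.- x) (λ x → a F.- x) (λ x _ → sym (back x) , refl) (λ y _ → sym (back y) , cong f (sym (back y)))
    where
    back : ∀ x → a F.- (a F.- x) ≡ x
    back x = F.solve 2 (λ a x → a F.:- (a F.:- x) F.:= x) refl a x

  G : Character → Carrier
  G A = g ⟦ A ⟧

  G-cong : ∀ {A B} → A ≋ B → G A ≡ G B
  G-cong A≋B = ∑x-cong (λ x → cong (_* θ x) (A≋B x))

  θ-0 : θ F.0# ≡ 1#
  θ-0 = *-cancelˡ {θ F.0#} (^≢0 (primeIndex (tr F.0#))) (trans (sym (θ-+ F.0# F.0#)) (trans (cong θ (F.+-identityˡ F.0#)) (sym (*-identityʳ _))))
    where
    ζ≢0 : ζ ≢ 0#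
    ζ≢0 ζ≡0 = 0≢1 (trans (sym (K.0^ (ℕ.>-nonZero⁻¹ p {{prime⇒nonZero p-prime}}))) (trans (cong (_^ p) (sym ζ≡0)) ζ-root))
    ^≢0 : ∀ n → ζ ^ n ≢ 0#
    ^≢0 zero    = 1≢0
    ^≢0 (suc n) = ζ≢0 ≢* ^≢0 n

  -- ε vanishes at 0, so this is the full sum of θ, which is 0, without the term θ(0) = 1.
  G-ε : G ε-char ≡ - 1#
  G-ε = trans (∑x-units θ) (trans (cong₂ _-_ ∑θ≡0 θ-0) (+-identityˡ _))

  -- The Jacobi sum; `binom A B` is by definition B(-1)/q times the Jacobi sum of A and B̄.
  J : Character → Character → Carrier
  J A B = ∑x (λ t → ⟦ A ⟧ t * ⟦ B ⟧ (1- t))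

  private
    -- For s ≠ 0, scaling x by s produces a Jacobi sum. For s = 0 the summand is AB up to a sign,
    -- and the indicator records the resulting full character sum.
    convolution : ∀ A B s → ∑x (λ x → ⟦ A ⟧ x * ⟦ B ⟧ (s F.- x)) ≡
                  ⟦ A ⊛ B ⟧ s * J A B + [ F.0# ≡? s ] * (⟦ B ⟧ -1F * ((q - 1#) * δ (A ⊛ B)))
    convolution A B s with F.0# F.≟ s
    ... | yes refl = begin
      ∑x (λ x → ⟦ A ⟧ x * ⟦ B ⟧ (F.0# F.- x))
        ≡⟨ ∑x-cong (λ x → trans (cong (⟦ A ⟧ x *_) (trans (cong ⟦ B ⟧ (F.+-identityˡ _)) (⟦⟧-neg B x)))
             (solve 3 (λ a b c → a :* (b :* c) := b :* (a :* c)) refl (⟦ A ⟧ x) (⟦ B ⟧ -1F) (⟦ B ⟧ x))) ⟩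
      ∑x (λ x → ⟦ B ⟧ -1F * ⟦ A ⊛ B ⟧ x)
        ≡⟨ trans (∑x-* (⟦ B ⟧ -1F) ⟦ A ⊛ B ⟧) (cong (⟦ B ⟧ -1F *_) (∑x-character (A ⊛ B))) ⟩
      ⟦ B ⟧ -1F * ((q - 1#) * δ (A ⊛ B))
        ≡⟨ solve 2 (λ a j → a := con 0ℤ :* j :+ con 1ℤ :* a) refl (⟦ B ⟧ -1F * ((q - 1#) * δ (A ⊛ B))) (J A B) ⟩
      0# * J A B + 1# * (⟦ B ⟧ -1F * ((q - 1#) * δ (A ⊛ B)))
        ≡⟨ cong (λ t → t * J A B + 1# * (⟦ B ⟧ -1F * ((q - 1#) * δ (A ⊛ B)))) (sym (at0 (A ⊛ B))) ⟩
      ⟦ A ⊛ B ⟧ F.0# * J A B + 1# * (⟦ B ⟧ -1F * ((q - 1#) * δ (A ⊛ B))) ∎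
      where open ≡-Reasoning
    ... | no 0≢s = begin
      ∑x (λ x → ⟦ A ⟧ x * ⟦ B ⟧ (s F.- x))
        ≡⟨ sym (∑x-scale (λ s≡0 → 0≢s (sym s≡0)) (λ x → ⟦ A ⟧ x * ⟦ B ⟧ (s F.- x))) ⟩
      ∑x (λ x → ⟦ A ⟧ (s F.* x) * ⟦ B ⟧ (s F.- s F.* x))
        ≡⟨ ∑x-cong (λ x → trans (cong₂ _*_ (mult A s x)
              (trans (cong ⟦ B ⟧ (F.solve 2 (λ s x → s F.:- s F.:* x F.:= s F.:* (F.con 1ℤ F.:- x)) refl s x)) (mult B s (1- x))))
             (solve 4 (λ a b c d → (a :* b) :* (c :* d) := (a :* c) :* (b :* d)) refl (⟦ A ⟧ s) (⟦ A ⟧ x) (⟦ B ⟧ s) (⟦ B ⟧ (1- x)))) ⟩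
      ∑x (λ x → ⟦ A ⊛ B ⟧ s * (⟦ A ⟧ x * ⟦ B ⟧ (1- x)))
        ≡⟨ ∑x-* (⟦ A ⊛ B ⟧ s) _ ⟩
      ⟦ A ⊛ B ⟧ s * J A B
        ≡⟨ solve 2 (λ a b → a := a :+ con 0ℤ :* b) refl (⟦ A ⊛ B ⟧ s * J A B) (⟦ B ⟧ -1F * ((q - 1#) * δ (A ⊛ B))) ⟩
      ⟦ A ⊛ B ⟧ s * J A B + 0# * (⟦ B ⟧ -1F * ((q - 1#) * δ (A ⊛ B))) ∎
      where open ≡-Reasoning

  -- The double sum is sorted by s = x + y. The correction is the contribution of s = 0, present
  -- only if AB = ε; keeping it makes the formula hold for all pairs.
  G-* : ∀ A B → G A * G B ≡ G (A ⊛ B) * J A B + ⟦ B ⟧ -1F * ((q - 1#) * δ (A ⊛ B))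
  G-* A B = begin
    G A * G B
      ≡⟨ sym (∑x-*ʳ (G B) _) ⟩
    ∑x (λ x → ⟦ A ⟧ x * θ x * G B)
      ≡⟨ ∑x-cong (λ x → sym (∑x-* (⟦ A ⟧ x * θ x) _)) ⟩
    ∑x (λ x → ∑x (λ y → ⟦ A ⟧ x * θ x * (⟦ B ⟧ y * θ y)))
      ≡⟨ ∑x-cong (λ x → sym (∑-translate (F.- x) _)) ⟩
    ∑x (λ x → ∑x (λ s → ⟦ A ⟧ x * θ x * (⟦ B ⟧ (s F.- x) * θ (s F.- x))))
      ≡⟨ ∑x-cong (λ x → ∑x-cong (λ s → regroup x s)) ⟩
    ∑x (λ x → ∑x (λ s → θ s * (⟦ A ⟧ x * ⟦ B ⟧ (s F.- x))))
      ≡⟨ ∑xx-swap _ ⟩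
    ∑x (λ s → ∑x (λ x → θ s * (⟦ A ⟧ x * ⟦ B ⟧ (s F.- x))))
      ≡⟨ ∑x-cong (λ s → trans (∑x-* (θ s) _) (trans (cong (θ s *_) (convolution A B s))
           (solve 5 (λ t a j d c → t :* (a :* j :+ d :* c) := a :* t :* j :+ d :* (t :* c)) refl (θ s) (⟦ A ⊛ B ⟧ s) (J A B) [ F.0# ≡? s ] c))) ⟩
    ∑x (λ s → ⟦ A ⊛ B ⟧ s * θ s * J A B + [ F.0# ≡? s ] * (θ s * c))
      ≡⟨ ∑x-+ _ _ ⟩
    ∑x (λ s → ⟦ A ⊛ B ⟧ s * θ s * J A B) + ∑x (λ s → [ F.0# ≡? s ] * (θ s * c))
      ≡⟨ cong₂ _+_ (∑x-*ʳ (J A B) _) (trans (∑x-[] F.0# (λ s → θ s * c)) (trans (cong (_* c) θ-0) (*-identityˡ c))) ⟩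
    G (A ⊛ B) * J A B + c ∎
    where
    open ≡-Reasoning
    c : Carrier
    c = ⟦ B ⟧ -1F * ((q - 1#) * δ (A ⊛ B))
    regroup : ∀ x s → ⟦ A ⟧ x * θ x * (⟦ B ⟧ (s F.- x) * θ (s F.- x)) ≡ θ s * (⟦ A ⟧ x * ⟦ B ⟧ (s F.- x))
    regroup x s = trans
      (solve 4 (λ a t b u → a :* t :* (b :* u) := (t :* u) :* (a :* b)) refl (⟦ A ⟧ x) (θ x) (⟦ B ⟧ (s F.- x)) (θ (s F.- x)))
      (cong (_* (⟦ A ⟧ x * ⟦ B ⟧ (s F.- x))) (trans (sym (θ-+ x (s F.- x))) (cong θ (F.solve 2 (λ x s → x F.:+ (s F.:- x) F.:= s) refl x s))))

  G-*-nontrivial : ∀ A B → ¬ (A ⊛ B ≋ ε-char) → G A * G B ≡ G (A ⊛ B) * J A B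
  G-*-nontrivial A B AB≉ε = trans (G-* A B) (trans
    (cong (λ t → G (A ⊛ B) * J A B + ⟦ B ⟧ -1F * ((q - 1#) * t)) (δ-no (A ⊛ B) AB≉ε))
    (solve 3 (λ a b c → a :+ b :* (c :* con 0ℤ) := a) refl (G (A ⊛ B) * J A B) (⟦ B ⟧ -1F) (q - 1#)))

  -- The substitution t = s / (1 + s).
  J-alt : ∀ A B → J A B ≡ ∑x (λ s → ⟦ A ⟧ s * ⟦ (A ⊛ B) ᶜ ⟧ (F.1# F.+ s))
  J-alt A B = ∑x-reindex σ τ
    (λ t ft≢0 → let 1-t≢0 = 1-t≢0 t ft≢0 in
       sym (τσ t 1-t≢0) , trans (cong f (sym (τσ t 1-t≢0))) (sym (h≡fτ (σ t) (1+σ t 1-t≢0))))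
    (λ s hs≢0 → let 1+s≢0 = 1+s≢0 s hs≢0 in sym (στ s 1+s≢0) , h≡fτ s 1+s≢0)
    where
    f h : F.Carrier → Carrier
    f t = ⟦ A ⟧ t * ⟦ B ⟧ (1- t)
    h s = ⟦ A ⟧ s * ⟦ (A ⊛ B) ᶜ ⟧ (F.1# F.+ s)
    σ τ : F.Carrier → F.Carrier
    σ t = t F./ (1- t)
    τ s = s F./ (F.1# F.+ s)
    1-t≢0 : ∀ t → f t ≢ 0# → 1- t ≢ F.0#
    1-t≢0 t ft≢0 eq = ft≢0 (trans (cong (⟦ A ⟧ t *_) (trans (cong ⟦ B ⟧ eq) (at0 B))) (zeroʳ _))
    1+s≢0 : ∀ s → h s ≢ 0# → F.1# F.+ s ≢ F.0#
    1+s≢0 s hs≢0 eq = hs≢0 (trans (cong (⟦ A ⟧ s *_) (trans (cong ⟦ (A ⊛ B) ᶜ ⟧ eq) (at0 ((A ⊛ B) ᶜ)))) (zeroʳ _))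
    1+σ≡ : ∀ t → 1- t ≢ F.0# → F.1# F.+ σ t ≡ F.1# F./ (1- t)
    1+σ≡ t n = F.fieldEq (t ∷ []) (𝟙 ⊕ #0 ⊘ (𝟙 ⊖ #0)) (𝟙 ⊘ (𝟙 ⊖ #0)) (n ∷ []) (n ∷ []) refl
    1-τ≡ : ∀ s → F.1# F.+ s ≢ F.0# → 1- (τ s) ≡ F.1# F./ (F.1# F.+ s)
    1-τ≡ s n = F.fieldEq (s ∷ []) (𝟙 ⊖ #0 ⊘ (𝟙 ⊕ #0)) (𝟙 ⊘ (𝟙 ⊕ #0)) (n ∷ []) (n ∷ []) refl
    1+σ : ∀ t → 1- t ≢ F.0# → F.1# F.+ σ t ≢ F.0#
    1+σ t n eq = F.1≢0 (F.*-cancelʳ (F.⁻¹-≢0 n) (trans (sym (1+σ≡ t n)) (trans eq (sym (F.zeroˡ _)))))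
    τσ : ∀ t → 1- t ≢ F.0# → τ (σ t) ≡ t
    τσ t n = F.fieldEq (t ∷ []) ((#0 ⊘ (𝟙 ⊖ #0)) ⊘ (𝟙 ⊕ #0 ⊘ (𝟙 ⊖ #0))) (#0) (n ∷ 1+σ t n ∷ n ∷ []) [] refl
    στ : ∀ s → F.1# F.+ s ≢ F.0# → σ (τ s) ≡ s
    στ s n = F.fieldEq (s ∷ []) ((#0 ⊘ (𝟙 ⊕ #0)) ⊘ (𝟙 ⊖ #0 ⊘ (𝟙 ⊕ #0))) (#0) (n ∷ 1-τ≢0 ∷ n ∷ []) [] refl
      where
      1-τ≢0 : 1- (τ s) ≢ F.0#
      1-τ≢0 eq = F.1≢0 (F.*-cancelʳ (F.⁻¹-≢0 n) (trans (sym (1-τ≡ s n)) (trans eq (sym (F.zeroˡ _)))))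
    h≡fτ : ∀ s → F.1# F.+ s ≢ F.0# → h s ≡ f (τ s)
    h≡fτ s n = sym (begin
      ⟦ A ⟧ (τ s) * ⟦ B ⟧ (1- (τ s))
        ≡⟨ cong₂ _*_ (⟦⟧-/ A s _) (trans (cong ⟦ B ⟧ (1-τ≡ s n)) (trans (⟦⟧-/ B F.1# _) (cong (_/ _) (at1 B)))) ⟩
      ⟦ A ⟧ s / ⟦ A ⟧ (F.1# F.+ s) * (1# / ⟦ B ⟧ (F.1# F.+ s))
        ≡⟨ solve 3 (λ a i j → a :* i :* (con 1ℤ :* j) := a :* (i :* j)) refl (⟦ A ⟧ s) _ _ ⟩
      ⟦ A ⟧ s * ((⟦ A ⟧ (F.1# F.+ s)) ⁻¹ * (⟦ B ⟧ (F.1# F.+ s)) ⁻¹)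
        ≡⟨ cong (⟦ A ⟧ s *_) (sym (⁻¹-distrib-* _ _)) ⟩
      ⟦ A ⟧ s * ⟦ (A ⊛ B) ᶜ ⟧ (F.1# F.+ s) ∎)
      where open ≡-Reasoning

  -- In `J-alt` the second character becomes ε(1+s), so all values of A are summed except the one at
  -- s = -1.
  J-inverse : ∀ A B → A ⊛ B ≋ ε-char → J A B ≡ (q - 1#) * δ A - ⟦ A ⟧ -1F
  J-inverse A B AB≋ε = begin
    J A B
      ≡⟨ J-alt A B ⟩
    ∑x (λ s → ⟦ A ⟧ s * ⟦ (A ⊛ B) ᶜ ⟧ (F.1# F.+ s))
      ≡⟨ ∑x-cong (λ s → trans (*-comm _ _) (cong₂ _*_ (AB-conj (F.1# F.+ s)) (cong ⟦ A ⟧ (F.solve 1 (λ s → s F.:= (F.con 1ℤ F.:+ s) F.:- F.con 1ℤ) refl s)))) ⟩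
    ∑x (λ s → ε (F.1# F.+ s) * ⟦ A ⟧ ((F.1# F.+ s) F.- F.1#))
      ≡⟨ ∑x-shift F.1# (λ t → ε t * ⟦ A ⟧ (t F.- F.1#)) ⟩
    ∑x (λ t → ε t * ⟦ A ⟧ (t F.- F.1#))
      ≡⟨ ∑x-units (λ t → ⟦ A ⟧ (t F.- F.1#)) ⟩
    ∑x (λ t → ⟦ A ⟧ (t F.- F.1#)) - ⟦ A ⟧ (F.0# F.- F.1#)
      ≡⟨ cong₂ _-_ (trans (∑-translate (F.- F.1#) ⟦ A ⟧) (∑x-character A)) (cong ⟦ A ⟧ (F.+-identityˡ _)) ⟩
    (q - 1#) * δ A - ⟦ A ⟧ -1F ∎
    where
    open ≡-Reasoning
    AB-conj : ∀ x → ⟦ (A ⊛ B) ᶜ ⟧ x ≡ ε x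
    AB-conj x = trans (cong _⁻¹ (AB≋ε x)) (εᶜ x)
      where
      εᶜ : ∀ x → (ε x) ⁻¹ ≡ ε x
      εᶜ x with x F.≟ F.0#
      ... | yes _ = 0⁻¹
      ... | no  _ = 1⁻¹

  sign-inverse : ∀ A B → A ⊛ B ≋ ε-char → ⟦ B ⟧ -1F ≡ ⟦ A ⟧ -1F
  sign-inverse A B AB≋ε = *-cancelˡ (⟦⟧≢0 A -1≢0) (trans (AB≋ε -1F) (trans (ε≡1 -1≢0) (sym (sign² A))))

  -- Covers both cases at once: the value is A(-1)q for nontrivial A, and for A = ε it is 1, the
  -- square of -1.
  G-inverse : ∀ A B → A ⊛ B ≋ ε-char → G A * G B ≡ ⟦ A ⟧ -1F * q - (q - 1#) * δ A
  G-inverse A B AB≋ε = begin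
    G A * G B
      ≡⟨ G-* A B ⟩
    G (A ⊛ B) * J A B + ⟦ B ⟧ -1F * ((q - 1#) * δ (A ⊛ B))
      ≡⟨ cong₂ _+_ (cong₂ _*_ (trans (G-cong {A ⊛ B} {ε-char} AB≋ε) G-ε) (J-inverse A B AB≋ε))
           (cong₂ (λ s d → s * ((q - 1#) * d)) (sign-inverse A B AB≋ε) (δ-yes (A ⊛ B) AB≋ε)) ⟩
    - 1# * ((q - 1#) * δ A - ⟦ A ⟧ -1F) + ⟦ A ⟧ -1F * ((q - 1#) * 1#)
      ≡⟨ solve 3 (λ q d a → (:- con 1ℤ) :* ((q :- con 1ℤ) :* d :- a) :+ a :* ((q :- con 1ℤ) :* con 1ℤ) := a :* q :- (q :- con 1ℤ) :* d)
           refl q (δ A) (⟦ A ⟧ -1F) ⟩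
    ⟦ A ⟧ -1F * q - (q - 1#) * δ A ∎
    where open ≡-Reasoning

  G-inverse-nontrivial : ∀ A B → ¬ (A ≋ ε-char) → A ⊛ B ≋ ε-char → G A * G B ≡ ⟦ A ⟧ -1F * q
  G-inverse-nontrivial A B A≉ε AB≋ε = trans (G-inverse A B AB≋ε)
    (trans (cong (λ d → ⟦ A ⟧ -1F * q - (q - 1#) * d) (δ-no A A≉ε))
           (solve 2 (λ a b → a :- b :* con 0ℤ := a) refl (⟦ A ⟧ -1F * q) (q - 1#)))

  G≢0 : ∀ A → G A ≢ 0#
  G≢0 A GA≡0 with A ≋? ε-char
  ... | yes A≋ε = -≢0 1≢0 (trans (sym G-ε) (trans (sym (G-cong {A} {ε-char} A≋ε)) GA≡0))
  ... | no A≉ε  = (⟦⟧≢0 A -1≢0 ≢* q≢0)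
    (trans (sym (G-inverse-nontrivial A (A ᶜ) A≉ε (⊛ᶜ≋ε A))) (trans (cong (_* G (A ᶜ)) GA≡0) (zeroˡ _)))

-- The quadratic character and the duplication formula

any-does : {A : Set} {P : A → Set} (P? : ∀ x → Dec (P x)) (xs : List A) →
           any (λ x → does (P? x)) xs ≡ does (Any.any? P? xs)
any-does P? []       = refl
any-does P? (x ∷ xs) = cong (does (P? x) ∨_) (any-does P? xs)

module QuadraticCharacter (S : Setup) where
  open GaussSums S public
  open Setup S using (p-odd)
  open Ops S using (φ; isSquare)
  open Trace S using (×1≡0⇒p∣)

  𝟚 𝟜 : F.Carrier
  𝟚 = 2 F.×1
  𝟜 = 4 F.×1

  𝟚≢0 : 𝟚 ≢ F.0#
  𝟚≢0 2≡0 = p-odd (ℕₚ.≤-antisym (∣⇒≤ (×1≡0⇒p∣ 2≡0)) (ℕ.nonTrivial⇒n>1 p {{prime⇒nonTrivial p-prime}}))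

  𝟜≡𝟚*𝟚 : 𝟜 ≡ 𝟚 F.* 𝟚
  𝟜≡𝟚*𝟚 = F.×1-homo-* 2 2

  𝟜≢0 : 𝟜 ≢ F.0#
  𝟜≢0 eq = (𝟚≢0 F.≢* 𝟚≢0) (trans (sym 𝟜≡𝟚*𝟚) eq)

  Square : F.Carrier → Set
  Square x = ∃ λ y → y F.* y ≡ x

  private
    any-square? : ∀ x → Dec (Any (λ y → y F.* y ≡ x) elems)
    any-square? x = Any.any? (λ y → (y F.* y) F.≟ x) elems

    square? : ∀ x → Dec (Square x)
    square? x = map′ Any.satisfied (λ (y , y²≡x) → lose (elems-complete y) y²≡x) (any-square? x)

    isSquare≡square? : ∀ x → isSquare x ≡ does (square? x)
    isSquare≡square? x = any-does (λ y → (y F.* y) F.≟ x) elems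

  φ-0 : φ F.0# ≡ 0#
  φ-0 rewrite dec-true (F.0# F.≟ F.0#) refl = refl

  φ-square : ∀ {x} → x ≢ F.0# → Square x → φ x ≡ 1#
  φ-square {x} x≢0 sq rewrite dec-false (x F.≟ F.0#) x≢0 =
    cong (λ b → if b then 1# else - 1#) (trans (isSquare≡square? x) (dec-true (square? x) sq))

  φ-nonsquare : ∀ {x} → ¬ Square x → φ x ≡ - 1#
  φ-nonsquare {x} ¬sq rewrite dec-false (x F.≟ F.0#) (λ x≡0 → ¬sq (F.0# , trans (F.zeroˡ _) (sym x≡0))) =
    cong (λ b → if b then 1# else - 1#) (trans (isSquare≡square? x) (dec-false (square? x) ¬sq))

  data Class (x : F.Carrier) : Set where
    null      : x ≡ F.0# → Class x
    square    : x ≢ F.0# → Square x → Class x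
    nonsquare : ¬ Square x → Class x

  classify : ∀ x → Class x
  classify x with x F.≟ F.0# | square? x
  ... | yes x≡0 | _       = null x≡0
  ... | no x≢0  | yes sq = square x≢0 sq
  ... | no _    | no ¬sq = nonsquare ¬sq

  private
    ≡-neg⇒0 : ∀ {y} → y ≡ F.- y → y ≡ F.0#
    ≡-neg⇒0 {y} y≡-y with F.x*y≡0 (trans
      (F.solve 1 (λ y → (F.con 1ℤ F.:+ (F.con 1ℤ F.:+ F.con 0ℤ)) F.:* y F.:= y F.:- (F.:- y)) refl y) (F.x≡y⇒x-y≡0 y≡-y))
    ... | inj₁ 2≡0 = ⊥-elim (𝟚≢0 2≡0)
    ... | inj₂ y≡0 = y≡0

    roots : ∀ {s y} → s F.* s ≡ y F.* y → s ≡ y ⊎ F.- s ≡ y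
    roots {s} {y} eq with F.x*y≡0 (trans
      (F.solve 2 (λ s y → (s F.:- y) F.:* (F.:- s F.:- y) F.:= y F.:* y F.:- s F.:* s) refl s y) (F.x≡y⇒x-y≡0 (sym eq)))
    ... | inj₁ s-y≡0  = inj₁ (F.x-y≡0⇒x≡y s-y≡0)
    ... | inj₂ -s-y≡0 = inj₂ (F.x-y≡0⇒x≡y -s-y≡0)

    [square] : ∀ {s} → s ≢ F.0# → ∀ y → [ s F.* s ≡? y F.* y ] ≡ [ s ≡? y ] * 1# + [ F.- s ≡? y ] * 1#
    [square] {s} s≢0 y with s F.≟ y | (F.- s) F.≟ y
    ... | yes refl | yes -s≡s = ⊥-elim (s≢0 (≡-neg⇒0 (sym -s≡s)))
    ... | yes refl | no _     = trans ([ (s F.* s) F.≟ (s F.* s) ]-yes refl)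
                                      (sym (trans (cong₂ _+_ (*-identityʳ 1#) (zeroˡ 1#)) (+-identityʳ 1#)))
    ... | no _     | yes refl = trans ([ (s F.* s) F.≟ _ ]-yes (F.solve 1 (λ s → s F.:* s F.:= F.:- s F.:* F.:- s) refl s))
                                      (sym (trans (cong₂ _+_ (zeroˡ 1#) (*-identityʳ 1#)) (+-identityˡ 1#)))
    ... | no s≢y   | no -s≢y  = trans ([ (s F.* s) F.≟ (y F.* y) ]-no (λ eq → not-both (roots eq)))
                                      (sym (trans (cong₂ _+_ (zeroˡ 1#) (zeroˡ 1#)) (+-identityʳ 0#)))
      where
      not-both : s ≡ y ⊎ F.- s ≡ y → ⊥
      not-both (inj₁ s≡y)  = s≢y s≡y
      not-both (inj₂ -s≡y) = -s≢y -s≡y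

  square-count : ∀ t → ∑x (λ y → [ t ≡? y F.* y ]) ≡ 1# + φ t
  square-count t with classify t
  ... | null refl = begin
    ∑x (λ y → [ F.0# ≡? y F.* y ])   ≡⟨ ∑x-cong (λ y → trans ([ F.0# F.≟ (y F.* y) ]-cong (F.0# F.≟ y) (y²≡0 y) (λ { refl → sym (F.zeroˡ _) })) (sym (*-identityʳ _))) ⟩
    ∑x (λ y → [ F.0# ≡? y ] * 1#)    ≡⟨ ∑x-[] F.0# (λ _ → 1#) ⟩
    1#                               ≡⟨ sym (trans (cong (1# +_) φ-0) (+-identityʳ 1#)) ⟩
    1# + φ F.0#                      ∎
    where
    open ≡-Reasoning
    y²≡0 : ∀ y → F.0# ≡ y F.* y → F.0# ≡ y
    y²≡0 y eq with F.x*y≡0 (sym eq)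
    ... | inj₁ y≡0 = sym y≡0
    ... | inj₂ y≡0 = sym y≡0
  ... | square t≢0 (s , refl) = begin
    ∑x (λ y → [ s F.* s ≡? y F.* y ])
      ≡⟨ trans (∑x-cong ([square] s≢0)) (∑x-+ _ _) ⟩
    ∑x (λ y → [ s ≡? y ] * 1#) + ∑x (λ y → [ F.- s ≡? y ] * 1#)
      ≡⟨ cong₂ _+_ (∑x-[] s (λ _ → 1#)) (∑x-[] (F.- s) (λ _ → 1#)) ⟩
    1# + 1#
      ≡⟨ cong (1# +_) (sym (φ-square t≢0 (s , refl))) ⟩
    1# + φ (s F.* s) ∎
    where
    open ≡-Reasoning
    s≢0 : s ≢ F.0#
    s≢0 refl = t≢0 (F.zeroˡ _)
  ... | nonsquare ¬sq = begin
    ∑x (λ y → [ t ≡? y F.* y ])   ≡⟨ ∑x-cong (λ y → [ t F.≟ (y F.* y) ]-no (λ eq → ¬sq (y , sym eq))) ⟩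
    ∑x (λ y → 0#)                 ≡⟨ sumL-0 elems ⟩
    0#                            ≡⟨ sym (-‿inverseʳ 1#) ⟩
    1# - 1#                       ≡⟨ cong (1# +_) (sym (φ-nonsquare ¬sq)) ⟩
    1# + φ t                      ∎
    where open ≡-Reasoning

  ∑x-squares : ∀ (f : F.Carrier → Carrier) → ∑x (λ y → f (y F.* y)) ≡ ∑x (λ t → (1# + φ t) * f t)
  ∑x-squares f = begin
    ∑x (λ y → f (y F.* y))                           ≡⟨ ∑x-cong (λ y → sym (∑x-[] (y F.* y) f)) ⟩
    ∑x (λ y → ∑x (λ t → [ y F.* y ≡? t ] * f t))     ≡⟨ ∑xx-swap _ ⟩
    ∑x (λ t → ∑x (λ y → [ y F.* y ≡? t ] * f t))     ≡⟨ ∑x-cong (λ t → trans (∑x-*ʳ (f t) _) (cong (_* f t)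
                                                         (trans (∑x-cong (λ y → [ (y F.* y) F.≟ t ]-cong (t F.≟ (y F.* y)) sym sym)) (square-count t)))) ⟩
    ∑x (λ t → (1# + φ t) * f t)                      ∎
    where open ≡-Reasoning

  -- For the constant function 1, `∑x-squares` reads q = q + ∑ φ.
  ∑x-φ : ∑x φ ≡ 0#
  ∑x-φ = begin
    ∑x φ
      ≡⟨ solve 2 (λ a b → a := (b :+ a) :- b) refl (∑x φ) q ⟩
    (q + ∑x φ) - q
      ≡⟨ cong (λ t → t + ∑x φ - q) (sym ∑x-1) ⟩
    (∑x (λ _ → 1#) + ∑x φ) - q
      ≡⟨ cong (_- q) (sym (trans (∑x-cong (λ t → *-identityʳ _)) (∑x-+ (λ _ → 1#) φ))) ⟩
    ∑x (λ t → (1# + φ t) * 1#) - q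
      ≡⟨ x≡y⇒x-y≡0 (trans (sym (∑x-squares (λ _ → 1#))) ∑x-1) ⟩
    0# ∎
    where open ≡-Reasoning

  private
    square-* : ∀ {a t} → Square a → Square t → Square (a F.* t)
    square-* (r , refl) (s , refl) = r F.* s , F.solve 2 (λ r s → (r F.:* s) F.:* (r F.:* s) F.:= (r F.:* r) F.:* (s F.:* s)) refl r s

    square-⁻¹ : ∀ {a} → Square a → Square (a F.⁻¹)
    square-⁻¹ (r , refl) = r F.⁻¹ , sym (F.⁻¹-distrib-* r r)

    a⁻¹*[a*t]≡t : ∀ {a} → a ≢ F.0# → ∀ t → a F.⁻¹ F.* (a F.* t) ≡ t
    a⁻¹*[a*t]≡t {a} a≢0 t = trans (sym (F.*-assoc _ _ _)) (trans (cong (F._* t) (F.⁻¹-inverseˡ a a≢0)) (F.*-identityˡ t))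

    square-cancel : ∀ {a t} → a ≢ F.0# → Square a → Square (a F.* t) → Square t
    square-cancel a≢0 sqa sqat = subst Square (a⁻¹*[a*t]≡t a≢0 _) (square-* (square-⁻¹ sqa) sqat)

    φ-cases : ∀ x → x ≢ F.0# → φ x ≡ 1# ⊎ φ x ≡ - 1#
    φ-cases x x≢0 with classify x
    ... | null x≡0      = ⊥-elim (x≢0 x≡0)
    ... | square _ sq   = inj₁ (φ-square x≢0 sq)
    ... | nonsquare ¬sq = inj₂ (φ-nonsquare ¬sq)

    -- For a nonsquare a, the sum of φ(at) + φ(t) over t vanishes while its
    -- terms are 0 or -2.
    module _ {a} (¬sq : ¬ Square a) where
      nonsquare⇒≢0 : a ≢ F.0#
      nonsquare⇒≢0 refl = ¬sq (F.0# , F.zeroˡ _)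

      pairSum : F.Carrier → Carrier
      pairSum t = φ (a F.* t) + φ t

      pairSum-cases : ∀ t → pairSum t ≡ 0# ⊎ pairSum t ≡ - 1# + - 1#
      pairSum-cases t with classify t
      ... | null refl = inj₁ (trans (cong₂ _+_ (trans (cong φ (F.zeroʳ a)) φ-0) φ-0) (+-identityʳ 0#))
      ... | square t≢0 sq = inj₁ (trans (cong₂ _+_
              (φ-nonsquare (λ sqat → ¬sq (square-cancel t≢0 sq (subst Square (F.*-comm a t) sqat)))) (φ-square t≢0 sq)) (-‿inverseˡ 1#))
      ... | nonsquare ¬sqt with φ-cases (a F.* t) (nonsquare⇒≢0 F.≢* (λ { refl → ¬sqt (F.0# , F.zeroˡ _) }))
      ...   | inj₁ eq = inj₁ (trans (cong₂ _+_ eq (φ-nonsquare ¬sqt)) (-‿inverseʳ 1#))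
      ...   | inj₂ eq = inj₂ (cong₂ _+_ eq (φ-nonsquare ¬sqt))

      -2≢0 : - 1# + - 1# ≢ 0#
      -2≢0 eq = K-char0 1 (trans (solve 0 (con 1ℤ :+ (con 1ℤ :+ con 0ℤ) := :- (:- con 1ℤ :+ :- con 1ℤ)) refl) (trans (cong -_ eq) -0≡0))

      φ-nonsquare-* : ∀ t → φ (a F.* t) ≡ - 1# * φ t
      φ-nonsquare-* t = x-y≡0⇒x≡y (trans
        (solve 2 (λ u v → u :- (:- con 1ℤ) :* v := u :+ v) refl (φ (a F.* t)) (φ t))
        (∑-two-valued elements K-char0 -2≢0 pairSum (cong pairSum) pairSum-cases
          (trans (∑x-+ _ _) (trans (cong₂ _+_ (trans (∑x-scale nonsquare⇒≢0 φ) ∑x-φ) ∑x-φ) (+-identityʳ 0#))) t))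

  -- Closure of the squares under products and quotients settles a square factor a; for a nonsquare
  -- a the sign change comes from the counting with `pairSum`.
  φ-* : ∀ a t → φ (a F.* t) ≡ φ a * φ t
  φ-* a t with classify a
  ... | null refl = trans (cong φ (F.zeroˡ t)) (trans φ-0 (sym (trans (cong (_* φ t) φ-0) (zeroˡ _))))
  ... | nonsquare ¬sq = trans (φ-nonsquare-* ¬sq t) (cong (_* φ t) (sym (φ-nonsquare ¬sq)))
  ... | square a≢0 sq = trans same (sym (trans (cong (_* φ t) (φ-square a≢0 sq)) (*-identityˡ _)))
    where
    same : φ (a F.* t) ≡ φ t
    same with classify t
    ... | null refl      = cong φ (F.zeroʳ a)
    ... | square t≢0 sqt = trans (φ-square (a≢0 F.≢* t≢0) (square-* sq sqt)) (sym (φ-square t≢0 sqt))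
    ... | nonsquare ¬sqt = trans (φ-nonsquare (λ sqat → ¬sqt (square-cancel a≢0 sq sqat))) (sym (φ-nonsquare ¬sqt))

  φ-char : Character
  φ-char = character φ record { at0 = φ-0 ; at1 = φ-square F.1≢0 (F.1# , F.*-identityˡ F.1#) ; mult = φ-* }

  φ²≋ε : φ-char ⊛ φ-char ≋ ε-char
  φ²≋ε = ≋-on-units (φ-char ⊛ φ-char) ε-char λ {x} x≢0 →
    trans (sym (φ-* x x)) (trans (φ-square (x≢0 F.≢* x≢0) (x , refl)) (sym (ε≡1 x≢0)))

  φᶜ≋φ : φ-char ᶜ ≋ φ-char
  φᶜ≋φ = ≋-on-units (φ-char ᶜ) φ-char λ {x} x≢0 → sym (⁻¹-unique (trans (φ²≋ε x) (ε≡1 x≢0)))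

  private
    x²≡1 : ∀ {x} → x * x ≡ 1# → x ≡ 1# ⊎ x ≡ - 1#
    x²≡1 {x} eq with x*y≡0 (trans (solve 1 (λ x → (x :- con 1ℤ) :* (x :- (:- con 1ℤ)) := x :* x :- con 1ℤ) refl x) (x≡y⇒x-y≡0 eq))
    ... | inj₁ x-1≡0 = inj₁ (x-y≡0⇒x≡y x-1≡0)
    ... | inj₂ x+1≡0 = inj₂ (x-y≡0⇒x≡y x+1≡0)

  -- Such a character is 1 on squares, and being nontrivial it takes the value -1 at some nonsquare
  -- a. For any other nonsquare x the product ax is a square, so A(x) = -1 as well.
  order-two : ∀ A → A ⊛ A ≋ ε-char → ¬ (A ≋ ε-char) → A ≋ φ-char
  order-two A A²≋ε A≉ε with All.all? (λ x → ⟦ A ⟧ x ≟ ε x) elems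
  ... | yes all = ⊥-elim (A≉ε (λ x → All.lookup all (elems-complete x)))
  ... | no ¬all with Any.satisfied (Allₚ.¬All⇒Any¬ (λ x → ⟦ A ⟧ x ≟ ε x) elems ¬all)
  ...   | a , Aa≢εa = ≋-on-units A φ-char on-units
    where
    on-square : ∀ {x} → x ≢ F.0# → Square x → ⟦ A ⟧ x ≡ 1#
    on-square x≢0 (y , refl) = trans (mult A y y) (trans (A²≋ε y) (ε≡1 (λ { refl → x≢0 (F.zeroˡ _) })))

    a≢0 : a ≢ F.0#
    a≢0 refl = Aa≢εa (trans (at0 A) (sym (at0 ε-char)))

    ¬sq : ¬ Square a
    ¬sq sq = Aa≢εa (trans (on-square a≢0 sq) (sym (ε≡1 a≢0)))

    Aa≡-1 : ⟦ A ⟧ a ≡ - 1#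
    Aa≡-1 with x²≡1 (trans (A²≋ε a) (ε≡1 a≢0))
    ... | inj₁ Aa≡1 = ⊥-elim (Aa≢εa (trans Aa≡1 (sym (ε≡1 a≢0))))
    ... | inj₂ eq   = eq

    on-units : ∀ {x} → x ≢ F.0# → ⟦ A ⟧ x ≡ φ x
    on-units {x} x≢0 with classify x
    ... | null x≡0       = ⊥-elim (x≢0 x≡0)
    ... | square _ sq    = trans (on-square x≢0 sq) (sym (φ-square x≢0 sq))
    ... | nonsquare ¬sqx with classify (a F.* x)
    ...   | null ax≡0      = ⊥-elim ((a≢0 F.≢* x≢0) ax≡0)
    ...   | nonsquare ¬sqax = ⊥-elim (1≢-1 (trans (sym -1*-1) (trans (sym (trans (φ-* a x) (cong₂ _*_ (φ-nonsquare ¬sq) (φ-nonsquare ¬sqx)))) (φ-nonsquare ¬sqax))))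
      where
      -1*-1 : - 1# * - 1# ≡ 1#
      -1*-1 = solve 0 (:- con 1ℤ :* :- con 1ℤ := con 1ℤ) refl
      1≢-1 : 1# ≢ - 1#
      1≢-1 eq = K-char0 1 (trans (solve 0 (con 1ℤ :+ (con 1ℤ :+ con 0ℤ) := con 1ℤ :- :- con 1ℤ) refl) (x≡y⇒x-y≡0 eq))
    ...   | square ax≢0 sqax = trans (*-cancelˡ (⟦⟧≢0 A a≢0) (begin
              ⟦ A ⟧ a * ⟦ A ⟧ x     ≡⟨ sym (mult A a x) ⟩
              ⟦ A ⟧ (a F.* x)       ≡⟨ on-square ax≢0 sqax ⟩
              1#                    ≡⟨ solve 0 (con 1ℤ := :- con 1ℤ :* :- con 1ℤ) refl ⟩
              - 1# * - 1#           ≡⟨ cong (_* - 1#) (sym Aa≡-1) ⟩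
              ⟦ A ⟧ a * - 1#        ∎)) (sym (φ-nonsquare ¬sqx))
      where open ≡-Reasoning

  private
    -- Completing the square, 4x(1-x) = 1 - (1-2x)²; counting square roots then replaces the sum
    -- over squares by one weighted with 1 + φ, and the part with weight 1 vanishes.
    J-duplication : ∀ ψ → ¬ (ψ ≋ ε-char) → ⟦ ψ ⟧ 𝟜 * J ψ ψ ≡ J φ-char ψ
    J-duplication ψ ψ≉ε = begin
      ⟦ ψ ⟧ 𝟜 * J ψ ψ
        ≡⟨ sym (∑x-* (⟦ ψ ⟧ 𝟜) _) ⟩
      ∑x (λ x → ⟦ ψ ⟧ 𝟜 * (⟦ ψ ⟧ x * ⟦ ψ ⟧ (1- x)))
        ≡⟨ ∑x-cong (λ x → trans (cong (⟦ ψ ⟧ 𝟜 *_) (sym (mult ψ x (1- x)))) (trans (sym (mult ψ 𝟜 _)) (cong ⟦ ψ ⟧ (complete-square x)))) ⟩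
      ∑x (λ x → f (F.1# F.- 𝟚 F.* x))
        ≡⟨ ∑x-scale 𝟚≢0 (λ x → f (F.1# F.- x)) ⟩
      ∑x (λ x → f (F.1# F.- x))
        ≡⟨ ∑x-reflect F.1# f ⟩
      ∑x f
        ≡⟨ ∑x-squares (λ t → ⟦ ψ ⟧ (1- t)) ⟩
      ∑x (λ t → (1# + φ t) * ⟦ ψ ⟧ (1- t))
        ≡⟨ trans (∑x-cong (λ t → trans (distribʳ _ _ _) (cong (_+ φ t * ⟦ ψ ⟧ (1- t)) (*-identityˡ _)))) (∑x-+ _ _) ⟩
      ∑x (λ t → ⟦ ψ ⟧ (1- t)) + J φ-char ψ
        ≡⟨ cong (_+ J φ-char ψ) (trans (∑x-reflect F.1# ⟦ ψ ⟧) (∑x-nontrivial ψ ψ≉ε)) ⟩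
      0# + J φ-char ψ
        ≡⟨ +-identityˡ _ ⟩
      J φ-char ψ ∎
      where
      open ≡-Reasoning
      f : F.Carrier → Carrier
      f y = ⟦ ψ ⟧ (1- (y F.* y))
      complete-square : ∀ x → 𝟜 F.* (x F.* (1- x)) ≡ 1- ((F.1# F.- 𝟚 F.* x) F.* (F.1# F.- 𝟚 F.* x))
      complete-square = F.solve 1 (λ x → (o F.:+ (o F.:+ (o F.:+ (o F.:+ F.con 0ℤ)))) F.:* (x F.:* (o F.:- x)) F.:=
                          o F.:- (o F.:- (o F.:+ (o F.:+ F.con 0ℤ)) F.:* x) F.:* (o F.:- (o F.:+ (o F.:+ F.con 0ℤ)) F.:* x)) refl
        where
        o : F.Polynomial 1
        o = F.con 1ℤ

  -- The Hasse–Davenport product formula for the quadratic character.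
  G-duplication : ∀ ψ → G ψ * G (ψ ⊛ φ-char) ≡ (⟦ ψ ⟧ 𝟜) ⁻¹ * G φ-char * G (ψ ⊛ ψ)
  G-duplication ψ with (ψ ⊛ ψ) ≋? ε-char
  ... | no ψ²≉ε = *-cancelˡ (G≢0 ψ) (begin
      G ψ * (G ψ * G (ψ ⊛ φ-char))
        ≡⟨ trans (sym (*-assoc _ _ _)) (cong (_* G (ψ ⊛ φ-char)) (G-*-nontrivial ψ ψ ψ²≉ε)) ⟩
      G (ψ ⊛ ψ) * J ψ ψ * G (ψ ⊛ φ-char)
        ≡⟨ cong (G (ψ ⊛ ψ) * J ψ ψ *_) (G-cong {ψ ⊛ φ-char} {φ-char ⊛ ψ} (λ x → *-comm _ _)) ⟩
      G (ψ ⊛ ψ) * J ψ ψ * G (φ-char ⊛ ψ)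
        ≡⟨ duplicate (⟦⟧≢0 ψ 𝟜≢0) (trans (G-*-nontrivial φ-char ψ φψ≉ε) (cong (G (φ-char ⊛ ψ) *_) (sym (J-duplication ψ ψ≉ε)))) ⟩
      G ψ * ((⟦ ψ ⟧ 𝟜) ⁻¹ * G φ-char * G (ψ ⊛ ψ)) ∎)
    where
    open ≡-Reasoning
    ψ≉ε : ¬ (ψ ≋ ε-char)
    ψ≉ε ψ≋ε = ψ²≉ε (λ x → trans (cong₂ _*_ (ψ≋ε x) (ψ≋ε x)) (ε⊛ ε-char x))
    φψ≉ε : ¬ (φ-char ⊛ ψ ≋ ε-char)
    φψ≉ε φψ≋ε = ψ²≉ε (λ x → trans (cong₂ _*_ (ψ≋φ x) (ψ≋φ x)) (φ²≋ε x))
      where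
      ψ≋φ : ψ ≋ φ-char
      ψ≋φ = ⊛ᶜ≋ε⇒≋ {ψ} {φ-char} (λ x → trans (cong (⟦ ψ ⟧ x *_) (φᶜ≋φ x)) (trans (*-comm _ _) (φψ≋ε x)))
    duplicate : ∀ {a b c f j k} → k ≢ 0# → f * a ≡ b * (k * j) → c * j * b ≡ a * (k ⁻¹ * f * c)
    duplicate {a} {b} {c} {f} {j} {k} k≢0 eq = sym (begin
      a * (k ⁻¹ * f * c)       ≡⟨ solve 4 (λ a i f c → a :* (i :* f :* c) := i :* c :* (f :* a)) refl a (k ⁻¹) f c ⟩
      k ⁻¹ * c * (f * a)       ≡⟨ cong (k ⁻¹ * c *_) eq ⟩
      k ⁻¹ * c * (b * (k * j)) ≡⟨ solve 5 (λ i c b k j → i :* c :* (b :* (k :* j)) := (k :* i) :* (c :* j :* b)) refl (k ⁻¹) c b k j ⟩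
      (k * k ⁻¹) * (c * j * b) ≡⟨ trans (cong (_* (c * j * b)) (⁻¹-inverse k k≢0)) (*-identityˡ _) ⟩
      c * j * b                ∎)
  -- Now ψ is ε or φ. In both cases the left side is G(φ)G(ε) up to order, and ψ(4) = ψ(2)² = 1.
  ... | yes ψ²≋ε = trans swap-order (trans (sym (*-identityˡ _)) (trans (cong (_* (G φ-char * G ε-char)) (sym ψ4≡1))
                     (trans (sym (*-assoc _ _ _)) (cong ((⟦ ψ ⟧ 𝟜) ⁻¹ * G φ-char *_) (G-cong {ε-char} {ψ ⊛ ψ} (λ x → sym (ψ²≋ε x)))))))
    where
    ψ4≡1 : (⟦ ψ ⟧ 𝟜) ⁻¹ ≡ 1#
    ψ4≡1 = trans (cong _⁻¹ (trans (cong ⟦ ψ ⟧ 𝟜≡𝟚*𝟚) (trans (mult ψ 𝟚 𝟚) (trans (ψ²≋ε 𝟚) (ε≡1 𝟚≢0))))) 1⁻¹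
    swap-order : G ψ * G (ψ ⊛ φ-char) ≡ G φ-char * G ε-char
    swap-order with ψ ≋? ε-char
    ... | yes ψ≋ε = trans (*-comm _ _) (cong₂ _*_
                      (G-cong {ψ ⊛ φ-char} {φ-char} (λ x → trans (cong (_* φ x) (ψ≋ε x)) (ε⊛ φ-char x))) (G-cong {ψ} {ε-char} ψ≋ε))
    ... | no ψ≉ε  = cong₂ _*_ (G-cong {ψ} {φ-char} ψ≋φ)
                      (G-cong {ψ ⊛ φ-char} {ε-char} (λ x → trans (cong (_* φ x) (ψ≋φ x)) (φ²≋ε x)))
      where
      ψ≋φ : ψ ≋ φ-char
      ψ≋φ = order-two ψ ψ²≋ε ψ≉ε

-- Möbius substitutions in sums over the field

module Moebius (S : Setup) where
  open GaussSums S public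

  module _ (μ : F.Carrier) where
    -- Denominator of the fractional linear map that fixes 0 and 1 and has derivative μ at 0. Under
    -- this map u/(1-u) is multiplied by μ.
    moebiusDen : F.Carrier → F.Carrier
    moebiusDen a = F.1# F.+ (μ F.- F.1#) F.* a

    moebius : F.Carrier → F.Carrier
    moebius a = (μ F.* a) F./ moebiusDen a

    1-moebius : ∀ a → moebiusDen a ≢ F.0# → 1- (moebius a) ≡ (1- a) F./ moebiusDen a
    1-moebius a n = F.fieldEq (μ ∷ a ∷ []) (𝟙 ⊖ (#0 ⊗ #1) ⊘ N) ((𝟙 ⊖ #1) ⊘ N) (n ∷ []) (n ∷ []) refl
      where
      N : Rational 2
      N = 𝟙 ⊕ (#0 ⊖ 𝟙) ⊗ #1

    -- By the convention for inverses the pole is sent to 0, where the functions to be summed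
    -- vanish.
    moebius-junk : ∀ a → moebiusDen a ≡ F.0# → moebius a ≡ F.0#
    moebius-junk a eq = trans (cong (μ F.* a F./_) eq) (trans (cong (μ F.* a F.*_) F.0⁻¹) (F.zeroʳ _))

    -- The image of ∞ is μ / (μ - 1), which for μ = 1 reads 0.
    ∑x-moebius : μ ≢ F.0# → ∀ (f : F.Carrier → Carrier) → f F.0# ≡ 0# →
                 ∑x f ≡ ∑x (λ a → f (moebius a)) + f (μ F./ (μ F.- F.1#))
    ∑x-moebius μ≢0 f f0≡0 = begin
      ∑x f
        ≡⟨ trans (∑x-cong split-at) (∑x-+ _ _) ⟩
      ∑x f′ + ∑x (λ u → [ c ≡? u ] * f u)
        ≡⟨ cong₂ _+_ (∑x-reindex σ moebius to from) (∑x-[] c f) ⟩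
      ∑x (λ a → f (moebius a)) + f c ∎
      where
      open ≡-Reasoning
      c : F.Carrier
      c = μ F./ (μ F.- F.1#)
      -- f without the image of ∞, the one nonzero value that `moebius` can miss; on the rest of the
      -- support σ is its inverse.
      f′ : F.Carrier → Carrier
      f′ u = (1# - [ c ≡? u ]) * f u
      σ : F.Carrier → F.Carrier
      σ u = u F./ (μ F.- (μ F.- F.1#) F.* u)
      split-at : ∀ u → f u ≡ f′ u + [ c ≡? u ] * f u
      split-at u = solve 2 (λ d t → t := (con 1ℤ :- d) :* t :+ d :* t) refl [ c ≡? u ] (f u)
      f≢0⇒≢0 : ∀ {u} → f u ≢ 0# → u ≢ F.0#
      f≢0⇒≢0 fu≢0 refl = fu≢0 f0≡0
      f′≡f : ∀ u → c ≢ u → f′ u ≡ f u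
      f′≡f u c≢u = trans (cong (λ d → (1# - d) * f u) ([ c F.≟ u ]-no c≢u))
                         (solve 1 (λ t → (con 1ℤ :- con 0ℤ) :* t := t) refl (f u))
      f′c≡0 : f′ c ≡ 0#
      f′c≡0 = trans (cong (λ d → (1# - d) * f c) ([ c F.≟ c ]-yes refl))
                    (solve 1 (λ t → (con 1ℤ :- con 1ℤ) :* t := con 0ℤ) refl (f c))
      to : ∀ u → f′ u ≢ 0# → u ≡ moebius (σ u) × f′ u ≡ f (moebius (σ u))
      to u f′u≢0 = sym Mσ , trans (f′≡f u c≢u) (cong f (sym Mσ))
        where
        c≢u : c ≢ u
        c≢u refl = f′u≢0 f′c≡0
        n : μ F.- (μ F.- F.1#) F.* u ≢ F.0#
        n eq with (μ F.- F.1#) F.≟ F.0#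
        ... | yes μ-1≡0 = μ≢0 (trans (F.x-y≡0⇒x≡y eq) (trans (cong (F._* u) μ-1≡0) (F.zeroˡ u)))
        ... | no μ-1≢0  = c≢u (sym (F./-unique μ-1≢0 (trans (F.*-comm _ _) (sym (F.x-y≡0⇒x≡y eq)))))
        D : Rational 2
        D = #0 ⊖ (#0 ⊖ 𝟙) ⊗ #1
        den≡ : moebiusDen (σ u) ≡ μ F./ (μ F.- (μ F.- F.1#) F.* u)
        den≡ = F.fieldEq (μ ∷ u ∷ []) (𝟙 ⊕ (#0 ⊖ 𝟙) ⊗ (#1 ⊘ D)) (#0 ⊘ D) (n ∷ []) (n ∷ []) refl
        den≢0 : moebiusDen (σ u) ≢ F.0#
        den≢0 eq = (μ≢0 F.≢* F.⁻¹-≢0 n) (trans (sym den≡) eq)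
        Mσ : moebius (σ u) ≡ u
        Mσ = F.fieldEq (μ ∷ u ∷ []) ((#0 ⊗ (#1 ⊘ D)) ⊘ (𝟙 ⊕ (#0 ⊖ 𝟙) ⊗ (#1 ⊘ D))) (#1) (n ∷ den≢0 ∷ n ∷ []) [] refl
      from : ∀ a → f (moebius a) ≢ 0# → a ≡ σ (moebius a) × f (moebius a) ≡ f′ (moebius a)
      from a fMa≢0 = sym σM , sym (f′≡f (moebius a) c≢M)
        where
        M≢0 : moebius a ≢ F.0#
        M≢0 = f≢0⇒≢0 fMa≢0
        n : moebiusDen a ≢ F.0#
        n eq = M≢0 (moebius-junk a eq)
        N : Rational 2
        N = 𝟙 ⊕ (#0 ⊖ 𝟙) ⊗ #1
        den≡ : μ F.- (μ F.- F.1#) F.* moebius a ≡ μ F./ moebiusDen a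
        den≡ = F.fieldEq (μ ∷ a ∷ []) (#0 ⊖ (#0 ⊖ 𝟙) ⊗ ((#0 ⊗ #1) ⊘ N)) (#0 ⊘ N) (n ∷ []) (n ∷ []) refl
        den≢0 : μ F.- (μ F.- F.1#) F.* moebius a ≢ F.0#
        den≢0 eq = (μ≢0 F.≢* F.⁻¹-≢0 n) (trans (sym den≡) eq)
        σM : σ (moebius a) ≡ a
        σM = F.fieldEq (μ ∷ a ∷ []) (((#0 ⊗ #1) ⊘ N) ⊘ (#0 ⊖ (#0 ⊖ 𝟙) ⊗ ((#0 ⊗ #1) ⊘ N))) (#1) (n ∷ den≢0 ∷ n ∷ []) [] refl
        c≢M : c ≢ moebius a
        c≢M c≡M with (μ F.- F.1#) F.≟ F.0#
        ... | yes μ-1≡0 = M≢0 (trans (sym c≡M) (trans (cong (λ d → μ F.* d F.⁻¹) μ-1≡0) (trans (cong (μ F.*_) F.0⁻¹) (F.zeroʳ μ))))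
        ... | no μ-1≢0  = den≢0 (trans (cong (λ t → μ F.- (μ F.- F.1#) F.* t) (sym c≡M))
              (F.fieldEq (μ ∷ []) (#0 ⊖ (#0 ⊖ 𝟙) ⊗ (#0 ⊘ (#0 ⊖ 𝟙))) (♯ 0ℤ) (μ-1≢0 ∷ []) [] refl))

  -- This is the Jacobi sum of X and its inverse. Three of the boundary sums reduce to it.
  ∑x-odds : ∀ X → ∑x (λ t → ⟦ X ⟧ (t F./ (1- t))) ≡ (q - 1#) * δ X - ⟦ X ⟧ -1F
  ∑x-odds X = trans (∑x-cong (λ t → ⟦⟧-/ X t (1- t))) (J-inverse X (X ᶜ) (⊛ᶜ≋ε X))

  -- Boundary summands agree with a simple character expression except at one point, where they
  -- vanish and the expression does not.
  ∑x-without : ∀ a (f g : F.Carrier → Carrier) → g a ≡ 0# → (∀ x → x ≢ a → g x ≡ f x) → ∑x g ≡ ∑x f - f a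
  ∑x-without a f g ga≡0 g≡f = begin
    ∑x g
      ≡⟨ solve 2 (λ s t → s := (s :+ t) :- t) refl (∑x g) (f a) ⟩
    (∑x g + f a) - f a
      ≡⟨ cong (λ t → (∑x g + t) - f a) (sym (∑x-[] a f)) ⟩
    (∑x g + ∑x (λ x → [ a ≡? x ] * f x)) - f a
      ≡⟨ cong (_- f a) (trans (sym (∑x-+ _ _)) (∑x-cong pointwise)) ⟩
    ∑x f - f a ∎
    where
    open ≡-Reasoning
    pointwise : ∀ x → g x + [ a ≡? x ] * f x ≡ f x
    pointwise x with a F.≟ x
    ... | yes refl = trans (cong (_+ 1# * f a) ga≡0) (trans (+-identityˡ _) (*-identityˡ _))
    ... | no a≢x   = trans (cong (g x +_) (zeroˡ _)) (trans (+-identityʳ _) (g≡f x (λ x≡a → a≢x (sym x≡a))))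

-- The two substitutions in the double sum

module Product (S : Setup) where
  open Moebius S public

  module Substitution (A B P : Character) {x : F.Carrier} (x≢0 : x ≢ F.0#) (x≢1 : x ≢ F.1#) where
    1-x≢0 : 1- x ≢ F.0#
    1-x≢0 eq = x≢1 (sym (F.x-y≡0⇒x≡y eq))

    triple : F.Carrier → F.Carrier → F.Carrier → Carrier
    triple α β γ = ⟦ A ⟧ α * ⟦ B ⟧ β * ⟦ P ⟧ γ

    triple-cong : ∀ {α α′ β β′ γ γ′} → α ≡ α′ → β ≡ β′ → γ ≡ γ′ → triple α β γ ≡ triple α′ β′ γ′
    triple-cong refl refl refl = refl

    triple-0₁ : ∀ {α β γ} → α ≡ F.0# → triple α β γ ≡ 0#
    triple-0₁ refl = trans (cong (λ t → t * _ * _) (at0 A)) (trans (cong (_* _) (zeroˡ _)) (zeroˡ _))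

    triple-0₂ : ∀ {α β γ} → β ≡ F.0# → triple α β γ ≡ 0#
    triple-0₂ refl = trans (cong (λ t → _ * t * _) (at0 B)) (trans (cong (_* _) (zeroʳ _)) (zeroˡ _))

    triple-0₃ : ∀ {α β γ} → γ ≡ F.0# → triple α β γ ≡ 0#
    triple-0₃ refl = trans (cong (_ *_) (at0 P)) (zeroʳ _)

    absorb : ∀ {e α α′ β γ} → e * α ≡ α′ → e * (α * β * γ) ≡ α′ * β * γ
    absorb {e} {α} {_} {β} {γ} refl = solve 4 (λ e α β γ → e :* (α :* β :* γ) := (e :* α) :* β :* γ) refl e α β γ

    0/ : ∀ {n d} → n ≡ F.0# → n F./ d ≡ F.0#
    0/ refl = F.zeroˡ _

    /0 : ∀ {n d} → d ≡ F.0# → n F./ d ≡ F.0#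
    /0 {n} refl = trans (cong (n F.*_) F.0⁻¹) (F.zeroʳ n)

    *0 : ∀ {m n} → n ≡ F.0# → m F.* n ≡ F.0#
    *0 refl = F.zeroʳ _

    0* : ∀ {m n} → m ≡ F.0# → m F.* n ≡ F.0#
    0* refl = F.zeroˡ _

    -- f is the summand of the product of the two integrals; the
    -- substitutions u ↦ a and then v ↦ r turn it into h and then into k.
    f : F.Carrier → F.Carrier → Carrier
    f u v = triple (u F./ ((1- u) F.* (1- (x F.* v)))) ((1- v) F./ (v F.* (1- (x F.* u)))) ((1- u) F.* v)

    -- The denominator of the first substitution: its parameter minus 1 is x(1-v)/(1-x).
    ω : F.Carrier → F.Carrier → F.Carrier
    ω a v = F.1# F.+ ((a F.* x) F./ (1- x)) F.* (1- v)

    h : F.Carrier → F.Carrier → Carrier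
    h a v = triple (a F./ ((1- x) F.* (1- a))) (((1- v) F.* ω a v) F./ (v F.* (1- (a F.* x F.* v)))) ((v F.* (1- a)) F./ ω a v)

    -- The argument wa(1-a) at which the inner series of the right-hand side will be evaluated.
    W : F.Carrier → F.Carrier
    W a = (F.- (x F.* x) F./ (1- x)) F.* (a F.* (1- a))

    k : F.Carrier → F.Carrier → Carrier
    k a r = triple (a F./ (1- a)) ((1- r) F./ (r F.* (1- (W a F.* r)))) (r F.* (1- a))

    module _ (v : F.Carrier) where
      -- The substitution multiplies u/(1-u) by this factor, which cancels 1 - xv in the argument of
      -- A and makes it independent of v.
      μ₁ : F.Carrier
      μ₁ = (1- (x F.* v)) F./ (1- x)

      private
        f-0 : f F.0# v ≡ 0#
        f-0 = triple-0₁ (F.zeroˡ _)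

        den≡ω : ∀ a → moebiusDen μ₁ a ≡ ω a v
        den≡ω a = F.fieldEq (x ∷ a ∷ v ∷ []) (𝟙 ⊕ ((𝟙 ⊖ #0 ⊗ #2) ⊘ (𝟙 ⊖ #0) ⊖ 𝟙) ⊗ #1)
                    (𝟙 ⊕ ((#1 ⊗ #0) ⊘ (𝟙 ⊖ #0)) ⊗ (𝟙 ⊖ #2)) (1-x≢0 ∷ []) (1-x≢0 ∷ []) refl

        module _ (xv≢1 : 1- (x F.* v) ≢ F.0#) (a : F.Carrier) where
          M : F.Carrier
          M = moebius μ₁ a

          module _ (ω≢0 : ω a v ≢ F.0#) where
            1-M : 1- M ≡ (1- a) F./ ω a v
            1-M = trans (1-moebius μ₁ a (λ eq → ω≢0 (trans (sym (den≡ω a)) eq))) (cong ((1- a) F./_) (den≡ω a))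

            M≡ : M ≡ (μ₁ F.* a) F./ ω a v
            M≡ = cong ((μ₁ F.* a) F./_) (den≡ω a)

            Ω μ : Rational 3
            Ω = 𝟙 ⊕ ((#1 ⊗ #0) ⊘ (𝟙 ⊖ #0)) ⊗ (𝟙 ⊖ #2)
            μ = (𝟙 ⊖ #0 ⊗ #2) ⊘ (𝟙 ⊖ #0)

            1-xM : 1- (x F.* M) ≡ (1- (a F.* x F.* v)) F./ ω a v
            1-xM = trans (cong (λ t → 1- (x F.* t)) M≡)
              (F.fieldEq (x ∷ a ∷ v ∷ []) (𝟙 ⊖ #0 ⊗ ((μ ⊗ #1) ⊘ Ω)) ((𝟙 ⊖ #1 ⊗ #0 ⊗ #2) ⊘ Ω)
                (1-x≢0 ∷ ω≢0 ∷ 1-x≢0 ∷ []) (ω≢0 ∷ 1-x≢0 ∷ []) refl)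

            generic : 1- a ≢ F.0# → v ≢ F.0# → 1- (a F.* x F.* v) ≢ F.0# → f M v ≡ h a v
            generic 1-a≢0 v≢0 1-axv≢0 = triple-cong
              (trans (cong₂ (λ m n → m F./ (n F.* (1- (x F.* v)))) M≡ 1-M)
                (F.fieldEq (x ∷ a ∷ v ∷ ω a v ∷ [])
                  (((((𝟙 ⊖ #0 ⊗ #2) ⊘ (𝟙 ⊖ #0)) ⊗ #1) ⊘ #3) ⊘ (((𝟙 ⊖ #1) ⊘ #3) ⊗ (𝟙 ⊖ #0 ⊗ #2)))
                  (#1 ⊘ ((𝟙 ⊖ #0) ⊗ (𝟙 ⊖ #1)))
                  (1-x≢0 ∷ ω≢0 ∷ ((1-a≢0 F.≢* F.⁻¹-≢0 ω≢0) F.≢* xv≢1) ∷ ω≢0 ∷ []) ((1-x≢0 F.≢* 1-a≢0) ∷ []) refl))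
              (trans (cong (λ m → (1- v) F./ (v F.* m)) 1-xM)
                (F.fieldEq (x ∷ a ∷ v ∷ ω a v ∷ [])
                  ((𝟙 ⊖ #2) ⊘ (#2 ⊗ ((𝟙 ⊖ #1 ⊗ #0 ⊗ #2) ⊘ #3)))
                  (((𝟙 ⊖ #2) ⊗ #3) ⊘ (#2 ⊗ (𝟙 ⊖ #1 ⊗ #0 ⊗ #2)))
                  ((v≢0 F.≢* (1-axv≢0 F.≢* F.⁻¹-≢0 ω≢0)) ∷ ω≢0 ∷ []) ((v≢0 F.≢* 1-axv≢0) ∷ []) refl))
              (trans (cong (F._* v) 1-M)
                (F.fieldEq (a ∷ v ∷ ω a v ∷ []) (((𝟙 ⊖ #0) ⊘ #2) ⊗ #1) ((#1 ⊗ (𝟙 ⊖ #0)) ⊘ #2)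
                  (ω≢0 ∷ []) (ω≢0 ∷ []) refl))

          f≡h : f M v ≡ h a v
          -- The rational identities behind `generic` need four nonzero quantities. Where one of
          -- them is 0, a character in each of the two products is evaluated at 0.
          f≡h with ω a v F.≟ F.0# | (1- a) F.≟ F.0# | v F.≟ F.0# | (1- (a F.* x F.* v)) F.≟ F.0#
          ... | yes ω≡0 | _ | _ | _ = trans (triple-0₁ (0/ (moebius-junk μ₁ a (trans (den≡ω a) ω≡0)))) (sym (triple-0₃ (/0 ω≡0)))
          ... | no ω≢0 | yes 1-a≡0 | _ | _ = trans (triple-0₃ (0* (trans (1-M ω≢0) (0/ 1-a≡0)))) (sym (triple-0₃ (0/ (*0 1-a≡0))))
          ... | no ω≢0 | no _ | yes v≡0 | _ = trans (triple-0₃ (*0 v≡0)) (sym (triple-0₃ (0/ (0* v≡0))))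
          ... | no ω≢0 | no _ | no _ | yes 1-axv≡0 = trans (triple-0₂ (/0 (*0 (trans (1-xM ω≢0) (0/ 1-axv≡0))))) (sym (triple-0₂ (/0 (*0 1-axv≡0))))
          ... | no ω≢0 | no 1-a≢0 | no v≢0 | no 1-axv≢0 = generic ω≢0 1-a≢0 v≢0 1-axv≢0

        xv≡1⇒ : 1- (x F.* v) ≡ F.0# → x F.⁻¹ ≡ v
        xv≡1⇒ eq = sym (F.⁻¹-unique (sym (F.x-y≡0⇒x≡y eq)))

        ⇒xv≡1 : x F.⁻¹ ≡ v → 1- (x F.* v) ≡ F.0#
        ⇒xv≡1 refl = F.x≡y⇒x-y≡0 (sym (F.⁻¹-inverse x x≢0))

      -- The middle term is the image of ∞. At v = 1/x the parameter `μ₁` is 0 and the substitution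
      -- collapses: the left side vanishes while the sum of h need not, so that sum is taken away
      -- again.
      substitute-u : ∑x (λ u → f u v) ≡
                     ∑x (λ a → h a v) + f (μ₁ F./ (μ₁ F.- F.1#)) v - [ x F.⁻¹ ≡? v ] * ∑x (λ a → h a v)
      substitute-u with (1- (x F.* v)) F.≟ F.0#
      ... | yes xv≡1 = begin
        ∑x (λ u → f u v)
          ≡⟨ trans (∑x-cong f≡0) (sumL-0 elems) ⟩
        0#
          ≡⟨ solve 1 (λ s → con 0ℤ := s :+ con 0ℤ :- con 1ℤ :* s) refl H ⟩
        H + 0# - 1# * H
          ≡⟨ cong₂ (λ t d → H + t - d * H) (sym (f≡0 _)) (sym ([ (x F.⁻¹) F.≟ v ]-yes (xv≡1⇒ xv≡1))) ⟩
        H + f (μ₁ F./ (μ₁ F.- F.1#)) v - [ x F.⁻¹ ≡? v ] * H ∎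
        where
        open ≡-Reasoning
        H : Carrier
        H = ∑x (λ a → h a v)
        f≡0 : ∀ u → f u v ≡ 0#
        f≡0 u = triple-0₁ (/0 (*0 xv≡1))
      ... | no xv≢1 = begin
        ∑x (λ u → f u v)
          ≡⟨ ∑x-moebius μ₁ (xv≢1 F.≢* F.⁻¹-≢0 1-x≢0) (λ u → f u v) f-0 ⟩
        ∑x (λ a → f (moebius μ₁ a) v) + T
          ≡⟨ cong (_+ T) (∑x-cong (f≡h xv≢1)) ⟩
        H + T
          ≡⟨ solve 2 (λ s t → s :+ t := s :+ t :- con 0ℤ :* s) refl H T ⟩
        H + T - 0# * H
          ≡⟨ cong (λ d → H + T - d * H) (sym ([ (x F.⁻¹) F.≟ v ]-no (λ eq → xv≢1 (⇒xv≡1 eq)))) ⟩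
        H + T - [ x F.⁻¹ ≡? v ] * H ∎
        where
        open ≡-Reasoning
        H T : Carrier
        H = ∑x (λ a → h a v)
        T = f (μ₁ F./ (μ₁ F.- F.1#)) v

    module _ (a : F.Carrier) where
      -- With this parameter v / ω a v becomes r, so that the argument of P turns into r(1-a).
      c μ₂ : F.Carrier
      c = (a F.* x) F./ (1- x)
      μ₂ = F.1# F.+ c

      private
        scaled : F.Carrier → Carrier
        scaled v = ⟦ A ⟧ (1- x) * h a v

        scaled-≡ : ∀ v → scaled v ≡ triple (a F./ (1- a)) (((1- v) F.* ω a v) F./ (v F.* (1- (a F.* x F.* v)))) ((v F.* (1- a)) F./ ω a v)
        scaled-≡ v = absorb (trans (sym (mult A (1- x) _)) (cong ⟦ A ⟧ cancel))
          where
          cancel : (1- x) F.* (a F./ ((1- x) F.* (1- a))) ≡ a F./ (1- a)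
          cancel = trans (cong (λ t → (1- x) F.* (a F.* t)) (trans (F.⁻¹-distrib-* (1- x) (1- a)) (F.*-comm _ _)))
            (F.fieldEq ((1- x) ∷ a ∷ ((1- a) F.⁻¹) ∷ []) (#0 ⊗ (#1 ⊗ (#2 ⊘ #0))) (#1 ⊗ #2) (1-x≢0 ∷ []) [] refl)

        scaled-0 : scaled F.0# ≡ 0#
        scaled-0 = trans (cong (⟦ A ⟧ (1- x) *_) (triple-0₃ (0/ (F.zeroˡ _)))) (zeroʳ _)

        -- The image of ∞ is a zero of ω, and ω is a denominator in h. If c = 0 the expression for
        -- the image reads 0, where the summand vanishes too.
        scaled-∞ : scaled (μ₂ F./ (μ₂ F.- F.1#)) ≡ 0#
        scaled-∞ with (μ₂ F.- F.1#) F.≟ F.0#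
        ... | yes μ-1≡0 = trans (cong scaled (/0 μ-1≡0)) scaled-0
        ... | no μ-1≢0  = trans (cong (⟦ A ⟧ (1- x) *_) (triple-0₃ (/0
              (F.fieldEq (c ∷ []) (𝟙 ⊕ #0 ⊗ (𝟙 ⊖ (𝟙 ⊕ #0) ⊘ ((𝟙 ⊕ #0) ⊖ 𝟙))) (♯ 0ℤ) (μ-1≢0 ∷ []) [] refl)))) (zeroʳ _)

        module _ (μ₂≢0 : μ₂ ≢ F.0#) (r : F.Carrier) where
          M′ n : F.Carrier
          M′ = moebius μ₂ r
          n = moebiusDen μ₂ r

          module _ (n≢0 : n ≢ F.0#) where
            ω-M′ : ω a M′ ≡ μ₂ F./ n
            ω-M′ = trans (cong (λ t → F.1# F.+ c F.* t) (1-moebius μ₂ r n≢0))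
              (F.fieldEq (c ∷ r ∷ []) (𝟙 ⊕ #0 ⊗ ((𝟙 ⊖ #1) ⊘ (𝟙 ⊕ ((𝟙 ⊕ #0) ⊖ 𝟙) ⊗ #1)))
                ((𝟙 ⊕ #0) ⊘ (𝟙 ⊕ ((𝟙 ⊕ #0) ⊖ 𝟙) ⊗ #1)) (n≢0 ∷ []) (n≢0 ∷ []) refl)

            -- The quadratic argument arises here: clearing the denominator leaves 1 - (ax(1+c) -
            -- c)r, and ax(1+c) - c equals W a.
            1-axM′ : 1- (a F.* x F.* M′) ≡ (1- (W a F.* r)) F./ n
            1-axM′ = F.fieldEq (x ∷ a ∷ r ∷ [])
              (𝟙 ⊖ #1 ⊗ #0 ⊗ ((m ⊗ #2) ⊘ N)) ((𝟙 ⊖ ((⊝ (#0 ⊗ #0) ⊘ (𝟙 ⊖ #0)) ⊗ (#1 ⊗ (𝟙 ⊖ #1))) ⊗ #2) ⊘ N)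
              (1-x≢0 ∷ n≢0 ∷ 1-x≢0 ∷ []) (1-x≢0 ∷ n≢0 ∷ 1-x≢0 ∷ []) refl
              where
              m N : Rational 3
              m = 𝟙 ⊕ (#1 ⊗ #0) ⊘ (𝟙 ⊖ #0)
              N = 𝟙 ⊕ (m ⊖ 𝟙) ⊗ #2

            generic₂ : r ≢ F.0# → 1- (W a F.* r) ≢ F.0# → scaled M′ ≡ k a r
            generic₂ r≢0 1-Wr≢0 = trans (scaled-≡ M′) (triple-cong refl
              (trans (cong₂ F._/_ (cong₂ F._*_ (1-moebius μ₂ r n≢0) ω-M′) (cong (M′ F.*_) 1-axM′))
                (F.fieldEq (μ₂ ∷ r ∷ n ∷ (1- (W a F.* r)) ∷ [])
                  ((((𝟙 ⊖ #1) ⊘ #2) ⊗ (#0 ⊘ #2)) ⊘ (((#0 ⊗ #1) ⊘ #2) ⊗ (#3 ⊘ #2)))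
                  ((𝟙 ⊖ #1) ⊘ (#1 ⊗ #3))
                  (n≢0 ∷ n≢0 ∷ (((μ₂≢0 F.≢* r≢0) F.≢* n⁻¹≢0) F.≢* (1-Wr≢0 F.≢* n⁻¹≢0)) ∷ n≢0 ∷ n≢0 ∷ []) ((r≢0 F.≢* 1-Wr≢0) ∷ []) refl))
              (trans (cong ((M′ F.* (1- a)) F./_) ω-M′)
                (F.fieldEq (μ₂ ∷ r ∷ n ∷ a ∷ []) ((((#0 ⊗ #1) ⊘ #2) ⊗ (𝟙 ⊖ #3)) ⊘ (#0 ⊘ #2)) (#1 ⊗ (𝟙 ⊖ #3))
                  (n≢0 ∷ (μ₂≢0 F.≢* n⁻¹≢0) ∷ n≢0 ∷ []) [] refl)))
              where
              n⁻¹≢0 : n F.⁻¹ ≢ F.0#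
              n⁻¹≢0 = F.⁻¹-≢0 n≢0

            scaled≡k : scaled M′ ≡ k a r
            scaled≡k with r F.≟ F.0# | (1- (W a F.* r)) F.≟ F.0#
            ... | yes r≡0 | _ = trans (trans (scaled-≡ M′) (triple-0₃ (0/ (0* (0/ (*0 r≡0)))))) (sym (triple-0₃ (0* r≡0)))
            ... | no _ | yes 1-Wr≡0 = trans (trans (scaled-≡ M′) (triple-0₂ (/0 (*0 (trans 1-axM′ (0/ 1-Wr≡0)))))) (sym (triple-0₂ (/0 (*0 1-Wr≡0))))
            ... | no r≢0 | no 1-Wr≢0 = generic₂ r≢0 1-Wr≢0

          n≡0⇒ : n ≡ F.0# → F.- (c F.⁻¹) ≡ r
          n≡0⇒ n≡0 = trans (cong F.-_ (sym (F.⁻¹-unique (F.x-y≡0⇒x≡y (trans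
            (F.solve 2 (λ c r → c F.:* (F.:- r) F.:- F.con 1ℤ F.:= F.:- (F.con 1ℤ F.:+ ((F.con 1ℤ F.:+ c) F.:- F.con 1ℤ) F.:* r)) refl c r)
            (trans (cong F.-_ n≡0) F.-0≡0))))))
            (F.solve 1 (λ r → F.:- (F.:- r) F.:= r) refl r)

          ⇒k≡0 : n ≢ F.0# → F.- (c F.⁻¹) ≡ r → k a r ≡ 0#
          ⇒k≡0 n≢0 r≡ with c F.≟ F.0#
          ... | yes c≡0 = triple-0₃ (0* (trans (sym r≡) (trans (cong (λ t → F.- (t F.⁻¹)) c≡0) (trans (cong F.-_ F.0⁻¹) F.-0≡0))))
          ... | no c≢0  = ⊥-elim (n≢0 (trans (cong (λ t → F.1# F.+ (μ₂ F.- F.1#) F.* t) (sym r≡)) (begin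
                F.1# F.+ ((F.1# F.+ c) F.- F.1#) F.* (F.- (c F.⁻¹))
                  ≡⟨ F.solve 2 (λ c i → F.con 1ℤ F.:+ ((F.con 1ℤ F.:+ c) F.:- F.con 1ℤ) F.:* (F.:- i) F.:= F.con 1ℤ F.:- c F.:* i) refl c (c F.⁻¹) ⟩
                F.1# F.- c F.* c F.⁻¹ ≡⟨ F.x≡y⇒x-y≡0 (sym (F.⁻¹-inverse c c≢0)) ⟩
                F.0# ∎)))
            where open ≡-Reasoning

          -- At the pole r = -1/c the left side is the summand at 0 and vanishes, whereas k a r may
          -- not; hence the subtraction. If c = 0 there is no pole, and the indicator then selects r
          -- = 0, where k is 0.
          scaled-M′ : scaled M′ ≡ k a r - [ F.- (c F.⁻¹) ≡? r ] * k a r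
          scaled-M′ with n F.≟ F.0#
          ... | yes n≡0 = trans (trans (cong scaled (moebius-junk μ₂ r n≡0)) scaled-0)
                (sym (trans (cong (λ d → k a r - d * k a r) ([ (F.- (c F.⁻¹)) F.≟ r ]-yes (n≡0⇒ n≡0)))
                  (solve 1 (λ t → t :- con 1ℤ :* t := con 0ℤ) refl (k a r))))
          ... | no n≢0 = trans (scaled≡k n≢0) (sym (trans (cong (λ t → k a r - t) vanish)
                  (solve 1 (λ t → t :- con 0ℤ := t) refl (k a r))))
            where
            vanish : [ F.- (c F.⁻¹) ≡? r ] * k a r ≡ 0#
            vanish = trans ([ (F.- (c F.⁻¹)) F.≟ r ]-* (⇒k≡0 n≢0)) (zeroʳ _)

      substitute-v-generic : μ₂ ≢ F.0# → ⟦ A ⟧ (1- x) * ∑x (h a) ≡ ∑x (k a) - k a (F.- (c F.⁻¹))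
      substitute-v-generic μ₂≢0 = begin
        ⟦ A ⟧ (1- x) * ∑x (h a)
          ≡⟨ sym (∑x-* _ (h a)) ⟩
        ∑x scaled
          ≡⟨ ∑x-moebius μ₂ μ₂≢0 scaled scaled-0 ⟩
        ∑x (λ r → scaled (moebius μ₂ r)) + scaled (μ₂ F./ (μ₂ F.- F.1#))
          ≡⟨ trans (cong₂ _+_ (∑x-cong (scaled-M′ μ₂≢0)) scaled-∞) (+-identityʳ _) ⟩
        ∑x (λ r → k a r - [ r₀ ≡? r ] * k a r)
          ≡⟨ trans (∑x-cong (λ r → cong (k a r +_) (solve 2 (λ d t → :- (d :* t) := d :* (:- t)) refl [ r₀ ≡? r ] (k a r)))) (∑x-+ _ _) ⟩
        ∑x (k a) + ∑x (λ r → [ r₀ ≡? r ] * (- k a r))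
          ≡⟨ cong (∑x (k a) +_) (∑x-[] r₀ (λ r → - k a r)) ⟩
        ∑x (k a) - k a r₀ ∎
        where
        open ≡-Reasoning
        r₀ : F.Carrier
        r₀ = F.- (c F.⁻¹)

    -- The value of a at which the second substitution degenerates.
    a* : F.Carrier
    a* = (x F.- F.1#) F./ x

    private
      μ₂≡0⇒ : ∀ a → μ₂ a ≡ F.0# → a* ≡ a
      μ₂≡0⇒ a eq = sym (F./-unique x≢0 (F.x-y≡0⇒x≡y (F.*-cancelʳ (F.⁻¹-≢0 1-x≢0) (trans
        (trans (F.fieldEq (x ∷ a ∷ []) ((#1 ⊗ #0 ⊖ (#0 ⊖ 𝟙)) ⊘ (𝟙 ⊖ #0)) (𝟙 ⊕ (#1 ⊗ #0) ⊘ (𝟙 ⊖ #0)) (1-x≢0 ∷ []) (1-x≢0 ∷ []) refl) eq)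
        (sym (F.zeroˡ _))))))

      c*≡-1 : c a* ≡ F.- F.1#
      c*≡-1 = F.fieldEq (x ∷ []) ((((#0 ⊖ 𝟙) ⊘ #0) ⊗ #0) ⊘ (𝟙 ⊖ #0)) (⊝ 𝟙) (x≢0 ∷ 1-x≢0 ∷ []) [] refl

    k-a*-0 : k a* (F.- (c a* F.⁻¹)) ≡ 0#
    k-a*-0 = triple-0₂ (0/ (trans (cong (λ t → 1- (F.- (t F.⁻¹))) c*≡-1) (trans
        (cong (λ t → 1- (F.- t)) (sym (F.⁻¹-unique (F.solve 0 (F.:- F.con 1ℤ F.:* F.:- F.con 1ℤ F.:= F.con 1ℤ) refl))))
        (F.solve 0 (F.con 1ℤ F.:- (F.:- (F.:- F.con 1ℤ)) F.:= F.con 0ℤ) refl))))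

    -- At `a*` the parameter `μ₂` is 0 and nothing can be substituted, so the difference of the two
    -- sums is carried along until both are computed directly. The pole term is harmless there
    -- because it sits at r = 1.
    substitute-v : ∀ a → ⟦ A ⟧ (1- x) * ∑x (h a) ≡
                   ∑x (k a) - k a (F.- (c a F.⁻¹)) + [ a* ≡? a ] * (⟦ A ⟧ (1- x) * ∑x (h a) - ∑x (k a))
    substitute-v a with a* F.≟ a
    ... | yes refl = sym (trans (cong (λ t → ∑x (k a*) - t + 1# * (⟦ A ⟧ (1- x) * ∑x (h a*) - ∑x (k a*))) k-a*-0)
          (solve 2 (λ s t → t :- con 0ℤ :+ con 1ℤ :* (s :- t) := s) refl (⟦ A ⟧ (1- x) * ∑x (h a*)) (∑x (k a*))))
    ... | no a*≢a = trans (substitute-v-generic a (λ eq → a*≢a (μ₂≡0⇒ a eq)))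
          (solve 2 (λ s t → s := s :+ con 0ℤ :* t) refl (∑x (k a) - k a (F.- (c a F.⁻¹))) (⟦ A ⟧ (1- x) * ∑x (h a) - ∑x (k a)))

    -- The exact defect of the two substitutions, with four sources: the pole of the second and its
    -- degenerate value `a*`, the point at infinity of the first and its degenerate value v = 1/x.
    double-substitution :
      ⟦ A ⟧ (1- x) * ∑x (λ v → ∑x (λ u → f u v)) ≡
      ∑x (λ a → ∑x (k a)) - ∑x (λ a → k a (F.- (c a F.⁻¹))) + (⟦ A ⟧ (1- x) * ∑x (h a*) - ∑x (k a*))
        + ⟦ A ⟧ (1- x) * (∑x (λ v → f (μ₁ v F./ (μ₁ v F.- F.1#)) v) - ∑x (λ a → h a (x F.⁻¹)))
    double-substitution = begin
      Ax * ∑x (λ v → ∑x (λ u → f u v))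
        ≡⟨ cong (Ax *_) (trans (∑x-cong (λ v → trans (substitute-u v) (regroup v))) (trans (∑x-+ _ _) (cong (∑x (λ v → ∑x (λ a → h a v)) +_) (∑x-+ _ _)))) ⟩
      Ax * (∑x (λ v → ∑x (λ a → h a v)) + (D + ∑x (λ v → [ x F.⁻¹ ≡? v ] * (- ∑x (λ a → h a v)))))
        ≡⟨ cong₂ (λ s t → Ax * (s + (D + t))) (∑xx-swap (λ v a → h a v)) (∑x-[] (x F.⁻¹) (λ v → - ∑x (λ a → h a v))) ⟩
      Ax * (∑x (λ a → ∑x (h a)) + (D - H₀))
        ≡⟨ trans (distribˡ _ _ _) (cong (_+ Ax * (D - H₀)) (sym (∑x-* Ax _))) ⟩
      ∑x (λ a → Ax * ∑x (h a)) + Ax * (D - H₀)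
        ≡⟨ cong (_+ Ax * (D - H₀)) (trans (∑x-cong substitute-v) (trans (∑x-+ _ _) (cong₂ _+_ (∑x-+ _ _) (∑x-[] a* (λ a → Ax * ∑x (h a) - ∑x (k a)))))) ⟩
      (∑x (λ a → ∑x (k a)) + ∑x (λ a → - k a (F.- (c a F.⁻¹)))) + (Ax * ∑x (h a*) - ∑x (k a*)) + Ax * (D - H₀)
        ≡⟨ cong (λ t → (∑x (λ a → ∑x (k a)) + t) + (Ax * ∑x (h a*) - ∑x (k a*)) + Ax * (D - H₀)) (∑x-neg (λ a → k a (F.- (c a F.⁻¹)))) ⟩
      (∑x (λ a → ∑x (k a)) - ∑x (λ a → k a (F.- (c a F.⁻¹)))) + (Ax * ∑x (h a*) - ∑x (k a*)) + Ax * (D - H₀) ∎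
      where
      open ≡-Reasoning
      Ax D H₀ : Carrier
      Ax = ⟦ A ⟧ (1- x)
      D = ∑x (λ v → f (μ₁ v F./ (μ₁ v F.- F.1#)) v)
      H₀ = ∑x (λ a → h a (x F.⁻¹))
      regroup : ∀ v → ∑x (λ a → h a v) + f (μ₁ v F./ (μ₁ v F.- F.1#)) v - [ x F.⁻¹ ≡? v ] * ∑x (λ a → h a v) ≡
                ∑x (λ a → h a v) + (f (μ₁ v F./ (μ₁ v F.- F.1#)) v + [ x F.⁻¹ ≡? v ] * (- ∑x (λ a → h a v)))
      regroup v = solve 3 (λ s t d → s :+ t :- d :* s := s :+ (t :+ d :* (:- s))) refl
        (∑x (λ a → h a v)) (f (μ₁ v F./ (μ₁ v F.- F.1#)) v) [ x F.⁻¹ ≡? v ]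
      ∑x-neg : ∀ (g : F.Carrier → Carrier) → ∑x (λ a → - g a) ≡ - ∑x g
      ∑x-neg g = trans (∑x-cong (λ a → solve 1 (λ t → :- t := (:- con 1ℤ) :* t) refl (g a)))
                       (trans (∑x-* (- 1#) g) (solve 1 (λ t → (:- con 1ℤ) :* t := :- t) refl (∑x g)))

-- Evaluation of the boundary sums

module Boundary (S : Setup) where
  open Product S public

  ⟦⟧-1/ : ∀ A x → ⟦ A ⟧ (F.1# F./ x) ≡ (⟦ A ⟧ x) ⁻¹
  ⟦⟧-1/ A x = trans (⟦⟧-/ A F.1# x) (trans (cong (_/ ⟦ A ⟧ x) (at1 A)) (*-identityˡ _))

  -- A Möbius substitution unless m = 1.
  ∑x-ratio : ∀ B → ¬ (B ≋ ε-char) → ∀ {m} → m ≢ F.0# →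
             ∑x (λ v → ⟦ B ⟧ ((1- v) F./ (1- (m F.* v)))) ≡ [ F.1# ≡? m ] * q - ⟦ B ⟧ (F.1# F./ m)
  ∑x-ratio B B≉ε {m} m≢0 with F.1# F.≟ m
  -- For m = 1 the ratio is 1 except at v = 1. With m = x - 1 this is the origin of the delta term
  -- at x = 2.
  ... | yes refl = begin
    ∑x (λ v → ⟦ B ⟧ ((1- v) F./ (1- (F.1# F.* v))))
      ≡⟨ ∑x-without F.1# (λ _ → 1#) _ (trans (cong (λ t → ⟦ B ⟧ (t F./ (1- (F.1# F.* F.1#)))) (F.-‿inverseʳ F.1#)) (trans (cong ⟦ B ⟧ (F.zeroˡ _)) (at0 B)))
           (λ v v≢1 → trans (cong ⟦ B ⟧ (trans (cong (λ t → (1- v) F./ (1- t)) (F.*-identityˡ v)) (F.⁻¹-inverse _ (λ eq → v≢1 (sym (F.x-y≡0⇒x≡y eq)))))) (at1 B)) ⟩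
    ∑x (λ _ → 1#) - 1#
      ≡⟨ cong₂ _-_ (trans ∑x-1 (sym (*-identityˡ q))) (sym (trans (⟦⟧-1/ B F.1#) (trans (cong _⁻¹ (at1 B)) 1⁻¹))) ⟩
    1# * q - ⟦ B ⟧ (F.1# F./ F.1#) ∎
    where open ≡-Reasoning
  ... | no 1≢m = begin
    ∑x (λ v → ⟦ B ⟧ ((1- v) F./ (1- (m F.* v))))
      ≡⟨ sym (∑x-reflect F.1# _) ⟩
    ∑x (λ t → ⟦ B ⟧ ((1- (1- t)) F./ (1- (m F.* (1- t)))))
      ≡⟨ ∑x-cong (λ t → cong ⟦ B ⟧ (ratio≡moebius t)) ⟩
    ∑x (λ t → ⟦ B ⟧ (moebius μ t))
      ≡⟨ solve 2 (λ s t → s := (s :+ t) :- t) refl (∑x (λ t → ⟦ B ⟧ (moebius μ t))) (⟦ B ⟧ (μ F./ (μ F.- F.1#))) ⟩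
    (∑x (λ t → ⟦ B ⟧ (moebius μ t)) + ⟦ B ⟧ (μ F./ (μ F.- F.1#))) - ⟦ B ⟧ (μ F./ (μ F.- F.1#))
      ≡⟨ cong₂ _-_ (trans (sym (∑x-moebius μ μ≢0 ⟦ B ⟧ (at0 B))) (∑x-nontrivial B B≉ε)) (cong ⟦ B ⟧ (∞≡ μ-1≢0)) ⟩
    0# - ⟦ B ⟧ (F.1# F./ m)
      ≡⟨ cong (_- ⟦ B ⟧ (F.1# F./ m)) (sym (zeroˡ q)) ⟩
    0# * q - ⟦ B ⟧ (F.1# F./ m) ∎
    where
    open ≡-Reasoning
    μ : F.Carrier
    μ = F.1# F./ (1- m)
    1-m≢0 : 1- m ≢ F.0#
    1-m≢0 eq = 1≢m (F.x-y≡0⇒x≡y eq)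
    μ≢0 : μ ≢ F.0#
    μ≢0 = F.1≢0 F.≢* F.⁻¹-≢0 1-m≢0
    μ-1≡ : μ F.- F.1# ≡ m F./ (1- m)
    μ-1≡ = F.fieldEq (m ∷ []) (𝟙 ⊘ (𝟙 ⊖ #0) ⊖ 𝟙) (#0 ⊘ (𝟙 ⊖ #0)) (1-m≢0 ∷ []) (1-m≢0 ∷ []) refl
    μ-1≢0 : μ F.- F.1# ≢ F.0#
    μ-1≢0 eq = (m≢0 F.≢* F.⁻¹-≢0 1-m≢0) (trans (sym μ-1≡) eq)
    ∞≡ : μ F.- F.1# ≢ F.0# → μ F./ (μ F.- F.1#) ≡ F.1# F./ m
    ∞≡ n = F.fieldEq (m ∷ []) ((𝟙 ⊘ (𝟙 ⊖ #0)) ⊘ (𝟙 ⊘ (𝟙 ⊖ #0) ⊖ 𝟙)) (𝟙 ⊘ #0) (1-m≢0 ∷ n ∷ 1-m≢0 ∷ []) (m≢0 ∷ []) refl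
    den≡ : ∀ t → moebiusDen μ t ≡ (1- (m F.* (1- t))) F./ (1- m)
    den≡ t = F.fieldEq (m ∷ t ∷ []) (𝟙 ⊕ (𝟙 ⊘ (𝟙 ⊖ #0) ⊖ 𝟙) ⊗ #1) ((𝟙 ⊖ #0 ⊗ (𝟙 ⊖ #1)) ⊘ (𝟙 ⊖ #0)) (1-m≢0 ∷ []) (1-m≢0 ∷ []) refl
    ratio≡moebius : ∀ t → (1- (1- t)) F./ (1- (m F.* (1- t))) ≡ moebius μ t
    ratio≡moebius t with (1- (m F.* (1- t))) F.≟ F.0#
    ... | yes eq = trans (trans (cong ((1- (1- t)) F./_) eq) (trans (cong ((1- (1- t)) F.*_) F.0⁻¹) (F.zeroʳ _)))
                         (sym (moebius-junk μ t (trans (den≡ t) (trans (cong (F._/ (1- m)) eq) (F.zeroˡ _)))))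
    ... | no n = F.fieldEq (m ∷ t ∷ []) ((𝟙 ⊖ (𝟙 ⊖ #1)) ⊘ (𝟙 ⊖ #0 ⊗ (𝟙 ⊖ #1)))
                   (((𝟙 ⊘ (𝟙 ⊖ #0)) ⊗ #1) ⊘ (𝟙 ⊕ (𝟙 ⊘ (𝟙 ⊖ #0) ⊖ 𝟙) ⊗ #1)) (n ∷ [])
                   (1-m≢0 ∷ (λ eq → (n F.≢* F.⁻¹-≢0 1-m≢0) (trans (sym (den≡ t)) eq)) ∷ 1-m≢0 ∷ []) refl

  module _ (A B P : Character) {x : F.Carrier} (x≢0 : x ≢ F.0#) (x≢1 : x ≢ F.1#)
           (A≉ε : ¬ (A ≋ ε-char)) (B≉ε : ¬ (B ≋ ε-char)) (A≉P : ¬ (A ≋ P)) (B≉P : ¬ (B ≋ P))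
           (P-even : ⟦ P ⟧ -1F ≡ 1#) where
    open Substitution A B P x≢0 x≢1

    private
      x-1 : F.Carrier
      x-1 = x F.- F.1#

      x-1≢0 : x-1 ≢ F.0#
      x-1≢0 eq = x≢1 (F.x-y≡0⇒x≡y eq)

      x⁻¹≡ : x F.⁻¹ ≡ F.1# F./ x
      x⁻¹≡ = sym (F.*-identityˡ _)

      -- X is the character applied to v/(1-v) in the term at infinity of the first substitution, Y
      -- the one applied to a/(1-a) in the pole term of the second.
      X Y : Character
      X = B ᶜ ⊛ B ᶜ ⊛ P
      Y = A ⊛ P ᶜ

      X-even : ⟦ X ⟧ -1F ≡ 1#
      X-even = trans (cong₂ _*_ (sign² (B ᶜ)) P-even) (*-identityˡ 1#)

      Cᴰ : Carrier
      Cᴰ = triple (F.1# F./ x-1) (F.1# F./ x-1) (x-1 F./ x)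

      ∞-term : F.Carrier → Carrier
      ∞-term v = f (μ₁ v F./ (μ₁ v F.- F.1#)) v

      -- At the image of ∞ the arguments of A, B and P are, up to constants in x, the powers 0, -2
      -- and 1 of v/(1-v); hence the character B̄²P.
      ∞-term≡ : ∀ v → v ≢ F.1# F./ x → ∞-term v ≡ Cᴰ * ⟦ X ⟧ (v F./ (1- v))
      ∞-term≡ v v≢ with v F.≟ F.0# | (1- v) F.≟ F.0#
      ... | yes v≡0 | _ = trans (triple-0₃ (*0 v≡0)) (sym (trans (cong (Cᴰ *_) (trans (cong ⟦ X ⟧ (0/ v≡0)) (at0 X))) (zeroʳ _)))
      ... | no _ | yes 1-v≡0 = trans (triple-0₂ (0/ 1-v≡0)) (sym (trans (cong (Cᴰ *_) (trans (cong ⟦ X ⟧ (/0 1-v≡0)) (at0 X))) (zeroʳ _)))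
      ... | no v≢0 | no 1-v≢0 = trans (triple-cong
              (trans (cong₂ (λ s t → s F./ (t F.* (1- (x F.* v)))) u₀≡ 1-u₀)
                (F.fieldEq (x ∷ v ∷ []) (u₀ ⊘ (((#0 ⊖ 𝟙) ⊘ (#0 ⊗ (𝟙 ⊖ #1))) ⊗ (𝟙 ⊖ #0 ⊗ #1))) (𝟙 ⊘ (#0 ⊖ 𝟙))
                  (d ∷ ((x-1≢0 F.≢* F.⁻¹-≢0 d) F.≢* 1-xv≢0) ∷ d ∷ []) (x-1≢0 ∷ []) refl))
              (trans (cong (λ t → (1- v) F./ (v F.* t)) 1-xu₀)
                (F.fieldEq (x ∷ v ∷ []) ((𝟙 ⊖ #1) ⊘ (#1 ⊗ ((#1 ⊗ (#0 ⊖ 𝟙)) ⊘ (𝟙 ⊖ #1))))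
                  ((𝟙 ⊘ (#0 ⊖ 𝟙)) ⊘ ((#1 ⊘ (𝟙 ⊖ #1)) ⊗ (#1 ⊘ (𝟙 ⊖ #1))))
                  ((v≢0 F.≢* ((v≢0 F.≢* x-1≢0) F.≢* F.⁻¹-≢0 1-v≢0)) ∷ 1-v≢0 ∷ []) (x-1≢0 ∷ (t≢0 F.≢* t≢0) ∷ 1-v≢0 ∷ 1-v≢0 ∷ []) refl))
              (trans (cong (F._* v) 1-u₀)
                (F.fieldEq (x ∷ v ∷ []) (((#0 ⊖ 𝟙) ⊘ (#0 ⊗ (𝟙 ⊖ #1))) ⊗ #1) (((#0 ⊖ 𝟙) ⊘ #0) ⊗ (#1 ⊘ (𝟙 ⊖ #1)))
                  (d ∷ []) (x≢0 ∷ 1-v≢0 ∷ []) refl)))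
              expand
        where
        t : F.Carrier
        t = v F./ (1- v)
        t≢0 : t ≢ F.0#
        t≢0 = v≢0 F.≢* F.⁻¹-≢0 1-v≢0
        1-xv≢0 : 1- (x F.* v) ≢ F.0#
        1-xv≢0 eq = v≢ (F./-unique x≢0 (trans (F.*-comm v x) (sym (F.x-y≡0⇒x≡y eq))))
        d : x F.* (1- v) ≢ F.0#
        d = x≢0 F.≢* 1-v≢0
        u₀ : Rational 2
        u₀ = (𝟙 ⊖ #0 ⊗ #1) ⊘ (#0 ⊗ (𝟙 ⊖ #1))
        μ₁ᵣ : Rational 2
        μ₁ᵣ = (𝟙 ⊖ #0 ⊗ #1) ⊘ (𝟙 ⊖ #0)
        μ₁-1≡ : μ₁ v F.- F.1# ≡ (x F.* (1- v)) F./ (1- x)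
        μ₁-1≡ = F.fieldEq (x ∷ v ∷ []) (μ₁ᵣ ⊖ 𝟙) ((#0 ⊗ (𝟙 ⊖ #1)) ⊘ (𝟙 ⊖ #0)) (1-x≢0 ∷ []) (1-x≢0 ∷ []) refl
        μ₁-1≢0 : μ₁ v F.- F.1# ≢ F.0#
        μ₁-1≢0 eq = (d F.≢* F.⁻¹-≢0 1-x≢0) (trans (sym μ₁-1≡) eq)
        u₀≡ : μ₁ v F./ (μ₁ v F.- F.1#) ≡ (1- (x F.* v)) F./ (x F.* (1- v))
        u₀≡ = F.fieldEq (x ∷ v ∷ []) (μ₁ᵣ ⊘ (μ₁ᵣ ⊖ 𝟙)) u₀ (1-x≢0 ∷ μ₁-1≢0 ∷ 1-x≢0 ∷ []) (d ∷ []) refl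
        1-u₀ : 1- (μ₁ v F./ (μ₁ v F.- F.1#)) ≡ x-1 F./ (x F.* (1- v))
        1-u₀ = trans (cong 1-_ u₀≡) (F.fieldEq (x ∷ v ∷ []) (𝟙 ⊖ u₀) ((#0 ⊖ 𝟙) ⊘ (#0 ⊗ (𝟙 ⊖ #1))) (d ∷ []) (d ∷ []) refl)
        1-xu₀ : 1- (x F.* (μ₁ v F./ (μ₁ v F.- F.1#))) ≡ (v F.* x-1) F./ (1- v)
        1-xu₀ = trans (cong (λ t → 1- (x F.* t)) u₀≡)
                  (F.fieldEq (x ∷ v ∷ []) (𝟙 ⊖ #0 ⊗ u₀) ((#1 ⊗ (#0 ⊖ 𝟙)) ⊘ (𝟙 ⊖ #1)) (d ∷ []) (1-v≢0 ∷ []) refl)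
        expand : triple (F.1# F./ x-1) ((F.1# F./ x-1) F./ (t F.* t)) ((x-1 F./ x) F.* t) ≡ Cᴰ * ⟦ X ⟧ t
        expand = trans (cong₂ (λ s r → ⟦ A ⟧ (F.1# F./ x-1) * s * r)
                   (trans (⟦⟧-/ B _ _) (cong (⟦ B ⟧ (F.1# F./ x-1) *_) (trans (cong _⁻¹ (mult B t t)) (⁻¹-distrib-* _ _)))) (mult P _ t))
          (solve 5 (λ a b c i d → a :* (b :* (i :* i)) :* (c :* d) := (a :* b :* c) :* (i :* i :* d)) refl
            (⟦ A ⟧ (F.1# F./ x-1)) (⟦ B ⟧ (F.1# F./ x-1)) (⟦ P ⟧ (x-1 F./ x)) ((⟦ B ⟧ t) ⁻¹) (⟦ P ⟧ t))

      ∞-term-0 : ∞-term (F.1# F./ x) ≡ 0#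
      ∞-term-0 = triple-0₁ (/0 (*0 (F.fieldEq (x ∷ []) (𝟙 ⊖ #0 ⊗ (𝟙 ⊘ #0)) (♯ 0ℤ) (x≢0 ∷ []) [] refl)))

      odds-1/x : (F.1# F./ x) F./ (1- (F.1# F./ x)) ≡ F.1# F./ x-1
      odds-1/x = F.fieldEq (x ∷ []) ((𝟙 ⊘ #0) ⊘ (𝟙 ⊖ 𝟙 ⊘ #0)) (𝟙 ⊘ (#0 ⊖ 𝟙)) (x≢0 ∷ 1-1/x≢0 ∷ x≢0 ∷ []) (x-1≢0 ∷ []) refl
        where
        1-1/x≢0 : 1- (F.1# F./ x) ≢ F.0#
        1-1/x≢0 eq = (x-1≢0 F.≢* F.⁻¹-≢0 x≢0) (trans (F.fieldEq (x ∷ []) ((#0 ⊖ 𝟙) ⊘ #0) (𝟙 ⊖ 𝟙 ⊘ #0) (x≢0 ∷ []) (x≢0 ∷ []) refl) eq)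

    -- Among the boundary sums only this one contains a delta of characters, since X is trivial
    -- exactly when B² = P. It is the source of the deltas of B in the theorem.
    ∑-∞-term : ∑x ∞-term ≡ Cᴰ * ((q - 1#) * δ X - 1# - ⟦ X ⟧ (F.1# F./ x-1))
    ∑-∞-term = begin
      ∑x ∞-term
        ≡⟨ ∑x-without (F.1# F./ x) (λ v → Cᴰ * ⟦ X ⟧ (v F./ (1- v))) ∞-term ∞-term-0 ∞-term≡ ⟩
      ∑x (λ v → Cᴰ * ⟦ X ⟧ (v F./ (1- v))) - Cᴰ * ⟦ X ⟧ ((F.1# F./ x) F./ (1- (F.1# F./ x)))
        ≡⟨ cong₂ _-_ (trans (∑x-* Cᴰ _) (cong (Cᴰ *_) (∑x-odds X))) (cong (λ t → Cᴰ * ⟦ X ⟧ t) odds-1/x) ⟩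
      Cᴰ * ((q - 1#) * δ X - ⟦ X ⟧ -1F) - Cᴰ * ⟦ X ⟧ (F.1# F./ x-1)
        ≡⟨ cong (λ s → Cᴰ * ((q - 1#) * δ X - s) - Cᴰ * ⟦ X ⟧ (F.1# F./ x-1)) X-even ⟩
      Cᴰ * ((q - 1#) * δ X - 1#) - Cᴰ * ⟦ X ⟧ (F.1# F./ x-1)
        ≡⟨ solve 3 (λ c s t → c :* s :- c :* t := c :* (s :- t)) refl Cᴰ ((q - 1#) * δ X - 1#) (⟦ X ⟧ (F.1# F./ x-1)) ⟩
      Cᴰ * ((q - 1#) * δ X - 1# - ⟦ X ⟧ (F.1# F./ x-1)) ∎
      where open ≡-Reasoning

    private
      1/x≢0 : F.1# F./ x ≢ F.0#
      1/x≢0 = F.1≢0 F.≢* F.⁻¹-≢0 x≢0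

      h-1/x : ∀ a → h a (x F.⁻¹) ≡ triple (F.1# F./ (1- x)) x-1 (F.1# F./ x) * ⟦ A ⟧ (a F./ (1- a))
      h-1/x a with (1- a) F.≟ F.0#
      ... | yes 1-a≡0 = trans (triple-0₁ (/0 (*0 1-a≡0))) (sym (trans (cong (triple (F.1# F./ (1- x)) x-1 (F.1# F./ x) *_) (trans (cong ⟦ A ⟧ (/0 1-a≡0)) (at0 A))) (zeroʳ _)))
      ... | no 1-a≢0 = trans (cong (h a) x⁻¹≡) (trans (triple-cong
              (F.fieldEq (x ∷ a ∷ []) (#1 ⊘ ((𝟙 ⊖ #0) ⊗ (𝟙 ⊖ #1))) ((𝟙 ⊘ (𝟙 ⊖ #0)) ⊗ (#1 ⊘ (𝟙 ⊖ #1)))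
                ((1-x≢0 F.≢* 1-a≢0) ∷ []) (1-x≢0 ∷ 1-a≢0 ∷ []) refl)
              (trans (cong₂ (λ w z → ((1- v) F.* w) F./ (v F.* z)) ω≡ 1-axv≡)
                (F.fieldEq (x ∷ a ∷ []) (((𝟙 ⊖ 𝟙 ⊘ #0) ⊗ (𝟙 ⊖ #1)) ⊘ ((𝟙 ⊘ #0) ⊗ (𝟙 ⊖ #1))) (#0 ⊖ 𝟙)
                  (x≢0 ∷ (1/x≢0 F.≢* 1-a≢0) ∷ x≢0 ∷ []) [] refl))
              (trans (cong ((v F.* (1- a)) F./_) ω≡)
                (F.fieldEq (x ∷ a ∷ []) (((𝟙 ⊘ #0) ⊗ (𝟙 ⊖ #1)) ⊘ (𝟙 ⊖ #1)) (𝟙 ⊘ #0) (x≢0 ∷ 1-a≢0 ∷ []) (x≢0 ∷ []) refl)))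
              (trans (cong (λ s → s * ⟦ B ⟧ x-1 * ⟦ P ⟧ v) (mult A (F.1# F./ (1- x)) _))
                (solve 4 (λ a t b c → (a :* t) :* b :* c := (a :* b :* c) :* t) refl (⟦ A ⟧ (F.1# F./ (1- x))) (⟦ A ⟧ (a F./ (1- a))) (⟦ B ⟧ x-1) (⟦ P ⟧ v))))
        where
        v : F.Carrier
        v = F.1# F./ x
        ω≡ : ω a v ≡ 1- a
        ω≡ = F.fieldEq (x ∷ a ∷ []) (𝟙 ⊕ ((#1 ⊗ #0) ⊘ (𝟙 ⊖ #0)) ⊗ (𝟙 ⊖ 𝟙 ⊘ #0)) (𝟙 ⊖ #1) (1-x≢0 ∷ x≢0 ∷ []) [] refl
        1-axv≡ : 1- (a F.* x F.* v) ≡ 1- a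
        1-axv≡ = F.fieldEq (x ∷ a ∷ []) (𝟙 ⊖ #1 ⊗ #0 ⊗ (𝟙 ⊘ #0)) (𝟙 ⊖ #1) (x≢0 ∷ []) [] refl

    ∑-h-1/x : ∑x (λ a → h a (x F.⁻¹)) ≡ - (triple (F.1# F./ (1- x)) x-1 (F.1# F./ x) * ⟦ A ⟧ -1F)
    ∑-h-1/x = begin
      ∑x (λ a → h a (x F.⁻¹))
        ≡⟨ trans (∑x-cong h-1/x) (∑x-* c₀ _) ⟩
      c₀ * ∑x (λ a → ⟦ A ⟧ (a F./ (1- a)))
        ≡⟨ cong (c₀ *_) (trans (∑x-odds A) (cong (λ d → (q - 1#) * d - ⟦ A ⟧ -1F) (δ-no A A≉ε))) ⟩
      c₀ * ((q - 1#) * 0# - ⟦ A ⟧ -1F)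
        ≡⟨ solve 3 (λ c r s → c :* (r :* con 0ℤ :- s) := :- (c :* s)) refl c₀ (q - 1#) (⟦ A ⟧ -1F) ⟩
      - (c₀ * ⟦ A ⟧ -1F) ∎
      where
      open ≡-Reasoning
      c₀ : Carrier
      c₀ = triple (F.1# F./ (1- x)) x-1 (F.1# F./ x)

    private
      1-a*≡ : 1- a* ≡ F.1# F./ x
      1-a*≡ = F.fieldEq (x ∷ []) (𝟙 ⊖ (#0 ⊖ 𝟙) ⊘ #0) (𝟙 ⊘ #0) (x≢0 ∷ []) (x≢0 ∷ []) refl

      1-a*≢0 : 1- a* ≢ F.0#
      1-a*≢0 eq = 1/x≢0 (trans (sym 1-a*≡) eq)

      odds-a* : a* F./ (1- a*) ≡ x-1
      odds-a* = F.fieldEq (x ∷ []) (((#0 ⊖ 𝟙) ⊘ #0) ⊘ (𝟙 ⊖ (#0 ⊖ 𝟙) ⊘ #0)) (#0 ⊖ 𝟙) (x≢0 ∷ 1-a*≢0 ∷ x≢0 ∷ []) [] refl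

      Cᵀ : Carrier
      Cᵀ = ⟦ B ⟧ (F.1# F./ x-1) * ⟦ P ⟧ (x-1 F./ x)

      missed : F.Carrier → Carrier
      missed a = k a (F.- (c a F.⁻¹))

      -- At the pole r = (x-1)/(ax) both 1 - r and 1 - W a r are multiples of ax - (x-1). These
      -- factors cancel in the argument of B and leave the constant 1/(x-1); they vanish only at
      -- `a*`.
      missed-generic : ∀ a → a ≢ F.0# → 1- a ≢ F.0# → a ≢ a* → missed a ≡ Cᵀ * ⟦ Y ⟧ (a F./ (1- a))
      missed-generic a a≢0 1-a≢0 a≢a* = trans (cong (k a) r≡) (trans (triple-cong refl
            (trans (cong (λ z → (1- r) F./ (r F.* z)) 1-Wr≡)
              (F.fieldEq (x ∷ a ∷ []) ((𝟙 ⊖ rᵣ) ⊘ (rᵣ ⊗ z)) (𝟙 ⊘ (#0 ⊖ 𝟙)) (ax≢0 ∷ (r≢0 F.≢* z≢0) ∷ ax≢0 ∷ []) (x-1≢0 ∷ []) refl))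
            (F.fieldEq (x ∷ a ∷ []) (rᵣ ⊗ (𝟙 ⊖ #1)) (((#0 ⊖ 𝟙) ⊘ #0) ⊗ (𝟙 ⊘ (#1 ⊘ (𝟙 ⊖ #1))))
              (ax≢0 ∷ []) (x≢0 ∷ t≢0 ∷ 1-a≢0 ∷ []) refl))
          (trans (cong (⟦ A ⟧ t * ⟦ B ⟧ (F.1# F./ x-1) *_) (trans (mult P _ _) (cong (⟦ P ⟧ (x-1 F./ x) *_) (⟦⟧-1/ P t))))
            (solve 4 (λ a b c i → a :* b :* (c :* i) := (b :* c) :* (a :* i)) refl (⟦ A ⟧ t) (⟦ B ⟧ (F.1# F./ x-1)) (⟦ P ⟧ (x-1 F./ x)) ((⟦ P ⟧ t) ⁻¹))))
        where
        t r : F.Carrier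
        t = a F./ (1- a)
        r = x-1 F./ (a F.* x)
        t≢0 : t ≢ F.0#
        t≢0 = a≢0 F.≢* F.⁻¹-≢0 1-a≢0
        ax≢0 : a F.* x ≢ F.0#
        ax≢0 = a≢0 F.≢* x≢0
        r≢0 : r ≢ F.0#
        r≢0 = x-1≢0 F.≢* F.⁻¹-≢0 ax≢0
        rᵣ z : Rational 2
        rᵣ = (#0 ⊖ 𝟙) ⊘ (#1 ⊗ #0)
        z = #1 ⊗ #0 ⊖ (#0 ⊖ 𝟙)
        z≢0 : a F.* x F.- x-1 ≢ F.0#
        z≢0 eq = a≢a* (F./-unique x≢0 (F.x-y≡0⇒x≡y eq))
        r≡ : F.- (c a F.⁻¹) ≡ r
        r≡ = trans (cong F.-_ (sym (F.*-identityˡ _)))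
          (F.fieldEq (x ∷ a ∷ []) (⊝ (𝟙 ⊘ ((#1 ⊗ #0) ⊘ (𝟙 ⊖ #0)))) rᵣ ((ax≢0 F.≢* F.⁻¹-≢0 1-x≢0) ∷ 1-x≢0 ∷ []) (ax≢0 ∷ []) refl)
        1-Wr≡ : 1- (W a F.* r) ≡ a F.* x F.- x-1
        1-Wr≡ = F.fieldEq (x ∷ a ∷ []) (𝟙 ⊖ ((⊝ (#0 ⊗ #0) ⊘ (𝟙 ⊖ #0)) ⊗ (#1 ⊗ (𝟙 ⊖ #1))) ⊗ rᵣ) z
          (1-x≢0 ∷ ax≢0 ∷ []) [] refl

      missed≡ : ∀ a → a ≢ a* → missed a ≡ Cᵀ * ⟦ Y ⟧ (a F./ (1- a))
      missed≡ a a≢a* with a F.≟ F.0# | (1- a) F.≟ F.0#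
      ... | yes a≡0 | _ = trans (triple-0₁ (0/ a≡0)) (sym (trans (cong (Cᵀ *_) (trans (cong ⟦ Y ⟧ (0/ a≡0)) (at0 Y))) (zeroʳ _)))
      ... | no _ | yes 1-a≡0 = trans (triple-0₃ (*0 1-a≡0)) (sym (trans (cong (Cᵀ *_) (trans (cong ⟦ Y ⟧ (/0 1-a≡0)) (at0 Y))) (zeroʳ _)))
      ... | no a≢0 | no 1-a≢0 = missed-generic a a≢0 1-a≢0 a≢a*

    ∑-missed : ∑x missed ≡ - (Cᵀ * (⟦ A ⟧ -1F + ⟦ Y ⟧ x-1))
    ∑-missed = begin
      ∑x missed
        ≡⟨ ∑x-without a* (λ a → Cᵀ * ⟦ Y ⟧ (a F./ (1- a))) missed k-a*-0 missed≡ ⟩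
      ∑x (λ a → Cᵀ * ⟦ Y ⟧ (a F./ (1- a))) - Cᵀ * ⟦ Y ⟧ (a* F./ (1- a*))
        ≡⟨ cong₂ _-_ (trans (∑x-* Cᵀ _) (cong (Cᵀ *_) (trans (∑x-odds Y) (cong₂ (λ d s → (q - 1#) * d - s) (δ-no Y (λ Y≋ε → A≉P (⊛ᶜ≋ε⇒≋ {A} {P} Y≋ε))) Y-sign))))
             (cong (λ t → Cᵀ * ⟦ Y ⟧ t) odds-a*) ⟩
      Cᵀ * ((q - 1#) * 0# - ⟦ A ⟧ -1F) - Cᵀ * ⟦ Y ⟧ x-1
        ≡⟨ solve 4 (λ c r s t → c :* (r :* con 0ℤ :- s) :- c :* t := :- (c :* (s :+ t))) refl Cᵀ (q - 1#) (⟦ A ⟧ -1F) (⟦ Y ⟧ x-1) ⟩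
      - (Cᵀ * (⟦ A ⟧ -1F + ⟦ Y ⟧ x-1)) ∎
      where
      open ≡-Reasoning
      Y-sign : ⟦ Y ⟧ -1F ≡ ⟦ A ⟧ -1F
      Y-sign = trans (cong (⟦ A ⟧ -1F *_) (trans (cong _⁻¹ P-even) 1⁻¹)) (*-identityʳ _)

    private
      -- At `a*` the denominator ω is v itself, so A and P become constant and a sum of B over a
      -- ratio of linear forms remains.
      h-a* : ∀ v → v ≢ F.0# → h a* v ≡ (⟦ A ⟧ -1F * ⟦ P ⟧ (F.1# F./ x)) * ⟦ B ⟧ ((1- v) F./ (1- (x-1 F.* v)))
      h-a* v v≢0 = trans (triple-cong α≡ β≡ γ≡)
          (solve 3 (λ a b c → a :* b :* c := (a :* c) :* b) refl (⟦ A ⟧ -1F) (⟦ B ⟧ ((1- v) F./ (1- (x-1 F.* v)))) (⟦ P ⟧ (F.1# F./ x)))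
        where
        a*ᵣ : Rational 2
        a*ᵣ = (#0 ⊖ 𝟙) ⊘ #0
        α≡ : a* F./ ((1- x) F.* (1- a*)) ≡ -1F
        α≡ = F.fieldEq (x ∷ v ∷ []) (a*ᵣ ⊘ ((𝟙 ⊖ #0) ⊗ (𝟙 ⊖ a*ᵣ))) (⊝ 𝟙) (x≢0 ∷ (1-x≢0 F.≢* 1-a*≢0) ∷ x≢0 ∷ []) [] refl
        ω≡ : ω a* v ≡ v
        ω≡ = F.fieldEq (x ∷ v ∷ []) (𝟙 ⊕ ((a*ᵣ ⊗ #0) ⊘ (𝟙 ⊖ #0)) ⊗ (𝟙 ⊖ #1)) (#1) (x≢0 ∷ 1-x≢0 ∷ []) [] refl
        z≡ : 1- (a* F.* x F.* v) ≡ 1- (x-1 F.* v)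
        z≡ = F.fieldEq (x ∷ v ∷ []) (𝟙 ⊖ a*ᵣ ⊗ #0 ⊗ #1) (𝟙 ⊖ (#0 ⊖ 𝟙) ⊗ #1) (x≢0 ∷ []) [] refl
        β≡ : ((1- v) F.* ω a* v) F./ (v F.* (1- (a* F.* x F.* v))) ≡ (1- v) F./ (1- (x-1 F.* v))
        β≡ = trans (cong₂ (λ w z → ((1- v) F.* w) F./ (v F.* z)) ω≡ z≡) (trans (cong (((1- v) F.* v) F.*_) (trans (F.⁻¹-distrib-* v _) (F.*-comm _ _)))
          (F.fieldEq (v ∷ ((1- (x-1 F.* v)) F.⁻¹) ∷ []) (((𝟙 ⊖ #0) ⊗ #0) ⊗ (#1 ⊘ #0)) ((𝟙 ⊖ #0) ⊗ #1) (v≢0 ∷ []) [] refl))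
        γ≡ : (v F.* (1- a*)) F./ ω a* v ≡ F.1# F./ x
        γ≡ = trans (cong₂ (λ s w → (v F.* s) F./ w) 1-a*≡ ω≡)
          (F.fieldEq (x ∷ v ∷ []) ((#1 ⊗ (𝟙 ⊘ #0)) ⊘ #1) (𝟙 ⊘ #0) (x≢0 ∷ v≢0 ∷ []) (x≢0 ∷ []) refl)

    ∑-h-a* : ∑x (h a*) ≡ (⟦ A ⟧ -1F * ⟦ P ⟧ (F.1# F./ x)) * ([ F.1# ≡? x-1 ] * q - ⟦ B ⟧ (F.1# F./ x-1) - 1#)
    ∑-h-a* = begin
      ∑x (h a*)
        ≡⟨ ∑x-without F.0# (λ v → c₀ * ⟦ B ⟧ ((1- v) F./ (1- (x-1 F.* v)))) (h a*) (triple-0₃ (0/ (0* refl))) h-a* ⟩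
      ∑x (λ v → c₀ * ⟦ B ⟧ ((1- v) F./ (1- (x-1 F.* v)))) - c₀ * ⟦ B ⟧ ((1- F.0#) F./ (1- (x-1 F.* F.0#)))
        ≡⟨ cong₂ _-_ (trans (∑x-* c₀ _) (cong (c₀ *_) (∑x-ratio B B≉ε x-1≢0))) (cong (c₀ *_) (trans (cong ⟦ B ⟧ at-0) (at1 B))) ⟩
      c₀ * ([ F.1# ≡? x-1 ] * q - ⟦ B ⟧ (F.1# F./ x-1)) - c₀ * 1#
        ≡⟨ solve 2 (λ c s → c :* s :- c :* con 1ℤ := c :* (s :- con 1ℤ)) refl c₀ ([ F.1# ≡? x-1 ] * q - ⟦ B ⟧ (F.1# F./ x-1)) ⟩
      c₀ * ([ F.1# ≡? x-1 ] * q - ⟦ B ⟧ (F.1# F./ x-1) - 1#) ∎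
      where
      open ≡-Reasoning
      c₀ : Carrier
      c₀ = ⟦ A ⟧ -1F * ⟦ P ⟧ (F.1# F./ x)
      at-0 : (1- F.0#) F./ (1- (x-1 F.* F.0#)) ≡ F.1#
      at-0 = trans (cong (λ t → (1- F.0#) F./ (1- t)) (F.zeroʳ x-1)) (F.⁻¹-inverse _ (λ eq → F.0≢1 (sym (F.x-y≡0⇒x≡y eq))))

    private
      -- W takes the value 1 at `a*`, so the factors 1 - r cancel and a pure character in r remains.
      k-a* : ∀ r → r ≢ F.1# → k a* r ≡ (⟦ A ⟧ x-1 * ⟦ P ⟧ (F.1# F./ x)) * ⟦ B ᶜ ⊛ P ⟧ r
      k-a* r r≢1 with r F.≟ F.0#
      ... | yes r≡0 = trans (triple-0₃ (0* r≡0)) (sym (trans (cong ((⟦ A ⟧ x-1 * ⟦ P ⟧ (F.1# F./ x)) *_) (trans (cong ⟦ B ᶜ ⊛ P ⟧ r≡0) (at0 (B ᶜ ⊛ P)))) (zeroʳ _)))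
      ... | no r≢0  = trans (triple-cong odds-a* β≡ (cong (r F.*_) 1-a*≡))
            (trans (cong₂ (λ s t → ⟦ A ⟧ x-1 * s * t) (⟦⟧-1/ B r) (mult P r _))
              (solve 4 (λ a i p c → a :* i :* (p :* c) := (a :* c) :* (i :* p)) refl (⟦ A ⟧ x-1) ((⟦ B ⟧ r) ⁻¹) (⟦ P ⟧ r) (⟦ P ⟧ (F.1# F./ x))))
        where
        1-r≢0 : 1- r ≢ F.0#
        1-r≢0 eq = r≢1 (sym (F.x-y≡0⇒x≡y eq))
        a*ᵣ : Rational 2
        a*ᵣ = (#0 ⊖ 𝟙) ⊘ #0
        z≡ : 1- (W a* F.* r) ≡ 1- r
        z≡ = F.fieldEq (x ∷ r ∷ []) (𝟙 ⊖ ((⊝ (#0 ⊗ #0) ⊘ (𝟙 ⊖ #0)) ⊗ (a*ᵣ ⊗ (𝟙 ⊖ a*ᵣ))) ⊗ #1) (𝟙 ⊖ #1)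
          (1-x≢0 ∷ x≢0 ∷ x≢0 ∷ []) [] refl
        β≡ : (1- r) F./ (r F.* (1- (W a* F.* r))) ≡ F.1# F./ r
        β≡ = trans (cong (λ z → (1- r) F./ (r F.* z)) z≡)
          (F.fieldEq (r ∷ []) ((𝟙 ⊖ #0) ⊘ (#0 ⊗ (𝟙 ⊖ #0))) (𝟙 ⊘ #0) ((r≢0 F.≢* 1-r≢0) ∷ []) (r≢0 ∷ []) refl)

    ∑-k-a* : ∑x (k a*) ≡ - (⟦ A ⟧ x-1 * ⟦ P ⟧ (F.1# F./ x))
    ∑-k-a* = begin
      ∑x (k a*)
        ≡⟨ ∑x-without F.1# (λ r → c₀ * ⟦ B ᶜ ⊛ P ⟧ r) (k a*) (triple-0₂ (0/ (F.-‿inverseʳ F.1#))) k-a* ⟩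
      ∑x (λ r → c₀ * ⟦ B ᶜ ⊛ P ⟧ r) - c₀ * ⟦ B ᶜ ⊛ P ⟧ F.1#
        ≡⟨ cong₂ _-_ (trans (∑x-* c₀ _) (cong (c₀ *_) (∑x-nontrivial (B ᶜ ⊛ P) BP≉ε))) (cong (c₀ *_) (at1 (B ᶜ ⊛ P))) ⟩
      c₀ * 0# - c₀ * 1#
        ≡⟨ solve 1 (λ c → c :* con 0ℤ :- c :* con 1ℤ := :- c) refl c₀ ⟩
      - c₀ ∎
      where
      open ≡-Reasoning
      c₀ : Carrier
      c₀ = ⟦ A ⟧ x-1 * ⟦ P ⟧ (F.1# F./ x)
      BP≉ε : ¬ (B ᶜ ⊛ P ≋ ε-char)
      BP≉ε eq = B≉P (λ y → sym (⊛ᶜ≋ε⇒≋ {P} {B} (λ y → trans (*-comm _ _) (eq y)) y))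

    -- The contributions of the pole, of `a*`, of ∞ and of v = 1/x cancel one another except for the
    -- part with δ X and the part with the indicator of x = 2.
    product-formula :
      ⟦ A ⟧ (1- x) * ∑x (λ v → ∑x (λ u → f u v)) ≡
      ∑x (λ a → ∑x (k a))
        + (q - 1#) * δ X * (⟦ A ⟧ -1F * ⟦ B ⟧ (F.1# F./ x-1) * ⟦ P ⟧ (x-1 F./ x))
        + q * [ F.1# ≡? x-1 ] * (⟦ A ⟧ x-1 * ⟦ P ⟧ (F.1# F./ x))
    product-formula = begin
      Ax * ∑x (λ v → ∑x (λ u → f u v))
        ≡⟨ double-substitution ⟩
      R - ∑x missed + (Ax * ∑x (h a*) - ∑x (k a*)) + Ax * (∑x ∞-term - ∑x (λ a → h a (x F.⁻¹)))
        ≡⟨ cong₂ (λ s t → s + Ax * t)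
             (cong₂ (λ s t → R - s + t) ∑-missed (cong₂ (λ s t → Ax * s - t) ∑-h-a* ∑-k-a*))
             (cong₂ _-_ ∑-∞-term ∑-h-1/x) ⟩
      R - - (b * pp * (s + am * P⁻))
        + (Ax * (s * pi * ([ F.1# ≡? x-1 ] * q - b - 1#)) - - (am * pi))
        + Ax * (A⁻ * b * pp * ((q - 1#) * δ X - 1# - b⁻ * b⁻ * P′) - - (A⁺ * bm * pi * s))
        ≡⟨ collect R b pp s am P⁻ Ax pi [ F.1# ≡? x-1 ] q (q - 1#) (δ X) A⁻ b⁻ P′ A⁺ bm Axs≡am AxA⁻≡s AxA⁺≡1 ppP⁻≡pi ppP′≡pi bb⁻b⁻≡bm ⟩
      R + (q - 1#) * δ X * (s * b * pp) + q * [ F.1# ≡? x-1 ] * (am * pi) ∎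
      where
      open ≡-Reasoning
      R Ax s b pp pi am P⁻ A⁻ b⁻ P′ A⁺ bm : Carrier
      R = ∑x (λ a → ∑x (k a))
      Ax = ⟦ A ⟧ (1- x)
      s = ⟦ A ⟧ -1F
      b = ⟦ B ⟧ (F.1# F./ x-1)
      pp = ⟦ P ⟧ (x-1 F./ x)
      pi = ⟦ P ⟧ (F.1# F./ x)
      am = ⟦ A ⟧ x-1
      P⁻ = (⟦ P ⟧ x-1) ⁻¹
      A⁻ = ⟦ A ⟧ (F.1# F./ x-1)
      b⁻ = b ⁻¹
      P′ = ⟦ P ⟧ (F.1# F./ x-1)
      A⁺ = ⟦ A ⟧ (F.1# F./ (1- x))
      bm = ⟦ B ⟧ x-1
      Axs≡am : Ax * s ≡ am
      Axs≡am = trans (sym (mult A (1- x) -1F)) (cong ⟦ A ⟧ (F.solve 1 (λ x → (F.con 1ℤ F.:- x) F.:* (F.:- F.con 1ℤ) F.:= x F.:- F.con 1ℤ) refl x))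
      AxA⁻≡s : Ax * A⁻ ≡ s
      AxA⁻≡s = trans (sym (mult A (1- x) _)) (cong ⟦ A ⟧ (F.fieldEq (x ∷ []) ((𝟙 ⊖ #0) ⊗ (𝟙 ⊘ (#0 ⊖ 𝟙))) (⊝ 𝟙) (x-1≢0 ∷ []) [] refl))
      AxA⁺≡1 : Ax * A⁺ ≡ 1#
      AxA⁺≡1 = trans (sym (mult A (1- x) _)) (trans (cong ⟦ A ⟧ (F.fieldEq (x ∷ []) ((𝟙 ⊖ #0) ⊗ (𝟙 ⊘ (𝟙 ⊖ #0))) 𝟙 (1-x≢0 ∷ []) [] refl)) (at1 A))
      ppP⁻≡pi : pp * P⁻ ≡ pi
      ppP⁻≡pi = trans (cong (pp *_) (sym (⟦⟧-1/ P x-1))) ppP′≡pi′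
        where
        ppP′≡pi′ : pp * P′ ≡ pi
        ppP′≡pi′ = trans (sym (mult P _ _)) (cong ⟦ P ⟧ (F.fieldEq (x ∷ []) (((#0 ⊖ 𝟙) ⊘ #0) ⊗ (𝟙 ⊘ (#0 ⊖ 𝟙))) (𝟙 ⊘ #0) (x≢0 ∷ x-1≢0 ∷ []) (x≢0 ∷ []) refl))
      ppP′≡pi : pp * P′ ≡ pi
      ppP′≡pi = trans (cong (pp *_) (⟦⟧-1/ P x-1)) ppP⁻≡pi
      bb⁻b⁻≡bm : b * (b⁻ * b⁻) ≡ bm
      bb⁻b⁻≡bm = trans (sym (*-assoc _ _ _)) (trans (cong (_* b⁻) (⁻¹-inverse b (⟦⟧≢0 B (F.1≢0 F.≢* F.⁻¹-≢0 x-1≢0))))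
        (trans (*-identityˡ _) (trans (cong _⁻¹ (⟦⟧-1/ B x-1)) (⁻¹-involutive _))))
      collect : ∀ R b pp s am P⁻ Ax pi d q r δ A⁻ b⁻ P′ A⁺ bm →
        Ax * s ≡ am → Ax * A⁻ ≡ s → Ax * A⁺ ≡ 1# → pp * P⁻ ≡ pi → pp * P′ ≡ pi → b * (b⁻ * b⁻) ≡ bm →
        R - - (b * pp * (s + am * P⁻)) + (Ax * (s * pi * (d * q - b - 1#)) - - (am * pi))
          + Ax * (A⁻ * b * pp * (r * δ - 1# - b⁻ * b⁻ * P′) - - (A⁺ * bm * pi * s)) ≡
        R + r * δ * (s * b * pp) + q * d * (am * pi)
      collect R b pp s am P⁻ Ax pi d q r δ A⁻ b⁻ P′ A⁺ bm e₁ e₂ e₃ e₄ e₅ e₆ = begin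
        R - - (b * pp * (s + am * P⁻)) + (Ax * (s * pi * (d * q - b - 1#)) - - (am * pi))
          + Ax * (A⁻ * b * pp * (r * δ - 1# - b⁻ * b⁻ * P′) - - (A⁺ * bm * pi * s))
          ≡⟨ cong₂ _+_
               (solve 10 (λ R b pp s am P⁻ Ax pi d q →
                  R :- :- (b :* pp :* (s :+ am :* P⁻)) :+ (Ax :* (s :* pi :* (d :* q :- b :- con 1ℤ)) :- :- (am :* pi)) :=
                  R :+ (b :* pp :* s :+ b :* am :* (pp :* P⁻)) :+ ((Ax :* s) :* pi :* (d :* q :- b :- con 1ℤ) :+ am :* pi))
                  refl R b pp s am P⁻ Ax pi d q)
               (solve 12 (λ Ax A⁻ b pp r δ b⁻ P′ A⁺ bm pi s →
                  Ax :* (A⁻ :* b :* pp :* (r :* δ :- con 1ℤ :- b⁻ :* b⁻ :* P′) :- :- (A⁺ :* bm :* pi :* s)) :=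
                  (Ax :* A⁻) :* (b :* pp :* (r :* δ :- con 1ℤ) :- (b :* (b⁻ :* b⁻)) :* (pp :* P′)) :+ (Ax :* A⁺) :* (bm :* (pi :* s)))
                  refl Ax A⁻ b pp r δ b⁻ P′ A⁺ bm pi s) ⟩
        (R + (b * pp * s + b * am * (pp * P⁻)) + ((Ax * s) * pi * (d * q - b - 1#) + am * pi))
          + ((Ax * A⁻) * (b * pp * (r * δ - 1#) - (b * (b⁻ * b⁻)) * (pp * P′)) + (Ax * A⁺) * (bm * (pi * s)))
          ≡⟨ cong₂ _+_ (cong₂ (λ t w → R + (b * pp * s + b * am * t) + (w * pi * (d * q - b - 1#) + am * pi)) e₄ e₁)
               (cong₂ _+_ (cong₂ (λ t w → t * (b * pp * (r * δ - 1#) - w)) e₂ (cong₂ _*_ e₆ e₅)) (cong (_* (bm * (pi * s))) e₃)) ⟩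
        (R + (b * pp * s + b * am * pi) + (am * pi * (d * q - b - 1#) + am * pi))
          + (s * (b * pp * (r * δ - 1#) - bm * pi) + 1# * (bm * (pi * s)))
          ≡⟨ solve 10 (λ R b pp s am pi d q e bm →
               (R :+ (b :* pp :* s :+ b :* am :* pi) :+ (am :* pi :* (d :* q :- b :- con 1ℤ) :+ am :* pi))
                 :+ (s :* (b :* pp :* (e :- con 1ℤ) :- bm :* pi) :+ con 1ℤ :* (bm :* (pi :* s))) :=
               R :+ e :* (s :* b :* pp) :+ q :* d :* (am :* pi)) refl R b pp s am pi d q (r * δ) bm ⟩
        R + r * δ * (s * b * pp) + q * d * (am * pi) ∎

-- Jacobi sums and integrals for the ₂F₁ series

module Hypergeometric (S : Setup) where
  open Boundary S public
  open Ops S using (binom; hyp; ₂F₁)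

  q/[q-1] : Carrier
  q/[q-1] = q / (q - 1#)

  series : (A B P : Character) → F.Carrier → Carrier
  series A B P x = ∑χ (λ χ → ⟦ χ ⟧ x * (J (A ⊛ χ) (χ ᶜ) * J (B ⊛ χ) ((P ⊛ χ) ᶜ)))

  -- The signs χ(-1) and Pχ(-1) of the two binomials multiply to P(-1) = 1, so only powers of q and
  -- q - 1 separate the two series.
  ₂F₁≡series : ∀ A B P x → ⟦ P ⟧ -1F ≡ 1# → q * (q - 1#) * ₂F₁ ⟦ A ⟧ ⟦ B ⟧ ⟦ P ⟧ x ≡ series A B P x
  ₂F₁≡series A B P x P-even = begin
    q * (q - 1#) * ₂F₁ ⟦ A ⟧ ⟦ B ⟧ ⟦ P ⟧ x
      ≡⟨ cong (λ t → q * (q - 1#) * (q/[q-1] * t)) (trans (sumL-chars _) (trans (∑χ-cong term) (∑χ-* (q ⁻¹ * q ⁻¹) _))) ⟩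
    q * (q - 1#) * (q/[q-1] * (q ⁻¹ * q ⁻¹ * series A B P x))
      ≡⟨ normalise (series A B P x) ⟩
    series A B P x ∎
    where
    open ≡-Reasoning
    normalise : ∀ s → q * (q - 1#) * (q/[q-1] * (q ⁻¹ * q ⁻¹ * s)) ≡ s
    normalise s = begin
      q * (q - 1#) * (q * (q - 1#) ⁻¹ * (q ⁻¹ * q ⁻¹ * s))
        ≡⟨ solve 5 (λ q r i j s → q :* r :* (q :* j :* (i :* i :* s)) := (q :* i) :* ((q :* i) :* ((r :* j) :* s))) refl q (q - 1#) (q ⁻¹) ((q - 1#) ⁻¹) s ⟩
      (q * q ⁻¹) * ((q * q ⁻¹) * (((q - 1#) * (q - 1#) ⁻¹) * s))
        ≡⟨ cong₂ (λ t u → t * (t * (u * s))) (⁻¹-inverse q q≢0) (⁻¹-inverse (q - 1#) q-1≢0) ⟩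
      1# * (1# * (1# * s))
        ≡⟨ trans (*-identityˡ _) (trans (*-identityˡ _) (*-identityˡ s)) ⟩
      s ∎
    term : ∀ χ → ⟦ χ ⟧ -1F / q * J (A ⊛ χ) (χ ᶜ) * (⟦ P ⊛ χ ⟧ -1F / q * J (B ⊛ χ) ((P ⊛ χ) ᶜ) * 1#) * ⟦ χ ⟧ x ≡
                 q ⁻¹ * q ⁻¹ * (⟦ χ ⟧ x * (J (A ⊛ χ) (χ ᶜ) * J (B ⊛ χ) ((P ⊛ χ) ᶜ)))
    term χ = begin
      ⟦ χ ⟧ -1F / q * j₁ * (⟦ P ⊛ χ ⟧ -1F / q * j₂ * 1#) * ⟦ χ ⟧ x
        ≡⟨ solve 6 (λ s p i j₁ j₂ c → s :* i :* j₁ :* (p :* s :* i :* j₂ :* con 1ℤ) :* c := (p :* (s :* s)) :* (i :* i :* (c :* (j₁ :* j₂))))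
             refl (⟦ χ ⟧ -1F) (⟦ P ⟧ -1F) (q ⁻¹) j₁ j₂ (⟦ χ ⟧ x) ⟩
      (⟦ P ⟧ -1F * (⟦ χ ⟧ -1F * ⟦ χ ⟧ -1F)) * (q ⁻¹ * q ⁻¹ * (⟦ χ ⟧ x * (j₁ * j₂)))
        ≡⟨ trans (cong (_* (q ⁻¹ * q ⁻¹ * (⟦ χ ⟧ x * (j₁ * j₂)))) (trans (cong₂ _*_ P-even (sign² χ)) (*-identityˡ 1#))) (*-identityˡ _) ⟩
      q ⁻¹ * q ⁻¹ * (⟦ χ ⟧ x * (j₁ * j₂)) ∎
      where
      j₁ j₂ : Carrier
      j₁ = J (A ⊛ χ) (χ ᶜ)
      j₂ = J (B ⊛ χ) ((P ⊛ χ) ᶜ)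

  private
    cancel-χ : ∀ B P χ → (B ⊛ χ) ⊛ (P ⊛ χ) ᶜ ≋ B ⊛ P ᶜ
    cancel-χ B P χ = ≋-on-units ((B ⊛ χ) ⊛ (P ⊛ χ) ᶜ) (B ⊛ P ᶜ) λ {y} y≢0 →
      fieldEq (⟦ B ⟧ y ∷ ⟦ χ ⟧ y ∷ ⟦ P ⟧ y ∷ []) ((#0 ⊗ #1) ⊘ (#2 ⊗ #1)) (#0 ⊘ #2)
        ((⟦⟧≢0 P y≢0 ≢* ⟦⟧≢0 χ y≢0) ∷ []) (⟦⟧≢0 P y≢0 ∷ []) refl

    cancel-χ₀ : ∀ A χ → (A ⊛ χ) ⊛ χ ᶜ ≋ A
    cancel-χ₀ A χ = ≋-on-units ((A ⊛ χ) ⊛ χ ᶜ) A λ {y} y≢0 →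
      fieldEq (⟦ A ⟧ y ∷ ⟦ χ ⟧ y ∷ []) ((#0 ⊗ #1) ⊘ #1) (#0) (⟦⟧≢0 χ y≢0 ∷ []) [] refl

    ᶜ-/ : ∀ B P → (B ⊛ P ᶜ) ᶜ ≋ B ᶜ ⊛ P
    ᶜ-/ B P y = trans (⁻¹-distrib-* _ _) (cong ((⟦ B ⟧ y) ⁻¹ *_) (⁻¹-involutive _))

  -- χ cancels in (Aχ)χ̄ = A, so a single condition on A excludes the correction of `G-*` for all χ.
  G-*-J₁ : ∀ A χ → ¬ (A ≋ ε-char) → G (A ⊛ χ) * G (χ ᶜ) ≡ G A * J (A ⊛ χ) (χ ᶜ)
  G-*-J₁ A χ A≉ε = trans
    (G-*-nontrivial (A ⊛ χ) (χ ᶜ) (λ eq → A≉ε (λ y → trans (sym (cancel-χ₀ A χ y)) (eq y))))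
    (cong (_* J (A ⊛ χ) (χ ᶜ)) (G-cong {(A ⊛ χ) ⊛ χ ᶜ} {A} (cancel-χ₀ A χ)))

  G-*-J₂ : ∀ B P χ → ¬ (B ≋ P) → G (B ⊛ χ) * G ((P ⊛ χ) ᶜ) ≡ G (B ⊛ P ᶜ) * J (B ⊛ χ) ((P ⊛ χ) ᶜ)
  G-*-J₂ B P χ B≉P = trans
    (G-*-nontrivial (B ⊛ χ) ((P ⊛ χ) ᶜ) (λ eq → B≉P (⊛ᶜ≋ε⇒≋ {B} {P} (λ y → trans (sym (cancel-χ B P χ y)) (eq y)))))
    (cong (_* J (B ⊛ χ) ((P ⊛ χ) ᶜ)) (G-cong {(B ⊛ χ) ⊛ (P ⊛ χ) ᶜ} {B ⊛ P ᶜ} (cancel-χ B P χ)))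

  -- In Gauss sums both series have the terms χ(x) G(Aχ) G(Bχ) G(χ̄) G(P̄χ̄), which are symmetric in
  -- A and B; only the prefactors differ.
  series-swap : ∀ A B P → ¬ (A ≋ ε-char) → ¬ (B ≋ ε-char) → ¬ (A ≋ P) → ¬ (B ≋ P) → ∀ x →
                G A * G (B ⊛ P ᶜ) * series A B P x ≡ G B * G (A ⊛ P ᶜ) * series B A P x
  series-swap A B P A≉ε B≉ε A≉P B≉P x = begin
    G A * G (B ⊛ P ᶜ) * series A B P x
      ≡⟨ trans (sym (∑χ-* _ _)) (∑χ-cong λ χ → expand {A} {B} A≉ε B≉P χ) ⟩
    ∑χ (λ χ → ⟦ χ ⟧ x * ((G (A ⊛ χ) * G (χ ᶜ)) * (G (B ⊛ χ) * G ((P ⊛ χ) ᶜ))))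
      ≡⟨ ∑χ-cong (λ χ → solve 5 (λ c a b d e → c :* ((a :* d) :* (b :* e)) := c :* ((b :* d) :* (a :* e))) refl (⟦ χ ⟧ x) (G (A ⊛ χ)) (G (B ⊛ χ)) (G (χ ᶜ)) (G ((P ⊛ χ) ᶜ))) ⟩
    ∑χ (λ χ → ⟦ χ ⟧ x * ((G (B ⊛ χ) * G (χ ᶜ)) * (G (A ⊛ χ) * G ((P ⊛ χ) ᶜ))))
      ≡⟨ sym (trans (sym (∑χ-* _ _)) (∑χ-cong λ χ → expand {B} {A} B≉ε A≉P χ)) ⟩
    G B * G (A ⊛ P ᶜ) * series B A P x ∎
    where
    open ≡-Reasoning
    expand : ∀ {A B} → ¬ (A ≋ ε-char) → ¬ (B ≋ P) → ∀ χ →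
             G A * G (B ⊛ P ᶜ) * (⟦ χ ⟧ x * (J (A ⊛ χ) (χ ᶜ) * J (B ⊛ χ) ((P ⊛ χ) ᶜ))) ≡
             ⟦ χ ⟧ x * ((G (A ⊛ χ) * G (χ ᶜ)) * (G (B ⊛ χ) * G ((P ⊛ χ) ᶜ)))
    expand {A} {B} A≉ε B≉P χ = trans
      (solve 5 (λ a b c j₁ j₂ → a :* b :* (c :* (j₁ :* j₂)) := c :* ((a :* j₁) :* (b :* j₂))) refl
        (G A) (G (B ⊛ P ᶜ)) (⟦ χ ⟧ x) (J (A ⊛ χ) (χ ᶜ)) (J (B ⊛ χ) ((P ⊛ χ) ᶜ)))
      (cong (⟦ χ ⟧ x *_) (sym (cong₂ _*_ (G-*-J₁ A χ A≉ε) (G-*-J₂ B P χ B≉P))))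

  private
    -- A Mellin transform: `J-alt` gathers all dependence on χ in the factor χ(s), which allows
    -- orthogonality to be applied to products of such sums.
    J-mellin₁ : ∀ A χ → J (A ⊛ χ) (χ ᶜ) ≡ ∑x (λ s → ⟦ χ ⟧ s * (⟦ A ⟧ s * ⟦ A ᶜ ⟧ (F.1# F.+ s)))
    J-mellin₁ A χ = trans (J-alt (A ⊛ χ) (χ ᶜ)) (∑x-cong λ s → trans
      (cong (⟦ A ⊛ χ ⟧ s *_) (cong _⁻¹ (cancel-χ₀ A χ (F.1# F.+ s))))
      (solve 3 (λ a c i → a :* c :* i := c :* (a :* i)) refl (⟦ A ⟧ s) (⟦ χ ⟧ s) (⟦ A ᶜ ⟧ (F.1# F.+ s))))

    J-mellin₂ : ∀ B P χ → J (B ⊛ χ) ((P ⊛ χ) ᶜ) ≡ ∑x (λ r → ⟦ χ ⟧ r * (⟦ B ⟧ r * ⟦ B ᶜ ⊛ P ⟧ (F.1# F.+ r)))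
    J-mellin₂ B P χ = trans (J-alt (B ⊛ χ) ((P ⊛ χ) ᶜ)) (∑x-cong λ r → trans
      (cong (⟦ B ⊛ χ ⟧ r *_) (trans (cong _⁻¹ (cancel-χ B P χ (F.1# F.+ r))) (ᶜ-/ B P (F.1# F.+ r))))
      (solve 3 (λ a c i → a :* c :* i := c :* (a :* i)) refl (⟦ B ⟧ r) (⟦ χ ⟧ r) (⟦ B ᶜ ⊛ P ⟧ (F.1# F.+ r))))

    -- Orthogonality forces s = 1 / (x r).
    convolve : ∀ {x} → x ≢ F.0# → ∀ (α β : F.Carrier → Carrier) → β F.0# ≡ 0# →
      ∑χ (λ χ → ⟦ χ ⟧ x * (∑x (λ s → ⟦ χ ⟧ s * α s) * ∑x (λ r → ⟦ χ ⟧ r * β r))) ≡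
      (q - 1#) * ∑x (λ r → β r * α ((x F.* r) F.⁻¹))
    convolve {x} x≢0 α β β0≡0 = begin
      ∑χ (λ χ → ⟦ χ ⟧ x * (∑x (λ s → ⟦ χ ⟧ s * α s) * ∑x (λ r → ⟦ χ ⟧ r * β r)))
        ≡⟨ ∑χ-cong (λ χ → trans (cong (⟦ χ ⟧ x *_) (sym (∑x-* _ _))) (trans (sym (∑x-* _ _)) (∑x-cong (λ r →
             trans (solve 4 (λ c a d b → c :* (a :* (d :* b)) := (c :* d :* b) :* a) refl (⟦ χ ⟧ x) (∑x (λ s → ⟦ χ ⟧ s * α s)) (⟦ χ ⟧ r) (β r))
               (trans (sym (∑x-* _ _)) (∑x-cong (λ s → combine χ r s))))))) ⟩
      ∑χ (λ χ → ∑x (λ r → ∑x (λ s → β r * α s * ⟦ χ ⟧ (x F.* r F.* s))))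
        ≡⟨ trans (∑χx-swap _) (∑x-cong (λ r → ∑χx-swap _)) ⟩
      ∑x (λ r → ∑x (λ s → ∑χ (λ χ → β r * α s * ⟦ χ ⟧ (x F.* r F.* s))))
        ≡⟨ ∑x-cong (λ r → ∑x-cong (λ s → trans (∑χ-* _ _) (cong (β r * α s *_) (∑χ-at _)))) ⟩
      ∑x (λ r → ∑x (λ s → β r * α s * ([ F.1# ≡? x F.* r F.* s ] * (q - 1#))))
        ≡⟨ ∑x-cong collapse ⟩
      ∑x (λ r → (q - 1#) * (β r * α ((x F.* r) F.⁻¹)))
        ≡⟨ ∑x-* _ _ ⟩
      (q - 1#) * ∑x (λ r → β r * α ((x F.* r) F.⁻¹)) ∎
      where
      open ≡-Reasoning
      combine : ∀ χ r s → ⟦ χ ⟧ x * ⟦ χ ⟧ r * β r * (⟦ χ ⟧ s * α s) ≡ β r * α s * ⟦ χ ⟧ (x F.* r F.* s)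
      combine χ r s = trans
        (solve 5 (λ c d b e a → c :* d :* b :* (e :* a) := b :* a :* (c :* d :* e)) refl (⟦ χ ⟧ x) (⟦ χ ⟧ r) (β r) (⟦ χ ⟧ s) (α s))
        (cong (β r * α s *_) (sym (trans (mult χ _ s) (cong (_* ⟦ χ ⟧ s) (mult χ x r)))))
      collapse : ∀ r → ∑x (λ s → β r * α s * ([ F.1# ≡? x F.* r F.* s ] * (q - 1#))) ≡ (q - 1#) * (β r * α ((x F.* r) F.⁻¹))
      collapse r with r F.≟ F.0#
      -- At r = 0 no s solves xrs = 1, while the right side evaluates α at 0⁻¹ = 0; β(0) = 0 makes
      -- both sides vanish.
      ... | yes refl = trans (trans (∑x-cong (λ s → trans (cong (λ t → t * α s * _) β0≡0) (solve 3 (λ a d q → con 0ℤ :* a :* (d :* q) := con 0ℤ) refl (α s) [ F.1# ≡? x F.* F.0# F.* s ] (q - 1#)))) (sumL-0 elems))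
                             (sym (trans (cong (λ t → (q - 1#) * (t * α ((x F.* F.0#) F.⁻¹))) β0≡0) (solve 2 (λ q a → q :* (con 0ℤ :* a) := con 0ℤ) refl (q - 1#) (α ((x F.* F.0#) F.⁻¹)))))
      ... | no r≢0 = begin
        ∑x (λ s → β r * α s * ([ F.1# ≡? x F.* r F.* s ] * (q - 1#)))
          ≡⟨ ∑x-cong (λ s → trans (cong (λ d → β r * α s * (d * (q - 1#)))
               ([ F.1# F.≟ (x F.* r F.* s) ]-cong (((x F.* r) F.⁻¹) F.≟ s) (λ eq → sym (F.⁻¹-unique (sym eq))) (λ { refl → sym (F.⁻¹-inverse _ (x≢0 F.≢* r≢0)) })))
               (solve 4 (λ b a d q → b :* a :* (d :* q) := d :* (q :* (b :* a))) refl (β r) (α s) [ (x F.* r) F.⁻¹ ≡? s ] (q - 1#))) ⟩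
        ∑x (λ s → [ (x F.* r) F.⁻¹ ≡? s ] * ((q - 1#) * (β r * α s)))
          ≡⟨ ∑x-[] _ (λ s → (q - 1#) * (β r * α s)) ⟩
        (q - 1#) * (β r * α ((x F.* r) F.⁻¹)) ∎

  -- Greene's integral representation of ₂F₁.
  series≡integral : ∀ A B P {x} → x ≢ F.0# →
    series A B P x ≡ (q - 1#) * (⟦ B ⟧ -1F * ∑x (λ v → ⟦ B ⟧ v * ⟦ B ᶜ ⊛ P ⟧ (1- v) * ⟦ A ᶜ ⟧ (1- (x F.* v))))
  series≡integral A B P {x} x≢0 = begin
    series A B P x
      ≡⟨ ∑χ-cong (λ χ → cong (⟦ χ ⟧ x *_) (cong₂ _*_ (J-mellin₁ A χ) (J-mellin₂ B P χ))) ⟩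
    ∑χ (λ χ → ⟦ χ ⟧ x * (∑x (λ s → ⟦ χ ⟧ s * α s) * ∑x (λ r → ⟦ χ ⟧ r * β r)))
      ≡⟨ convolve x≢0 α β (trans (cong (_* ⟦ B ᶜ ⊛ P ⟧ (F.1# F.+ F.0#)) (at0 B)) (zeroˡ _)) ⟩
    (q - 1#) * ∑x (λ r → β r * α ((x F.* r) F.⁻¹))
      ≡⟨ cong ((q - 1#) *_) (trans (sym (∑x-scale -1≢0 (λ r → β r * α ((x F.* r) F.⁻¹)))) (trans (∑x-cong reflected) (∑x-* _ _))) ⟩
    (q - 1#) * (⟦ B ⟧ -1F * ∑x (λ v → ⟦ B ⟧ v * ⟦ B ᶜ ⊛ P ⟧ (1- v) * ⟦ A ᶜ ⟧ (1- (x F.* v)))) ∎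
    where
    open ≡-Reasoning
    α β : F.Carrier → Carrier
    α s = ⟦ A ⟧ s * ⟦ A ᶜ ⟧ (F.1# F.+ s)
    β r = ⟦ B ⟧ r * ⟦ B ᶜ ⊛ P ⟧ (F.1# F.+ r)
    α-inverse : ∀ {t} → t ≢ F.0# → α (t F.⁻¹) ≡ ⟦ A ᶜ ⟧ (F.1# F.+ t)
    α-inverse {t} t≢0 = begin
      ⟦ A ⟧ (t F.⁻¹) * ⟦ A ᶜ ⟧ (F.1# F.+ t F.⁻¹)
        ≡⟨ cong₂ _*_ (⟦⟧-⁻¹ A t) (trans (cong ⟦ A ᶜ ⟧ 1+t⁻¹) (⟦⟧-/ (A ᶜ) (F.1# F.+ t) t)) ⟩
      (⟦ A ⟧ t) ⁻¹ * (⟦ A ᶜ ⟧ (F.1# F.+ t) * (⟦ A ᶜ ⟧ t) ⁻¹)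
        ≡⟨ solve 3 (λ i b j → i :* (b :* j) := (i :* j) :* b) refl ((⟦ A ⟧ t) ⁻¹) (⟦ A ᶜ ⟧ (F.1# F.+ t)) ((⟦ A ᶜ ⟧ t) ⁻¹) ⟩
      ((⟦ A ⟧ t) ⁻¹ * (⟦ A ᶜ ⟧ t) ⁻¹) * ⟦ A ᶜ ⟧ (F.1# F.+ t)
        ≡⟨ trans (cong (_* ⟦ A ᶜ ⟧ (F.1# F.+ t)) (⁻¹-inverse _ (⁻¹-≢0 (⟦⟧≢0 A t≢0)))) (*-identityˡ _) ⟩
      ⟦ A ᶜ ⟧ (F.1# F.+ t) ∎
      where
      1+t⁻¹ : F.1# F.+ t F.⁻¹ ≡ (F.1# F.+ t) F./ t
      1+t⁻¹ = trans (cong (F.1# F.+_) (sym (F.*-identityˡ _))) (F.fieldEq (t ∷ []) (𝟙 ⊕ 𝟙 ⊘ #0) ((𝟙 ⊕ #0) ⊘ #0) (t≢0 ∷ []) (t≢0 ∷ []) refl)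
    reflected : ∀ v → β (-1F F.* v) * α ((x F.* (-1F F.* v)) F.⁻¹) ≡ ⟦ B ⟧ -1F * (⟦ B ⟧ v * ⟦ B ᶜ ⊛ P ⟧ (1- v) * ⟦ A ᶜ ⟧ (1- (x F.* v)))
    reflected v with v F.≟ F.0#
    ... | yes refl = trans (cong (_* α ((x F.* (-1F F.* F.0#)) F.⁻¹)) (trans (cong (_* ⟦ B ᶜ ⊛ P ⟧ (F.1# F.+ -1F F.* F.0#)) (trans (cong ⟦ B ⟧ (F.zeroʳ -1F)) (at0 B))) (zeroˡ _))) (trans (zeroˡ _)
            (sym (trans (cong (λ t → ⟦ B ⟧ -1F * (t * ⟦ B ᶜ ⊛ P ⟧ (1- F.0#) * ⟦ A ᶜ ⟧ (1- (x F.* F.0#)))) (at0 B))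
              (solve 3 (λ a b c → a :* (con 0ℤ :* b :* c) := con 0ℤ) refl (⟦ B ⟧ -1F) (⟦ B ᶜ ⊛ P ⟧ (1- F.0#)) (⟦ A ᶜ ⟧ (1- (x F.* F.0#)))))))
    ... | no v≢0 = trans (cong₂ _*_ (cong₂ _*_ (mult B -1F v) (cong ⟦ B ᶜ ⊛ P ⟧ (F.solve 1 (λ v → F.con 1ℤ F.:+ (F.:- F.con 1ℤ) F.:* v F.:= F.con 1ℤ F.:- v) refl v)))
                     (trans (α-inverse (x≢0 F.≢* (-1≢0 F.≢* v≢0))) (cong ⟦ A ᶜ ⟧ (F.solve 2 (λ x v → F.con 1ℤ F.:+ x F.:* ((F.:- F.con 1ℤ) F.:* v) F.:= F.con 1ℤ F.:- x F.:* v) refl x v))))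
                   (solve 4 (λ s b p a → s :* b :* p :* a := s :* (b :* p :* a)) refl (⟦ B ⟧ -1F) (⟦ B ⟧ v) (⟦ B ᶜ ⊛ P ⟧ (1- v)) (⟦ A ᶜ ⟧ (1- (x F.* v))))

-- The two double sums to be compared

module Clausen (S : Setup) where
  open Hypergeometric S public
  open Ops S using (₂F₁)

  module _ (A B C : Character) where
    P A′ B′ : Character
    P = C ⊛ C
    A′ = A ᶜ ⊛ C ⊛ C
    B′ = B ᶜ ⊛ C ⊛ C

    P-even : ⟦ P ⟧ -1F ≡ 1#
    P-even = sign² C

    -- `G A` and `G (B ⊛ P ᶜ)` are the prefactor of `series-swap`. The other two factors turn the
    -- Gauss sums G(B) and G(AP̄) left by the swap into B(-1)q and A(-1)q.
    N : Carrier
    N = G A * G (B ᶜ) * G A′ * G (B ⊛ P ᶜ)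

    private
      A-P⊛A′ : (A ⊛ P ᶜ) ⊛ A′ ≋ ε-char
      A-P⊛A′ = ≋-on-units ((A ⊛ P ᶜ) ⊛ A′) ε-char λ {y} y≢0 → trans
        (fieldEq (⟦ A ⟧ y ∷ ⟦ C ⟧ y ∷ []) ((#0 ⊗ ⅟ (#1 ⊗ #1)) ⊗ (⅟ #0 ⊗ #1 ⊗ #1)) 𝟙
          ((⟦⟧≢0 C y≢0 ≢* ⟦⟧≢0 C y≢0) ∷ ⟦⟧≢0 A y≢0 ∷ []) [] refl)
        (sym (ε≡1 y≢0))

      [P-B]ᶜ⊛P : (P ⊛ B ᶜ) ᶜ ⊛ P ≋ B
      [P-B]ᶜ⊛P = ≋-on-units ((P ⊛ B ᶜ) ᶜ ⊛ P) B λ {y} y≢0 →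
        fieldEq (⟦ B ⟧ y ∷ ⟦ P ⟧ y ∷ []) (⅟ (#1 ⊗ ⅟ #0) ⊗ #1) (#0)
          ((⟦⟧≢0 P y≢0 ≢* ⁻¹-≢0 (⟦⟧≢0 B y≢0)) ∷ ⟦⟧≢0 B y≢0 ∷ []) [] refl

      B′ᶜ⊛P : B′ ᶜ ⊛ P ≋ B
      B′ᶜ⊛P = ≋-on-units (B′ ᶜ ⊛ P) B λ {y} y≢0 →
        fieldEq (⟦ B ⟧ y ∷ ⟦ C ⟧ y ∷ []) (⅟ (⅟ #0 ⊗ #1 ⊗ #1) ⊗ (#1 ⊗ #1)) (#0)
          (((⁻¹-≢0 (⟦⟧≢0 B y≢0) ≢* ⟦⟧≢0 C y≢0) ≢* ⟦⟧≢0 C y≢0) ∷ ⟦⟧≢0 B y≢0 ∷ []) [] refl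

      B′-sign : ⟦ B′ ⟧ -1F ≡ ⟦ B ⟧ -1F
      B′-sign = trans (*-assoc _ _ _) (trans (cong₂ _*_ (sign-⁻¹ B) P-even) (*-identityʳ _))

      P-B-sign : ⟦ P ⊛ B ᶜ ⟧ -1F ≡ ⟦ B ⟧ -1F
      P-B-sign = trans (cong₂ _*_ P-even (sign-⁻¹ B)) (*-identityˡ _)

    module _ {x : F.Carrier} (x≢0 : x ≢ F.0#) (x≢1 : x ≢ F.1#) where
      open Substitution A B P x≢0 x≢1 using (f; k; W)

      w : F.Carrier
      w = F.- (x F.* x) F./ (1- x)

      private
        integral-product :
          ∑x (λ u → ⟦ A ⟧ u * ⟦ A ᶜ ⊛ P ⟧ (1- u) * ⟦ B ᶜ ⟧ (1- (x F.* u))) *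
          ∑x (λ v → ⟦ P ⊛ B ᶜ ⟧ v * ⟦ (P ⊛ B ᶜ) ᶜ ⊛ P ⟧ (1- v) * ⟦ A ᶜ ⟧ (1- (x F.* v))) ≡
          ∑x (λ v → ∑x (λ u → f u v))
        integral-product = trans (sym (∑x-* _ _)) (∑x-cong λ v → trans (sym (∑x-*ʳ _ _)) (∑x-cong λ u → pointwise u v))
          where
          open ≡-Reasoning
          pointwise : ∀ u v →
            (⟦ A ⟧ u * ⟦ A ᶜ ⊛ P ⟧ (1- u) * ⟦ B ᶜ ⟧ (1- (x F.* u))) *
            (⟦ P ⊛ B ᶜ ⟧ v * ⟦ (P ⊛ B ᶜ) ᶜ ⊛ P ⟧ (1- v) * ⟦ A ᶜ ⟧ (1- (x F.* v))) ≡ f u v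
          pointwise u v = begin
            (⟦ A ⟧ u * ((⟦ A ⟧ (1- u)) ⁻¹ * ⟦ P ⟧ (1- u)) * (⟦ B ⟧ (1- (x F.* u))) ⁻¹) *
            (⟦ P ⟧ v * (⟦ B ⟧ v) ⁻¹ * ⟦ (P ⊛ B ᶜ) ᶜ ⊛ P ⟧ (1- v) * (⟦ A ⟧ (1- (x F.* v))) ⁻¹)
              ≡⟨ cong (λ t → (⟦ A ⟧ u * ((⟦ A ⟧ (1- u)) ⁻¹ * ⟦ P ⟧ (1- u)) * (⟦ B ⟧ (1- (x F.* u))) ⁻¹) *
                   (⟦ P ⟧ v * (⟦ B ⟧ v) ⁻¹ * t * (⟦ A ⟧ (1- (x F.* v))) ⁻¹)) ([P-B]ᶜ⊛P (1- v)) ⟩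
            (⟦ A ⟧ u * ((⟦ A ⟧ (1- u)) ⁻¹ * ⟦ P ⟧ (1- u)) * (⟦ B ⟧ (1- (x F.* u))) ⁻¹) *
            (⟦ P ⟧ v * (⟦ B ⟧ v) ⁻¹ * ⟦ B ⟧ (1- v) * (⟦ A ⟧ (1- (x F.* v))) ⁻¹)
              ≡⟨ solve 8 (λ a i p b p′ j b′ l → (a :* (i :* p) :* b) :* (p′ :* j :* b′ :* l) := a :* (i :* l) :* (b′ :* (j :* b)) :* (p :* p′)) refl
                   (⟦ A ⟧ u) ((⟦ A ⟧ (1- u)) ⁻¹) (⟦ P ⟧ (1- u)) ((⟦ B ⟧ (1- (x F.* u))) ⁻¹) (⟦ P ⟧ v) ((⟦ B ⟧ v) ⁻¹) (⟦ B ⟧ (1- v)) ((⟦ A ⟧ (1- (x F.* v))) ⁻¹) ⟩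
            ⟦ A ⟧ u * ((⟦ A ⟧ (1- u)) ⁻¹ * (⟦ A ⟧ (1- (x F.* v))) ⁻¹) * (⟦ B ⟧ (1- v) * ((⟦ B ⟧ v) ⁻¹ * (⟦ B ⟧ (1- (x F.* u))) ⁻¹)) * (⟦ P ⟧ (1- u) * ⟦ P ⟧ v)
              ≡⟨ sym (cong₂ _*_ (cong₂ _*_ (⟦⟧-/* A u (1- u) (1- (x F.* v))) (⟦⟧-/* B (1- v) v (1- (x F.* u)))) (mult P (1- u) v)) ⟩
            f u v ∎
            where
            ⟦⟧-/* : ∀ A a b c → ⟦ A ⟧ (a F./ (b F.* c)) ≡ ⟦ A ⟧ a * ((⟦ A ⟧ b) ⁻¹ * (⟦ A ⟧ c) ⁻¹)
            ⟦⟧-/* A a b c = trans (⟦⟧-/ A a (b F.* c)) (cong (⟦ A ⟧ a *_) (trans (cong _⁻¹ (mult A b c)) (⁻¹-distrib-* _ _)))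

      -- The upper parameters are exchanged in the first factor only; this gives A the argument
      -- u/((1-u)(1-xv)), to which the first Möbius substitution is adapted.
      N*₂F₁*₂F₁ : ¬ (A ≋ ε-char) → ¬ (B ≋ ε-char) → ¬ (A ≋ P) → ¬ (B ≋ P) →
        N * (₂F₁ ⟦ A ⟧ ⟦ B ⟧ ⟦ P ⟧ x * ₂F₁ ⟦ A ⟧ ⟦ P ⊛ B ᶜ ⟧ ⟦ P ⟧ x) ≡ ∑x (λ v → ∑x (λ u → f u v))
      N*₂F₁*₂F₁ A≉ε B≉ε A≉P B≉P = trans
        (assemble Q≢0 (₂F₁≡series A B P x P-even) (₂F₁≡series A (P ⊛ B ᶜ) P x P-even)
          (series-swap A B P A≉ε B≉ε A≉P B≉P x) (series≡integral B A P x≢0) (series≡integral A (P ⊛ B ᶜ) P x≢0)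
          P-B-sign
          (G-inverse-nontrivial B (B ᶜ) B≉ε (⊛ᶜ≋ε B))
          (trans (G-inverse-nontrivial (A ⊛ P ᶜ) A′ (λ eq → A≉P (⊛ᶜ≋ε⇒≋ {A} {P} eq)) A-P⊛A′)
                 (cong (_* q) (trans (cong (⟦ A ⟧ -1F *_) (trans (cong _⁻¹ P-even) 1⁻¹)) (*-identityʳ _))))
          (sign² A) (sign² B))
        integral-product
        where
        open ≡-Reasoning
        Q≢0 : q * (q - 1#) ≢ 0#
        Q≢0 = q≢0 ≢* q-1≢0
        assemble : ∀ {f₁ f₂ s₁ s₂ s₃ Φ₁ Φ₂ ga gb′ ga′ gbp gb gap α β β′ r} → q * r ≢ 0# →
          q * r * f₁ ≡ s₁ → q * r * f₂ ≡ s₂ → ga * gbp * s₁ ≡ gb * gap * s₃ →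
          s₃ ≡ r * (α * Φ₁) → s₂ ≡ r * (β′ * Φ₂) → β′ ≡ β →
          gb * gb′ ≡ β * q → gap * ga′ ≡ α * q → α * α ≡ 1# → β * β ≡ 1# →
          ga * gb′ * ga′ * gbp * (f₁ * f₂) ≡ Φ₁ * Φ₂
        assemble {f₁} {f₂} {s₁} {s₂} {s₃} {Φ₁} {Φ₂} {ga} {gb′} {ga′} {gbp} {gb} {gap} {α} {β} {_} {r} n e₁ e₂ e₃ e₄ e₅ refl e₇ e₈ e₉ e₁₀ =
          *-cancelˡ n (*-cancelˡ n (begin
          q * r * (q * r * (ga * gb′ * ga′ * gbp * (f₁ * f₂)))
            ≡⟨ solve 7 (λ Q ga gb′ ga′ gbp f₁ f₂ → Q :* (Q :* (ga :* gb′ :* ga′ :* gbp :* (f₁ :* f₂))) := ga :* gbp :* (Q :* f₁) :* (gb′ :* ga′ :* (Q :* f₂)))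
                 refl (q * r) ga gb′ ga′ gbp f₁ f₂ ⟩
          ga * gbp * (q * r * f₁) * (gb′ * ga′ * (q * r * f₂))
            ≡⟨ cong₂ _*_ (trans (cong (ga * gbp *_) e₁) (trans e₃ (cong (gb * gap *_) e₄))) (cong (gb′ * ga′ *_) (trans e₂ e₅)) ⟩
          gb * gap * (r * (α * Φ₁)) * (gb′ * ga′ * (r * (β * Φ₂)))
            ≡⟨ solve 9 (λ gb gap r α Φ₁ gb′ ga′ β Φ₂ → gb :* gap :* (r :* (α :* Φ₁)) :* (gb′ :* ga′ :* (r :* (β :* Φ₂))) :=
                 (gb :* gb′) :* (gap :* ga′) :* (r :* r :* α :* β :* (Φ₁ :* Φ₂))) refl gb gap r α Φ₁ gb′ ga′ β Φ₂ ⟩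
          (gb * gb′) * (gap * ga′) * (r * r * α * β * (Φ₁ * Φ₂))
            ≡⟨ cong₂ (λ s t → s * t * (r * r * α * β * (Φ₁ * Φ₂))) e₇ e₈ ⟩
          (β * q) * (α * q) * (r * r * α * β * (Φ₁ * Φ₂))
            ≡⟨ solve 5 (λ β α q r p → (β :* q) :* (α :* q) :* (r :* r :* α :* β :* p) := (α :* α) :* (β :* β) :* (q :* r :* (q :* r :* p))) refl β α q r (Φ₁ * Φ₂) ⟩
          (α * α) * (β * β) * (q * r * (q * r * (Φ₁ * Φ₂)))
            ≡⟨ trans (cong₂ (λ s t → s * t * (q * r * (q * r * (Φ₁ * Φ₂)))) e₉ e₁₀) (trans (cong (_* (q * r * (q * r * (Φ₁ * Φ₂)))) (*-identityˡ 1#)) (*-identityˡ _)) ⟩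
          q * r * (q * r * (Φ₁ * Φ₂)) ∎))

      triple-series : Carrier
      triple-series = ∑χ (λ χ → ⟦ χ ⟧ w * (J (A ⊛ χ) (A′ ⊛ χ) * (J (B ⊛ χ) (χ ᶜ) * J (B′ ⊛ χ) ((P ⊛ χ) ᶜ))))

      -- Writing out J(Aχ, A′χ) as a sum over a attaches χ(a(1-a)) to χ(w). What remains for each a
      -- is a ₂F₁ series at W a, to which the integral representation applies.
      triple-series≡ : triple-series ≡ (q - 1#) * (⟦ B ⟧ -1F * ∑x (λ a → ∑x (k a)))
      triple-series≡ = begin
        triple-series
          ≡⟨ ∑χ-cong (λ χ → trans (cong (⟦ χ ⟧ w *_) (sym (∑x-*ʳ _ _))) (trans (sym (∑x-* _ _)) (∑x-cong (λ a → gather χ a)))) ⟩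
        ∑χ (λ χ → ∑x (λ a → ⟦ A ⟧ a * ⟦ A′ ⟧ (1- a) * (⟦ χ ⟧ (W a) * (J (B ⊛ χ) (χ ᶜ) * J (B′ ⊛ χ) ((P ⊛ χ) ᶜ)))))
          ≡⟨ trans (∑χx-swap _) (∑x-cong (λ a → ∑χ-* _ _)) ⟩
        ∑x (λ a → ⟦ A ⟧ a * ⟦ A′ ⟧ (1- a) * series B B′ P (W a))
          ≡⟨ ∑x-cong inner ⟩
        ∑x (λ a → (q - 1#) * ⟦ B ⟧ -1F * ∑x (k a))
          ≡⟨ trans (∑x-* _ _) (*-assoc _ _ _) ⟩
        (q - 1#) * (⟦ B ⟧ -1F * ∑x (λ a → ∑x (k a))) ∎
        where
        open ≡-Reasoning
        gather : ∀ χ a → ⟦ χ ⟧ w * (⟦ A ⊛ χ ⟧ a * ⟦ A′ ⊛ χ ⟧ (1- a) * (J (B ⊛ χ) (χ ᶜ) * J (B′ ⊛ χ) ((P ⊛ χ) ᶜ))) ≡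
                 ⟦ A ⟧ a * ⟦ A′ ⟧ (1- a) * (⟦ χ ⟧ (W a) * (J (B ⊛ χ) (χ ᶜ) * J (B′ ⊛ χ) ((P ⊛ χ) ᶜ)))
        gather χ a = trans
          (solve 6 (λ c a d a′ e j → c :* ((a :* d) :* (a′ :* e) :* j) := a :* a′ :* (c :* (d :* e) :* j)) refl
            (⟦ χ ⟧ w) (⟦ A ⟧ a) (⟦ χ ⟧ a) (⟦ A′ ⟧ (1- a)) (⟦ χ ⟧ (1- a)) (J (B ⊛ χ) (χ ᶜ) * J (B′ ⊛ χ) ((P ⊛ χ) ᶜ)))
          (cong (λ t → ⟦ A ⟧ a * ⟦ A′ ⟧ (1- a) * (t * (J (B ⊛ χ) (χ ᶜ) * J (B′ ⊛ χ) ((P ⊛ χ) ᶜ))))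
            (sym (trans (mult χ w _) (cong (⟦ χ ⟧ w *_) (mult χ a (1- a))))))
        w≢0 : w ≢ F.0#
        w≢0 = F.-≢0 (x≢0 F.≢* x≢0) F.≢* F.⁻¹-≢0 (λ eq → x≢1 (sym (F.x-y≡0⇒x≡y eq)))
        k≡ : ∀ a r → ⟦ A ⟧ a * ⟦ A′ ⟧ (1- a) * (⟦ B′ ⟧ r * ⟦ B′ ᶜ ⊛ P ⟧ (1- r) * ⟦ B ᶜ ⟧ (1- (W a F.* r))) ≡ k a r
        k≡ a r = begin
          ⟦ A ⟧ a * ⟦ A′ ⟧ (1- a) * (⟦ B′ ⟧ r * ⟦ B′ ᶜ ⊛ P ⟧ (1- r) * ⟦ B ᶜ ⟧ (1- (W a F.* r)))
            ≡⟨ cong (λ t → ⟦ A ⟧ a * ⟦ A′ ⟧ (1- a) * (⟦ B′ ⟧ r * t * ⟦ B ᶜ ⟧ (1- (W a F.* r)))) (B′ᶜ⊛P (1- r)) ⟩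
          ⟦ A ⟧ a * ((⟦ A ⟧ (1- a)) ⁻¹ * ⟦ C ⟧ (1- a) * ⟦ C ⟧ (1- a)) * ((⟦ B ⟧ r) ⁻¹ * ⟦ C ⟧ r * ⟦ C ⟧ r * ⟦ B ⟧ (1- r) * (⟦ B ⟧ (1- (W a F.* r))) ⁻¹)
            ≡⟨ solve 7 (λ a i c j d b l → a :* (i :* c :* c) :* (j :* d :* d :* b :* l) := (a :* i) :* (b :* (j :* l)) :* ((d :* d) :* (c :* c))) refl
                 (⟦ A ⟧ a) ((⟦ A ⟧ (1- a)) ⁻¹) (⟦ C ⟧ (1- a)) ((⟦ B ⟧ r) ⁻¹) (⟦ C ⟧ r) (⟦ B ⟧ (1- r)) ((⟦ B ⟧ (1- (W a F.* r))) ⁻¹) ⟩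
          (⟦ A ⟧ a / ⟦ A ⟧ (1- a)) * (⟦ B ⟧ (1- r) * ((⟦ B ⟧ r) ⁻¹ * (⟦ B ⟧ (1- (W a F.* r))) ⁻¹)) * (⟦ P ⟧ r * ⟦ P ⟧ (1- a))
            ≡⟨ sym (cong₂ _*_ (cong₂ _*_ (⟦⟧-/ A a (1- a)) (trans (⟦⟧-/ B (1- r) _) (cong (⟦ B ⟧ (1- r) *_) (trans (cong _⁻¹ (mult B r _)) (⁻¹-distrib-* _ _))))) (mult P r (1- a))) ⟩
          k a r ∎
        vanishing : ∀ a → a F.* (1- a) ≡ F.0# → ⟦ A ⟧ a * ⟦ A′ ⟧ (1- a) ≡ 0#
        vanishing a eq with F.x*y≡0 eq
        ... | inj₁ a≡0   = trans (cong (_* ⟦ A′ ⟧ (1- a)) (trans (cong ⟦ A ⟧ a≡0) (at0 A))) (zeroˡ _)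
        ... | inj₂ 1-a≡0 = trans (cong (⟦ A ⟧ a *_) (trans (cong ⟦ A′ ⟧ 1-a≡0) (at0 A′))) (zeroʳ _)
        ∑-k : ∀ a → ∑x (k a) ≡ ⟦ A ⟧ a * ⟦ A′ ⟧ (1- a) * ∑x (λ r → ⟦ B′ ⟧ r * ⟦ B′ ᶜ ⊛ P ⟧ (1- r) * ⟦ B ᶜ ⟧ (1- (W a F.* r)))
        ∑-k a = trans (∑x-cong (λ r → sym (k≡ a r))) (∑x-* _ _)
        inner : ∀ a → ⟦ A ⟧ a * ⟦ A′ ⟧ (1- a) * series B B′ P (W a) ≡ (q - 1#) * ⟦ B ⟧ -1F * ∑x (k a)
        inner a with (a F.* (1- a)) F.≟ F.0#
        -- Here W a = 0, outside the range of the integral representation, but the weight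
        -- A(a)A′(1-a) annihilates both sides.
        ... | yes eq = trans (trans (cong (_* series B B′ P (W a)) (vanishing a eq)) (zeroˡ _))
                (sym (trans (cong ((q - 1#) * ⟦ B ⟧ -1F *_) (trans (∑-k a) (trans (cong (_* ∑x (λ r → ⟦ B′ ⟧ r * ⟦ B′ ᶜ ⊛ P ⟧ (1- r) * ⟦ B ᶜ ⟧ (1- (W a F.* r)))) (vanishing a eq)) (zeroˡ _)))) (zeroʳ _)))
        ... | no n = begin
          ⟦ A ⟧ a * ⟦ A′ ⟧ (1- a) * series B B′ P (W a)
            ≡⟨ cong (⟦ A ⟧ a * ⟦ A′ ⟧ (1- a) *_) (trans (series≡integral B B′ P (w≢0 F.≢* n)) (cong (λ t → (q - 1#) * (t * Φ)) B′-sign)) ⟩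
          ⟦ A ⟧ a * ⟦ A′ ⟧ (1- a) * ((q - 1#) * (⟦ B ⟧ -1F * Φ))
            ≡⟨ solve 4 (λ a r b p → a :* (r :* (b :* p)) := r :* b :* (a :* p)) refl (⟦ A ⟧ a * ⟦ A′ ⟧ (1- a)) (q - 1#) (⟦ B ⟧ -1F) Φ ⟩
          (q - 1#) * ⟦ B ⟧ -1F * (⟦ A ⟧ a * ⟦ A′ ⟧ (1- a) * Φ)
            ≡⟨ cong ((q - 1#) * ⟦ B ⟧ -1F *_) (sym (∑-k a)) ⟩
          (q - 1#) * ⟦ B ⟧ -1F * ∑x (k a) ∎
          where
          Φ : Carrier
          Φ = ∑x (λ r → ⟦ B′ ⟧ r * ⟦ B′ ᶜ ⊛ P ⟧ (1- r) * ⟦ B ᶜ ⟧ (1- (W a F.* r)))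

-- The series of Gauss sums and its exceptional term

module GaussSeries (S : Setup) where
  open Clausen S public
  open QuadraticCharacter S public
    using (𝟜; 𝟜≢0; φ-char; φᶜ≋φ; φ²≋ε; ∑x-φ; order-two; G-duplication; φ-*)
  open Ops S using (binom; φ)

  -- For XY ≠ ε the sums G(XY) and G(Z) multiply to q. For XY = ε also Z = ε, and comparing
  -- `G-inverse` with `J-inverse` leaves a defect only if X and Y are both trivial.
  G-*-* : ∀ X Y Z → (X ⊛ Y) ⊛ Z ≋ ε-char → ⟦ X ⊛ Y ⟧ -1F ≡ 1# →
          G X * G Y * G Z ≡ q * J X Y - (q - 1#) * (q - 1#) * (δ (X ⊛ Y) * δ X)
  G-*-* X Y Z XYZ≋ε even with (X ⊛ Y) ≋? ε-char
  ... | yes XY≋ε = begin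
    G X * G Y * G Z
      ≡⟨ cong₂ _*_ (G-inverse X Y XY≋ε) (trans (G-cong {Z} {ε-char} Z≋ε) G-ε) ⟩
    (⟦ X ⟧ -1F * q - (q - 1#) * δ X) * - 1#
      ≡⟨ solve 3 (λ s q d → (s :* q :- (q :- con 1ℤ) :* d) :* (:- con 1ℤ) :=
           q :* ((q :- con 1ℤ) :* d :- s) :- (q :- con 1ℤ) :* (q :- con 1ℤ) :* (con 1ℤ :* d)) refl (⟦ X ⟧ -1F) q (δ X) ⟩
    q * ((q - 1#) * δ X - ⟦ X ⟧ -1F) - (q - 1#) * (q - 1#) * (1# * δ X)
      ≡⟨ sym (cong₂ (λ j d → q * j - (q - 1#) * (q - 1#) * (d * δ X)) (J-inverse X Y XY≋ε) (δ-yes (X ⊛ Y) XY≋ε)) ⟩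
    q * J X Y - (q - 1#) * (q - 1#) * (δ (X ⊛ Y) * δ X) ∎
    where
    open ≡-Reasoning
    Z≋ε : Z ≋ ε-char
    Z≋ε y = trans (sym (ε⊛ Z y)) (trans (cong (_* ⟦ Z ⟧ y) (sym (XY≋ε y))) (XYZ≋ε y))
  ... | no XY≉ε = begin
    G X * G Y * G Z
      ≡⟨ cong (_* G Z) (G-*-nontrivial X Y XY≉ε) ⟩
    G (X ⊛ Y) * J X Y * G Z
      ≡⟨ solve 3 (λ g j z → g :* j :* z := (g :* z) :* j) refl (G (X ⊛ Y)) (J X Y) (G Z) ⟩
    G (X ⊛ Y) * G Z * J X Y
      ≡⟨ cong (_* J X Y) (trans (G-inverse-nontrivial (X ⊛ Y) Z XY≉ε XYZ≋ε) (trans (cong (_* q) even) (*-identityˡ q))) ⟩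
    q * J X Y
      ≡⟨ solve 3 (λ a r d → a := a :- r :* r :* (con 0ℤ :* d)) refl (q * J X Y) (q - 1#) (δ X) ⟩
    q * J X Y - (q - 1#) * (q - 1#) * (0# * δ X)
      ≡⟨ cong (λ d → q * J X Y - (q - 1#) * (q - 1#) * (d * δ X)) (sym (δ-no (X ⊛ Y) XY≉ε)) ⟩
    q * J X Y - (q - 1#) * (q - 1#) * (δ (X ⊛ Y) * δ X) ∎
    where open ≡-Reasoning

  -- The correction (q-1)/q · δ makes the Gauss sum formula for the binomial
  -- coefficient uniform in X and Y.
  G-*-binom : ∀ X Y → G (X ⊛ Y ᶜ) * (binom ⟦ X ⟧ ⟦ Y ⟧ - (q - 1#) / q * δ (X ⊛ Y ᶜ)) ≡ ⟦ Y ⟧ -1F / q * (G X * G (Y ᶜ))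
  G-*-binom X Y with (X ⊛ Y ᶜ) ≋? ε-char
  ... | yes XY≋ε = begin
    G (X ⊛ Y ᶜ) * (s / q * j - (q - 1#) / q * δ (X ⊛ Y ᶜ))
      ≡⟨ cong₂ (λ g d → g * (s / q * j - (q - 1#) / q * d)) (trans (G-cong {X ⊛ Y ᶜ} {ε-char} XY≋ε) G-ε) (δ-yes (X ⊛ Y ᶜ) XY≋ε) ⟩
    - 1# * (s / q * j - (q - 1#) / q * 1#)
      ≡⟨ solve 4 (λ s i j r → (:- con 1ℤ) :* (s :* i :* j :- r :* i :* con 1ℤ) := s :* i :* ((:- con 1ℤ) :* j) :+ con 1ℤ :* (i :* r)) refl s (q ⁻¹) j (q - 1#) ⟩
    s / q * (- 1# * j) + 1# * (q ⁻¹ * (q - 1#))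
      ≡⟨ cong (λ t → s / q * (- 1# * j) + t * (q ⁻¹ * (q - 1#))) (sym (sign² Y)) ⟩
    s / q * (- 1# * j) + s * s * (q ⁻¹ * (q - 1#))
      ≡⟨ solve 4 (λ s i j r → s :* i :* ((:- con 1ℤ) :* j) :+ s :* s :* (i :* r) := s :* i :* ((:- con 1ℤ) :* j :+ s :* (r :* con 1ℤ))) refl s (q ⁻¹) j (q - 1#) ⟩
    s / q * (- 1# * j + s * ((q - 1#) * 1#))
      ≡⟨ cong (s / q *_) (sym (trans (G-* X (Y ᶜ)) (cong₂ _+_ (cong (_* j) (trans (G-cong {X ⊛ Y ᶜ} {ε-char} XY≋ε) G-ε))
           (cong₂ (λ t d → t * ((q - 1#) * d)) (sign-⁻¹ Y) (δ-yes (X ⊛ Y ᶜ) XY≋ε))))) ⟩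
    s / q * (G X * G (Y ᶜ)) ∎
    where
    open ≡-Reasoning
    s j : Carrier
    s = ⟦ Y ⟧ -1F
    j = J X (Y ᶜ)
  ... | no XY≉ε = begin
    G (X ⊛ Y ᶜ) * (s / q * j - (q - 1#) / q * δ (X ⊛ Y ᶜ))
      ≡⟨ cong (λ d → G (X ⊛ Y ᶜ) * (s / q * j - (q - 1#) / q * d)) (δ-no (X ⊛ Y ᶜ) XY≉ε) ⟩
    G (X ⊛ Y ᶜ) * (s / q * j - (q - 1#) / q * 0#)
      ≡⟨ solve 4 (λ g t j r → g :* (t :* j :- r :* con 0ℤ) := t :* (g :* j)) refl (G (X ⊛ Y ᶜ)) (s / q) j ((q - 1#) / q) ⟩
    s / q * (G (X ⊛ Y ᶜ) * j)
      ≡⟨ cong (s / q *_) (sym (G-*-nontrivial X (Y ᶜ) XY≉ε)) ⟩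
    s / q * (G X * G (Y ᶜ)) ∎
    where
    open ≡-Reasoning
    s j : Carrier
    s = ⟦ Y ⟧ -1F
    j = J X (Y ᶜ)

  φ≉ε : ¬ (φ-char ≋ ε-char)
  φ≉ε φ≋ε = q-1≢0 (trans (sym ∑x-ε) (trans (∑x-cong (λ x → sym (φ≋ε x))) ∑x-φ))

  data SquareRoot (C A : Character) : Set where
    root   : A ≋ C → SquareRoot C A
    φ-root : A ≋ C ⊛ φ-char → SquareRoot C A
    none   : ¬ (A ⊛ A ≋ C ⊛ C) → SquareRoot C A

  -- If A² = C², the square of AC̄ is trivial, so AC̄ is ε or, by `order-two`, φ. This is how the
  -- deltas with and without φ are separated.
  squareRoot : ∀ C A → SquareRoot C A
  squareRoot C A with (A ⊛ A) ≋? (C ⊛ C)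
  ... | no A²≉C² = none A²≉C²
  ... | yes A²≋C² with (A ⊛ C ᶜ) ≋? ε-char
  ...   | yes AC≋ε = root (⊛ᶜ≋ε⇒≋ {A} {C} AC≋ε)
  ...   | no AC≉ε  = φ-root (λ y → trans (sym (⊛-cancel C A y)) (cong (⟦ C ⟧ y *_) (trans (*-comm _ _) (AC≋φ y))))
    where
    AC≋φ : A ⊛ C ᶜ ≋ φ-char
    AC≋φ = order-two (A ⊛ C ᶜ) (λ y → trans
      (solve 2 (λ a c → (a :* c) :* (a :* c) := (a :* a) :* (c :* c)) refl (⟦ A ⟧ y) ((⟦ C ⟧ y) ⁻¹))
      (trans (cong₂ _*_ (A²≋C² y) (sym (⁻¹-distrib-* (⟦ C ⟧ y) (⟦ C ⟧ y)))) (⊛ᶜ≋ε (C ⊛ C) y))) AC≉ε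

  private
    [Cφ]C≋φ : ∀ C → C ⊛ φ-char ⊛ C ᶜ ≋ φ-char
    [Cφ]C≋φ C = ≋-on-units (C ⊛ φ-char ⊛ C ᶜ) φ-char λ {y} y≢0 →
      fieldEq (⟦ C ⟧ y ∷ φ y ∷ []) ((#0 ⊗ #1) ⊘ #0) (#1) (⟦⟧≢0 C y≢0 ∷ []) [] refl

  δ-root : ∀ {C A} → A ≋ C → δ (A ⊛ C ᶜ) ≡ 1# × δ (A ⊛ C ᶜ ⊛ φ-char) ≡ 0#
  δ-root {C} {A} A≋C =
    δ-yes (A ⊛ C ᶜ) AC≋ε ,
    δ-no (A ⊛ C ᶜ ⊛ φ-char) (λ eq → φ≉ε (λ y → trans (sym (ε⊛ φ-char y)) (trans (cong (_* φ y) (sym (AC≋ε y))) (eq y))))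
    where
    AC≋ε : A ⊛ C ᶜ ≋ ε-char
    AC≋ε = ≋⇒⊛ᶜ≋ε {A} {C} A≋C

  δ-φ-root : ∀ {C A} → A ≋ C ⊛ φ-char → δ (A ⊛ C ᶜ) ≡ 0# × δ (A ⊛ C ᶜ ⊛ φ-char) ≡ 1#
  δ-φ-root {C} {A} A≋Cφ =
    δ-no (A ⊛ C ᶜ) (λ eq → φ≉ε (λ y → trans (sym (AC≋φ y)) (eq y))) ,
    δ-yes (A ⊛ C ᶜ ⊛ φ-char) (λ y → trans (cong (_* φ y) (AC≋φ y)) (φ²≋ε y))
    where
    AC≋φ : A ⊛ C ᶜ ≋ φ-char
    AC≋φ y = trans (cong (_* _) (A≋Cφ y)) ([Cφ]C≋φ C y)

  δ-none : ∀ {C A} → ¬ (A ⊛ A ≋ C ⊛ C) → δ (A ⊛ C ᶜ) ≡ 0# × δ (A ⊛ C ᶜ ⊛ φ-char) ≡ 0#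
  δ-none {C} {A} A²≉C² =
    δ-no (A ⊛ C ᶜ) (λ eq → A²≉C² (λ y → let A≋C = ⊛ᶜ≋ε⇒≋ {A} {C} eq in cong₂ _*_ (A≋C y) (A≋C y))) ,
    δ-no (A ⊛ C ᶜ ⊛ φ-char) (λ eq → A²≉C² (≋-on-units (A ⊛ A) (C ⊛ C) (λ y≢0 → squares eq y≢0)))
    where
    squares : A ⊛ C ᶜ ⊛ φ-char ≋ ε-char → ∀ {y} → y ≢ F.0# → ⟦ A ⟧ y * ⟦ A ⟧ y ≡ ⟦ C ⟧ y * ⟦ C ⟧ y
    squares eq {y} y≢0 = begin
      a * a                                       ≡⟨ sym (*-identityʳ _) ⟩
      a * a * 1#                                  ≡⟨ cong (a * a *_) (sym (trans (φ²≋ε y) (ε≡1 y≢0))) ⟩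
      a * a * (φ y * φ y)
        ≡⟨ fieldEq (a ∷ c ∷ φ y ∷ []) (#0 ⊗ #0 ⊗ (#2 ⊗ #2))
             (((#0 ⊘ #1) ⊗ #2) ⊗ ((#0 ⊘ #1) ⊗ #2) ⊗ (#1 ⊗ #1)) [] (c≢0 ∷ c≢0 ∷ []) refl ⟩
      (a / c * φ y) * (a / c * φ y) * (c * c)     ≡⟨ cong (λ t → t * t * (c * c)) (trans (eq y) (ε≡1 y≢0)) ⟩
      1# * 1# * (c * c)                           ≡⟨ trans (cong (_* (c * c)) (*-identityˡ 1#)) (*-identityˡ _) ⟩
      c * c                                       ∎
      where
      open ≡-Reasoning
      a c : Carrier
      a = ⟦ A ⟧ y
      c = ⟦ C ⟧ y
      c≢0 : c ≢ 0#
      c≢0 = ⟦⟧≢0 C y≢0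

  module _ (A B C : Character) where
    private
      A⁺ B⁺ P⁺ : Character
      A⁺ = A′ A B C
      B⁺ = B′ A B C
      P⁺ = P A B C

    -- The Gauss sum of the squared character is what the duplication formula makes of the two lower
    -- parameters C and Cφ.
    gaussTerm : F.Carrier → Character → Carrier
    gaussTerm w χ = ⟦ χ ⟧ w * ((G (A ⊛ χ) * G (A⁺ ⊛ χ) * G ((C ⊛ χ) ᶜ ⊛ (C ⊛ χ) ᶜ)) *
                    ((G (B ⊛ χ) * G (χ ᶜ)) * (G (B⁺ ⊛ χ) * G ((P⁺ ⊛ χ) ᶜ))))

    -- The correction to gaussTerm where G-*-* fails to be a pure Jacobi sum;
    -- only χ = Ā contributes.
    exceptional : F.Carrier → Character → Carrier
    exceptional w χ = δ ((A ⊛ χ) ⊛ (A⁺ ⊛ χ)) * (⟦ χ ⟧ w * ((G (B ⊛ χ) * G (χ ᶜ)) * (G (B⁺ ⊛ χ) * G ((P⁺ ⊛ χ) ᶜ))))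

    private
      exceptional-cong : ∀ w {χ ψ} → χ ≋ ψ → exceptional w χ ≡ exceptional w ψ
      exceptional-cong w {χ} {ψ} χ≋ψ = cong₂ _*_
        (δ-cong {(A ⊛ χ) ⊛ (A⁺ ⊛ χ)} {(A ⊛ ψ) ⊛ (A⁺ ⊛ ψ)} (λ y → cong (λ t → ⟦ A ⟧ y * t * (⟦ A⁺ ⟧ y * t)) (χ≋ψ y)))
        (cong₂ _*_ (χ≋ψ w) (cong₂ _*_
          (cong₂ _*_ (G-cong {B ⊛ χ} {B ⊛ ψ} (λ y → cong (⟦ B ⟧ y *_) (χ≋ψ y))) (G-cong {χ ᶜ} {ψ ᶜ} (λ y → cong _⁻¹ (χ≋ψ y))))
          (cong₂ _*_ (G-cong {B⁺ ⊛ χ} {B⁺ ⊛ ψ} (λ y → cong (⟦ B⁺ ⟧ y *_) (χ≋ψ y)))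
                     (G-cong {(P⁺ ⊛ χ) ᶜ} {(P⁺ ⊛ ψ) ᶜ} (λ y → cong (λ t → (⟦ P⁺ ⟧ y * t) ⁻¹) (χ≋ψ y))))))

      Ψ-trivial : ∀ χ → ((A ⊛ χ) ⊛ (A⁺ ⊛ χ)) ⊛ ((C ⊛ χ) ᶜ ⊛ (C ⊛ χ) ᶜ) ≋ ε-char
      Ψ-trivial χ = ≋-on-units (((A ⊛ χ) ⊛ (A⁺ ⊛ χ)) ⊛ ((C ⊛ χ) ᶜ ⊛ (C ⊛ χ) ᶜ)) ε-char λ {y} y≢0 → trans
        (fieldEq (⟦ A ⟧ y ∷ ⟦ C ⟧ y ∷ ⟦ χ ⟧ y ∷ [])
          (((#0 ⊗ #2) ⊗ ((⅟ #0 ⊗ #1 ⊗ #1) ⊗ #2)) ⊗ (⅟ (#1 ⊗ #2) ⊗ ⅟ (#1 ⊗ #2))) 𝟙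
          (⟦⟧≢0 A y≢0 ∷ (⟦⟧≢0 C y≢0 ≢* ⟦⟧≢0 χ y≢0) ∷ (⟦⟧≢0 C y≢0 ≢* ⟦⟧≢0 χ y≢0) ∷ []) [] refl)
        (sym (ε≡1 y≢0))

      Ψ-even : ∀ χ → ⟦ (A ⊛ χ) ⊛ (A⁺ ⊛ χ) ⟧ -1F ≡ 1#
      Ψ-even χ = begin
        (⟦ A ⟧ -1F * ⟦ χ ⟧ -1F) * (((⟦ A ⟧ -1F) ⁻¹ * ⟦ C ⟧ -1F * ⟦ C ⟧ -1F) * ⟦ χ ⟧ -1F)
          ≡⟨ solve 4 (λ a h i c → (a :* h) :* ((i :* c :* c) :* h) := (a :* i) :* ((c :* c) :* (h :* h))) refl (⟦ A ⟧ -1F) (⟦ χ ⟧ -1F) ((⟦ A ⟧ -1F) ⁻¹) (⟦ C ⟧ -1F) ⟩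
        (⟦ A ⟧ -1F * (⟦ A ⟧ -1F) ⁻¹) * ((⟦ C ⟧ -1F * ⟦ C ⟧ -1F) * (⟦ χ ⟧ -1F * ⟦ χ ⟧ -1F))
          ≡⟨ cong₂ _*_ (⁻¹-inverse _ (⟦⟧≢0 A -1≢0)) (cong₂ _*_ (sign² C) (sign² χ)) ⟩
        1# * (1# * 1#)
          ≡⟨ trans (*-identityˡ _) (*-identityˡ 1#) ⟩
        1# ∎
        where open ≡-Reasoning

    -- The factor q²(q-1) collects q from `G-*-*`, B(-1)q from G(B)G(B̄), and (q-1)B(-1) from
    -- `triple-series≡`; the two signs cancel.
    gaussSeries≡ : ∀ {x} (x≢0 : x ≢ F.0#) (x≢1 : x ≢ F.1#) → ¬ (B ≋ ε-char) →
      ∑χ (gaussTerm (w A B C x≢0 x≢1)) ≡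
      q * q * (q - 1#) * ∑x (λ a → ∑x (Substitution.k A B P⁺ x≢0 x≢1 a))
        - (q - 1#) * (q - 1#) * exceptional (w A B C x≢0 x≢1) (A ᶜ)
    gaussSeries≡ x≢0 x≢1 B≉ε = begin
      ∑χ (gaussTerm w₀)
        ≡⟨ trans (∑χ-cong term) (∑χ-+ _ _) ⟩
      ∑χ (λ χ → q * (G B * G (B ᶜ)) * main χ) + ∑χ (λ χ → [ A ᶜ ≋? χ ] * (- ((q - 1#) * (q - 1#)) * exceptional w₀ χ))
        ≡⟨ cong₂ _+_ (trans (∑χ-* _ _) (cong₂ _*_ (cong (q *_) (G-inverse-nontrivial B (B ᶜ) B≉ε (⊛ᶜ≋ε B))) (triple-series≡ A B C x≢0 x≢1)))
             (∑-[] characters (A ᶜ) _ (λ {χ} {ψ} χ≋ψ → cong (- ((q - 1#) * (q - 1#)) *_) (exceptional-cong w₀ {χ} {ψ} χ≋ψ))) ⟩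
      q * (⟦ B ⟧ -1F * q) * ((q - 1#) * (⟦ B ⟧ -1F * R)) + - ((q - 1#) * (q - 1#)) * E
        ≡⟨ solve 5 (λ q b r R E → q :* (b :* q) :* (r :* (b :* R)) :+ :- (r :* r) :* E := (b :* b) :* (q :* q :* r :* R) :- r :* r :* E) refl
             q (⟦ B ⟧ -1F) (q - 1#) R E ⟩
      (⟦ B ⟧ -1F * ⟦ B ⟧ -1F) * (q * q * (q - 1#) * R) - (q - 1#) * (q - 1#) * E
        ≡⟨ cong (λ t → t - (q - 1#) * (q - 1#) * E) (trans (cong (_* (q * q * (q - 1#) * R)) (sign² B)) (*-identityˡ _)) ⟩
      q * q * (q - 1#) * R - (q - 1#) * (q - 1#) * E ∎
      where
      open ≡-Reasoning
      w₀ : F.Carrier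
      w₀ = w A B C x≢0 x≢1
      R E : Carrier
      R = ∑x (λ a → ∑x (Substitution.k A B P⁺ x≢0 x≢1 a))
      E = exceptional w₀ (A ᶜ)
      main : Character → Carrier
      main χ = ⟦ χ ⟧ w₀ * (J (A ⊛ χ) (A⁺ ⊛ χ) * (J (B ⊛ χ) (χ ᶜ) * J (B⁺ ⊛ χ) ((P⁺ ⊛ χ) ᶜ)))
      B⁺≉P : ¬ (B⁺ ≋ P⁺)
      B⁺≉P eq = B≉ε (≋-on-units B ε-char λ {y} y≢0 → trans (begin
        ⟦ B ⟧ y
          ≡⟨ fieldEq (⟦ B ⟧ y ∷ ⟦ C ⟧ y ∷ []) (#0) ((#1 ⊗ #1) ⊘ (⅟ #0 ⊗ #1 ⊗ #1)) []
               (((⁻¹-≢0 (⟦⟧≢0 B y≢0) ≢* ⟦⟧≢0 C y≢0) ≢* ⟦⟧≢0 C y≢0) ∷ ⟦⟧≢0 B y≢0 ∷ []) refl ⟩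
        ⟦ P⁺ ⟧ y / ⟦ B⁺ ⟧ y
          ≡⟨ cong (_/ ⟦ B⁺ ⟧ y) (sym (eq y)) ⟩
        ⟦ B⁺ ⟧ y / ⟦ B⁺ ⟧ y
          ≡⟨ ⁻¹-inverse _ (⟦⟧≢0 B⁺ y≢0) ⟩
        1# ∎) (sym (ε≡1 y≢0)))
      B⁺-P≋Bᶜ : B⁺ ⊛ P⁺ ᶜ ≋ B ᶜ
      B⁺-P≋Bᶜ = ≋-on-units (B⁺ ⊛ P⁺ ᶜ) (B ᶜ) λ {y} y≢0 →
        fieldEq (⟦ B ⟧ y ∷ ⟦ C ⟧ y ∷ []) ((⅟ #0 ⊗ #1 ⊗ #1) ⊗ ⅟ (#1 ⊗ #1)) (⅟ #0)
          (⟦⟧≢0 B y≢0 ∷ (⟦⟧≢0 C y≢0 ≢* ⟦⟧≢0 C y≢0) ∷ []) (⟦⟧≢0 B y≢0 ∷ []) refl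
      δ-shift : ∀ χ → δ (A ⊛ χ) ≡ [ A ᶜ ≋? χ ]
      δ-shift χ = [ (A ⊛ χ) ≋? ε-char ]-cong (A ᶜ ≋? χ)
        (λ eq y → sym (trans (sym (⊛-ᶜ-cancel A χ y)) (trans (cong ((⟦ A ⟧ y) ⁻¹ *_) (eq y)) (trans (*-comm _ _) (ε⊛ (A ᶜ) y)))))
        (λ eq y → trans (cong (⟦ A ⟧ y *_) (sym (eq y))) (⊛ᶜ≋ε A y))
      term : ∀ χ → gaussTerm w₀ χ ≡ q * (G B * G (B ᶜ)) * main χ + [ A ᶜ ≋? χ ] * (- ((q - 1#) * (q - 1#)) * exceptional w₀ χ)
      term χ = begin
        ⟦ χ ⟧ w₀ * ((G (A ⊛ χ) * G (A⁺ ⊛ χ) * G ((C ⊛ χ) ᶜ ⊛ (C ⊛ χ) ᶜ)) * (g₁ * g₂))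
          ≡⟨ cong (λ t → ⟦ χ ⟧ w₀ * (t * (g₁ * g₂))) (G-*-* (A ⊛ χ) (A⁺ ⊛ χ) ((C ⊛ χ) ᶜ ⊛ (C ⊛ χ) ᶜ) (Ψ-trivial χ) (Ψ-even χ)) ⟩
        ⟦ χ ⟧ w₀ * ((q * jA - (q - 1#) * (q - 1#) * (d * δ (A ⊛ χ))) * (g₁ * g₂))
          ≡⟨ solve 8 (λ c q j r d e g₁ g₂ → c :* ((q :* j :- r :* r :* (d :* e)) :* (g₁ :* g₂)) :=
               q :* (c :* (j :* (g₁ :* g₂))) :+ e :* (:- (r :* r) :* (d :* (c :* (g₁ :* g₂))))) refl (⟦ χ ⟧ w₀) q jA (q - 1#) d (δ (A ⊛ χ)) g₁ g₂ ⟩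
        q * (⟦ χ ⟧ w₀ * (jA * (g₁ * g₂))) + δ (A ⊛ χ) * (- ((q - 1#) * (q - 1#)) * (d * (⟦ χ ⟧ w₀ * (g₁ * g₂))))
          ≡⟨ cong₂ (λ s t → q * (⟦ χ ⟧ w₀ * (jA * s)) + t * (- ((q - 1#) * (q - 1#)) * exceptional w₀ χ))
               (cong₂ _*_ (G-*-J₁ B χ B≉ε) (trans (G-*-J₂ B⁺ P⁺ χ B⁺≉P) (cong (_* j₂) (G-cong {B⁺ ⊛ P⁺ ᶜ} {B ᶜ} B⁺-P≋Bᶜ)))) (δ-shift χ) ⟩
        q * (⟦ χ ⟧ w₀ * (jA * ((G B * j₁) * (G (B ᶜ) * j₂)))) + [ A ᶜ ≋? χ ] * (- ((q - 1#) * (q - 1#)) * exceptional w₀ χ)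
          ≡⟨ cong (_+ [ A ᶜ ≋? χ ] * (- ((q - 1#) * (q - 1#)) * exceptional w₀ χ))
               (solve 7 (λ q c j b j₁ b′ j₂ → q :* (c :* (j :* ((b :* j₁) :* (b′ :* j₂)))) := q :* (b :* b′) :* (c :* (j :* (j₁ :* j₂)))) refl
                  q (⟦ χ ⟧ w₀) jA (G B) j₁ (G (B ᶜ)) j₂) ⟩
        q * (G B * G (B ᶜ)) * main χ + [ A ᶜ ≋? χ ] * (- ((q - 1#) * (q - 1#)) * exceptional w₀ χ) ∎
        where
        g₁ g₂ jA j₁ j₂ d : Carrier
        g₁ = G (B ⊛ χ) * G (χ ᶜ)
        g₂ = G (B⁺ ⊛ χ) * G ((P⁺ ⊛ χ) ᶜ)
        jA = J (A ⊛ χ) (A⁺ ⊛ χ)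
        j₁ = J (B ⊛ χ) (χ ᶜ)
        j₂ = J (B⁺ ⊛ χ) ((P⁺ ⊛ χ) ᶜ)
        d = δ ((A ⊛ χ) ⊛ (A⁺ ⊛ χ))

-- From the hypergeometric series to Gauss sums

module RightHandSide (S : Setup) where
  open GaussSeries S public
  open Ops S using (binom; hyp; ₂F₁; ₃F₂; ₄F₃; φ)

  hyp-0 : ∀ A₀ ps → hyp A₀ ps F.0# ≡ 0#
  hyp-0 A₀ ps = trans (cong (q/[q-1] *_) (trans (sumL-chars _)
    (trans (∑χ-cong (λ χ → annihilate (at0 χ))) (sumL-0 (Enumeration.list characters))))) (zeroʳ _)
    where
    annihilate : ∀ {x y} → y ≡ 0# → x * y ≡ 0#
    annihilate refl = zeroʳ _

  E : Carrier
  E = (q - 1#) / q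

  -- Applied to binomials, the four sums on the right are those of the ₄F₃, the two ₃F₂ and the ₂F₁.
  -- Each trailing `1#` is the empty product that ends `prodL`.
  ∑χ-expand : ∀ (b₁ b₂ b₃ b₄ e : Character → Carrier) d₃ d₄ →
    ∑χ (λ χ → b₁ χ * b₂ χ * ((b₃ χ - E * d₃) * (b₄ χ - E * d₄)) * e χ) ≡
    ∑χ (λ χ → b₁ χ * (b₂ χ * (b₃ χ * (b₄ χ * 1#))) * e χ) - E * d₃ * ∑χ (λ χ → b₁ χ * (b₂ χ * (b₄ χ * 1#)) * e χ)
      - E * d₄ * ∑χ (λ χ → b₁ χ * (b₂ χ * (b₃ χ * 1#)) * e χ) + E * d₃ * (E * d₄) * ∑χ (λ χ → b₁ χ * (b₂ χ * 1#) * e χ)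
  ∑χ-expand b₁ b₂ b₃ b₄ e d₃ d₄ = begin
    ∑χ (λ χ → b₁ χ * b₂ χ * ((b₃ χ - E * d₃) * (b₄ χ - E * d₄)) * e χ)
      ≡⟨ ∑χ-cong (λ χ → solve 7 (λ b₁ b₂ b₃ b₄ e u v →
           b₁ :* b₂ :* ((b₃ :- u) :* (b₄ :- v)) :* e :=
           b₁ :* (b₂ :* (b₃ :* (b₄ :* con 1ℤ))) :* e :+ ((:- u) :* (b₁ :* (b₂ :* (b₄ :* con 1ℤ)) :* e)
             :+ ((:- v) :* (b₁ :* (b₂ :* (b₃ :* con 1ℤ)) :* e) :+ u :* v :* (b₁ :* (b₂ :* con 1ℤ) :* e))))
           refl (b₁ χ) (b₂ χ) (b₃ χ) (b₄ χ) (e χ) (E * d₃) (E * d₄)) ⟩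
    ∑χ (λ χ → t₃₄ χ + (- (E * d₃) * t₄ χ + (- (E * d₄) * t₃ χ + E * d₃ * (E * d₄) * t χ)))
      ≡⟨ trans (∑χ-+ _ _) (cong (∑χ t₃₄ +_) (trans (∑χ-+ _ _) (cong₂ _+_ (∑χ-* _ t₄) (trans (∑χ-+ _ _) (cong₂ _+_ (∑χ-* _ t₃) (∑χ-* _ t)))))) ⟩
    ∑χ t₃₄ + (- (E * d₃) * ∑χ t₄ + (- (E * d₄) * ∑χ t₃ + E * d₃ * (E * d₄) * ∑χ t))
      ≡⟨ solve 6 (λ a b c d u v → a :+ ((:- u) :* b :+ ((:- v) :* c :+ u :* v :* d)) := a :- u :* b :- v :* c :+ u :* v :* d) refl
           (∑χ t₃₄) (∑χ t₄) (∑χ t₃) (∑χ t) (E * d₃) (E * d₄) ⟩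
    ∑χ t₃₄ - E * d₃ * ∑χ t₄ - E * d₄ * ∑χ t₃ + E * d₃ * (E * d₄) * ∑χ t ∎
    where
    open ≡-Reasoning
    t₃₄ t₄ t₃ t : Character → Carrier
    t₃₄ χ = b₁ χ * (b₂ χ * (b₃ χ * (b₄ χ * 1#))) * e χ
    t₄ χ = b₁ χ * (b₂ χ * (b₄ χ * 1#)) * e χ
    t₃ χ = b₁ χ * (b₂ χ * (b₃ χ * 1#)) * e χ
    t χ = b₁ χ * (b₂ χ * 1#) * e χ

  module _ (A B C : Character) where
    private
      A⁺ B⁺ P⁺ AC BCφ : Character
      A⁺ = A′ A B C
      B⁺ = B′ A B C
      P⁺ = P A B C
      AC = A ᶜ ⊛ C
      BCφ = B ᶜ ⊛ C ⊛ φ-char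

      b₁ b₂ b₃ b₄ : Character → Carrier
      b₁ χ = binom ⟦ A ⊛ χ ⟧ ⟦ χ ⟧
      b₂ χ = binom ⟦ B ⊛ χ ⟧ ⟦ P⁺ ⊛ χ ⟧
      b₃ χ = binom ⟦ A⁺ ⊛ χ ⟧ ⟦ C ⊛ χ ⟧
      b₄ χ = binom ⟦ B⁺ ⊛ χ ⟧ ⟦ C ⊛ φ-char ⊛ χ ⟧

      ε₀ : Carrier
      ε₀ = φ -1F

      -- The part of a term that is independent of χ: q⁻⁴ from four binomials, φ(-1) from the sign
      -- of the lower parameter Cφ, and C(4)G(φ) from duplication.
      κ : Carrier
      κ = q ⁻¹ * q ⁻¹ * (q ⁻¹ * q ⁻¹) * (ε₀ * ⟦ C ⟧ 𝟜 * G φ-char)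

      A⁺-C : ∀ χ → (A⁺ ⊛ χ) ⊛ (C ⊛ χ) ᶜ ≋ AC
      A⁺-C χ = ≋-on-units ((A⁺ ⊛ χ) ⊛ (C ⊛ χ) ᶜ) AC λ {y} y≢0 →
        fieldEq ((⟦ A ⟧ y) ⁻¹ ∷ ⟦ C ⟧ y ∷ ⟦ χ ⟧ y ∷ []) (#0 ⊗ #1 ⊗ #1 ⊗ #2 ⊗ ⅟ (#1 ⊗ #2)) (#0 ⊗ #1)
          ((⟦⟧≢0 C y≢0 ≢* ⟦⟧≢0 χ y≢0) ∷ []) [] refl

      B⁺-Cφ : ∀ χ → (B⁺ ⊛ χ) ⊛ (C ⊛ φ-char ⊛ χ) ᶜ ≋ BCφ
      B⁺-Cφ χ = ≋-on-units ((B⁺ ⊛ χ) ⊛ (C ⊛ φ-char ⊛ χ) ᶜ) BCφ λ {y} y≢0 → trans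
        (fieldEq ((⟦ B ⟧ y) ⁻¹ ∷ ⟦ C ⟧ y ∷ ⟦ χ ⟧ y ∷ φ y ∷ []) (#0 ⊗ #1 ⊗ #1 ⊗ #2 ⊗ ⅟ (#1 ⊗ #3 ⊗ #2)) (#0 ⊗ #1 ⊗ ⅟ #3)
          (((⟦⟧≢0 C y≢0 ≢* ⟦⟧≢0 φ-char y≢0) ≢* ⟦⟧≢0 χ y≢0) ∷ []) (⟦⟧≢0 φ-char y≢0 ∷ []) refl)
        (cong ((⟦ B ⟧ y) ⁻¹ * ⟦ C ⟧ y *_) (φᶜ≋φ y))

      ψφ : ∀ χ → (C ⊛ φ-char ⊛ χ) ᶜ ≋ (C ⊛ χ) ᶜ ⊛ φ-char
      ψφ χ y = trans (cong _⁻¹ (solve 3 (λ c f h → c :* f :* h := (c :* h) :* f) refl (⟦ C ⟧ y) (φ y) (⟦ χ ⟧ y)))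
                     (trans (⁻¹-distrib-* _ _) (cong (((⟦ C ⟧ y) * ⟦ χ ⟧ y) ⁻¹ *_) (φᶜ≋φ y)))

    module _ (A≉ε : ¬ (A ≋ ε-char)) (B≉P : ¬ (B ≋ P⁺)) {y w : F.Carrier} (4y≡w : 𝟜 F.* y ≡ w) where
      private
        -- The corrected third and fourth binomials are exact products of Gauss sums for all χ.
        -- Duplication then merges the sums for the inverses of Cχ and Cφχ, and its factor χ(4)
        -- moves the argument from y to w.
        uniformTerm : ∀ χ →
          G A * G (B ⊛ P⁺ ᶜ) * (G AC * G BCφ) * (b₁ χ * b₂ χ * ((b₃ χ - E * δ AC) * (b₄ χ - E * δ BCφ)) * ⟦ χ ⟧ y) ≡
          κ * gaussTerm A B C w χ
        uniformTerm χ = begin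
          G A * G (B ⊛ P⁺ ᶜ) * (G AC * G BCφ) * (h / q * j₁ * (h′ / q * j₂) * (u₃ * u₄) * ⟦ χ ⟧ y)
            ≡⟨ solve 12 (λ gA gB g₃ g₄ h p i j₁ j₂ u₃ u₄ e → gA :* gB :* (g₃ :* g₄) :* (h :* i :* j₁ :* (p :* i :* j₂) :* (u₃ :* u₄) :* e) :=
                 h :* p :* (i :* i) :* ((gA :* j₁) :* (gB :* j₂)) :* ((g₃ :* u₃) :* (g₄ :* u₄)) :* e) refl
                 (G A) (G (B ⊛ P⁺ ᶜ)) (G AC) (G BCφ) h h′ (q ⁻¹) j₁ j₂ u₃ u₄ (⟦ χ ⟧ y) ⟩
          h * h′ * (q ⁻¹ * q ⁻¹) * ((G A * j₁) * (G (B ⊛ P⁺ ᶜ) * j₂)) * ((G AC * u₃) * (G BCφ * u₄)) * ⟦ χ ⟧ y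
            ≡⟨ cong₂ (λ s t → h * h′ * (q ⁻¹ * q ⁻¹) * s * t * ⟦ χ ⟧ y)
                 (cong₂ _*_ (sym (G-*-J₁ A χ A≉ε)) (sym (G-*-J₂ B P⁺ χ B≉P))) (cong₂ _*_ G*u₃ G*u₄) ⟩
          h * h′ * (q ⁻¹ * q ⁻¹) * ((gA * gχ) * (gB * gP)) * ((c * h / q * (gA⁺ * gψ)) * (c * ε₀ * h / q * (gB⁺ * gψ′))) * ⟦ χ ⟧ y
            ≡⟨ solve 13 (λ h c f i gA gχ gB gP gA⁺ gψ gB⁺ gψ′ e →
                 h :* (c :* c :* h) :* (i :* i) :* ((gA :* gχ) :* (gB :* gP)) :* ((c :* h :* i :* (gA⁺ :* gψ)) :* (c :* f :* h :* i :* (gB⁺ :* gψ′))) :* e :=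
                 ((h :* h) :* (h :* h) :* ((c :* c) :* (c :* c))) :* (i :* i :* (i :* i) :* f :* (gA :* gA⁺ :* ((gB :* gχ) :* (gB⁺ :* gP))) :* e :* (gψ :* gψ′)))
                 refl h c ε₀ (q ⁻¹) gA gχ gB gP gA⁺ gψ gB⁺ gψ′ (⟦ χ ⟧ y) ⟩
          ((h * h) * (h * h) * ((c * c) * (c * c))) * (i⁴ * ε₀ * (gA * gA⁺ * ((gB * gχ) * (gB⁺ * gP))) * ⟦ χ ⟧ y * (gψ * gψ′))
            ≡⟨ cong₂ _*_ (trans (cong₂ (λ s t → s * s * (t * t)) (sign² χ) (sign² C)) (solve 0 (con 1ℤ :* con 1ℤ :* (con 1ℤ :* con 1ℤ) := con 1ℤ) refl))
                 (cong (i⁴ * ε₀ * (gA * gA⁺ * ((gB * gχ) * (gB⁺ * gP))) * ⟦ χ ⟧ y *_) duplication) ⟩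
          1# * (i⁴ * ε₀ * (gA * gA⁺ * ((gB * gχ) * (gB⁺ * gP))) * ⟦ χ ⟧ y * (⟦ C ⟧ 𝟜 * ⟦ χ ⟧ 𝟜 * G φ-char * gψψ))
            ≡⟨ solve 11 (λ i f gA gA⁺ g₁ g₂ e c e′ gφ gψψ → con 1ℤ :* (i :* f :* (gA :* gA⁺ :* (g₁ :* g₂)) :* e :* (c :* e′ :* gφ :* gψψ)) :=
                 i :* (f :* c :* gφ) :* (e′ :* e :* ((gA :* gA⁺ :* gψψ) :* (g₁ :* g₂)))) refl
                 i⁴ ε₀ gA gA⁺ (gB * gχ) (gB⁺ * gP) (⟦ χ ⟧ y) (⟦ C ⟧ 𝟜) (⟦ χ ⟧ 𝟜) (G φ-char) gψψ ⟩
          κ * (⟦ χ ⟧ 𝟜 * ⟦ χ ⟧ y * ((gA * gA⁺ * gψψ) * ((gB * gχ) * (gB⁺ * gP))))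
            ≡⟨ cong (λ t → κ * (t * ((gA * gA⁺ * gψψ) * ((gB * gχ) * (gB⁺ * gP))))) (trans (sym (mult χ 𝟜 y)) (cong ⟦ χ ⟧ 4y≡w)) ⟩
          κ * gaussTerm A B C w χ ∎
          where
          open ≡-Reasoning
          h h′ c j₁ j₂ u₃ u₄ i⁴ gA gχ gB gP gA⁺ gψ gB⁺ gψ′ gψψ : Carrier
          h = ⟦ χ ⟧ -1F
          h′ = ⟦ P⁺ ⊛ χ ⟧ -1F
          c = ⟦ C ⟧ -1F
          j₁ = J (A ⊛ χ) (χ ᶜ)
          j₂ = J (B ⊛ χ) ((P⁺ ⊛ χ) ᶜ)
          u₃ = b₃ χ - E * δ AC
          u₄ = b₄ χ - E * δ BCφ
          i⁴ = q ⁻¹ * q ⁻¹ * (q ⁻¹ * q ⁻¹)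
          gA = G (A ⊛ χ)
          gχ = G (χ ᶜ)
          gB = G (B ⊛ χ)
          gP = G ((P⁺ ⊛ χ) ᶜ)
          gA⁺ = G (A⁺ ⊛ χ)
          gψ = G ((C ⊛ χ) ᶜ)
          gB⁺ = G (B⁺ ⊛ χ)
          gψ′ = G ((C ⊛ φ-char ⊛ χ) ᶜ)
          gψψ = G ((C ⊛ χ) ᶜ ⊛ (C ⊛ χ) ᶜ)
          G*u₃ : G AC * u₃ ≡ c * h / q * (gA⁺ * gψ)
          G*u₃ = trans (sym (cong₂ (λ g d → g * (b₃ χ - E * d)) (G-cong {(A⁺ ⊛ χ) ⊛ (C ⊛ χ) ᶜ} {AC} (A⁺-C χ)) (δ-cong {(A⁺ ⊛ χ) ⊛ (C ⊛ χ) ᶜ} {AC} (A⁺-C χ))))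
                       (G-*-binom (A⁺ ⊛ χ) (C ⊛ χ))
          G*u₄ : G BCφ * u₄ ≡ c * ε₀ * h / q * (gB⁺ * gψ′)
          G*u₄ = trans (sym (cong₂ (λ g d → g * (b₄ χ - E * d)) (G-cong {(B⁺ ⊛ χ) ⊛ (C ⊛ φ-char ⊛ χ) ᶜ} {BCφ} (B⁺-Cφ χ)) (δ-cong {(B⁺ ⊛ χ) ⊛ (C ⊛ φ-char ⊛ χ) ᶜ} {BCφ} (B⁺-Cφ χ))))
                       (G-*-binom (B⁺ ⊛ χ) (C ⊛ φ-char ⊛ χ))
          duplication : gψ * gψ′ ≡ ⟦ C ⟧ 𝟜 * ⟦ χ ⟧ 𝟜 * G φ-char * gψψ
          duplication = trans (cong (gψ *_) (G-cong {(C ⊛ φ-char ⊛ χ) ᶜ} {(C ⊛ χ) ᶜ ⊛ φ-char} (ψφ χ)))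
            (trans (G-duplication ((C ⊛ χ) ᶜ)) (cong (λ t → t * G φ-char * gψψ) (⁻¹-involutive _)))

      M : Carrier → Carrier
      M ax = (ax * G AC * G BCφ) / (ε₀ * ⟦ C ⟧ 𝟜 * G φ-char * G A⁺ * G (B ᶜ))

      -- N cancels G(A′)G(B̄) in the denominator of M and supplies G(A)G(BP̄); the numerator of M
      -- supplies the other two Gauss sums that `uniformTerm` requires.
      hypergeometric-part : ∀ ax →
        q * q * (q - 1#) * (N A B C *
          (q * M ax * ₄F₃ ⟦ A ⟧ ⟦ B ⟧ ⟦ A⁺ ⟧ ⟦ B⁺ ⟧ ⟦ P⁺ ⟧ ⟦ C ⟧ ⟦ C ⊛ φ-char ⟧ y
          + (q - 1#) * M ax *
            (E * ₂F₁ ⟦ A ⟧ ⟦ B ⟧ ⟦ P⁺ ⟧ y * δ AC * δ BCφ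
             - ₃F₂ ⟦ A ⟧ ⟦ B ⟧ ⟦ B⁺ ⟧ ⟦ P⁺ ⟧ ⟦ C ⊛ φ-char ⟧ y * δ AC
             - ₃F₂ ⟦ A ⟧ ⟦ B ⟧ ⟦ A⁺ ⟧ ⟦ P⁺ ⟧ ⟦ C ⟧ y * δ BCφ))) ≡
        ax * ∑χ (gaussTerm A B C w)
      hypergeometric-part ax = begin
        q * q * (q - 1#) * (N A B C * (q * M ax * F₄ + (q - 1#) * M ax * (E * F₂ * δ AC * δ BCφ - F₃ * δ AC - F₃′ * δ BCφ)))
          ≡⟨ cong (λ t → q * q * (q - 1#) * (N A B C * t)) (trans
               (cong₂ (λ s t → q * M ax * s + (q - 1#) * M ax * t) (cong (q/[q-1] *_) (sumL-chars _))
                 (cong₂ (λ s t → s - t * δ BCφ) (cong₂ (λ s t → E * s * δ AC * δ BCφ - t * δ AC) (cong (q/[q-1] *_) (sumL-chars _)) (cong (q/[q-1] *_) (sumL-chars _)))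
                   (cong (q/[q-1] *_) (sumL-chars _))))
               (collect (M ax) T₃₄ T T₄ T₃ (δ AC) (δ BCφ))) ⟩
        q * q * (q - 1#) * (N A B C * (q * q/[q-1] * M ax * (T₃₄ - E * δ AC * T₄ - E * δ BCφ * T₃ + E * δ AC * (E * δ BCφ) * T)))
          ≡⟨ cong (λ t → q * q * (q - 1#) * (N A B C * (q * q/[q-1] * M ax * t))) (sym (∑χ-expand b₁ b₂ b₃ b₄ (λ χ → ⟦ χ ⟧ y) (δ AC) (δ BCφ))) ⟩
        q * q * (q - 1#) * (N A B C * (q * q/[q-1] * M ax * U))
          ≡⟨ cancel-M (G A) (G (B ᶜ)) (G A⁺) (G (B ⊛ P⁺ ᶜ)) (G AC) (G BCφ) (ε₀ * ⟦ C ⟧ 𝟜 * G φ-char) U ax (G≢0 (B ᶜ)) (G≢0 A⁺)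
               ((⟦⟧≢0 φ-char -1≢0 ≢* ⟦⟧≢0 C 𝟜≢0) ≢* G≢0 φ-char) ⟩
        q * q * (q * q) * (ax * (G A * G (B ⊛ P⁺ ᶜ) * (G AC * G BCφ) * U) / (ε₀ * ⟦ C ⟧ 𝟜 * G φ-char))
          ≡⟨ cong (λ t → q * q * (q * q) * (ax * t / (ε₀ * ⟦ C ⟧ 𝟜 * G φ-char))) (trans (sym (∑χ-* _ _)) (trans (∑χ-cong uniformTerm) (∑χ-* κ _))) ⟩
        q * q * (q * q) * (ax * (κ * ∑χ (gaussTerm A B C w)) / (ε₀ * ⟦ C ⟧ 𝟜 * G φ-char))
          ≡⟨ cancel-κ (ε₀ * ⟦ C ⟧ 𝟜 * G φ-char) ax (∑χ (gaussTerm A B C w)) ((⟦⟧≢0 φ-char -1≢0 ≢* ⟦⟧≢0 C 𝟜≢0) ≢* G≢0 φ-char) ⟩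
        ax * ∑χ (gaussTerm A B C w) ∎
        where
        open ≡-Reasoning
        F₄ F₂ F₃ F₃′ T₃₄ T₄ T₃ T U : Carrier
        F₄ = ₄F₃ ⟦ A ⟧ ⟦ B ⟧ ⟦ A⁺ ⟧ ⟦ B⁺ ⟧ ⟦ P⁺ ⟧ ⟦ C ⟧ ⟦ C ⊛ φ-char ⟧ y
        F₂ = ₂F₁ ⟦ A ⟧ ⟦ B ⟧ ⟦ P⁺ ⟧ y
        F₃ = ₃F₂ ⟦ A ⟧ ⟦ B ⟧ ⟦ B⁺ ⟧ ⟦ P⁺ ⟧ ⟦ C ⊛ φ-char ⟧ y
        F₃′ = ₃F₂ ⟦ A ⟧ ⟦ B ⟧ ⟦ A⁺ ⟧ ⟦ P⁺ ⟧ ⟦ C ⟧ y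
        T₃₄ = ∑χ (λ χ → b₁ χ * (b₂ χ * (b₃ χ * (b₄ χ * 1#))) * ⟦ χ ⟧ y)
        T₄ = ∑χ (λ χ → b₁ χ * (b₂ χ * (b₄ χ * 1#)) * ⟦ χ ⟧ y)
        T₃ = ∑χ (λ χ → b₁ χ * (b₂ χ * (b₃ χ * 1#)) * ⟦ χ ⟧ y)
        T = ∑χ (λ χ → b₁ χ * (b₂ χ * 1#) * ⟦ χ ⟧ y)
        U = ∑χ (λ χ → b₁ χ * b₂ χ * ((b₃ χ - E * δ AC) * (b₄ χ - E * δ BCφ)) * ⟦ χ ⟧ y)
        collect : ∀ m t₃₄ t t₄ t₃ d₃ d₄ →
          q * m * (q/[q-1] * t₃₄) + (q - 1#) * m * (E * (q/[q-1] * t) * d₃ * d₄ - q/[q-1] * t₄ * d₃ - q/[q-1] * t₃ * d₄) ≡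
          q * q/[q-1] * m * (t₃₄ - E * d₃ * t₄ - E * d₄ * t₃ + E * d₃ * (E * d₄) * t)
        collect m t₃₄ t t₄ t₃ d₃ d₄ = begin
          q * m * (Q * t₃₄) + (q - 1#) * m * (E * (Q * t) * d₃ * d₄ - Q * t₄ * d₃ - Q * t₃ * d₄)
            -- Writing q - 1 as qE gives the correction terms the coefficients that occur in
            -- `∑χ-expand`.
            ≡⟨ cong (λ r → q * m * (Q * t₃₄) + r * m * (E * (Q * t) * d₃ * d₄ - Q * t₄ * d₃ - Q * t₃ * d₄)) (sym qE≡q-1) ⟩
          q * m * (Q * t₃₄) + q * E * m * (E * (Q * t) * d₃ * d₄ - Q * t₄ * d₃ - Q * t₃ * d₄)
            ≡⟨ solve 10 (λ q Q E m t₃₄ t t₄ t₃ d₃ d₄ →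
                 q :* m :* (Q :* t₃₄) :+ q :* E :* m :* (E :* (Q :* t) :* d₃ :* d₄ :- Q :* t₄ :* d₃ :- Q :* t₃ :* d₄) :=
                 q :* Q :* m :* (t₃₄ :- E :* d₃ :* t₄ :- E :* d₄ :* t₃ :+ E :* d₃ :* (E :* d₄) :* t)) refl q Q E m t₃₄ t t₄ t₃ d₃ d₄ ⟩
          q * Q * m * (t₃₄ - E * d₃ * t₄ - E * d₄ * t₃ + E * d₃ * (E * d₄) * t) ∎
          where
          Q : Carrier
          Q = q/[q-1]
          qE≡q-1 : q * E ≡ q - 1#
          qE≡q-1 = fieldEq (q ∷ []) (#0 ⊗ ((#0 ⊖ 𝟙) ⊘ #0)) (#0 ⊖ 𝟙) (q≢0 ∷ []) [] refl
        cancel-M : ∀ gA gB′ gA⁺ gBP g₃ g₄ z U ax → gB′ ≢ 0# → gA⁺ ≢ 0# → z ≢ 0# →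
          q * q * (q - 1#) * (gA * gB′ * gA⁺ * gBP * (q * q/[q-1] * ((ax * g₃ * g₄) / (z * gA⁺ * gB′)) * U)) ≡
          q * q * (q * q) * (ax * (gA * gBP * (g₃ * g₄) * U) / z)
        cancel-M gA gB′ gA⁺ gBP g₃ g₄ z U ax n₁ n₂ n₃ = begin
          q * q * (q - 1#) * (gA * gB′ * gA⁺ * gBP * (q * (q * (q - 1#) ⁻¹) * (ax * g₃ * g₄ * (z * gA⁺ * gB′) ⁻¹) * U))
            ≡⟨ cong (λ t → q * q * (q - 1#) * (gA * gB′ * gA⁺ * gBP * (q * (q * (q - 1#) ⁻¹) * (ax * g₃ * g₄ * t) * U)))
                 (trans (⁻¹-distrib-* _ _) (cong (_* gB′ ⁻¹) (⁻¹-distrib-* _ _))) ⟩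
          q * q * (q - 1#) * (gA * gB′ * gA⁺ * gBP * (q * (q * (q - 1#) ⁻¹) * (ax * g₃ * g₄ * (z ⁻¹ * gA⁺ ⁻¹ * gB′ ⁻¹)) * U))
            ≡⟨ solve 14 (λ q r j gA gB′ gA⁺ gBP ax g₃ g₄ iz iA iB U →
                 q :* q :* r :* (gA :* gB′ :* gA⁺ :* gBP :* (q :* (q :* j) :* (ax :* g₃ :* g₄ :* (iz :* iA :* iB)) :* U)) :=
                 (r :* j) :* ((gB′ :* iB) :* ((gA⁺ :* iA) :* (q :* q :* (q :* q) :* (ax :* (gA :* gBP :* (g₃ :* g₄) :* U) :* iz)))))
                 refl q (q - 1#) ((q - 1#) ⁻¹) gA gB′ gA⁺ gBP ax g₃ g₄ (z ⁻¹) (gA⁺ ⁻¹) (gB′ ⁻¹) U ⟩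
          ((q - 1#) * (q - 1#) ⁻¹) * ((gB′ * gB′ ⁻¹) * ((gA⁺ * gA⁺ ⁻¹) * V))
            ≡⟨ cong₂ (λ s t → s * t) (⁻¹-inverse _ q-1≢0) (cong₂ (λ s t → s * (t * V)) (⁻¹-inverse gB′ n₁) (⁻¹-inverse gA⁺ n₂)) ⟩
          1# * (1# * (1# * V))
            ≡⟨ trans (*-identityˡ _) (trans (*-identityˡ _) (*-identityˡ V)) ⟩
          V ∎
          where
          V : Carrier
          V = q * q * (q * q) * (ax * (gA * gBP * (g₃ * g₄) * U) / z)
        cancel-κ : ∀ z ax s → z ≢ 0# → q * q * (q * q) * (ax * (q ⁻¹ * q ⁻¹ * (q ⁻¹ * q ⁻¹) * z * s) / z) ≡ ax * s
        cancel-κ z ax s z≢0 = fieldEq (q ∷ z ∷ ax ∷ s ∷ [])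
          (#0 ⊗ #0 ⊗ (#0 ⊗ #0) ⊗ ((#2 ⊗ (⅟ #0 ⊗ ⅟ #0 ⊗ (⅟ #0 ⊗ ⅟ #0) ⊗ #1 ⊗ #3)) ⊘ #1)) (#2 ⊗ #3)
          (q≢0 ∷ q≢0 ∷ q≢0 ∷ q≢0 ∷ z≢0 ∷ []) [] refl

-- The delta terms and the final assembly

module Theorem (S : Setup) where
  open RightHandSide S public
  open Ops S using (binom; hyp; ₂F₁; ₃F₂; ₄F₃; φ; g)

  module _ (A B C : Character) {x : F.Carrier} (x≢0 : x ≢ F.0#) (x≢1 : x ≢ F.1#) where
    private
      A⁺ B⁺ P⁺ : Character
      A⁺ = A′ A B C
      B⁺ = B′ A B C
      P⁺ = P A B C

      w₀ x-1 : F.Carrier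
      w₀ = w A B C x≢0 x≢1
      x-1 = x F.- F.1#

      x-1≢0 : x-1 ≢ F.0#
      x-1≢0 eq = x≢1 (F.x-y≡0⇒x≡y eq)

      1-x≢0 : 1- x ≢ F.0#
      1-x≢0 eq = x≢1 (sym (F.x-y≡0⇒x≡y eq))

      w≢0 : w₀ ≢ F.0#
      w≢0 = F.-≢0 (x≢0 F.≢* x≢0) F.≢* F.⁻¹-≢0 1-x≢0

      α β γ ε₀ cw f a₁ a₂ b₁ b₂ : Carrier
      α = ⟦ A ⟧ -1F
      β = ⟦ B ⟧ -1F
      γ = ⟦ C ⟧ -1F
      ε₀ = φ -1F
      cw = (⟦ C ⟧ w₀) ⁻¹
      f = φ x-1
      a₁ = δ (A ⊛ C ᶜ)
      a₂ = δ (A ⊛ C ᶜ ⊛ φ-char)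
      b₁ = δ (B ⊛ C ᶜ)
      b₂ = δ (B ⊛ C ᶜ ⊛ φ-char)

      φ[1-x] : φ (1- x) ≡ ε₀ * f
      φ[1-x] = trans (cong φ (F.solve 1 (λ x → F.con 1ℤ F.:- x F.:= F.:- (x F.:- F.con 1ℤ)) refl x)) (⟦⟧-neg φ-char x-1)

      φ-w : φ w₀ ≡ f
      φ-w = trans (cong φ (F.fieldEq (x ∷ []) (⊝ (#0 ⊗ #0) ⊘ (𝟙 ⊖ #0)) ((#0 ⊗ #0) ⊘ (#0 ⊖ 𝟙)) (1-x≢0 ∷ []) (x-1≢0 ∷ []) refl))
        (trans (⟦⟧-/ φ-char (x F.* x) x-1) (trans (cong₂ _*_ (trans (φ-* x x) (trans (φ²≋ε x) (ε≡1 x≢0))) (φᶜ≋φ x-1)) (*-identityˡ f)))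

      cc≡ : (⟦ C ⟧ (x F.* x)) ⁻¹ * ⟦ C ⟧ (1- x) ≡ γ * cw
      cc≡ = sym (begin
        γ * (⟦ C ⟧ w₀) ⁻¹
          ≡⟨ cong (λ t → γ * t ⁻¹) (trans (⟦⟧-/ C _ (1- x)) (cong (_/ ⟦ C ⟧ (1- x)) (⟦⟧-neg C (x F.* x)))) ⟩
        γ * (γ * ⟦ C ⟧ (x F.* x) / ⟦ C ⟧ (1- x)) ⁻¹
          ≡⟨ fieldEq (γ ∷ ⟦ C ⟧ (x F.* x) ∷ ⟦ C ⟧ (1- x) ∷ []) (#0 ⊗ ⅟ ((#0 ⊗ #1) ⊘ #2)) (⅟ #1 ⊗ #2)
               (((γ≢0 ≢* xx≢0) ≢* ⁻¹-≢0 1-x≢0′) ∷ 1-x≢0′ ∷ []) (xx≢0 ∷ []) refl ⟩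
        (⟦ C ⟧ (x F.* x)) ⁻¹ * ⟦ C ⟧ (1- x) ∎)
        where
        open ≡-Reasoning
        γ≢0 : γ ≢ 0#
        γ≢0 = ⟦⟧≢0 C -1≢0
        xx≢0 : ⟦ C ⟧ (x F.* x) ≢ 0#
        xx≢0 = ⟦⟧≢0 C (x≢0 F.≢* x≢0)
        1-x≢0′ : ⟦ C ⟧ (1- x) ≢ 0#
        1-x≢0′ = ⟦⟧≢0 C 1-x≢0

      square-ratio : ∀ X → ⟦ X ⟧ (F.1# F./ x-1) * (⟦ X ⟧ (x-1 F./ x) * ⟦ X ⟧ (x-1 F./ x)) ≡ (⟦ X ⟧ w₀) ⁻¹
      square-ratio X = trans (cong (⟦ X ⟧ (F.1# F./ x-1) *_) (sym (mult X _ _))) (trans (sym (mult X _ _)) (trans (cong ⟦ X ⟧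
        (F.fieldEq (x ∷ []) ((𝟙 ⊘ (#0 ⊖ 𝟙)) ⊗ (((#0 ⊖ 𝟙) ⊘ #0) ⊗ ((#0 ⊖ 𝟙) ⊘ #0))) (⅟ (⊝ (#0 ⊗ #0) ⊘ (𝟙 ⊖ #0)))
          (x-1≢0 ∷ x≢0 ∷ x≢0 ∷ []) (w≢0 ∷ 1-x≢0 ∷ []) refl)) (⟦⟧-⁻¹ X w₀)))

      -- B² = C² leaves B = C or B = Cφ. In the first case the arguments combine to 1/w; in the
      -- second there is an additional factor φ(x-1).
      B-part : δ (B ᶜ ⊛ B ᶜ ⊛ P⁺) * (⟦ B ⟧ (F.1# F./ x-1) * ⟦ P⁺ ⟧ (x-1 F./ x)) ≡ cw * (b₁ + f * b₂)
      B-part with squareRoot C B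
      ... | root B≋C = trans
            (cong₂ _*_ (δ-yes (B ᶜ ⊛ B ᶜ ⊛ P⁺) (squares-cancel (λ y → cong₂ _*_ (B≋C y) (B≋C y))))
               (trans (cong (_* ⟦ P⁺ ⟧ (x-1 F./ x)) (B≋C _)) (square-ratio C)))
            (trans (solve 2 (λ c f → con 1ℤ :* c := c :* (con 1ℤ :+ f :* con 0ℤ)) refl cw f)
               (sym (cong₂ (λ s t → cw * (s + f * t)) (proj₁ (δ-root {C} {B} B≋C)) (proj₂ (δ-root {C} {B} B≋C)))))
            where
            squares-cancel : B ⊛ B ≋ P⁺ → B ᶜ ⊛ B ᶜ ⊛ P⁺ ≋ ε-char
            squares-cancel eq y = trans (cong₂ _*_ (sym (⁻¹-distrib-* _ _)) (sym (eq y))) (trans (*-comm _ _) (⊛ᶜ≋ε (B ⊛ B) y))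
      ... | φ-root B≋Cφ = trans
            (cong₂ _*_ (δ-yes (B ᶜ ⊛ B ᶜ ⊛ P⁺) (λ y → trans (cong₂ _*_ (sym (⁻¹-distrib-* _ _)) (sym (B²≋P y))) (trans (*-comm _ _) (⊛ᶜ≋ε (B ⊛ B) y))))
               (trans (cong (_* ⟦ P⁺ ⟧ (x-1 F./ x)) (B≋Cφ _))
                 (trans (solve 3 (λ c f s → c :* f :* s := (c :* s) :* f) refl (⟦ C ⟧ (F.1# F./ x-1)) (φ (F.1# F./ x-1)) (⟦ P⁺ ⟧ (x-1 F./ x)))
                   (cong₂ _*_ (square-ratio C) (trans (⟦⟧-1/ φ-char x-1) (φᶜ≋φ x-1))))))
            (trans (solve 2 (λ c f → con 1ℤ :* (c :* f) := c :* (con 0ℤ :+ f :* con 1ℤ)) refl cw f)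
               (sym (cong₂ (λ s t → cw * (s + f * t)) (proj₁ (δ-φ-root {C} {B} B≋Cφ)) (proj₂ (δ-φ-root {C} {B} B≋Cφ)))))
            where
            B²≋P : B ⊛ B ≋ P⁺
            B²≋P = ≋-on-units (B ⊛ B) P⁺ λ {y} y≢0 → trans (cong₂ _*_ (B≋Cφ y) (B≋Cφ y))
              (trans (solve 2 (λ c f → (c :* f) :* (c :* f) := (f :* f) :* (c :* c)) refl (⟦ C ⟧ y) (φ y))
                (trans (cong (_* ⟦ P⁺ ⟧ y) (trans (φ²≋ε y) (ε≡1 y≢0))) (*-identityˡ _)))
      ... | none B²≉C² = trans
            (cong (_* (⟦ B ⟧ (F.1# F./ x-1) * ⟦ P⁺ ⟧ (x-1 F./ x))) (δ-no (B ᶜ ⊛ B ᶜ ⊛ P⁺) (λ eq → B²≉C² (λ y →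
               sym (⊛ᶜ≋ε⇒≋ {P⁺} {B ⊛ B} (λ y → trans (cong (⟦ P⁺ ⟧ y *_) (⁻¹-distrib-* _ _)) (trans (*-comm _ _) (eq y))) y)))))
            (trans (solve 3 (λ t c f → con 0ℤ :* t := c :* (con 0ℤ :+ f :* con 0ℤ)) refl (⟦ B ⟧ (F.1# F./ x-1) * ⟦ P⁺ ⟧ (x-1 F./ x)) cw f)
               (sym (cong₂ (λ s t → cw * (s + f * t)) (proj₁ (δ-none {C} {B} B²≉C²)) (proj₂ (δ-none {C} {B} B²≉C²)))))

      E₀ : Carrier
      E₀ = exceptional A B C w₀ (A ᶜ)

      Ψ : Character
      Ψ = (A ⊛ A ᶜ) ⊛ (A⁺ ⊛ A ᶜ)

      Ψ-on-units : ∀ {y} → y ≢ F.0# → ⟦ Ψ ⟧ y ≡ ⟦ P⁺ ⟧ y / (⟦ A ⟧ y * ⟦ A ⟧ y)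
      Ψ-on-units {y} y≢0 = fieldEq (⟦ A ⟧ y ∷ ⟦ C ⟧ y ∷ []) ((#0 ⊗ ⅟ #0) ⊗ ((⅟ #0 ⊗ #1 ⊗ #1) ⊗ ⅟ #0)) ((#1 ⊗ #1) ⊘ (#0 ⊗ #0))
        (a≢0 ∷ a≢0 ∷ a≢0 ∷ []) ((a≢0 ≢* a≢0) ∷ []) refl
        where
        a≢0 : ⟦ A ⟧ y ≢ 0#
        a≢0 = ⟦⟧≢0 A y≢0

      -- If A² = P, the four Gauss sums at χ = Ā pair off into inverse characters. One pair is A
      -- with Ā, which are nontrivial; the other contains BĀ, whose triviality the delta records.
      exceptional-root : ¬ (A ≋ ε-char) → A ⊛ A ≋ P⁺ →
        E₀ ≡ (⟦ A ⟧ w₀) ⁻¹ * ((α * β * q - (q - 1#) * δ (B ⊛ A ᶜ)) * (α * q))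
      exceptional-root A≉ε A²≋P = begin
        δ Ψ * ((⟦ A ⟧ w₀) ⁻¹ * ((G (B ⊛ A ᶜ) * G (A ᶜ ᶜ)) * (G (B⁺ ⊛ A ᶜ) * G ((P⁺ ⊛ A ᶜ) ᶜ))))
          ≡⟨ cong (λ d → d * ((⟦ A ⟧ w₀) ⁻¹ * ((G (B ⊛ A ᶜ) * G (A ᶜ ᶜ)) * (G (B⁺ ⊛ A ᶜ) * G ((P⁺ ⊛ A ᶜ) ᶜ))))) (δ-yes Ψ Ψ≋ε) ⟩
        1# * ((⟦ A ⟧ w₀) ⁻¹ * ((G (B ⊛ A ᶜ) * G (A ᶜ ᶜ)) * (G (B⁺ ⊛ A ᶜ) * G ((P⁺ ⊛ A ᶜ) ᶜ))))
          ≡⟨ solve 5 (λ i a b c d → con 1ℤ :* (i :* ((a :* b) :* (c :* d))) := i :* ((a :* c) :* (b :* d))) refl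
               ((⟦ A ⟧ w₀) ⁻¹) (G (B ⊛ A ᶜ)) (G (A ᶜ ᶜ)) (G (B⁺ ⊛ A ᶜ)) (G ((P⁺ ⊛ A ᶜ) ᶜ)) ⟩
        (⟦ A ⟧ w₀) ⁻¹ * ((G (B ⊛ A ᶜ) * G (B⁺ ⊛ A ᶜ)) * (G (A ᶜ ᶜ) * G ((P⁺ ⊛ A ᶜ) ᶜ)))
          ≡⟨ cong ((⟦ A ⟧ w₀) ⁻¹ *_) (cong₂ _*_
               (trans (G-inverse (B ⊛ A ᶜ) (B⁺ ⊛ A ᶜ) B-pair) (cong (λ s → s * q - (q - 1#) * δ (B ⊛ A ᶜ)) (trans (cong (β *_) (sign-⁻¹ A)) (*-comm β α))))
               (trans (G-inverse-nontrivial (A ᶜ ᶜ) ((P⁺ ⊛ A ᶜ) ᶜ) Aᶜᶜ≉ε A-pair) (cong (_* q) (⁻¹-involutive α)))) ⟩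
        (⟦ A ⟧ w₀) ⁻¹ * ((α * β * q - (q - 1#) * δ (B ⊛ A ᶜ)) * (α * q)) ∎
        where
        open ≡-Reasoning
        Ψ≋ε : Ψ ≋ ε-char
        Ψ≋ε = ≋-on-units Ψ ε-char λ {y} y≢0 → trans (Ψ-on-units y≢0) (trans (cong (_/ (⟦ A ⟧ y * ⟦ A ⟧ y)) (sym (A²≋P y)))
          (trans (⁻¹-inverse _ (⟦⟧≢0 A y≢0 ≢* ⟦⟧≢0 A y≢0)) (sym (ε≡1 y≢0))))
        B-pair : (B ⊛ A ᶜ) ⊛ (B⁺ ⊛ A ᶜ) ≋ ε-char
        B-pair = ≋-on-units ((B ⊛ A ᶜ) ⊛ (B⁺ ⊛ A ᶜ)) ε-char λ {y} y≢0 → trans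
          (fieldEq (⟦ A ⟧ y ∷ ⟦ B ⟧ y ∷ ⟦ C ⟧ y ∷ []) ((#1 ⊗ ⅟ #0) ⊗ ((⅟ #1 ⊗ #2 ⊗ #2) ⊗ ⅟ #0)) ((#2 ⊗ #2) ⊘ (#0 ⊗ #0))
            (⟦⟧≢0 A y≢0 ∷ ⟦⟧≢0 B y≢0 ∷ ⟦⟧≢0 A y≢0 ∷ []) ((⟦⟧≢0 A y≢0 ≢* ⟦⟧≢0 A y≢0) ∷ []) refl)
          (trans (sym (Ψ-on-units y≢0)) (Ψ≋ε y))
        A-pair : A ᶜ ᶜ ⊛ (P⁺ ⊛ A ᶜ) ᶜ ≋ ε-char
        A-pair = ≋-on-units (A ᶜ ᶜ ⊛ (P⁺ ⊛ A ᶜ) ᶜ) ε-char λ {y} y≢0 → trans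
          (cong (λ t → (⟦ A ⟧ y) ⁻¹ ⁻¹ * (t * (⟦ A ⟧ y) ⁻¹) ⁻¹) (sym (A²≋P y)))
          (trans (fieldEq (⟦ A ⟧ y ∷ []) (⅟ ⅟ #0 ⊗ ⅟ (#0 ⊗ #0 ⊗ ⅟ #0)) 𝟙
            (⁻¹-≢0 (⟦⟧≢0 A y≢0) ∷ ⟦⟧≢0 A y≢0 ∷ ((⟦⟧≢0 A y≢0 ≢* ⟦⟧≢0 A y≢0) ≢* ⁻¹-≢0 (⟦⟧≢0 A y≢0)) ∷ ⟦⟧≢0 A y≢0 ∷ []) [] refl)
            (sym (ε≡1 y≢0)))
        Aᶜᶜ≉ε : ¬ (A ᶜ ᶜ ≋ ε-char)
        Aᶜᶜ≉ε eq = A≉ε (λ y → trans (sym (⁻¹-involutive _)) (eq y))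

      A-part : ¬ (A ≋ ε-char) →
        E₀ ≡ cw * q * (a₁ * α * (α * β * q - (q - 1#) * b₁) + a₂ * α * f * (α * β * q - (q - 1#) * b₂))
      A-part A≉ε with squareRoot C A
      ... | root A≋C = trans (exceptional-root A≉ε (λ y → cong₂ _*_ (A≋C y) (A≋C y))) (trans
            (cong₂ (λ c d → c * ((α * β * q - (q - 1#) * d) * (α * q))) (cong _⁻¹ (A≋C w₀)) (δ-cong {B ⊛ A ᶜ} {B ⊛ C ᶜ} (λ y → cong (λ t → ⟦ B ⟧ y * t ⁻¹) (A≋C y))))
            (trans (solve 6 (λ c u a q v f → c :* (u :* (a :* q)) := c :* q :* (con 1ℤ :* a :* u :+ con 0ℤ :* a :* f :* v)) refl
                cw (α * β * q - (q - 1#) * b₁) α q (α * β * q - (q - 1#) * b₂) f)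
              (sym (cong₂ (λ s t → cw * q * (s * α * (α * β * q - (q - 1#) * b₁) + t * α * f * (α * β * q - (q - 1#) * b₂)))
                (proj₁ (δ-root {C} {A} A≋C)) (proj₂ (δ-root {C} {A} A≋C))))))
      ... | φ-root A≋Cφ = trans (exceptional-root A≉ε A²≋P) (trans
            (cong₂ (λ c d → c * ((α * β * q - (q - 1#) * d) * (α * q))) A-at-w (δ-cong {B ⊛ A ᶜ} {B ⊛ C ᶜ ⊛ φ-char} BA≋))
            (trans (solve 6 (λ c f u a q v → c :* f :* (u :* (a :* q)) := c :* q :* (con 0ℤ :* a :* v :+ con 1ℤ :* a :* f :* u)) refl
                cw f (α * β * q - (q - 1#) * b₂) α q (α * β * q - (q - 1#) * b₁))
              (sym (cong₂ (λ s t → cw * q * (s * α * (α * β * q - (q - 1#) * b₁) + t * α * f * (α * β * q - (q - 1#) * b₂)))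
                (proj₁ (δ-φ-root {C} {A} A≋Cφ)) (proj₂ (δ-φ-root {C} {A} A≋Cφ))))))
            where
            A²≋P : A ⊛ A ≋ P⁺
            A²≋P = ≋-on-units (A ⊛ A) P⁺ λ {y} y≢0 → trans (cong₂ _*_ (A≋Cφ y) (A≋Cφ y))
              (trans (solve 2 (λ c f → (c :* f) :* (c :* f) := (f :* f) :* (c :* c)) refl (⟦ C ⟧ y) (φ y))
                (trans (cong (_* ⟦ P⁺ ⟧ y) (trans (φ²≋ε y) (ε≡1 y≢0))) (*-identityˡ _)))
            Aᶜ≋ : A ᶜ ≋ C ᶜ ⊛ φ-char
            Aᶜ≋ y = trans (cong _⁻¹ (A≋Cφ y)) (trans (⁻¹-distrib-* _ _) (cong ((⟦ C ⟧ y) ⁻¹ *_) (φᶜ≋φ y)))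
            A-at-w : (⟦ A ⟧ w₀) ⁻¹ ≡ cw * f
            A-at-w = trans (Aᶜ≋ w₀) (cong (cw *_) φ-w)
            BA≋ : B ⊛ A ᶜ ≋ B ⊛ C ᶜ ⊛ φ-char
            BA≋ y = trans (cong (⟦ B ⟧ y *_) (Aᶜ≋ y)) (sym (*-assoc _ _ _))
      ... | none A²≉C² = trans
            (cong (_* ((⟦ A ⟧ w₀) ⁻¹ * ((G (B ⊛ A ᶜ) * G (A ᶜ ᶜ)) * (G (B⁺ ⊛ A ᶜ) * G ((P⁺ ⊛ A ᶜ) ᶜ))))) (δ-no Ψ Ψ≉ε))
            (trans (solve 6 (λ t c q a u v → con 0ℤ :* t := c :* q :* (con 0ℤ :* a :* u :+ con 0ℤ :* a :* v)) refl
                ((⟦ A ⟧ w₀) ⁻¹ * ((G (B ⊛ A ᶜ) * G (A ᶜ ᶜ)) * (G (B⁺ ⊛ A ᶜ) * G ((P⁺ ⊛ A ᶜ) ᶜ))))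
                cw q α (α * β * q - (q - 1#) * b₁) (f * (α * β * q - (q - 1#) * b₂)))
              (trans (cong (λ t → cw * q * (0# * α * (α * β * q - (q - 1#) * b₁) + t)) (sym (*-assoc _ _ _)))
              (sym (cong₂ (λ s t → cw * q * (s * α * (α * β * q - (q - 1#) * b₁) + t * α * f * (α * β * q - (q - 1#) * b₂)))
                (proj₁ (δ-none {C} {A} A²≉C²)) (proj₂ (δ-none {C} {A} A²≉C²))))))
            where
            Ψ≉ε : ¬ (Ψ ≋ ε-char)
            Ψ≉ε eq = A²≉C² (≋-on-units (A ⊛ A) P⁺ λ {y} y≢0 → let a²≢0 = ⟦⟧≢0 A y≢0 ≢* ⟦⟧≢0 A y≢0 in
              trans (trans (sym (*-identityˡ _)) (cong (_* (⟦ A ⟧ y * ⟦ A ⟧ y)) (sym (trans (sym (Ψ-on-units y≢0)) (trans (eq y) (ε≡1 y≢0))))))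
                (trans (*-assoc _ _ _) (trans (cong (⟦ P⁺ ⟧ y *_) (⁻¹-inverseˡ _ a²≢0)) (*-identityʳ _))))

      -- Under the delta A(-1) may be read as C(-1); this matches the signs of the products of two
      -- deltas in `delta-terms`.
      a₁-sign : a₁ * α ≡ a₁ * γ
      a₁-sign = [ (A ⊛ C ᶜ) ≋? ε-char ]-* (λ eq → ⊛ᶜ≋ε⇒≋ {A} {C} eq -1F)

      a₂-sign : a₂ * α ≡ a₂ * (γ * ε₀)
      a₂-sign = [ (A ⊛ C ᶜ ⊛ φ-char) ≋? ε-char ]-* (λ eq → begin
        α                               ≡⟨ solve 1 (λ a → a := a :* con 1ℤ :* con 1ℤ :* con 1ℤ) refl α ⟩
        α * 1# * 1# * 1#                ≡⟨ cong₂ (λ s t → α * s * t * 1#) (sym (sign² C)) (sym (sign² φ-char)) ⟩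
        α * (γ * γ) * (ε₀ * ε₀) * 1#    ≡⟨ solve 3 (λ a c e → a :* (c :* c) :* (e :* e) :* con 1ℤ := a :* c :* e :* (c :* e)) refl α γ ε₀ ⟩
        α * γ * ε₀ * (γ * ε₀)           ≡⟨ cong (λ t → α * t * ε₀ * (γ * ε₀)) (sym (sign-⁻¹ C)) ⟩
        α * γ ⁻¹ * ε₀ * (γ * ε₀)        ≡⟨ cong (_* (γ * ε₀)) (trans (eq -1F) (ε≡1 -1≢0)) ⟩
        1# * (γ * ε₀)                   ≡⟨ *-identityˡ _ ⟩
        γ * ε₀                          ∎)
        where open ≡-Reasoning

      bracket : Carrier
      bracket = (q - 1#) * a₁ * b₁ - q * (β * γ) * a₁ - q * (α * γ) * b₁
                + (q - 1#) * φ (1- x) * a₂ * b₂ - q * (β * γ) * f * a₂ - q * (α * γ) * f * b₂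

      -- All terms of `bracket` with a delta of A come from the exceptional character; those with a
      -- delta of B alone come from the term at infinity.
      delta-terms : ¬ (A ≋ ε-char) →
        q * q * (α * (cw * (b₁ + f * b₂))) ≡ - E₀ - q * (γ * cw) * bracket
      delta-terms A≉ε = sym (begin
        - E₀ - q * (γ * cw) * bracket
          ≡⟨ cong₂ (λ s t → - s - q * (γ * cw) * ((q - 1#) * a₁ * b₁ - q * (β * γ) * a₁ - q * (α * γ) * b₁ + (q - 1#) * t * a₂ * b₂ - q * (β * γ) * f * a₂ - q * (α * γ) * f * b₂))
               (A-part A≉ε) φ[1-x] ⟩
        - (cw * q * (a₁ * α * (α * β * q - r * b₁) + a₂ * α * f * (α * β * q - r * b₂)))
          - q * (γ * cw) * (r * a₁ * b₁ - q * (β * γ) * a₁ - q * (α * γ) * b₁ + r * (ε₀ * f) * a₂ * b₂ - q * (β * γ) * f * a₂ - q * (α * γ) * f * b₂)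
          ≡⟨ solve 12 (λ cw q a₁ a₂ α β r b₁ b₂ f γ ε₀ →
               :- (cw :* q :* (a₁ :* α :* (α :* β :* q :- r :* b₁) :+ a₂ :* α :* f :* (α :* β :* q :- r :* b₂)))
                 :- q :* (γ :* cw) :* (r :* a₁ :* b₁ :- q :* (β :* γ) :* a₁ :- q :* (α :* γ) :* b₁ :+ r :* (ε₀ :* f) :* a₂ :* b₂ :- q :* (β :* γ) :* f :* a₂ :- q :* (α :* γ) :* f :* b₂) :=
               cw :* q :* ((a₁ :* α) :* (r :* b₁) :+ (a₂ :* α) :* (f :* r :* b₂) :- (α :* α) :* (β :* q :* (a₁ :+ a₂ :* f))
                 :- a₁ :* γ :* (r :* b₁) :- a₂ :* (γ :* ε₀) :* (f :* r :* b₂)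
                 :+ (γ :* γ) :* (q :* β :* (a₁ :+ a₂ :* f) :+ q :* α :* (b₁ :+ f :* b₂))))
               refl cw q a₁ a₂ α β r b₁ b₂ f γ ε₀ ⟩
        cw * q * ((a₁ * α) * (r * b₁) + (a₂ * α) * (f * r * b₂) - (α * α) * (β * q * (a₁ + a₂ * f))
          - a₁ * γ * (r * b₁) - a₂ * (γ * ε₀) * (f * r * b₂)
          + (γ * γ) * (q * β * (a₁ + a₂ * f) + q * α * (b₁ + f * b₂)))
          ≡⟨ cong₂ (λ s t → cw * q * (s - a₁ * γ * (r * b₁) - a₂ * (γ * ε₀) * (f * r * b₂) + t * (q * β * (a₁ + a₂ * f) + q * α * (b₁ + f * b₂))))
               (cong₂ _-_ (cong₂ (λ s t → s * (r * b₁) + t * (f * r * b₂)) a₁-sign a₂-sign) (cong (_* (β * q * (a₁ + a₂ * f))) (sign² A))) (sign² C) ⟩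
        cw * q * ((a₁ * γ) * (r * b₁) + (a₂ * (γ * ε₀)) * (f * r * b₂) - 1# * (β * q * (a₁ + a₂ * f))
          - a₁ * γ * (r * b₁) - a₂ * (γ * ε₀) * (f * r * b₂)
          + 1# * (q * β * (a₁ + a₂ * f) + q * α * (b₁ + f * b₂)))
          ≡⟨ solve 10 (λ cw q s t β a₁ a₂ f b₁ b₂ → cw :* q :* (s :+ t :- con 1ℤ :* (β :* q :* (a₁ :+ a₂ :* f)) :- s :- t
                 :+ con 1ℤ :* (q :* β :* (a₁ :+ a₂ :* f) :+ q :* b₁ :* b₂)) := q :* q :* (b₁ :* (cw :* b₂)))
               refl cw q ((a₁ * γ) * (r * b₁)) ((a₂ * (γ * ε₀)) * (f * r * b₂)) β a₁ a₂ f α (b₁ + f * b₂) ⟩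
        q * q * (α * (cw * (b₁ + f * b₂))) ∎)
        where
        open ≡-Reasoning
        r : Carrier
        r = q - 1#

      -- The indicator forces x = 2 and 1 - x = -1, so apart from P̄(x) both sides consist of signs
      -- whose squares are 1.
      δ₂-term : [ F.1# ≡? x-1 ] * (⟦ A ⟧ x-1 * ⟦ P⁺ ⟧ (F.1# F./ x)) ≡
                [ F.1# ≡? x-1 ] * (⟦ A ⟧ (1- x) * (α * β * ((⟦ A ⟧ (1- x)) ⁻¹ * (⟦ A ⟧ (1- x)) ⁻¹ * ⟦ B ⟧ (1- x)) * (⟦ P⁺ ⟧ x) ⁻¹))
      δ₂-term = [ F.1# F.≟ x-1 ]-* (λ 1≡x-1 → begin
        ⟦ A ⟧ x-1 * ⟦ P⁺ ⟧ (F.1# F./ x)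
          ≡⟨ cong₂ _*_ (trans (cong ⟦ A ⟧ (sym 1≡x-1)) (at1 A)) (⟦⟧-1/ P⁺ x) ⟩
        1# * pi
          ≡⟨ solve 1 (λ p → con 1ℤ :* p := (con 1ℤ :* con 1ℤ) :* (con 1ℤ :* p)) refl pi ⟩
        (1# * 1#) * (1# * pi)
          ≡⟨ cong₂ (λ s t → s * t * (1# * pi)) (sym (sign² A)) (sym (sign² A)) ⟩
        ((α * α) * (α * α)) * (1# * pi)
          ≡⟨ cong (λ t → ((α * α) * (α * α)) * (t * pi)) (sym (sign² B)) ⟩
        ((α * α) * (α * α)) * (β * β * pi)
          ≡⟨ solve 3 (λ a b p → ((a :* a) :* (a :* a)) :* (b :* b :* p) := a :* (a :* b :* (a :* a :* b) :* p)) refl α β pi ⟩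
        α * (α * β * (α * α * β) * pi)
          ≡⟨ cong (λ t → α * (α * β * (t * t * β) * pi)) (sym (sign-⁻¹ A)) ⟩
        α * (α * β * (α ⁻¹ * α ⁻¹ * β) * pi)
          ≡⟨ cong (λ t → ⟦ A ⟧ t * (α * β * ((⟦ A ⟧ t) ⁻¹ * (⟦ A ⟧ t) ⁻¹ * ⟦ B ⟧ t) * pi)) (sym (1-x≡-1 1≡x-1)) ⟩
        ⟦ A ⟧ (1- x) * (α * β * ((⟦ A ⟧ (1- x)) ⁻¹ * (⟦ A ⟧ (1- x)) ⁻¹ * ⟦ B ⟧ (1- x)) * pi) ∎)
        where
        open ≡-Reasoning
        pi : Carrier
        pi = (⟦ P⁺ ⟧ x) ⁻¹
        1-x≡-1 : F.1# ≡ x-1 → 1- x ≡ -1F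
        1-x≡-1 eq = trans (F.solve 1 (λ x → F.con 1ℤ F.:- x F.:= F.:- (x F.:- F.con 1ℤ)) refl x) (cong F.-_ (sym eq))

      δF≡ : δF ((x F.- 2 F.×1) F./ x-1) ≡ [ F.1# ≡? x-1 ]
      δF≡ = [ ((x F.- 2 F.×1) F./ x-1) F.≟ F.0# ]-cong (F.1# F.≟ x-1) to from
        where
        x-2≡ : x F.- 2 F.×1 ≡ x-1 F.- F.1#
        x-2≡ = F.solve 1 (λ x → x F.:- (F.con 1ℤ F.:+ (F.con 1ℤ F.:+ F.con 0ℤ)) F.:= (x F.:- F.con 1ℤ) F.:- F.con 1ℤ) refl x
        to : (x F.- 2 F.×1) F./ x-1 ≡ F.0# → F.1# ≡ x-1
        to eq with F.x*y≡0 eq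
        ... | inj₁ x-2≡0 = sym (F.x-y≡0⇒x≡y (trans (sym x-2≡) x-2≡0))
        ... | inj₂ i≡0   = ⊥-elim (F.⁻¹-≢0 x-1≢0 i≡0)
        from : F.1# ≡ x-1 → (x F.- 2 F.×1) F./ x-1 ≡ F.0#
        from eq = trans (cong (F._/ x-1) (trans x-2≡ (F.x≡y⇒x-y≡0 (sym eq)))) (F.zeroˡ _)

      -- With every sum replaced by a variable only field arithmetic is left; r stands for q - 1.
      -- The exceptional value E enters once through the Gauss series and once through the deltas,
      -- and cancels.
      conclude : ∀ {L n Σf Λ S R E dX bp d₂ ap k₁ k₂ E₂ cc ax ax′ q r α dF gA gB gBP gA⁺} →
        q ≢ 0# → r ≢ 0# → ax′ ≢ 0# → gA ≢ 0# → gB ≢ 0# → gA⁺ ≢ 0# → gBP ≢ 0# → n ≡ gA * gB * gA⁺ * gBP →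
        ax′ * ax ≡ 1# → n * L ≡ Σf → ax′ * Σf ≡ R + r * dX * (α * bp) + q * d₂ * ap →
        q * q * r * (n * Λ) ≡ ax * S → S ≡ q * q * r * R - r * r * E →
        q * q * (α * (dX * bp)) ≡ - E - q * cc * E₂ →
        d₂ * ap ≡ d₂ * (ax′ * k₁) → dF ≡ d₂ → k₂ ≡ r * ax * cc →
        L ≡ (q * k₁ / n) * dF + Λ - k₂ / (q * gA * gB * gBP * gA⁺) * E₂
      conclude {L} {n} {Σf} {Λ} {S} {R} {E} {dX} {bp} {d₂} {ap} {k₁} {_} {E₂} {cc} {ax} {ax′} {q} {r} {α} {_} {gA} {gB} {gBP} {gA⁺}
               q≢0 r≢0 ax′≢0 gA≢0 gB≢0 gA⁺≢0 gBP≢0 refl ax′ax≡1 nL≡ formula Λ≡ refl deltas δ₂ refl refl =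
        *-cancelˡ ((((q≢0 ≢* q≢0) ≢* r≢0) ≢* ax′≢0) ≢* n≢0) (begin
          q * q * r * ax′ * n * L
            ≡⟨ solve 5 (λ q r a n L → q :* q :* r :* a :* n :* L := q :* q :* r :* (a :* (n :* L))) refl q r ax′ n L ⟩
          q * q * r * (ax′ * (n * L))
            ≡⟨ cong (q * q * r *_) (trans (cong (ax′ *_) nL≡) formula) ⟩
          q * q * r * (R + r * dX * (α * bp) + q * d₂ * ap)
            ≡⟨ solve 8 (λ q r R d α b e p → q :* q :* r :* (R :+ r :* d :* (α :* b) :+ q :* e :* p) :=
                 q :* q :* r :* R :+ r :* r :* (q :* q :* (α :* (d :* b))) :+ q :* q :* r :* q :* (e :* p)) refl q r R dX α bp d₂ ap ⟩
          q * q * r * R + r * r * (q * q * (α * (dX * bp))) + q * q * r * q * (d₂ * ap)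
            ≡⟨ cong₂ (λ s t → q * q * r * R + r * r * s + q * q * r * q * t) deltas δ₂ ⟩
          q * q * r * R + r * r * (- E - q * cc * E₂) + q * q * r * q * (d₂ * (ax′ * k₁))
            ≡⟨ solve 9 (λ q r R E cc E₂ d a k → q :* q :* r :* R :+ r :* r :* (:- E :- q :* cc :* E₂) :+ q :* q :* r :* q :* (d :* (a :* k)) :=
                 q :* q :* r :* a :* (q :* k :* d) :+ con 1ℤ :* (q :* q :* r :* R :- r :* r :* E) :- con 1ℤ :* (q :* r :* (r :* cc :* E₂))) refl q r R E cc E₂ d₂ ax′ k₁ ⟩
          q * q * r * ax′ * (q * k₁ * d₂) + 1# * (q * q * r * R - r * r * E) - 1# * (q * r * (r * cc * E₂))
            ≡⟨ cong (λ t → q * q * r * ax′ * (q * k₁ * d₂) + t * (q * q * r * R - r * r * E) - t * (q * r * (r * cc * E₂))) (sym ax′ax≡1) ⟩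
          q * q * r * ax′ * (q * k₁ * d₂) + ax′ * ax * (q * q * r * R - r * r * E) - ax′ * ax * (q * r * (r * cc * E₂))
            ≡⟨ cong (λ t → q * q * r * ax′ * (q * k₁ * d₂) + t - ax′ * ax * (q * r * (r * cc * E₂))) (trans (*-assoc _ _ _) (cong (ax′ *_) (sym Λ≡))) ⟩
          q * q * r * ax′ * (q * k₁ * d₂) + ax′ * (q * q * r * (n * Λ)) - ax′ * ax * (q * r * (r * cc * E₂))
            ≡⟨ cong₂ (λ s t → q * q * r * ax′ * (s * d₂) + ax′ * (q * q * r * (n * Λ)) - t) (sym n*k₁) (sym n*k₂) ⟩
          q * q * r * ax′ * (n * (q * k₁ / n) * d₂) + ax′ * (q * q * r * (n * Λ)) - q * q * r * ax′ * (n * (r * ax * cc / m)) * E₂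
            ≡⟨ solve 9 (λ q r a n u d Λ v E₂ → q :* q :* r :* a :* (n :* u :* d) :+ a :* (q :* q :* r :* (n :* Λ)) :- q :* q :* r :* a :* (n :* v) :* E₂ :=
                 q :* q :* r :* a :* n :* (u :* d :+ Λ :- v :* E₂)) refl q r ax′ n (q * k₁ / n) d₂ Λ (r * ax * cc / m) E₂ ⟩
          q * q * r * ax′ * n * ((q * k₁ / n) * d₂ + Λ - r * ax * cc / m * E₂) ∎)
        where
        open ≡-Reasoning
        m : Carrier
        m = q * gA * gB * gBP * gA⁺
        n≢0 : n ≢ 0#
        n≢0 = ((gA≢0 ≢* gB≢0) ≢* gA⁺≢0) ≢* gBP≢0
        m≢0 : m ≢ 0#
        m≢0 = (((q≢0 ≢* gA≢0) ≢* gB≢0) ≢* gBP≢0) ≢* gA⁺≢0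
        n*k₁ : n * (q * k₁ / n) ≡ q * k₁
        n*k₁ = fieldEq (n ∷ (q * k₁) ∷ []) (#0 ⊗ (#1 ⊘ #0)) (#1) (n≢0 ∷ []) [] refl
        m≡qn : m ≡ q * n
        m≡qn = solve 5 (λ q a b c d → q :* a :* b :* c :* d := q :* (a :* b :* d :* c)) refl q gA gB gBP gA⁺
        n*k₂ : q * q * r * ax′ * (n * (r * ax * cc / m)) * E₂ ≡ ax′ * ax * (q * r * (r * cc * E₂))
        n*k₂ = begin
          q * q * r * ax′ * (n * (r * ax * cc / m)) * E₂
            ≡⟨ solve 8 (λ q r a n x c i E₂ → q :* q :* r :* a :* (n :* (r :* x :* c :* i)) :* E₂ :=
                 (q :* n) :* i :* (a :* x :* (q :* r :* (r :* c :* E₂)))) refl q r ax′ n ax cc (m ⁻¹) E₂ ⟩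
          (q * n) * m ⁻¹ * (ax′ * ax * (q * r * (r * cc * E₂)))
            ≡⟨ cong (_* (ax′ * ax * (q * r * (r * cc * E₂)))) (trans (cong (_* m ⁻¹) (sym m≡qn)) (⁻¹-inverse m m≢0)) ⟩
          1# * (ax′ * ax * (q * r * (r * cc * E₂)))
            ≡⟨ *-identityˡ _ ⟩
          ax′ * ax * (q * r * (r * cc * E₂)) ∎

    -- The deltas are variables constrained by equations, so that the conclusion can be instantiated
    -- with the Boolean test `δc` of the theorem.
    product≡ : ¬ (A ≋ ε-char) → ¬ (B ≋ ε-char) → ¬ (A ≋ P⁺) → ¬ (B ≋ P⁺) →
      ∀ {a₁ a₂ b₁ b₂ d₃ d₄} →
      δ (A ⊛ C ᶜ) ≡ a₁ → δ (A ⊛ C ᶜ ⊛ φ-char) ≡ a₂ → δ (B ⊛ C ᶜ) ≡ b₁ → δ (B ⊛ C ᶜ ⊛ φ-char) ≡ b₂ →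
      δ (A ᶜ ⊛ C) ≡ d₃ → δ (B ᶜ ⊛ C ⊛ φ-char) ≡ d₄ →
      let y = (F.- (x F.* x)) F./ (𝟜 F.* (1- x))
          ax = (⟦ A ⟧ (1- x)) ⁻¹
          M = (ax * G (A ᶜ ⊛ C) * G (B ᶜ ⊛ C ⊛ φ-char)) / (φ -1F * ⟦ C ⟧ 𝟜 * G φ-char * G A⁺ * G (B ᶜ))
      in
      ₂F₁ ⟦ A ⟧ ⟦ B ⟧ ⟦ P⁺ ⟧ x * ₂F₁ ⟦ A ⟧ ⟦ P⁺ ⊛ B ᶜ ⟧ ⟦ P⁺ ⟧ x ≡
      ((q * ⟦ A ⊛ B ⟧ -1F * ⟦ A ᶜ ⊛ A ᶜ ⊛ B ⟧ (1- x) * ⟦ P⁺ ᶜ ⟧ x) / (G A * G (B ᶜ) * G A⁺ * G (B ⊛ P⁺ ᶜ))) * δF ((x F.- 2 F.×1) F./ (x F.- F.1#))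
        + q * M * ₄F₃ ⟦ A ⟧ ⟦ B ⟧ ⟦ A⁺ ⟧ ⟦ B⁺ ⟧ ⟦ P⁺ ⟧ ⟦ C ⟧ ⟦ C ⊛ φ-char ⟧ y
        + (q - 1#) * M *
          ( ((q - 1#) / q) * ₂F₁ ⟦ A ⟧ ⟦ B ⟧ ⟦ P⁺ ⟧ y * d₃ * d₄
          - ₃F₂ ⟦ A ⟧ ⟦ B ⟧ ⟦ B⁺ ⟧ ⟦ P⁺ ⟧ ⟦ C ⊛ φ-char ⟧ y * d₃
          - ₃F₂ ⟦ A ⟧ ⟦ B ⟧ ⟦ A⁺ ⟧ ⟦ P⁺ ⟧ ⟦ C ⟧ y * d₄)
        - ((q - 1#) * ax * (⟦ C ⟧ (x F.* x)) ⁻¹ * ⟦ C ⟧ (1- x)) / (q * G A * G (B ᶜ) * G (B ⊛ P⁺ ᶜ) * G A⁺)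
          * ( (q - 1#) * a₁ * b₁ - q * (⟦ B ⟧ -1F * ⟦ C ⟧ -1F) * a₁ - q * (⟦ A ⟧ -1F * ⟦ C ⟧ -1F) * b₁
            + (q - 1#) * φ (1- x) * a₂ * b₂ - q * (⟦ B ⟧ -1F * ⟦ C ⟧ -1F) * φ (x F.- F.1#) * a₂
            - q * (⟦ A ⟧ -1F * ⟦ C ⟧ -1F) * φ (x F.- F.1#) * b₂)
    product≡ A≉ε B≉ε A≉P B≉P refl refl refl refl refl refl = begin
      ₂F₁ ⟦ A ⟧ ⟦ B ⟧ ⟦ P⁺ ⟧ x * ₂F₁ ⟦ A ⟧ ⟦ P⁺ ⊛ B ᶜ ⟧ ⟦ P⁺ ⟧ x
        ≡⟨ conclude q≢0 q-1≢0 (⟦⟧≢0 A 1-x≢0) (G≢0 A) (G≢0 (B ᶜ)) (G≢0 A⁺) (G≢0 (B ⊛ P⁺ ᶜ)) refl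
             (⁻¹-inverse _ (⟦⟧≢0 A 1-x≢0)) (N*₂F₁*₂F₁ A B C x≢0 x≢1 A≉ε B≉ε A≉P B≉P) formula
             (hypergeometric-part A B C A≉ε B≉P 4y≡w ax) (gaussSeries≡ A B C x≢0 x≢1 B≉ε)
             deltas δ₂-term δF≡ (trans (*-assoc _ _ _) (cong ((q - 1#) * ax *_) cc≡)) ⟩
      (q * k₁ / N A B C) * d + (L₁ + L₂) - k₂ * bracket
        ≡⟨ cong₂ (λ s t → s - t) (trans (sym (+-assoc _ _ _)) (cong (λ t → t / N A B C * d + L₁ + L₂) q*k₁)) refl ⟩
      q * (α * β) * (ax * ax * ⟦ B ⟧ (1- x)) * (⟦ P⁺ ⟧ x) ⁻¹ / N A B C * d + L₁ + L₂ - k₂ * bracket ∎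
      where
      open ≡-Reasoning
      y : F.Carrier
      y = (F.- (x F.* x)) F./ (𝟜 F.* (1- x))
      ax k₁ k₂ d L₁ L₂ : Carrier
      ax = (⟦ A ⟧ (1- x)) ⁻¹
      k₁ = α * β * (ax * ax * ⟦ B ⟧ (1- x)) * (⟦ P⁺ ⟧ x) ⁻¹
      k₂ = ((q - 1#) * ax * (⟦ C ⟧ (x F.* x)) ⁻¹ * ⟦ C ⟧ (1- x)) / (q * G A * G (B ᶜ) * G (B ⊛ P⁺ ᶜ) * G A⁺)
      d = δF ((x F.- 2 F.×1) F./ (x F.- F.1#))
      M₀ : Carrier
      M₀ = M A B C A≉ε B≉P {y} refl ax
      L₁ = q * M₀ * ₄F₃ ⟦ A ⟧ ⟦ B ⟧ ⟦ A⁺ ⟧ ⟦ B⁺ ⟧ ⟦ P⁺ ⟧ ⟦ C ⟧ ⟦ C ⊛ φ-char ⟧ y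
      L₂ = (q - 1#) * M₀ *
           (E * ₂F₁ ⟦ A ⟧ ⟦ B ⟧ ⟦ P⁺ ⟧ y * δ (A ᶜ ⊛ C) * δ (B ᶜ ⊛ C ⊛ φ-char)
            - ₃F₂ ⟦ A ⟧ ⟦ B ⟧ ⟦ B⁺ ⟧ ⟦ P⁺ ⟧ ⟦ C ⊛ φ-char ⟧ y * δ (A ᶜ ⊛ C)
            - ₃F₂ ⟦ A ⟧ ⟦ B ⟧ ⟦ A⁺ ⟧ ⟦ P⁺ ⟧ ⟦ C ⟧ y * δ (B ᶜ ⊛ C ⊛ φ-char))
      4y≡w : 𝟜 F.* y ≡ w₀
      4y≡w = F.fieldEq (x ∷ 𝟜 ∷ []) (#1 ⊗ (⊝ (#0 ⊗ #0) ⊘ (#1 ⊗ (𝟙 ⊖ #0)))) (⊝ (#0 ⊗ #0) ⊘ (𝟙 ⊖ #0))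
               ((𝟜≢0 F.≢* 1-x≢0) ∷ []) (1-x≢0 ∷ []) refl
      q*k₁ : q * k₁ ≡ q * (α * β) * (ax * ax * ⟦ B ⟧ (1- x)) * (⟦ P⁺ ⟧ x) ⁻¹
      q*k₁ = solve 4 (λ q s t p → q :* (s :* t :* p) := q :* s :* t :* p) refl q (α * β) (ax * ax * ⟦ B ⟧ (1- x)) ((⟦ P⁺ ⟧ x) ⁻¹)
      X : Character
      X = B ᶜ ⊛ B ᶜ ⊛ P⁺
      bp : Carrier
      bp = ⟦ B ⟧ (F.1# F./ x-1) * ⟦ P⁺ ⟧ (x-1 F./ x)
      formula : ⟦ A ⟧ (1- x) * ∑x (λ v → ∑x (λ u → Substitution.f A B P⁺ x≢0 x≢1 u v)) ≡
                ∑x (λ a → ∑x (Substitution.k A B P⁺ x≢0 x≢1 a)) + (q - 1#) * δ X * (α * bp) + q * [ F.1# ≡? x-1 ] * (⟦ A ⟧ x-1 * ⟦ P⁺ ⟧ (F.1# F./ x))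
      formula = trans (product-formula A B P⁺ x≢0 x≢1 A≉ε B≉ε A≉P B≉P (P-even A B C))
        (cong (λ t → ∑x (λ a → ∑x (Substitution.k A B P⁺ x≢0 x≢1 a)) + (q - 1#) * δ X * t + q * [ F.1# ≡? x-1 ] * (⟦ A ⟧ x-1 * ⟦ P⁺ ⟧ (F.1# F./ x))) (*-assoc _ _ _))
      deltas : q * q * (α * (δ X * bp)) ≡ - E₀ - q * (γ * cw) * bracket
      deltas = trans (cong (λ t → q * q * (α * t)) B-part) (delta-terms A≉ε)

theorem1p5 : (S : Setup) → let open Ops S in
    (A B C : Char) → IsChar (Setup.F S) (Setup.K S) A → IsChar (Setup.F S) (Setup.K S) B → IsChar (Setup.F S) (Setup.K S) C →
    ¬ (A ≈χ ε) → ¬ (B ≈χ ε) → ¬ ((C · C) ≈χ ε) → ¬ (A ≈χ (C · C)) → ¬ (B ≈χ (C · C)) →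
    (x : F.Carrier) → ¬ (x ≡ F.1#) →
    let y = (F.- (x F.* x)) F./ (4F F.* (F.1# F.- x))
        M = (inv A (F.1# F.- x) * g (inv A · C) * g (inv B · C · φ))
            / (φ -1F * C 4F * g φ * g (inv A · C · C) * g (inv B))
    in
    ₂F₁ A B (C · C) x * ₂F₁ A ((C · C) · inv B) (C · C) x
    ≡ ((q * (A · B) -1F * (inv A · inv A · B) (F.1# F.- x) * inv (C · C) x)
         / (g A * g (inv B) * g (inv A · C · C) * g (B · inv (C · C))))
        * δF ((x F.- 2F) F./ (x F.- F.1#))
      + q * M * ₄F₃ A B (inv A · C · C) (inv B · C · C) (C · C) C (C · φ) y
      + (q - 1#) * M *
          ( ((q - 1#) / q) * ₂F₁ A B (C · C) y * δc (inv A · C) * δc (inv B · C · φ)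
          - ₃F₂ A B (inv B · C · C) (C · C) (C · φ) y * δc (inv A · C)
          - ₃F₂ A B (inv A · C · C) (C · C) C y * δc (inv B · C · φ))
      - ((q - 1#) * inv A (F.1# F.- x) * inv C (x F.* x) * C (F.1# F.- x))
          / (q * g A * g (inv B) * g (B · inv (C · C)) * g (inv A · C · C))
        * ( (q - 1#) * δc (A · inv C) * δc (B · inv C)
          - q * (B · C) -1F * δc (A · inv C)
          - q * (A · C) -1F * δc (B · inv C)
          + (q - 1#) * φ (F.1# F.- x) * δc (A · inv C · φ) * δc (B · inv C · φ)
          - q * (B · C) -1F * φ (x F.- F.1#) * δc (A · inv C · φ)
          - q * (A · C) -1F * φ (x F.- F.1#) * δc (B · inv C · φ))
theorem1p5 S A B C A-is B-is C-is A≉ε B≉ε _ A≉P B≉P x x≢1 = by-cases (x F.≟ F.0#)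
  where
  open Theorem S hiding (P; A′; B′)
  open Ops S using (₂F₁; φ)
  Â B̂ Ĉ : Character
  Â = character A A-is
  B̂ = character B B-is
  Ĉ = character C C-is

  y-0 : (F.- (F.0# F.* F.0#)) F./ (𝟜 F.* (1- F.0#)) ≡ F.0#
  y-0 = trans (cong (F._/ (𝟜 F.* (1- F.0#))) (trans (cong F.-_ (F.zeroˡ F.0#)) F.-0≡0)) (F.zeroˡ _)

  -- The substitutions divide by x, so x = 0 is treated apart: there y = 0, and each term contains a
  -- character or a series evaluated at 0.
  vanish : ∀ {s i n d M q f₄ r e f₂ d₃ d₄ f₃ f₃′ a j c m b} →
    i ≡ 0# → f₄ ≡ 0# → f₂ ≡ 0# → f₃ ≡ 0# → f₃′ ≡ 0# → j ≡ 0# →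
    (s * i / n) * d + q * M * f₄ + r * M * (e * f₂ * d₃ * d₄ - f₃ * d₃ - f₃′ * d₄) - (r * a * j * c) / m * b ≡ 0#
  vanish {s} {_} {n} {d} {M} {q} {_} {r} {e} {_} {d₃} {d₄} {_} {_} {a} {_} {c} {m} {b} refl refl refl refl refl refl =
    trans (cong₂ _-_ (cong₂ _+_ (cong₂ _+_ (lemma₁ s (n ⁻¹) d) (zeroʳ _)) (lemma₂ (r * M) e d₃ d₄)) (lemma₃ (r * a) c (m ⁻¹) b))
          (solve 0 (con 0ℤ :+ con 0ℤ :+ con 0ℤ :- con 0ℤ := con 0ℤ) refl)
    where
    lemma₁ : ∀ s i d → (s * 0# * i) * d ≡ 0#
    lemma₁ = solve 3 (λ s i d → (s :* con 0ℤ :* i) :* d := con 0ℤ) refl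
    lemma₂ : ∀ m e d₃ d₄ → m * (e * 0# * d₃ * d₄ - 0# * d₃ - 0# * d₄) ≡ 0#
    lemma₂ = solve 4 (λ m e d₃ d₄ → m :* (e :* con 0ℤ :* d₃ :* d₄ :- con 0ℤ :* d₃ :- con 0ℤ :* d₄) := con 0ℤ) refl
    lemma₃ : ∀ a c i b → (a * 0# * c * i) * b ≡ 0#
    lemma₃ = solve 4 (λ a c i b → (a :* con 0ℤ :* c :* i) :* b := con 0ℤ) refl

  at-y-0 : ∀ A₀ ps → Ops.hyp S A₀ ps ((F.- (F.0# F.* F.0#)) F./ (𝟜 F.* (1- F.0#))) ≡ 0#
  at-y-0 A₀ ps = trans (cong (Ops.hyp S A₀ ps) y-0) (hyp-0 A₀ ps)

  by-cases : Dec (x ≡ F.0#) → _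
  by-cases (no x≢0) = product≡ Â B̂ Ĉ x≢0 x≢1 A≉ε B≉ε A≉P B≉P
    (sym (δc≡δ (Â ⊛ Ĉ ᶜ))) (sym (δc≡δ (Â ⊛ Ĉ ᶜ ⊛ φ-char))) (sym (δc≡δ (B̂ ⊛ Ĉ ᶜ))) (sym (δc≡δ (B̂ ⊛ Ĉ ᶜ ⊛ φ-char)))
    (sym (δc≡δ (Â ᶜ ⊛ Ĉ))) (sym (δc≡δ (B̂ ᶜ ⊛ Ĉ ⊛ φ-char)))
  by-cases (yes refl) = trans
    (trans (cong (_* ₂F₁ A ((C · C) · inv B) (C · C) F.0#) (hyp-0 A ((B , C · C) ∷ []))) (zeroˡ _))
    (sym (vanish (at0 ((Ĉ ⊛ Ĉ) ᶜ))
      (at-y-0 A ((B , C · C) ∷ (inv A · C · C , C) ∷ (inv B · C · C , C · φ) ∷ []))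
      (at-y-0 A ((B , C · C) ∷ []))
      (at-y-0 A ((B , C · C) ∷ (inv B · C · C , C · φ) ∷ []))
      (at-y-0 A ((B , C · C) ∷ (inv A · C · C , C) ∷ []))
      (trans (cong ⟦ Ĉ ᶜ ⟧ (F.zeroˡ F.0#)) (at0 (Ĉ ᶜ)))))
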